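{- Let $D<-4$ be the discriminant of an imaginary quadratic field with $D\equiv1\pmod4$, and assume $3$ does not divide $D$. Let $N=|D|$, $\chi=\chi_D$, $h=h(D)$, and $$E_0(6)=\sum_{0<x<\frac N6}\chi(x),\qquad E_1(6)=\sum_{\frac N6<x<\frac{2N}6}\chi(x),\qquad E_2(6)=\sum_{\frac{2N}6<x<\frac{3N}6}\chi(x).$$ Then: - if $N\equiv23\pmod{24}$: $E_0(6)=h$, $E_1(6)=0$, $E_2(6)=0$; - if $N\equiv11\pmod{24}$: $E_0(6)=h$, $E_1(6)=0$, $E_2(6)=2h$; - if $N\equiv7\pmod{24}$: $E_0(6)=h$, $E_1(6)=h$, $E_2(6)=-h$; - if $N\equiv19\pmod{24}$: $E_0(6)=-h$, $E_1(6)=3h$, $E_2(6)=h$.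
   Context: Here $D\equiv 1\pmod 4$ is a negative square-free integer, the discriminant of $K=\mathbb{Q}(\sqrt D)$; $h(D)$ is the order of the ideal class group of $K$; and $\chi_D(x)=\left(\frac{x}{N}\right)$ is the Jacobi symbol (equal to $0$ when $\gcd(x,N)>1$). Sums are over integers $x$ with $1\le x\le N$ and $\gcd(x,N)=1$ in the indicated open intervals. -}

module Defs where

open import Level using (0ℓ) renaming (suc to lsuc)
open import Data.Bool.Base using (if_then_else_)
open import Data.Fin.Base using (Fin; toℕ)
open import Data.Fin.Properties using (any?)
open import Data.Integer.Base as ℤ using (ℤ; +_; 0ℤ; 1ℤ; -1ℤ)
open import Data.List.Base using (List; []; _∷_; foldr; map; filter; upTo)
open import Data.Nat.Base as ℕ using (ℕ; zero; suc; ∣_-_∣)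
open import Data.Nat.Coprimality using (Coprime; coprime?)
open import Data.Nat.Divisibility using (_∣_; _∣?_)
open import Data.Nat.Primality.Factorisation using (factorise; factors)
open import Data.Nat.Properties using (_<?_)
open import Data.Product.Base using (Σ-syntax; ∃-syntax; _×_)
open import Data.Rational.Base as ℚ using (ℚ; 0ℚ; 1ℚ)
open import Function.Definitions using (Bijective)
open import Relation.Binary.Core using (Rel)
open import Relation.Binary.PropositionalEquality.Core using (_≡_; _≢_)
open import Relation.Nullary.Decidable using (does; _×-dec_)
open import Relation.Unary using (Pred; Decidable; _∈_; _⊆_; _≐_)

SquareFree : ℕ → Set
SquareFree n = ∀ m → m ℕ.* m ∣ n → m ≡ 1

------------------------------------------------------------------------
-- The quadratic field K = ℚ(√D) and its ideal class group

module QuadraticField (D : ℤ) where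

  -- (a +√ b) is a + b√D.  When D is not a square these are pairwise
  -- distinct and form a field, so _≡_ is the equality of K.
  record K : Set where
    constructor _+√_
    field
      re im : ℚ

  infix 5 _+√_

  fromℚ : ℚ → K
  fromℚ q = q +√ 0ℚ

  fromℤ : ℤ → K
  fromℤ n = fromℚ (n ℚ./ 1)

  0ᴷ 1ᴷ : K
  0ᴷ = fromℚ 0ℚ
  1ᴷ = fromℚ 1ℚ

  infixl 6 _⊕_
  infixl 7 _⊗_

  _⊕_ : K → K → K
  (a +√ b) ⊕ (c +√ d) = (a ℚ.+ c) +√ (b ℚ.+ d)

  _⊗_ : K → K → K
  (a +√ b) ⊗ (c +√ d) =
    (a ℚ.* c ℚ.+ (D ℚ./ 1) ℚ.* (b ℚ.* d)) +√ (a ℚ.* d ℚ.+ b ℚ.* c)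

  -- The value at x of the monic polynomial
  -- c₀ + c₁ X + ⋯ + cₙ₋₁ Xⁿ⁻¹ + Xⁿ, where cs = c₀ ∷ ⋯ ∷ cₙ₋₁ ∷ [].
  evalMonic : List ℤ → K → K
  evalMonic []       x = 1ᴷ
  evalMonic (c ∷ cs) x = fromℤ c ⊕ x ⊗ evalMonic cs x

  -- The ring of integers: the elements of K integral over ℤ.
  𝒪 : Pred K 0ℓ
  𝒪 x = ∃[ cs ] evalMonic cs x ≡ 0ᴷ

  -- Nonzero ideals of 𝒪.  Closure under negation and membership of 0
  -- follow from closure under multiplication by 𝒪.  Classically mem? is
  -- automatic; constructively it is what makes the class group finite.
  record NonzeroIdeal : Set (lsuc 0ℓ) where
    field
      mem       : Pred K 0ℓ
      mem?      : Decidable mem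
      integral  : mem ⊆ 𝒪
      ⊕-closed  : ∀ {x y} → x ∈ mem → y ∈ mem → x ⊕ y ∈ mem
      ⊗-closed  : ∀ {a x} → a ∈ 𝒪 → x ∈ mem → a ⊗ x ∈ mem
      nonzero   : ∃[ x ] x ∈ mem × x ≢ 0ᴷ

  open NonzeroIdeal public

  _·_ : K → Pred K 0ℓ → Pred K 0ℓ
  (a · I) y = ∃[ x ] x ∈ I × y ≡ a ⊗ x

  -- Equality of ideal classes: αI = βJ for some nonzero α, β in 𝒪.
  _∼_ : Rel NonzeroIdeal 0ℓ
  I ∼ J = ∃[ α ] ∃[ β ]
    α ∈ 𝒪 × α ≢ 0ᴷ × β ∈ 𝒪 × β ≢ 0ᴷ × (α · mem I) ≐ (β · mem J)

  -- The ideal class group, the set of nonzero ideals modulo _∼_, has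
  -- exactly h elements.
  IsClassNumber : ℕ → Set (lsuc 0ℓ)
  IsClassNumber h = Σ[ f ∈ (Fin h → NonzeroIdeal) ] Bijective _≡_ _∼_ f

open QuadraticField public using (IsClassNumber)

------------------------------------------------------------------------
-- The Jacobi symbol

legendre : ℕ → ℕ → ℤ
legendre a p =
  if does (p ∣? a) then 0ℤ else
  if does (any? λ (y : Fin p) → p ∣? ∣ toℕ y ℕ.* toℕ y - a ∣) then 1ℤ else
  -1ℤ

-- The product of the Legendre symbols (a/p) over the prime factors p of
-- n, with multiplicity.  Meaningful for odd n only; the value at 0 is a
-- dummy.
jacobi : ℕ → ℕ → ℤ
jacobi a zero      = 0ℤ
jacobi a n@(suc _) =
  foldr ℤ._*_ 1ℤ (map (legendre a) (factors (factorise n)))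

χ : ℤ → ℕ → ℤ
χ D x = jacobi x ℤ.∣ D ∣

------------------------------------------------------------------------
-- Character sums

-- The sum of χ D x over the integers 1 ≤ x ≤ N prime to N = |D| with
-- jN/r < x < (j+1)N/r, i.e. jN < rx < (j+1)N.
E : ℤ → (r j : ℕ) → ℤ
E D r j = foldr ℤ._+_ 0ℤ (map (χ D) (filter inRange? (map suc (upTo N))))
  where
  N : ℕ
  N = ℤ.∣ D ∣

  inRange? : Decidable λ x →
    Coprime x N × j ℕ.* N ℕ.< r ℕ.* x × r ℕ.* x ℕ.< suc j ℕ.* N
  inRange? x =
    coprime? x N ×-dec (j ℕ.* N <? r ℕ.* x) ×-dec (r ℕ.* x <? suc j ℕ.* N)

{-# OPTIONS --safe #-}
-- Write D = −N, χ = χ_D, g(t) = max(t, 0)³, and let r(n) count the representations of n by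
-- the quadratic forms of the h ideal classes.  Multiplying lattices by prime ideals shows that r(n) and
-- 2 ∑_{d ∣ n} χ(d) obey the same recursion at every prime, so they agree for n ≥ 1.  Hence
--   U(Y) = ∑_{n < Y} r(n) g(Y − n) = h Y³ + 2 V(Y),   V(Y) = ∑_{k,l ≥ 1} χ(k) g(Y − kl).
-- As a sum over lattice points, U(4Y) − 256 U(Y) consists of alternating sums of g along quadratic
-- progressions and is O(Y^{5/2}), since third differences of g are small.  On the divisor side
-- V(2Y) = 16 V(Y) + W(2Y) with W(Y) = ∑ (−1)^{l+1} χ(k) g(Y − kl), and the hyperbola method gives
-- 2N W(Y) = M Y³ + O(Y^{14/5}) with M = −∑_{x ≤ N} x χ(x).  Comparing the coefficients of Y³
-- yields the class number formula N h = M.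
--
-- Folding ∑ x χ(x) by x ↦ N − x, directly and along the even numbers, turns it into
-- ∑_{x < N/2} χ(x) = (2 − χ(2)) h.  Multiplying by 2 and by 3 modulo N permutes the sixths up to
-- reflection and gives E₀ − E₂ = χ(2)(E₀ + E₁) and E₀ + E₁ + E₂ = χ(3)(E₀ − E₁ + E₂).  These three
-- linear equations determine E₀, E₁, E₂ from χ(2) and χ(3), hence from N modulo 24.

module Submission where

open import Defs using (SquareFree; legendre; jacobi; module QuadraticField)
import Defs
open import Data.Empty using (⊥; ⊥-elim)
open import Data.Fin.Base as Fin using (Fin; toℕ; fromℕ<)
open import Data.Fin.Properties using (all?; any?; toℕ-fromℕ<)
open import Data.List.Base using (List; []; _∷_; length)
import Data.Nat.Base as ℕ
open ℕ using (ℕ; zero; suc; NonZero; _∸_; _%_)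
import Data.Nat.Divisibility as ℕD
open ℕD using (_∤_)
import Data.Nat.DivMod as ℕM
import Data.Nat.Properties as ℕP
import Data.Nat.Tactic.RingSolver as ℕSolver
open import Data.Nat.Coprimality as Coprimality using (Coprime; coprime?; coprime-Bézout; coprime-divisor; gcd≡1⇒coprime)
open import Data.Nat.GCD using (gcd; gcd[m,n]∣m; gcd[m,n]∣n; module Bézout; module GCD)
open import Data.Nat.Induction using (<-rec)
open import Data.Nat.Primality using (Prime; prime?; prime[2]; euclidsLemma; prime⇒nonZero; prime⇒nonTrivial; prime⇒irreducible; ¬prime[1])
open import Data.Product.Base using (∃; ∃₂; _×_; _,_; proj₁; proj₂)
open import Data.Sum.Base as Sum using (_⊎_; inj₁; inj₂; [_,_]′)
open import Function.Base using (_∘_)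
open import Relation.Binary.PropositionalEquality hiding ([_])
open import Relation.Nullary using (¬_; yes; no; Dec; does)
open import Relation.Nullary.Decidable using (map′; _×-dec_; dec-true; dec-false; from-yes; from-no; toWitness)
open import Relation.Unary using (Pred; Decidable)

module QuadraticOrder where

  open import Data.Integer.Base hiding (suc; pred; NonZero; _%_)
  open import Data.Integer.Properties
  open import Data.Integer.DivMod using (_/ℕ_; n%ℕd<d; a≡a%ℕn+[a/ℕn]*n)
  open import Data.Integer.Divisibility.Signed
    using (_∣_; divides; ∣ᵤ⇒∣; ∣⇒∣ᵤ; ∣m∣n⇒∣m+n; ∣m∣n⇒∣m-n; ∣n⇒∣m*n; ∣m⇒∣m*n; _∣?_; ∣-refl)
  open import Data.Integer.Tactic.RingSolver using (solve-∀; solve)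

  ≤-from : ∀ {a b} c → 0ℤ ≤ c → b ≡ a + c → a ≤ b
  ≤-from {a} c 0≤c refl = subst (_≤ a + c) (+-identityʳ a) (+-monoʳ-≤ a 0≤c)

  0≤+ : ∀ {a b} → 0ℤ ≤ a → 0ℤ ≤ b → 0ℤ ≤ a + b
  0≤+ = +-mono-≤

  0≤* : ∀ {a b} → 0ℤ ≤ a → 0ℤ ≤ b → 0ℤ ≤ a * b
  0≤* {+ m} {+ n} _ _ = subst (0ℤ ≤_) (pos-* m n) (+≤+ ℕ.z≤n)

  0≤sq : ∀ a → 0ℤ ≤ a * a
  0≤sq (+ n) = 0≤* {+ n} {+ n} (+≤+ ℕ.z≤n) (+≤+ ℕ.z≤n)
  0≤sq -[1+ n ] = +≤+ ℕ.z≤n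

  0≤ℕ : ∀ {n} → 0ℤ ≤ + n
  0≤ℕ = +≤+ ℕ.z≤n

  0≤- : ∀ {a b} → a ≤ b → 0ℤ ≤ b - a
  0≤- = i≤j⇒0≤j-i

  -- A strict inequality a < b in the form 0 ≤ b − a − 1.
  0≤-< : ∀ {a b} → a < b → 0ℤ ≤ b - a - 1ℤ
  0≤-< {a} {b} a<b = subst (0ℤ ≤_) (lem a b) (0≤- (i<j⇒suc[i]≤j a<b))
    where
    lem : ∀ a b → b - (1ℤ + a) ≡ b - a - 1ℤ
    lem = solve-∀

  <-from : ∀ {a b} c → 0ℤ ≤ c → b ≡ a + 1ℤ + c → a < b
  <-from {a} c 0≤c eq = suc[i]≤j⇒i<j (≤-from c 0≤c (trans eq (lem a c)))
    where
    lem : ∀ a c → a + 1ℤ + c ≡ (1ℤ + a) + c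
    lem = solve-∀

  *-monoˡ : ∀ {a b} c → 0ℤ ≤ c → a ≤ b → c * a ≤ c * b
  *-monoˡ {a} {b} c 0≤c a≤b =
    ≤-from (c * (b - a)) (0≤* 0≤c (0≤- a≤b)) (solve (a ∷ b ∷ c ∷ []))

  *-mono : ∀ {a b c d} → 0ℤ ≤ a → 0ℤ ≤ d → a ≤ b → c ≤ d → a * c ≤ b * d
  *-mono {a} {b} {c} {d} 0≤a 0≤d a≤b c≤d =
    ≤-from (a * (d - c) + (b - a) * d) (0≤+ (0≤* 0≤a (0≤- c≤d)) (0≤* (0≤- a≤b) 0≤d))
      (solve (a ∷ b ∷ c ∷ d ∷ []))

  0≤half : ∀ c → 0ℤ ≤ + 2 * c → 0ℤ ≤ c
  0≤half (+ n) _ = +≤+ ℕ.z≤n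

  data Bounded (x b : ℤ) : Set where
    bounded : - b ≤ x → x ≤ b → Bounded x b

  bounded-+ : ∀ {x y a b} → Bounded x a → Bounded y b → Bounded (x + y) (a + b)
  bounded-+ {a = a} {b} (bounded p q) (bounded r s) =
    bounded (subst (_≤ _) (sym (neg-distrib-+ a b)) (+-mono-≤ p r)) (+-mono-≤ q s)

  bounded-neg : ∀ {x a} → Bounded x a → Bounded (- x) a
  bounded-neg {x} {a} (bounded p q) =
    bounded (neg-mono-≤ q) (subst (- x ≤_) (neg-involutive a) (neg-mono-≤ p))

  bounded-- : ∀ {x y a b} → Bounded x a → Bounded y b → Bounded (x - y) (a + b)
  bounded-- p q = bounded-+ p (bounded-neg q)

  bounded-* : ∀ {x y a b} → Bounded x a → Bounded y b → Bounded (x * y) (a * b)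
  bounded-* {x} {y} {a} {b} (bounded p q) (bounded r s) =
    bounded
      (≤-from (x * y + a * b)
        (0≤half _ (subst (0ℤ ≤_) (lem₁ x y a b)
          (0≤+ (0≤* (0≤- p) (0≤- r)) (0≤* (0≤- q) (0≤- s)))))
        (lem₂ x y a b))
      (≤-from (a * b - x * y)
        (0≤half _ (subst (0ℤ ≤_) (lem₃ x y a b)
          (0≤+ (0≤* (0≤- q) (0≤- r)) (0≤* (0≤- p) (0≤- s)))))
        (lem₄ x y a b))
    where
    lem₁ : ∀ x y a b → (x - - a) * (y - - b) + (a - x) * (b - y) ≡ + 2 * (x * y + a * b)
    lem₁ = solve-∀
    lem₂ : ∀ x y a b → x * y ≡ - (a * b) + (x * y + a * b)
    lem₂ = solve-∀
    lem₃ : ∀ x y a b → (a - x) * (y - - b) + (x - - a) * (b - y) ≡ + 2 * (a * b - x * y)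
    lem₃ = solve-∀
    lem₄ : ∀ x y a b → a * b ≡ x * y + (a * b - x * y)
    lem₄ = solve-∀

  bounded-≤ : ∀ {x a b} → a ≤ b → Bounded x a → Bounded x b
  bounded-≤ a≤b (bounded p q) = bounded (≤-trans (neg-mono-≤ a≤b) p) (≤-trans q a≤b)

  bounded-nonneg : ∀ {x a} → 0ℤ ≤ x → x ≤ a → Bounded x a
  bounded-nonneg 0≤x x≤a = bounded (≤-trans (neg-mono-≤ (≤-trans 0≤x x≤a)) 0≤x) x≤a

  bounded-∣∣ : ∀ x → Bounded x (+ ∣ x ∣)
  bounded-∣∣ (+ n) = bounded-nonneg 0≤ℕ ≤-refl
  bounded-∣∣ -[1+ n ] = bounded ≤-refl -≤+

  -- Divisibility

  ∣-eq : ∀ {d x y} → x ≡ y → d ∣ x → d ∣ y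
  ∣-eq refl p = p

  ∣-prod : ∀ {p} → Prime p → ∀ a b → + p ∣ a * b → (+ p ∣ a) ⊎ (+ p ∣ b)
  ∣-prod pp a b d =
    Sum.map ∣ᵤ⇒∣ ∣ᵤ⇒∣ (euclidsLemma ∣ a ∣ ∣ b ∣ pp (subst (_ ℕD.∣_) (abs-* a b) (∣⇒∣ᵤ d)))

  ∣-cancel : ∀ {p} → Prime p → ∀ a b → ¬ (+ p ∣ a) → + p ∣ a * b → + p ∣ b
  ∣-cancel pp a b p∤a d with ∣-prod pp a b d
  ... | inj₁ p∣a = ⊥-elim (p∤a p∣a)
  ... | inj₂ p∣b = p∣b

  ∣-∣∣< : ∀ {p x} → + p ∣ x → ∣ x ∣ ℕ.< p → x ≡ 0ℤ
  ∣-∣∣< {p} {x} d x<p with ∣ x ∣ in eq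
  ... | ℕ.zero = ∣i∣≡0⇒i≡0 eq
  ... | ℕ.suc k = ⊥-elim (ℕD.>⇒∤ x<p (subst (p ℕD.∣_) eq (∣⇒∣ᵤ d)))

  bezout : ∀ {m n} → Coprime m n → ∃₂ λ x y → x * + m + y * + n ≡ 1ℤ
  bezout {m} {n} c with coprime-Bézout c
  ... | Bézout.+- x y eq = + x , - + y , trans (cong (_+ (- + y * + n)) lem) (lem₂ (+ y * + n) (+ y) (+ n) refl)
    where
    lem : + x * + m ≡ 1ℤ + + y * + n
    lem = trans (sym (pos-* x m)) (trans (cong +_ (sym eq)) (cong (_+_ 1ℤ) (pos-* y n)))
    lem₂ : ∀ w y n → w ≡ y * n → 1ℤ + w + (- y * n) ≡ 1ℤ
    lem₂ w y n refl = lem₃ y n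
      where
      lem₃ : ∀ y n → 1ℤ + y * n + (- y * n) ≡ 1ℤ
      lem₃ = solve-∀
  ... | Bézout.-+ x y eq = - + x , + y , trans (cong (_+_ (- + x * + m)) lem) (lem₃ (+ x) (+ m))
    where
    lem : + y * + n ≡ 1ℤ + + x * + m
    lem = trans (sym (pos-* y n)) (trans (cong +_ (sym eq)) (cong (_+_ 1ℤ) (pos-* x m)))
    lem₃ : ∀ y n → - y * n + (1ℤ + y * n) ≡ 1ℤ
    lem₃ = solve-∀

  prime-coprime : ∀ {p} → Prime p → ∀ a → ¬ (+ p ∣ a) → Coprime p ∣ a ∣
  prime-coprime pp a p∤a {d} (d∣p , d∣a) with prime⇒irreducible pp d∣p
  ... | inj₁ d≡1 = d≡1
  ... | inj₂ refl = ⊥-elim (p∤a (∣ᵤ⇒∣ d∣a))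

  ∣∣*sign : ∀ a → ∃ λ s → + ∣ a ∣ ≡ s * a
  ∣∣*sign (+ n) = 1ℤ , sym (*-identityˡ (+ n))
  ∣∣*sign -[1+ n ] = -1ℤ , sym (-1*i≡-i -[1+ n ])

  mod-inverse : ∀ {p} → Prime p → ∀ a → ¬ (+ p ∣ a) → ∃ λ b → + p ∣ a * b - 1ℤ
  mod-inverse {p} pp a p∤a with bezout (prime-coprime pp a p∤a) | ∣∣*sign a
  ... | x , y , eq | s , eqs =
    y * s , divides (- x) (trans (lem x y s (+ p) a) (trans (cong (_-_ (- x * + p)) lem₂) (+-identityʳ (- x * + p))))
    where
    lem₂ : 1ℤ - (x * + p + y * (s * a)) ≡ 0ℤ
    lem₂ = trans (cong (λ t → 1ℤ - (x * + p + y * t)) (sym eqs)) (cong (_-_ 1ℤ) eq)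
    lem : ∀ x y s p a → a * (y * s) - 1ℤ ≡ - x * p - (1ℤ - (x * p + y * (s * a)))
    lem = solve-∀

  gcd-combination : ∀ a b → ∃ λ g → (+ g ∣ a) × (+ g ∣ b) × ∃₂ λ x y → x * a + y * b ≡ + g
  gcd-combination a b with Bézout.lemma ∣ a ∣ ∣ b ∣ | ∣∣*sign a | ∣∣*sign b
  ... | Bézout.result d g i | s , es | t , et =
    d , ∣ᵤ⇒∣ (GCD.gcd∣m g) , ∣ᵤ⇒∣ (GCD.gcd∣n g) , combine i
    where
    combine : Bézout.Identity.Identity d ∣ a ∣ ∣ b ∣ → ∃₂ λ x y → x * a + y * b ≡ + d
    combine (Bézout.+- x y eq) = + x * s , - + y * t ,
      trans (lem₁ (+ x) s a (+ y) t b) (trans (cong₂ (λ A B → + x * A - + y * B) (sym es) (sym et)) (lem₂ (+ d) _ _ eq′))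
      where
      eq′ : + d + + y * + ∣ b ∣ ≡ + x * + ∣ a ∣
      eq′ = trans (cong (_+_ (+ d)) (sym (pos-* y ∣ b ∣))) (trans (sym (pos-+ d (y ℕ.* ∣ b ∣))) (trans (cong +_ eq) (pos-* x ∣ a ∣)))
      lem₁ : ∀ x s a y t b → x * s * a + - y * t * b ≡ x * (s * a) - y * (t * b)
      lem₁ = solve-∀
      lem₂ : ∀ d B A → d + B ≡ A → A - B ≡ d
      lem₂ d B A refl = lem₃ d B
        where
        lem₃ : ∀ d B → d + B - B ≡ d
        lem₃ = solve-∀
    combine (Bézout.-+ x y eq) = - + x * s , + y * t ,
      trans (lem₁ (+ x) s a (+ y) t b) (trans (cong₂ (λ A B → + y * B - + x * A) (sym es) (sym et)) (lem₂ (+ d) _ _ eq′))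
      where
      eq′ : + d + + x * + ∣ a ∣ ≡ + y * + ∣ b ∣
      eq′ = trans (cong (_+_ (+ d)) (sym (pos-* x ∣ a ∣))) (trans (sym (pos-+ d (x ℕ.* ∣ a ∣))) (trans (cong +_ eq) (pos-* y ∣ b ∣)))
      lem₁ : ∀ x s a y t b → - x * s * a + y * t * b ≡ y * (t * b) - x * (s * a)
      lem₁ = solve-∀
      lem₂ : ∀ d B A → d + B ≡ A → A - B ≡ d
      lem₂ d B A refl = lem₃ d B
        where
        lem₃ : ∀ d B → d + B - B ≡ d
        lem₃ = solve-∀

  ∣-antisym-pos : ∀ {a b} → 0ℤ ≤ a → 0ℤ ≤ b → a ∣ b → b ∣ a → a ≡ b
  ∣-antisym-pos {+ a} {+ b} _ _ p q = cong +_ (ℕD.∣-antisym (∣⇒∣ᵤ p) (∣⇒∣ᵤ q))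

  *-cancelˡ-≢0 : ∀ a {x y} → a ≢ 0ℤ → a * x ≡ a * y → x ≡ y
  *-cancelˡ-≢0 a {x} {y} a≢0 e = *-cancelˡ-≡ a x y {{≢-nonZero a≢0}} e

  ∣-cancelˡ : ∀ a {x y} → a ≢ 0ℤ → a * x ∣ a * y → x ∣ y
  ∣-cancelˡ a {x} {y} a≢0 (divides k e) = divides k (*-cancelˡ-≢0 a a≢0 (trans e (lem k a x)))
    where
    lem : ∀ k a x → k * (a * x) ≡ a * (k * x)
    lem = solve-∀

  product≢0 : ∀ a b → a ≢ 0ℤ → b ≢ 0ℤ → a * b ≢ 0ℤ
  product≢0 a b a≢0 b≢0 e with i*j≡0⇒i≡0∨j≡0 a e
  ... | inj₁ p = a≢0 p
  ... | inj₂ p = b≢0 p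

  pos-≢0 : ∀ {a} → 0ℤ < a → a ≢ 0ℤ
  pos-≢0 0<a e = <-irrefl (sym e) 0<a

  least : {P : ℕ.ℕ → Set} → (∀ n → Dec (P n)) → ∀ n → P n → ∃ λ m → P m × (∀ j → j ℕ.< m → ¬ P j)
  least {P} P? n p with search n
    where
    search : ∀ n → (∃ λ m → P m × (∀ j → j ℕ.< m → ¬ P j)) ⊎ (∀ j → j ℕ.< n → ¬ P j)
    search ℕ.zero = inj₂ (λ j ())
    search (ℕ.suc n) with search n
    ... | inj₁ r = inj₁ r
    ... | inj₂ none with P? n
    ... | yes p = inj₁ (n , p , none)
    ... | no ¬p = inj₂ λ j j<1+n pj → case-≤ j<1+n pj
      where
      case-≤ : ∀ {j} → j ℕ.< ℕ.suc n → P j → ⊥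
      case-≤ {j} j<1+n pj with ℕP.m≤n⇒m<n∨m≡n (ℕ.s≤s⁻¹ j<1+n)
      ... | inj₁ j<n = none j j<n pj
      ... | inj₂ refl = ¬p pj
  ... | inj₁ r = r
  ... | inj₂ none = search-self
    where
    search-self : ∃ λ m → P m × (∀ j → j ℕ.< m → ¬ P j)
    search-self = n , p , none

  sum-nonneg-0 : ∀ {a b} → 0ℤ ≤ a → 0ℤ ≤ b → a + b ≡ 0ℤ → b ≡ 0ℤ
  sum-nonneg-0 {a} {b} 0≤a 0≤b e = ≤-antisym (≤-from a 0≤a (trans (sym e) (+-comm a b))) 0≤b

  square-0 : ∀ {a} → a * a ≡ 0ℤ → a ≡ 0ℤ
  square-0 {a} e with i*j≡0⇒i≡0∨j≡0 a e
  ... | inj₁ p = p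
  ... | inj₂ p = p

  module Quad (m : ℕ) where

    q N : ℤ
    q = + suc m
    N = + 4 * q - 1ℤ

    0<N : 0ℤ < N
    0<N = <-from (+ 2 + + 4 * + m) (0≤+ {+ 2} 0≤ℕ (0≤* {+ 4} {+ m} 0≤ℕ 0≤ℕ)) (trans (cong (λ x → + 4 * x - 1ℤ) (pos-+ 1 m)) (lem (+ m)))
      where
      lem : ∀ m → + 4 * (1ℤ + m) - 1ℤ ≡ 0ℤ + 1ℤ + (+ 2 + + 4 * m)
      lem = solve-∀

    -- ⟨ u , w ⟩ is u + wω with ω = (1 + √−N)/2, so ω² = ω − q.
    infix 5 ⟨_,_⟩
    record O : Set where
      constructor ⟨_,_⟩
      field
        u w : ℤ
    open O public

    infixl 7 _⊛_
    infixl 6 _⊞_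

    0ₒ 1ₒ ω : O
    0ₒ = ⟨ 0ℤ , 0ℤ ⟩
    1ₒ = ⟨ 1ℤ , 0ℤ ⟩
    ω = ⟨ 0ℤ , 1ℤ ⟩

    opaque
      _⊞_ : O → O → O
      ⟨ a , b ⟩ ⊞ ⟨ c , d ⟩ = ⟨ a + c , b + d ⟩

      _⊛_ : O → O → O
      ⟨ a , b ⟩ ⊛ ⟨ c , d ⟩ = ⟨ a * c - q * (b * d) , a * d + b * c + b * d ⟩

      infixr 7 _•_
      _•_ : ℤ → O → O
      k • ⟨ a , b ⟩ = ⟨ k * a , k * b ⟩

      conj : O → O
      conj ⟨ a , b ⟩ = ⟨ a + b , - b ⟩

      nrm : O → ℤ
      nrm ⟨ a , b ⟩ = a * a + a * b + q * (b * b)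

      ⊞-def : ∀ a b c d → ⟨ a , b ⟩ ⊞ ⟨ c , d ⟩ ≡ ⟨ a + c , b + d ⟩
      ⊞-def a b c d = refl

      ⊛-def : ∀ a b c d → ⟨ a , b ⟩ ⊛ ⟨ c , d ⟩ ≡ ⟨ a * c - q * (b * d) , a * d + b * c + b * d ⟩
      ⊛-def a b c d = refl

      •-def : ∀ k v → k • v ≡ ⟨ k * u v , k * w v ⟩
      •-def k v = refl

      nrm-def : ∀ a b → nrm ⟨ a , b ⟩ ≡ a * a + a * b + q * (b * b)
      nrm-def a b = refl

      ⊛-comm : ∀ x y → x ⊛ y ≡ y ⊛ x
      ⊛-comm ⟨ a , b ⟩ ⟨ c , d ⟩ = cong₂ ⟨_,_⟩ (lem₁ q a b c d) (lem₂ a b c d)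
        where
        lem₁ : ∀ q a b c d → a * c - q * (b * d) ≡ c * a - q * (d * b)
        lem₁ = solve-∀
        lem₂ : ∀ a b c d → a * d + b * c + b * d ≡ c * b + d * a + d * b
        lem₂ = solve-∀

      ⊛-assoc : ∀ x y z → (x ⊛ y) ⊛ z ≡ x ⊛ (y ⊛ z)
      ⊛-assoc ⟨ a , b ⟩ ⟨ c , d ⟩ ⟨ e , f ⟩ = cong₂ ⟨_,_⟩ (lem₁ q a b c d e f) (lem₂ q a b c d e f)
        where
        lem₁ : ∀ q a b c d e f → (a * c - q * (b * d)) * e - q * ((a * d + b * c + b * d) * f)
          ≡ a * (c * e - q * (d * f)) - q * (b * (c * f + d * e + d * f))
        lem₁ = solve-∀
        lem₂ : ∀ q a b c d e f → (a * c - q * (b * d)) * f + (a * d + b * c + b * d) * e + (a * d + b * c + b * d) * f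
          ≡ a * (c * f + d * e + d * f) + b * (c * e - q * (d * f)) + b * (c * f + d * e + d * f)
        lem₂ = solve-∀

      ⊛-distribˡ : ∀ x y z → x ⊛ (y ⊞ z) ≡ x ⊛ y ⊞ x ⊛ z
      ⊛-distribˡ ⟨ a , b ⟩ ⟨ c , d ⟩ ⟨ e , f ⟩ = cong₂ ⟨_,_⟩ (lem₁ q a b c d e f) (lem₂ a b c d e f)
        where
        lem₁ : ∀ q a b c d e f → a * (c + e) - q * (b * (d + f)) ≡ a * c - q * (b * d) + (a * e - q * (b * f))
        lem₁ = solve-∀
        lem₂ : ∀ a b c d e f → a * (d + f) + b * (c + e) + b * (d + f) ≡ a * d + b * c + b * d + (a * f + b * e + b * f)
        lem₂ = solve-∀

      ⊛-• : ∀ x k y → x ⊛ (k • y) ≡ k • (x ⊛ y)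
      ⊛-• ⟨ a , b ⟩ k ⟨ c , d ⟩ = cong₂ ⟨_,_⟩ (lem₁ q a b c d k) (lem₂ a b c d k)
        where
        lem₁ : ∀ q a b c d k → a * (k * c) - q * (b * (k * d)) ≡ k * (a * c - q * (b * d))
        lem₁ = solve-∀
        lem₂ : ∀ a b c d k → a * (k * d) + b * (k * c) + b * (k * d) ≡ k * (a * d + b * c + b * d)
        lem₂ = solve-∀

      •-⊛ : ∀ k x → ⟨ k , 0ℤ ⟩ ⊛ x ≡ k • x
      •-⊛ k ⟨ a , b ⟩ = cong₂ ⟨_,_⟩ (lem₁ q k a b) (lem₂ k a b)
        where
        lem₁ : ∀ q k a b → k * a - q * (0ℤ * b) ≡ k * a
        lem₁ = solve-∀
        lem₂ : ∀ k a b → k * b + 0ℤ * a + 0ℤ * b ≡ k * b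
        lem₂ = solve-∀

      •-assoc : ∀ j k x → j • k • x ≡ (j * k) • x
      •-assoc j k ⟨ a , b ⟩ = cong₂ ⟨_,_⟩ (sym (*-assoc j k a)) (sym (*-assoc j k b))

      •-comm : ∀ j k x → j • k • x ≡ k • j • x
      •-comm j k x = trans (•-assoc j k x) (trans (cong (_• x) (*-comm j k)) (sym (•-assoc k j x)))

      1ₒ-⊛ : ∀ x → 1ₒ ⊛ x ≡ x
      1ₒ-⊛ x = trans (•-⊛ 1ℤ x) (cong₂ ⟨_,_⟩ (*-identityˡ (u x)) (*-identityˡ (w x)))

      conj-⊛ : ∀ x → conj x ⊛ x ≡ ⟨ nrm x , 0ℤ ⟩
      conj-⊛ ⟨ a , b ⟩ = cong₂ ⟨_,_⟩ (lem₁ q a b) (lem₂ a b)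
        where
        lem₁ : ∀ q a b → (a + b) * a - q * (- b * b) ≡ a * a + a * b + q * (b * b)
        lem₁ = solve-∀
        lem₂ : ∀ a b → (a + b) * b + - b * a + - b * b ≡ 0ℤ
        lem₂ = solve-∀

      nrm-conj : ∀ x → nrm (conj x) ≡ nrm x
      nrm-conj ⟨ a , b ⟩ = lem q a b
        where
        lem : ∀ q a b → (a + b) * (a + b) + (a + b) * - b + q * (- b * - b) ≡ a * a + a * b + q * (b * b)
        lem = solve-∀

      nrm-⊛ : ∀ x y → nrm (x ⊛ y) ≡ nrm x * nrm y
      nrm-⊛ ⟨ a , b ⟩ ⟨ c , d ⟩ = lem q a b c d
        where
        lem : ∀ q a b c d → (a * c - q * (b * d)) * (a * c - q * (b * d))
          + (a * c - q * (b * d)) * (a * d + b * c + b * d)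
          + q * ((a * d + b * c + b * d) * (a * d + b * c + b * d))
          ≡ (a * a + a * b + q * (b * b)) * (c * c + c * d + q * (d * d))
        lem = solve-∀

      nrm-• : ∀ k x → nrm (k • x) ≡ k * k * nrm x
      nrm-• k ⟨ a , b ⟩ = lem q k a b
        where
        lem : ∀ q k a b → k * a * (k * a) + k * a * (k * b) + q * (k * b * (k * b)) ≡ k * k * (a * a + a * b + q * (b * b))
        lem = solve-∀

      4nrm : ∀ a b → + 4 * nrm ⟨ a , b ⟩ ≡ (+ 2 * a + b) * (+ 2 * a + b) + N * (b * b)
      4nrm a b = lem q a b
        where
        lem : ∀ q a b → + 4 * (a * a + a * b + q * (b * b)) ≡ (+ 2 * a + b) * (+ 2 * a + b) + (+ 4 * q - 1ℤ) * (b * b)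
        lem = solve-∀

      0≤nrm : ∀ x → 0ℤ ≤ nrm x
      0≤nrm ⟨ a , b ⟩ = 0≤half _ (0≤half _ (subst (0ℤ ≤_)
        (trans (sym (4nrm a b)) (lem (nrm ⟨ a , b ⟩)))
        (0≤+ (0≤sq (+ 2 * a + b)) (0≤* (<⇒≤ 0<N) (0≤sq b)))))
        where
        lem : ∀ n → + 4 * n ≡ + 2 * (+ 2 * n)
        lem = solve-∀

      nrm-0 : ∀ x → nrm x ≡ 0ℤ → x ≡ 0ₒ
      nrm-0 ⟨ a , b ⟩ e = cong₂ ⟨_,_⟩ a≡0 b≡0
        where
        eq : (+ 2 * a + b) * (+ 2 * a + b) + N * (b * b) ≡ 0ℤ
        eq = trans (sym (4nrm a b)) (trans (cong (_*_ (+ 4)) e) refl)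
        b≡0 : b ≡ 0ℤ
        b≡0 = square-0 (*-cancelˡ-≢0 N (pos-≢0 0<N)
          (trans (sum-nonneg-0 (0≤sq (+ 2 * a + b)) (0≤* (<⇒≤ 0<N) (0≤sq b)) eq) (sym (*-zeroʳ N))))
        a≡0 : a ≡ 0ℤ
        a≡0 = square-0 (trans (lem q a) (trans (cong (λ b → a * a + a * b + q * (b * b)) (sym b≡0)) e))
          where
          lem : ∀ q a → a * a ≡ a * a + a * 0ℤ + q * (0ℤ * 0ℤ)
          lem = solve-∀

      nrm-0ₒ : nrm 0ₒ ≡ 0ℤ
      nrm-0ₒ = lem q
        where
        lem : ∀ q → 0ℤ * 0ℤ + 0ℤ * 0ℤ + q * (0ℤ * 0ℤ) ≡ 0ℤ
        lem = solve-∀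

      •-cancel : ∀ k {x y} → k ≢ 0ℤ → k • x ≡ k • y → x ≡ y
      •-cancel k {⟨ a , b ⟩} {⟨ c , d ⟩} k≢0 e = cong₂ ⟨_,_⟩ (*-cancelˡ-≢0 k k≢0 (cong u e)) (*-cancelˡ-≢0 k k≢0 (cong w e))

    0<nrm : ∀ {x} → x ≢ 0ₒ → 0ℤ < nrm x
    0<nrm {x} x≢0 = ≤∧≢⇒< (0≤nrm x) (λ e → x≢0 (nrm-0 x (sym e)))

    conj-⊛-⊛ : ∀ x y → conj x ⊛ (x ⊛ y) ≡ nrm x • y
    conj-⊛-⊛ x y = trans (sym (⊛-assoc (conj x) x y)) (trans (cong (_⊛ y) (conj-⊛ x)) (•-⊛ (nrm x) y))

    ⊛-cancel : ∀ {x y z} → x ≢ 0ₒ → x ⊛ y ≡ x ⊛ z → y ≡ z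
    ⊛-cancel {x} {y} {z} x≢0 e = •-cancel (nrm x) (pos-≢0 (0<nrm x≢0))
      (trans (sym (conj-⊛-⊛ x y)) (trans (cong (conj x ⊛_) e) (conj-⊛-⊛ x z)))

    ⊛-≢0 : ∀ {x y} → x ≢ 0ₒ → y ≢ 0ₒ → x ⊛ y ≢ 0ₒ
    ⊛-≢0 {x} {y} x≢0 y≢0 e = product≢0 (nrm x) (nrm y) (pos-≢0 (0<nrm x≢0)) (pos-≢0 (0<nrm y≢0))
      (trans (sym (nrm-⊛ x y)) (trans (cong nrm e) nrm-0ₒ))

    record Similar (P Q : O → Set) : Set where
      field
        α β : O
        α≢0 : α ≢ 0ₒ
        β≢0 : β ≢ 0ₒ
        to   : ∀ {x} → P x → ∃ λ y → Q y × α ⊛ x ≡ β ⊛ y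
        from : ∀ {y} → Q y → ∃ λ x → P x × α ⊛ x ≡ β ⊛ y
    open Similar

    similar-sym : ∀ {P Q} → Similar P Q → Similar Q P
    similar-sym s = record { α = β s ; β = α s ; α≢0 = β≢0 s ; β≢0 = α≢0 s
      ; to = λ y → let x , p , e = from s y in x , p , sym e
      ; from = λ x → let y , p , e = to s x in y , p , sym e }

    similar-trans : ∀ {P Q R} → Similar P Q → Similar Q R → Similar P R
    similar-trans s t = record { α = α t ⊛ α s ; β = β s ⊛ β t ; α≢0 = ⊛-≢0 (α≢0 t) (α≢0 s) ; β≢0 = ⊛-≢0 (β≢0 s) (β≢0 t)
      ; to = λ {x} px → let y , qy , e = to s px ; z , rz , f = to t qy in z , rz , lem x y z e f
      ; from = λ {z} rz → let y , qy , f = from t rz ; x , px , e = from s qy in x , px , lem x y z e f }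
      where
      lem : ∀ x y z → α s ⊛ x ≡ β s ⊛ y → α t ⊛ y ≡ β t ⊛ z → (α t ⊛ α s) ⊛ x ≡ (β s ⊛ β t) ⊛ z
      lem x y z e f = begin
        (α t ⊛ α s) ⊛ x ≡⟨ ⊛-assoc (α t) (α s) x ⟩
        α t ⊛ (α s ⊛ x) ≡⟨ cong (α t ⊛_) e ⟩
        α t ⊛ (β s ⊛ y) ≡⟨ sym (⊛-assoc (α t) (β s) y) ⟩
        (α t ⊛ β s) ⊛ y ≡⟨ cong (_⊛ y) (⊛-comm (α t) (β s)) ⟩
        (β s ⊛ α t) ⊛ y ≡⟨ ⊛-assoc (β s) (α t) y ⟩
        β s ⊛ (α t ⊛ y) ≡⟨ cong (β s ⊛_) f ⟩
        β s ⊛ (β t ⊛ z) ≡⟨ sym (⊛-assoc (β s) (β t) z) ⟩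
        (β s ⊛ β t) ⊛ z ∎
        where open ≡-Reasoning

    record Ideal : Set₁ where
      field
        mem     : O → Set
        mem?    : ∀ x → Dec (mem x)
        closed-⊞ : ∀ {x y} → mem x → mem y → mem (x ⊞ y)
        closed-⊛ : ∀ a {x} → mem x → mem (a ⊛ x)
        nonzero : ∃ λ x → mem x × x ≢ 0ₒ

      closed-• : ∀ k {x} → mem x → mem (k • x)
      closed-• k {x} p = subst mem (•-⊛ k x) (closed-⊛ ⟨ k , 0ℤ ⟩ p)
    open Ideal public

    record Form : Set where
      field
        a x c : ℤ
        0<a   : 0ℤ < a
        ac≡   : a * c ≡ x * x + x + q

      b : ℤ
      b = + 2 * x + 1ℤ

      a≢0 : a ≢ 0ℤ
      a≢0 = pos-≢0 0<a

      -- The lattice ℤa + ℤ(x + ω).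
      L : O → Set
      L ⟨ u , w ⟩ = a ∣ u - w * x

      vec : ℤ → ℤ → O
      vec i j = ⟨ i * a + j * x , j ⟩

      Q : ℤ → ℤ → ℤ
      Q i j = a * (i * i) + b * (i * j) + c * (j * j)

      nrm-vec : ∀ i j → nrm (vec i j) ≡ a * Q i j
      nrm-vec i j = trans (trans (nrm-def (i * a + j * x) j) (lem₁ q a x i j)) (trans (cong (λ t → a * (a * (i * i) + b * (i * j)) + t * (j * j)) (sym ac≡)) (lem₂ a b c i j))
        where
        lem₁ : ∀ q a x i j → (i * a + j * x) * (i * a + j * x) + (i * a + j * x) * j + q * (j * j)
          ≡ a * (a * (i * i) + (+ 2 * x + 1ℤ) * (i * j)) + (x * x + x + q) * (j * j)
        lem₁ = solve-∀
        lem₂ : ∀ a b c i j → a * (a * (i * i) + b * (i * j)) + a * c * (j * j) ≡ a * (a * (i * i) + b * (i * j) + c * (j * j))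
        lem₂ = solve-∀

      L-vec : ∀ i j → L (vec i j)
      L-vec i j = divides i (lem a x i j)
        where
        lem : ∀ a x i j → i * a + j * x - j * x ≡ i * a
        lem = solve-∀

      vec-L : ∀ {v} → L v → ∃₂ λ i j → v ≡ vec i j
      vec-L {⟨ u , w ⟩} (divides i e) = i , w , cong ⟨_, w ⟩ (trans (lem u (w * x)) (cong (_+ w * x) e))
        where
        lem : ∀ u t → u ≡ u - t + t
        lem = solve-∀

      vec-injective : ∀ {i j i′ j′} → vec i j ≡ vec i′ j′ → i ≡ i′ × j ≡ j′
      vec-injective {i} {j} {i′} {j′} e = *-cancelˡ-≢0 a a≢0 (trans (lem a i (j * x)) (trans (cong₂ _-_ (cong u e) (cong (_* x) (cong w e))) (sym (lem a i′ (j′ * x))))) , cong w e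
        where
        lem : ∀ a i t → a * i ≡ i * a + t - t
        lem = solve-∀

      L-ideal : Ideal
      L-ideal = record
        { mem = L
        ; mem? = λ { ⟨ u , w ⟩ → a ∣? (u - w * x) }
        ; closed-⊞ = λ { {⟨ u , w ⟩} {⟨ u′ , w′ ⟩} d e → subst L (sym (⊞-def u w u′ w′)) (∣-eq (lem₁ u w u′ w′ x) (∣m∣n⇒∣m+n d e)) }
        ; closed-⊛ = λ { ⟨ s , t ⟩ {⟨ u , w ⟩} d → subst L (sym (⊛-def s t u w)) (∣-eq (lem₂ q s t u w x)
            (∣m∣n⇒∣m-n (∣n⇒∣m*n (s - t * x) d) (∣n⇒∣m*n (t * w) (∣-eq ac≡ (∣m⇒∣m*n c ∣-refl))))) }
        ; nonzero = vec 1ℤ 0ℤ , L-vec 1ℤ 0ℤ , λ e → a≢0 (trans (lem₃ a x) (cong u e)) }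
        where
        lem₁ : ∀ u w u′ w′ x → u - w * x + (u′ - w′ * x) ≡ u + u′ - (w + w′) * x
        lem₁ = solve-∀
        lem₂ : ∀ q s t u w x → (s - t * x) * (u - w * x) - t * w * (x * x + x + q)
          ≡ s * u - q * (t * w) - (s * w + t * u + t * w) * x
        lem₂ = solve-∀
        lem₃ : ∀ a x → a ≡ 1ℤ * a + 0ℤ * x
        lem₃ = solve-∀

    open Form

    opaque
     unfolding _⊛_
     conj-multiple : ∀ x k t → t ≡ x * k → conj ⟨ x , 1ℤ ⟩ ⊛ ⟨ t , k ⟩ ≡ ⟨ k * (x * x + x + q) , 0ℤ ⟩
     conj-multiple x k t refl = cong₂ ⟨_,_⟩ (lem₁ q x k) (lem₂ x k)
       where
       lem₁ : ∀ q x k → (x + 1ℤ) * (x * k) - q * (-1ℤ * k) ≡ k * (x * x + x + q)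
       lem₁ = solve-∀
       lem₂ : ∀ x k → (x + 1ℤ) * k + -1ℤ * (x * k) + -1ℤ * k ≡ 0ℤ
       lem₂ = solve-∀

    divides-norm : ∀ a x k e → k ≢ 0ℤ → e ≡ a * k → e ∣ k * (x * x + x + q) → a ∣ x * x + x + q
    divides-norm a x k e k≢0 refl d = ∣-cancelˡ k k≢0 (subst (_∣ k * (x * x + x + q)) (*-comm a k) d)

    module Hermite (I : Ideal) where

      private
        z : O
        z = proj₁ (nonzero I)

        shift : ∀ k {a b c d} → mem I ⟨ a , b ⟩ → mem I ⟨ c , d ⟩ → mem I ⟨ a + k * c , b + k * d ⟩
        shift k {a} {b} {c} {d} p q = subst (mem I) (trans (cong (⟨ a , b ⟩ ⊞_) (•-def k ⟨ c , d ⟩)) (⊞-def a b (k * c) (k * d)))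
          (closed-⊞ I p (closed-• I k q))

        multiply-ω : ∀ {a b} → mem I ⟨ a , b ⟩ → mem I ⟨ 0ℤ * a - q * (1ℤ * b) , 0ℤ * b + 1ℤ * a + 1ℤ * b ⟩
        multiply-ω {a} {b} p = subst (mem I) (⊛-def 0ℤ 1ℤ a b) (closed-⊛ I ω p)

        first : ∃ λ n → mem I ⟨ + suc n , 0ℤ ⟩
        first = go (nrm z) (0<nrm (proj₂ (proj₂ (nonzero I)))) (subst (mem I) (conj-⊛ z) (closed-⊛ I (conj z) (proj₁ (proj₂ (nonzero I)))))
          where
          go : ∀ n → 0ℤ < n → mem I ⟨ n , 0ℤ ⟩ → ∃ λ n → mem I ⟨ + suc n , 0ℤ ⟩
          go (+ suc n) _ p = n , p
          go (+ zero) lt _ = ⊥-elim (<-irrefl refl lt)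

        least-integer : ∃ λ n → mem I ⟨ + suc n , 0ℤ ⟩ × (∀ j → j ℕ.< n → ¬ mem I ⟨ + suc j , 0ℤ ⟩)
        least-integer = least (λ n → mem? I ⟨ + suc n , 0ℤ ⟩) (proj₁ first) (proj₂ first)

      abstract
        a₀ : ℕ
        a₀ = suc (proj₁ least-integer)

        a₀-nonZero : NonZero a₀
        a₀-nonZero = _

        a₀-mem : mem I ⟨ + a₀ , 0ℤ ⟩
        a₀-mem = proj₁ (proj₂ least-integer)

        a₀-least : ∀ j → j ℕ.< a₀ → mem I ⟨ + j , 0ℤ ⟩ → j ≡ 0
        a₀-least zero _ _ = refl
        a₀-least (suc j) lt p = ⊥-elim (proj₂ (proj₂ least-integer) j (ℕ.s≤s⁻¹ lt) p)

      private instance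
        a₀-nz : NonZero a₀
        a₀-nz = a₀-nonZero

      reduce : ∀ {t s} → mem I ⟨ t , s ⟩ → mem I ⟨ + (t %ℕ a₀) , s ⟩
      reduce {t} {s} p = subst (mem I) (cong₂ ⟨_,_⟩
          (trans (cong (_+ - (t /ℕ a₀) * + a₀) (a≡a%ℕn+[a/ℕn]*n t a₀)) (lem (+ (t %ℕ a₀)) (t /ℕ a₀) (+ a₀)))
          (lem′ s (t /ℕ a₀)))
        (shift (- (t /ℕ a₀)) p a₀-mem)
        where
        lem : ∀ r k a → r + k * a + - k * a ≡ r
        lem = solve-∀
        lem′ : ∀ s k → s + - k * 0ℤ ≡ s
        lem′ = solve-∀

      a₀-divides : ∀ {t} → mem I ⟨ t , 0ℤ ⟩ → + a₀ ∣ t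
      a₀-divides {t} p = divides (t /ℕ a₀) (trans (a≡a%ℕn+[a/ℕn]*n t a₀)
        (trans (cong (λ r → + r + (t /ℕ a₀) * + a₀) (a₀-least (t %ℕ a₀) (n%ℕd<d t a₀) (reduce p))) (+-identityˡ _)))

      private
        HasSecond : ℕ → Set
        HasSecond k = ∃ λ (r : Fin a₀) → mem I ⟨ + toℕ r , + suc k ⟩

        toFin : ∀ {t k} → mem I ⟨ t , + suc k ⟩ → HasSecond k
        toFin {t} {k} p = fromℕ< (n%ℕd<d t a₀) , subst (λ r → mem I ⟨ + r , + suc k ⟩) (sym (toℕ-fromℕ< (n%ℕd<d t a₀))) (reduce p)

        ω-a₀ : mem I ⟨ 0ℤ , + a₀ ⟩
        ω-a₀ = subst (mem I) (cong₂ ⟨_,_⟩ (lem₁ q (+ a₀)) (lem₂ (+ a₀))) (multiply-ω a₀-mem)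
          where
          lem₁ : ∀ q a → 0ℤ * a - q * (1ℤ * 0ℤ) ≡ 0ℤ
          lem₁ = solve-∀
          lem₂ : ∀ a → 0ℤ * 0ℤ + 1ℤ * a + 1ℤ * 0ℤ ≡ a
          lem₂ = solve-∀

        a₀-suc : ∃ λ n → a₀ ≡ suc n
        a₀-suc with a₀ | a₀-nonZero
        ... | suc n | _ = n , refl

        least-second : ∃ λ k → HasSecond k × (∀ j → j ℕ.< k → ¬ HasSecond j)
        least-second = least (λ k → any? (λ r → mem? I ⟨ + toℕ r , + suc k ⟩)) (proj₁ a₀-suc)
          (toFin (subst (λ n → mem I ⟨ 0ℤ , + n ⟩) (proj₂ a₀-suc) ω-a₀))

      abstract
        k₀ : ℕ
        k₀ = suc (proj₁ least-second)

        k₀-nonZero : NonZero k₀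
        k₀-nonZero = _

        u₀ : ℤ
        u₀ = + toℕ (proj₁ (proj₁ (proj₂ least-second)))

        k₀-mem : mem I ⟨ u₀ , + k₀ ⟩
        k₀-mem = proj₂ (proj₁ (proj₂ least-second))

        k₀-least : ∀ j {t} → j ℕ.< k₀ → mem I ⟨ t , + j ⟩ → j ≡ 0
        k₀-least zero _ _ = refl
        k₀-least (suc j) lt p = ⊥-elim (proj₂ (proj₂ least-second) j (ℕ.s≤s⁻¹ lt) (toFin p))

      private instance
        k₀-nz : NonZero k₀
        k₀-nz = k₀-nonZero

      0<k₀ : 0ℤ < + k₀
      0<k₀ = +<+ (ℕ.>-nonZero⁻¹ k₀)

      k₀≢0 : + k₀ ≢ 0ℤ
      k₀≢0 = pos-≢0 0<k₀

      k₀-divides : ∀ {t s} → mem I ⟨ t , s ⟩ → + k₀ ∣ s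
      k₀-divides {t} {s} p = divides (s /ℕ k₀) (trans (a≡a%ℕn+[a/ℕn]*n s k₀)
        (trans (cong (λ r → + r + (s /ℕ k₀) * + k₀) (k₀-least (s %ℕ k₀) (n%ℕd<d s k₀) reduced)) (+-identityˡ _)))
        where
        lem : ∀ r k a → r + k * a + - k * a ≡ r
        lem = solve-∀
        reduced : mem I ⟨ t + - (s /ℕ k₀) * u₀ , + (s %ℕ k₀) ⟩
        reduced = subst (λ r → mem I ⟨ t + - (s /ℕ k₀) * u₀ , r ⟩)
          (trans (cong (_+ - (s /ℕ k₀) * + k₀) (a≡a%ℕn+[a/ℕn]*n s k₀)) (lem (+ (s %ℕ k₀)) (s /ℕ k₀) (+ k₀)))
          (shift (- (s /ℕ k₀)) p k₀-mem)

      decompose : ∀ {t s j} → mem I ⟨ t , s ⟩ → s ≡ j * + k₀ → + a₀ ∣ t - j * u₀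
      decompose {t} {s} {j} p e = a₀-divides (subst (mem I) (cong₂ ⟨_,_⟩ (lem₁ t j u₀) (trans (cong (_+ - j * + k₀) e) (lem₂ j (+ k₀)))) (shift (- j) p k₀-mem))
        where
        lem₁ : ∀ t j u → t + - j * u ≡ t - j * u
        lem₁ = solve-∀
        lem₂ : ∀ j k → j * k + - j * k ≡ 0ℤ
        lem₂ = solve-∀

      abstract
        k∣a : + k₀ ∣ + a₀
        k∣a = k₀-divides ω-a₀

        k∣u : + k₀ ∣ u₀
        k∣u = ∣-eq (lem u₀ (+ k₀)) (∣m∣n⇒∣m-n (k₀-divides (multiply-ω k₀-mem)) ∣-refl)
          where
          lem : ∀ u k → 0ℤ * k + 1ℤ * u + 1ℤ * k - k ≡ u
          lem = solve-∀

      private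
        a′ x′ : ℤ
        a′ = _∣_.quotient k∣a
        x′ = _∣_.quotient k∣u

        a₀≡ : + a₀ ≡ a′ * + k₀
        a₀≡ = _∣_.equality k∣a

        u₀≡ : u₀ ≡ x′ * + k₀
        u₀≡ = _∣_.equality k∣u

        0<a′ : 0ℤ < a′
        0<a′ = *-cancelʳ-<-nonNeg (+ k₀) (subst₂ _<_ (sym (lem (+ k₀))) a₀≡ (+<+ (ℕ.>-nonZero⁻¹ a₀)))
          where
          lem : ∀ k → 0ℤ * k ≡ 0ℤ
          lem = solve-∀

        abstract
          a′∣norm : a′ ∣ x′ * x′ + x′ + q
          a′∣norm = divides-norm a′ x′ (+ k₀) (+ a₀) k₀≢0 a₀≡
            (a₀-divides (subst (mem I) (conj-multiple x′ (+ k₀) u₀ u₀≡) (closed-⊛ I (conj ⟨ x′ , 1ℤ ⟩) k₀-mem)))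

      form : Form
      form = record
        { a = a′ ; x = x′ ; c = _∣_.quotient a′∣norm ; 0<a = 0<a′
        ; ac≡ = trans (*-comm a′ (_∣_.quotient a′∣norm)) (sym (_∣_.equality a′∣norm)) }

      form-to : ∀ {v} → mem I v → ∃ λ v′ → L form v′ × v ≡ + k₀ • v′
      form-to {⟨ t , s ⟩} p with k₀-divides p
      ... | divides j e with decompose {j = j} p e
      ... | divides i f = vec form i j , L-vec form i j ,
        trans (cong₂ ⟨_,_⟩ (trans (lem₁ t (j * u₀)) (trans (cong₂ (λ A U → A + j * U) (trans f (cong (_*_ i) a₀≡)) u₀≡) (lem₂ i j a′ x′ (+ k₀)))) (trans e (*-comm j (+ k₀)))) (sym (•-def (+ k₀) (vec form i j)))
        where
        lem₁ : ∀ t r → t ≡ t - r + r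
        lem₁ = solve-∀
        lem₂ : ∀ i j a x k → i * (a * k) + j * (x * k) ≡ k * (i * a + j * x)
        lem₂ = solve-∀

      form-from : ∀ {v} → L form v → mem I (+ k₀ • v)
      form-from {v} l with vec-L form {v} l
      ... | i , j , e = subst (λ v → mem I (+ k₀ • v)) (sym e) (subst (mem I) (trans (cong₂ ⟨_,_⟩
          (trans (cong₂ (λ A U → i * A + j * U) a₀≡ u₀≡) (lem₁ i j a′ x′ (+ k₀)))
          (lem₂ i j (+ k₀))) (sym (•-def (+ k₀) (vec form i j))))
        (shift j (subst (mem I) (•-def i ⟨ + a₀ , 0ℤ ⟩) (closed-• I i a₀-mem)) k₀-mem))
        where
        lem₁ : ∀ i j a x k → i * (a * k) + j * (x * k) ≡ k * (i * a + j * x)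
        lem₁ = solve-∀
        lem₂ : ∀ i j k → i * 0ℤ + j * k ≡ k * j
        lem₂ = solve-∀

      form-similar : Similar (mem I) (L form)
      form-similar = record
        { α = 1ₒ ; β = ⟨ + k₀ , 0ℤ ⟩ ; α≢0 = λ () ; β≢0 = λ e → k₀≢0 (cong u e)
        ; to = λ {v} p → let v′ , l , e = form-to p in v′ , l , trans (1ₒ-⊛ v) (trans e (sym (•-⊛ (+ k₀) v′)))
        ; from = λ {v′} l → + k₀ • v′ , form-from l , trans (1ₒ-⊛ (+ k₀ • v′)) (sym (•-⊛ (+ k₀) v′)) }

  module _ (m : ℕ) where
    open Quad m
    open Form

    record Representatives (h : ℕ) : Set where
      field
        F        : Fin h → Form
        complete : ∀ G → ∃ λ i → Similar (L G) (L (F i))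
        distinct : ∀ {i j} → Similar (L (F i)) (L (F j)) → i ≡ j

module Field where

  open QuadraticOrder
  open import Data.Integer.Base as ℤ using (ℤ; +_; -[1+_]; 0ℤ; 1ℤ)
  import Data.Integer.Properties as ℤP
  open import Data.Integer.Divisibility.Signed as ℤD using (divides)
  open import Data.Integer.Tactic.RingSolver using (solve-∀)
  open import Data.Rational.Base as ℚ using (ℚ; mkℚ; 0ℚ; 1ℚ; ½; ↥_; ↧_; ↧ₙ_; toℚᵘ; _+_; _*_; -_; _-_)
  open import Data.Rational.Properties as ℚP
  open import Data.Rational.Solver using (module +-*-Solver)
  open import Data.Rational.Unnormalised.Base as ℚᵘ using (mkℚᵘ; *≡*)
  import Data.Rational.Unnormalised.Properties as ℚᵘP
  open +-*-Solver

  -- The embedding of ℤ into ℚ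

  [_] : ℤ → ℚ
  [ z ] = z ℚ./ 1

  private
    to[_] : ∀ z → toℚᵘ [ z ] ℚᵘ.≃ mkℚᵘ z 0
    to[ z ] = toℚᵘ-fromℚᵘ (mkℚᵘ z 0)

  []-+ : ∀ y z → [ y ℤ.+ z ] ≡ [ y ] + [ z ]
  []-+ y z = toℚᵘ-injective (ℚᵘP.≃-trans to[ y ℤ.+ z ] (ℚᵘP.≃-sym (ℚᵘP.≃-trans (toℚᵘ-homo-+ [ y ] [ z ])
    (ℚᵘP.≃-trans (ℚᵘP.+-cong to[ y ] to[ z ]) (*≡* (lem y z))))))
    where
    lem : ∀ y z → (y ℤ.* + 1 ℤ.+ z ℤ.* + 1) ℤ.* + 1 ≡ (y ℤ.+ z) ℤ.* + 1
    lem = solve-∀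

  []-* : ∀ y z → [ y ℤ.* z ] ≡ [ y ] * [ z ]
  []-* y z = toℚᵘ-injective (ℚᵘP.≃-trans to[ y ℤ.* z ] (ℚᵘP.≃-sym (ℚᵘP.≃-trans (toℚᵘ-homo-* [ y ] [ z ])
    (ℚᵘP.≃-trans (ℚᵘP.*-cong to[ y ] to[ z ]) (*≡* refl)))))

  []-neg : ∀ z → [ ℤ.- z ] ≡ - [ z ]
  []-neg z = toℚᵘ-injective (ℚᵘP.≃-trans to[ ℤ.- z ] (ℚᵘP.≃-sym (ℚᵘP.≃-trans (toℚᵘ-homo‿- [ z ])
    (ℚᵘP.≃-trans (ℚᵘP.-‿cong to[ z ]) (*≡* refl)))))

  []-injective : ∀ {y z} → [ y ] ≡ [ z ] → y ≡ z
  []-injective {y} {z} e with ℚᵘP.≃-trans (ℚᵘP.≃-sym to[ y ]) (ℚᵘP.≃-trans (ℚᵘP.≃-reflexive (cong toℚᵘ e)) to[ z ])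
  ... | *≡* e′ = trans (sym (ℤP.*-identityʳ y)) (trans e′ (ℤP.*-identityʳ z))

  ↥*↧ : ∀ r → r * [ ↧ r ] ≡ [ ↥ r ]
  ↥*↧ r = toℚᵘ-injective (ℚᵘP.≃-trans (toℚᵘ-homo-* r [ ↧ r ]) (ℚᵘP.≃-trans (ℚᵘP.*-cong (ℚᵘP.≃-refl {toℚᵘ r}) to[ ↧ r ])
    (ℚᵘP.≃-trans (lem r) (ℚᵘP.≃-sym to[ ↥ r ]))))
    where
    lem : ∀ r → toℚᵘ r ℚᵘ.* mkℚᵘ (↧ r) 0 ℚᵘ.≃ mkℚᵘ (↥ r) 0
    lem (mkℚ n d _) = *≡* (trans (ℤP.*-identityʳ (n ℤ.* + suc d)) (cong (λ k → n ℤ.* + k) (sym (ℕP.*-identityʳ (suc d)))))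

  IsInt : ℚ → Set
  IsInt r = ∃ λ z → r ≡ [ z ]

  int? : ∀ r → Dec (IsInt r)
  int? r = map′ (λ e → ↥ r , e) (λ { (z , e) → trans e (cong [_] (sym (trans (cong ↥_ e) (↥[] z)))) }) (r ℚP.≟ [ ↥ r ])
    where
    ↥[] : ∀ z → ↥ [ z ] ≡ z
    ↥[] z = trans (cong ↥_ (↥p/↧p≡p (mkℚ z 0 (λ { (_ , d) → ℕD.∣1⇒≡1 d })))) refl

  int-+ : ∀ {r s} → IsInt r → IsInt s → IsInt (r + s)
  int-+ (y , refl) (z , refl) = y ℤ.+ z , sym ([]-+ y z)

  int-* : ∀ {r s} → IsInt r → IsInt s → IsInt (r * s)
  int-* (y , refl) (z , refl) = y ℤ.* z , sym ([]-* y z)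

  int-neg : ∀ {r} → IsInt r → IsInt (- r)
  int-neg (y , refl) = ℤ.- y , sym ([]-neg y)

  infixl 8 _^_
  _^_ : ℚ → ℕ → ℚ
  r ^ zero = 1ℚ
  r ^ suc n = r * r ^ n

  -- If b divides every term of f with f (k + 1) b = f k a, then f / b has the same property.
  bounded-denominator : ∀ a b .{{_ : NonZero b}} → Coprime b a → ∀ j (f : ℕ → ℕ) → (∀ k → f (suc k) ℕ.* b ≡ f k ℕ.* a) → b ℕ.^ j ℕD.∣ f 0
  bounded-denominator a b c zero f rec = ℕD.1∣ f 0
  bounded-denominator a b c (suc j) f rec = subst (b ℕ.^ suc j ℕD.∣_) (sym (trans (ℕD._∣_.equality (b∣f 0)) (ℕP.*-comm (g 0) b)))
    (ℕD.*-monoʳ-∣ b (bounded-denominator a b c j g rec′))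
    where
    b∣f : ∀ k → b ℕD.∣ f k
    b∣f k = coprime-divisor c (ℕD.divides (f (suc k)) (trans (ℕP.*-comm a (f k)) (sym (rec k))))
    g : ℕ → ℕ
    g k = ℕD.quotient (b∣f k)
    rec′ : ∀ k → g (suc k) ℕ.* b ≡ g k ℕ.* a
    rec′ k = ℕP.*-cancelʳ-≡ (g (suc k) ℕ.* b) (g k ℕ.* a) b (begin
      g (suc k) ℕ.* b ℕ.* b ≡⟨ cong (ℕ._* b) (sym (ℕD._∣_.equality (b∣f (suc k)))) ⟩
      f (suc k) ℕ.* b ≡⟨ rec k ⟩
      f k ℕ.* a ≡⟨ cong (ℕ._* a) (ℕD._∣_.equality (b∣f k)) ⟩
      g k ℕ.* b ℕ.* a ≡⟨ ℕP.*-assoc (g k) b a ⟩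
      g k ℕ.* (b ℕ.* a) ≡⟨ cong (g k ℕ.*_) (ℕP.*-comm b a) ⟩
      g k ℕ.* (a ℕ.* b) ≡⟨ sym (ℕP.*-assoc (g k) a b) ⟩
      g k ℕ.* a ℕ.* b ∎)
      where open ≡-Reasoning

  powers-bound : ∀ b e → e ≢ 0 → (∀ j → b ℕ.^ j ℕD.∣ e) → b ℕ.≤ 1
  powers-bound b e e≢0 h = ℕP.≮⇒≥ λ 1<b → ℕP.<⇒≱ (lt b 1<b e) (ℕD.∣⇒≤ {{ℕ.≢-nonZero e≢0}} (h e))
    where
    lt : ∀ b → 1 ℕ.< b → ∀ e → e ℕ.< b ℕ.^ e
    lt b 1<b zero = ℕ.s≤s ℕ.z≤n
    lt b 1<b (suc e) = ℕP.<-≤-trans (ℕP.≤-<-trans (lt b 1<b e) (ℕP.m<m+n (b ℕ.^ e) (ℕP.≤-trans (ℕ.s≤s ℕ.z≤n) (lt b 1<b e))))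
      (subst (ℕ._≤ b ℕ.^ suc e) (cong (b ℕ.^ e ℕ.+_) (ℕP.+-identityʳ (b ℕ.^ e))) (ℕP.*-monoˡ-≤ (b ℕ.^ e) 1<b))

  ↥↧-coprime : ∀ r → Coprime ℤ.∣ ↥ r ∣ (↧ₙ r)
  ↥↧-coprime (mkℚ n d c) = Coprimality.recompute c

  powers⇒int : ∀ r e → e ≢ 0ℤ → (∀ k → IsInt ([ e ] * r ^ k)) → IsInt r
  powers⇒int r e e≢0 h = ↥ r , trans (trans (sym (*-identityʳ r)) (cong (λ d → r * [ + d ]) (sym ↧≡1))) (↥*↧ r)
    where
    f : ℕ → ℤ
    f k = proj₁ (h k)
    f-rec : ∀ k → f (suc k) ℤ.* ↧ r ≡ f k ℤ.* ↥ r
    f-rec k = []-injective (trans ([]-* (f (suc k)) (↧ r)) (trans (cong (_* [ ↧ r ]) (sym (proj₂ (h (suc k)))))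
      (trans (lem [ e ] r (r ^ k) [ ↧ r ]) (trans (cong₂ _*_ (proj₂ (h k)) (↥*↧ r)) (sym ([]-* (f k) (↥ r)))))))
      where
      lem : ∀ e r p d → e * (r * p) * d ≡ e * p * (r * d)
      lem = solve 4 (λ e r p d → e :* (r :* p) :* d := e :* p :* (r :* d)) refl
    f0≡e : f 0 ≡ e
    f0≡e = []-injective (trans (sym (proj₂ (h 0))) (*-identityʳ [ e ]))
    ↧≤1 : ↧ₙ r ℕ.≤ 1
    ↧≤1 = powers-bound (↧ₙ r) ℤ.∣ f 0 ∣ (λ z → e≢0 (trans (sym f0≡e) (ℤP.∣i∣≡0⇒i≡0 z)))
      (λ j → bounded-denominator ℤ.∣ ↥ r ∣ (↧ₙ r) (Coprimality.sym (↥↧-coprime r)) j (λ k → ℤ.∣ f k ∣)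
        (λ k → trans (sym (ℤP.abs-* (f (suc k)) (↧ r))) (trans (cong ℤ.∣_∣ (f-rec k)) (ℤP.abs-* (f k) (↥ r)))))
    ↧≡1 : ↧ₙ r ≡ 1
    ↧≡1 = ℕP.≤-antisym ↧≤1 (ℕ.s≤s ℕ.z≤n)

  coprime-square : ∀ {a b} → Coprime b a → Coprime (b ℕ.* b) a
  coprime-square {a} {b} c {d} (d∣bb , d∣a) = c (coprime-divisor {d} {b} {b} (λ { (e∣d , e∣b) → c (e∣b , ℕD.∣-trans e∣d d∣a) }) d∣bb , d∣a)

  square-free⇒int : ∀ {n} → SquareFree n → ∀ D r → ℤ.∣ D ∣ ≡ n → IsInt ([ D ] * (r * r)) → IsInt r
  square-free⇒int {n} sf D r ∣D∣≡n (z , e) = ↥ r , trans (trans (sym (*-identityʳ r)) (cong (λ d → r * [ + d ]) (sym ↧≡1))) (↥*↧ r)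
    where
    eq : D ℤ.* (↥ r ℤ.* ↥ r) ≡ z ℤ.* (↧ r ℤ.* ↧ r)
    eq = []-injective (begin
      [ D ℤ.* (↥ r ℤ.* ↥ r) ] ≡⟨ trans ([]-* D (↥ r ℤ.* ↥ r)) (cong ([ D ] *_) ([]-* (↥ r) (↥ r))) ⟩
      [ D ] * ([ ↥ r ] * [ ↥ r ]) ≡⟨ cong (λ t → [ D ] * (t * t)) (sym (↥*↧ r)) ⟩
      [ D ] * (r * [ ↧ r ] * (r * [ ↧ r ])) ≡⟨ lem [ D ] r [ ↧ r ] ⟩
      [ D ] * (r * r) * ([ ↧ r ] * [ ↧ r ]) ≡⟨ cong₂ _*_ e (sym ([]-* (↧ r) (↧ r))) ⟩
      [ z ] * [ ↧ r ℤ.* ↧ r ] ≡⟨ sym ([]-* z (↧ r ℤ.* ↧ r)) ⟩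
      [ z ℤ.* (↧ r ℤ.* ↧ r) ] ∎)
      where
      open ≡-Reasoning
      lem : ∀ D r d → D * (r * d * (r * d)) ≡ D * (r * r) * (d * d)
      lem = solve 3 (λ D r d → D :* (r :* d :* (r :* d)) := D :* (r :* r) :* (d :* d)) refl
    a = ℤ.∣ ↥ r ∣
    b = ↧ₙ r
    eqℕ : n ℕ.* (a ℕ.* a) ≡ ℤ.∣ z ∣ ℕ.* (b ℕ.* b)
    eqℕ = trans (cong₂ ℕ._*_ (sym ∣D∣≡n) (sym (ℤP.abs-* (↥ r) (↥ r)))) (trans (sym (ℤP.abs-* D (↥ r ℤ.* ↥ r)))
      (trans (cong ℤ.∣_∣ eq) (trans (ℤP.abs-* z (↧ r ℤ.* ↧ r)) (cong (ℤ.∣ z ∣ ℕ.*_) (ℤP.abs-* (↧ r) (↧ r))))))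
    c : Coprime (b ℕ.* b) a
    c = coprime-square {a} {b} (Coprimality.sym (↥↧-coprime r))
    bb∣n : b ℕ.* b ℕD.∣ n
    bb∣n = coprime-divisor {b ℕ.* b} {a} {n} c (coprime-divisor {b ℕ.* b} {a} {a ℕ.* n} c
      (ℕD.divides ℤ.∣ z ∣ (trans (trans (sym (ℕP.*-assoc a a n)) (ℕP.*-comm (a ℕ.* a) n)) eqℕ)))
    ↧≡1 : b ≡ 1
    ↧≡1 = sf b bb∣n

  module RingOfIntegers (m : ℕ) where

    D : ℤ
    D = -[1+ suc (suc (m ℕ.* 4)) ]

    open QuadraticField D public
    open Quad m using (O; ⟨_,_⟩; u; w; _⊞_; _⊛_; ⊞-def; ⊛-def; 0ₒ; nrm; nrm-def)

    q : ℤ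
    q = + suc m

    D≡ : [ D ] ≡ 1ℚ - [ + 4 ] * [ q ]
    D≡ = trans (cong [_] D-int) (trans ([]-+ 1ℤ (ℤ.- (+ 4 ℤ.* q))) (cong (_+_ 1ℚ) (trans ([]-neg (+ 4 ℤ.* q)) (cong -_ ([]-* (+ 4) q)))))
      where
      D-int : D ≡ 1ℤ ℤ.+ ℤ.- (+ 4 ℤ.* q)
      D-int = trans (cong ℤ.-_ (trans (ℤP.pos-+ 3 (m ℕ.* 4)) (cong (ℤ._+_ (+ 3)) (ℤP.pos-* m 4))))
        (trans (lem (+ m)) (cong (λ t → 1ℤ ℤ.+ ℤ.- (+ 4 ℤ.* t)) (sym (ℤP.pos-+ 1 m))))
        where
        lem : ∀ m → ℤ.- (+ 3 ℤ.+ m ℤ.* + 4) ≡ 1ℤ ℤ.+ ℤ.- (+ 4 ℤ.* (1ℤ ℤ.+ m))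
        lem = solve-∀

    open K public using (re; im)

    ⊗-comm : ∀ x y → x ⊗ y ≡ y ⊗ x
    ⊗-comm (a +√ b) (c +√ d) = cong₂ _+√_
      (solve 5 (λ D a b c d → a :* c :+ D :* (b :* d) := c :* a :+ D :* (d :* b)) refl [ D ] a b c d)
      (solve 4 (λ a b c d → a :* d :+ b :* c := c :* b :+ d :* a) refl a b c d)

    ⊗-assoc : ∀ x y z → (x ⊗ y) ⊗ z ≡ x ⊗ (y ⊗ z)
    ⊗-assoc (a +√ b) (c +√ d) (e +√ f) = cong₂ _+√_
      (solve 7 (λ D a b c d e f → (a :* c :+ D :* (b :* d)) :* e :+ D :* ((a :* d :+ b :* c) :* f)
        := a :* (c :* e :+ D :* (d :* f)) :+ D :* (b :* (c :* f :+ d :* e))) refl [ D ] a b c d e f)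
      (solve 7 (λ D a b c d e f → (a :* c :+ D :* (b :* d)) :* f :+ (a :* d :+ b :* c) :* e
        := a :* (c :* f :+ d :* e) :+ b :* (c :* e :+ D :* (d :* f))) refl [ D ] a b c d e f)

    ⊗-distribˡ : ∀ x y z → x ⊗ (y ⊕ z) ≡ x ⊗ y ⊕ x ⊗ z
    ⊗-distribˡ (a +√ b) (c +√ d) (e +√ f) = cong₂ _+√_
      (solve 7 (λ D a b c d e f → a :* (c :+ e) :+ D :* (b :* (d :+ f)) := a :* c :+ D :* (b :* d) :+ (a :* e :+ D :* (b :* f))) refl [ D ] a b c d e f)
      (solve 6 (λ a b c d e f → a :* (d :+ f) :+ b :* (c :+ e) := a :* d :+ b :* c :+ (a :* f :+ b :* e)) refl a b c d e f)

    fromℚ-⊗ : ∀ r x → fromℚ r ⊗ x ≡ (r * re x) +√ (r * im x)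
    fromℚ-⊗ r (a +√ b) = cong₂ _+√_
      (solve 4 (λ D r a b → r :* a :+ D :* (con 0ℚ :* b) := r :* a) refl [ D ] r a b)
      (solve 3 (λ r a b → r :* b :+ con 0ℚ :* a := r :* b) refl r a b)

    1ᴷ-⊗ : ∀ x → 1ᴷ ⊗ x ≡ x
    1ᴷ-⊗ x = trans (fromℚ-⊗ 1ℚ x) (cong₂ _+√_ (*-identityˡ (re x)) (*-identityˡ (im x)))

    fromℤ-⊗ : ∀ y z → fromℤ (y ℤ.* z) ≡ fromℤ y ⊗ fromℤ z
    fromℤ-⊗ y z = sym (trans (fromℚ-⊗ [ y ] (fromℤ z)) (cong₂ _+√_ (sym ([]-* y z)) (*-zeroʳ [ y ])))

    ι : O → K
    ι v = ([ u v ] + ½ * [ w v ]) +√ (½ * [ w v ])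

    ι-⊞ : ∀ x y → ι (x ⊞ y) ≡ ι x ⊕ ι y
    ι-⊞ ⟨ a , b ⟩ ⟨ c , d ⟩ = trans (cong ι (⊞-def a b c d)) (cong₂ _+√_
      (trans (cong₂ (λ s t → s + ½ * t) ([]-+ a c) ([]-+ b d)) (solve 4 (λ a b c d → (a :+ c) :+ con ½ :* (b :+ d) := (a :+ con ½ :* b) :+ (c :+ con ½ :* d)) refl [ a ] [ b ] [ c ] [ d ]))
      (trans (cong (½ *_) ([]-+ b d)) (solve 2 (λ b d → con ½ :* (b :+ d) := con ½ :* b :+ con ½ :* d) refl [ b ] [ d ])))

    ι-⊛ : ∀ x y → ι (x ⊛ y) ≡ ι x ⊗ ι y
    ι-⊛ ⟨ a , b ⟩ ⟨ c , d ⟩ = trans (cong ι (⊛-def a b c d)) (cong₂ _+√_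
      (trans (cong₂ (λ s t → s + ½ * t) eq₁ eq₂) (trans
        (solve 5 (λ q a b c d → a :* c :+ :- (q :* (b :* d)) :+ con ½ :* (a :* d :+ b :* c :+ b :* d)
          := (a :+ con ½ :* b) :* (c :+ con ½ :* d) :+ (con 1ℚ :+ :- (con [ + 4 ] :* q)) :* ((con ½ :* b) :* (con ½ :* d))) refl [ q ] [ a ] [ b ] [ c ] [ d ])
        (cong (λ D → ([ a ] + ½ * [ b ]) * ([ c ] + ½ * [ d ]) + D * ((½ * [ b ]) * (½ * [ d ]))) (sym D≡))))
      (trans (cong (½ *_) eq₂)
        (solve 4 (λ a b c d → con ½ :* (a :* d :+ b :* c :+ b :* d) := (a :+ con ½ :* b) :* (con ½ :* d) :+ (con ½ :* b) :* (c :+ con ½ :* d)) refl [ a ] [ b ] [ c ] [ d ])))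
      where
      eq₁ : [ a ℤ.* c ℤ.- q ℤ.* (b ℤ.* d) ] ≡ [ a ] * [ c ] + - ([ q ] * ([ b ] * [ d ]))
      eq₁ = trans ([]-+ (a ℤ.* c) (ℤ.- (q ℤ.* (b ℤ.* d)))) (cong₂ _+_ ([]-* a c) (trans ([]-neg (q ℤ.* (b ℤ.* d))) (cong -_ (trans ([]-* q (b ℤ.* d)) (cong ([ q ] *_) ([]-* b d))))))
      eq₂ : [ a ℤ.* d ℤ.+ b ℤ.* c ℤ.+ b ℤ.* d ] ≡ [ a ] * [ d ] + [ b ] * [ c ] + [ b ] * [ d ]
      eq₂ = trans ([]-+ (a ℤ.* d ℤ.+ b ℤ.* c) (b ℤ.* d)) (cong₂ _+_ (trans ([]-+ (a ℤ.* d) (b ℤ.* c)) (cong₂ _+_ ([]-* a d) ([]-* b c))) ([]-* b d))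

    ι-injective : ∀ {x y} → ι x ≡ ι y → x ≡ y
    ι-injective {x} {y} e = cong₂ ⟨_,_⟩ ([]-injective u≡) ([]-injective w≡)
      where
      double : ∀ r → (½ * r) + (½ * r) ≡ r
      double = solve 1 (λ r → (con ½ :* r) :+ (con ½ :* r) := r) refl
      w≡ : [ w x ] ≡ [ w y ]
      w≡ = trans (sym (double [ w x ])) (trans (cong (λ z → z + z) (cong im e)) (double [ w y ]))
      u≡ : [ u x ] ≡ [ u y ]
      u≡ = trans (lem [ u x ] (½ * [ w x ])) (trans (cong₂ (λ s t → s + - t) (cong re e) (cong im e)) (sym (lem [ u y ] (½ * [ w y ]))))
        where
        lem : ∀ s t → s ≡ s + t + - t
        lem = solve 2 (λ s t → s := s :+ t :+ :- t) refl

    ι-∈𝒪 : ∀ v → 𝒪 (ι v)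
    ι-∈𝒪 v = nrm v ∷ (ℤ.- (u v ℤ.+ u v ℤ.+ w v)) ∷ [] , trans (cong₂ (λ c t → c ⊕ ι v ⊗ (t ⊕ ι v ⊗ 1ᴷ)) nrm≡ tr≡)
        (cong₂ _+√_
          (trans (cong (λ D → n + (r * (t + (r * 1ℚ + D * (s * 0ℚ))) + D * (s * (0ℚ + (r * 0ℚ + s * 1ℚ))))) D≡)
            (solve 3 (λ q a b → let r = a :+ con ½ :* b ; s = con ½ :* b ; D = con 1ℚ :+ :- (con [ + 4 ] :* q)
                                    n = a :* a :+ a :* b :+ q :* (b :* b) ; t = :- (a :+ a :+ b) in
              n :+ (r :* (t :+ (r :* con 1ℚ :+ D :* (s :* con 0ℚ))) :+ D :* (s :* (con 0ℚ :+ (r :* con 0ℚ :+ s :* con 1ℚ)))) := con 0ℚ) refl [ q ] [ u v ] [ w v ]))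
          (trans (cong (λ D → 0ℚ + (r * (0ℚ + (r * 0ℚ + s * 1ℚ)) + s * (t + (r * 1ℚ + D * (s * 0ℚ))))) D≡)
            (solve 3 (λ q a b → let r = a :+ con ½ :* b ; s = con ½ :* b ; D = con 1ℚ :+ :- (con [ + 4 ] :* q) ; t = :- (a :+ a :+ b) in
              con 0ℚ :+ (r :* (con 0ℚ :+ (r :* con 0ℚ :+ s :* con 1ℚ)) :+ s :* (t :+ (r :* con 1ℚ :+ D :* (s :* con 0ℚ)))) := con 0ℚ) refl [ q ] [ u v ] [ w v ])))
      where
      r = [ u v ] + ½ * [ w v ]
      s = ½ * [ w v ]
      n = [ u v ] * [ u v ] + [ u v ] * [ w v ] + [ q ] * ([ w v ] * [ w v ])
      t = - ([ u v ] + [ u v ] + [ w v ])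
      nrm≡ : fromℤ (nrm v) ≡ fromℚ n
      nrm≡ = cong fromℚ (trans (cong [_] (nrm-def (u v) (w v))) (trans ([]-+ (u v ℤ.* u v ℤ.+ u v ℤ.* w v) (q ℤ.* (w v ℤ.* w v)))
        (cong₂ _+_ (trans ([]-+ (u v ℤ.* u v) (u v ℤ.* w v)) (cong₂ _+_ ([]-* (u v) (u v)) ([]-* (u v) (w v)))) (trans ([]-* q (w v ℤ.* w v)) (cong ([ q ] *_) ([]-* (w v) (w v)))))))
      tr≡ : fromℤ (ℤ.- (u v ℤ.+ u v ℤ.+ w v)) ≡ fromℚ t
      tr≡ = cong fromℚ (trans ([]-neg (u v ℤ.+ u v ℤ.+ w v)) (cong -_ (trans ([]-+ (u v ℤ.+ u v) (w v)) (cong (_+ [ w v ]) ([]-+ (u v) (u v))))))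

    Int² : K → Set
    Int² x = IsInt (re x) × IsInt (im x)

    int²-⊕ : ∀ {x y} → Int² x → Int² y → Int² (x ⊕ y)
    int²-⊕ (a , b) (c , d) = int-+ a c , int-+ b d

    int²-⊗ : ∀ {x y} → Int² x → Int² y → Int² (x ⊗ y)
    int²-⊗ (a , b) (c , d) = int-+ (int-* a c) (int-* (D , refl) (int-* b d)) , int-+ (int-* a d) (int-* b c)

    int²-fromℤ : ∀ z → Int² (fromℤ z)
    int²-fromℤ z = (z , refl) , (0ℤ , refl)

    int²-cancel : ∀ {x y} → Int² (x ⊕ y) → Int² x → Int² y
    int²-cancel {x} {y} (a , b) (c , d) = subst IsInt (lem (re x) (re y)) (int-+ a (int-neg c)) , subst IsInt (lem (im x) (im y)) (int-+ b (int-neg d))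
      where
      lem : ∀ x y → x + y + - x ≡ y
      lem = solve 2 (λ x y → x :+ y :+ :- x := y) refl

    infixl 8 _^ᴷ_
    _^ᴷ_ : K → ℕ → K
    x ^ᴷ zero = 1ᴷ
    x ^ᴷ suc k = x ⊗ x ^ᴷ k

    ⊗-interchange : ∀ a b c d → (a ⊗ b) ⊗ (c ⊗ d) ≡ (a ⊗ c) ⊗ (b ⊗ d)
    ⊗-interchange a b c d = trans (⊗-assoc a b (c ⊗ d)) (trans (cong (a ⊗_) (trans (sym (⊗-assoc b c d)) (trans (cong (_⊗ d) (⊗-comm b c)) (⊗-assoc c b d)))) (sym (⊗-assoc a c (b ⊗ d))))

    ⊗-swapˡ : ∀ a b c → a ⊗ (b ⊗ c) ≡ b ⊗ (a ⊗ c)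
    ⊗-swapˡ a b c = trans (sym (⊗-assoc a b c)) (trans (cong (_⊗ c) (⊗-comm a b)) (⊗-assoc b a c))

    ⊗-zeroʳ : ∀ x → x ⊗ 0ᴷ ≡ 0ᴷ
    ⊗-zeroʳ x = trans (⊗-comm x 0ᴷ) (trans (fromℚ-⊗ 0ℚ x) (cong₂ _+√_ (*-zeroˡ (re x)) (*-zeroˡ (im x))))

    denominator : K → ℤ
    denominator x = ↧ re x ℤ.* ↧ im x

    denominator-⊗ : ∀ x → Int² (fromℤ (denominator x) ⊗ x)
    denominator-⊗ x = subst Int² (sym (fromℚ-⊗ [ denominator x ] x))
      ( subst IsInt (trans (cong (_* [ ↧ im x ]) (sym (↥*↧ (re x)))) (trans (lem₁ (re x) [ ↧ re x ] [ ↧ im x ]) (cong (_* re x) (sym ([]-* (↧ re x) (↧ im x)))))) (int-* (↥ re x , refl) (↧ im x , refl))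
      , subst IsInt (trans (cong (_* [ ↧ re x ]) (sym (↥*↧ (im x)))) (trans (lem₂ (im x) [ ↧ re x ] [ ↧ im x ]) (cong (_* im x) (sym ([]-* (↧ re x) (↧ im x)))))) (int-* (↥ im x , refl) (↧ re x , refl)) )
      where
      lem₁ : ∀ r c d → r * c * d ≡ (c * d) * r
      lem₁ = solve 3 (λ r c d → r :* c :* d := (c :* d) :* r) refl
      lem₂ : ∀ r c d → r * d * c ≡ (c * d) * r
      lem₂ = solve 3 (λ r c d → r :* d :* c := (c :* d) :* r) refl

    denominator≢0 : ∀ x → denominator x ≢ 0ℤ
    denominator≢0 x = product≢0 (↧ re x) (↧ im x) (λ ()) (λ ())

    module Integral (x : K) (cs : List ℤ) (root : evalMonic cs x ≡ 0ᴷ) where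

      private
        n = length cs
        C = denominator x

        C^_ : ℕ → ℤ
        C^ zero = 1ℤ
        C^ suc k = C ℤ.* (C^ k)

        e : ℤ
        e = C^ n

        C^≢0 : ∀ k → (C^ k) ≢ 0ℤ
        C^≢0 zero ()
        C^≢0 (suc k) = product≢0 C (C^ k) (denominator≢0 x) (C^≢0 k)

        low : ∀ n k → k ℕ.≤ n → Int² (fromℤ (C^ n) ⊗ x ^ᴷ k)
        low n zero _ = int²-⊗ {fromℤ (C^ n)} {1ᴷ} (int²-fromℤ (C^ n)) (int²-fromℤ 1ℤ)
        low (suc n) (suc k) (ℕ.s≤s k≤n) = subst Int² (sym (trans (cong (_⊗ (x ⊗ x ^ᴷ k)) (fromℤ-⊗ C (C^ n))) (⊗-interchange (fromℤ C) (fromℤ (C^ n)) x (x ^ᴷ k))))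
          (int²-⊗ {fromℤ C ⊗ x} {fromℤ (C^ n) ⊗ x ^ᴷ k} (denominator-⊗ x) (low n k k≤n))

        leading : ∀ cs j → Int² (fromℤ e ⊗ (x ^ᴷ j ⊗ evalMonic cs x)) → (∀ i → i ℕ.< length cs → Int² (fromℤ e ⊗ x ^ᴷ (j ℕ.+ i))) →
          Int² (fromℤ e ⊗ x ^ᴷ (j ℕ.+ length cs))
        leading [] j h _ = subst Int² (cong (fromℤ e ⊗_) (trans (trans (⊗-comm (x ^ᴷ j) 1ᴷ) (1ᴷ-⊗ (x ^ᴷ j))) (cong (x ^ᴷ_) (sym (ℕP.+-identityʳ j))))) h
        leading (c ∷ cs) j h lower = subst (λ k → Int² (fromℤ e ⊗ x ^ᴷ k)) (sym (ℕP.+-suc j (length cs)))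
          (leading cs (suc j)
            (int²-cancel {fromℤ c ⊗ (fromℤ e ⊗ x ^ᴷ j)} (subst Int² split h)
              (int²-⊗ {fromℤ c} (int²-fromℤ c) (subst (λ k → Int² (fromℤ e ⊗ x ^ᴷ k)) (ℕP.+-identityʳ j) (lower 0 (ℕ.s≤s ℕ.z≤n)))))
            (λ i i< → subst (λ k → Int² (fromℤ e ⊗ x ^ᴷ k)) (ℕP.+-suc j i) (lower (suc i) (ℕ.s≤s i<))))
          where
          E = evalMonic cs x
          split : fromℤ e ⊗ (x ^ᴷ j ⊗ (fromℤ c ⊕ x ⊗ E)) ≡ fromℤ c ⊗ (fromℤ e ⊗ x ^ᴷ j) ⊕ fromℤ e ⊗ (x ^ᴷ suc j ⊗ E)
          split = trans (cong (fromℤ e ⊗_) (⊗-distribˡ (x ^ᴷ j) (fromℤ c) (x ⊗ E))) (trans (⊗-distribˡ (fromℤ e) (x ^ᴷ j ⊗ fromℤ c) (x ^ᴷ j ⊗ (x ⊗ E)))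
            (cong₂ _⊕_ (trans (cong (fromℤ e ⊗_) (⊗-comm (x ^ᴷ j) (fromℤ c))) (⊗-swapˡ (fromℤ e) (fromℤ c) (x ^ᴷ j)))
              (cong (fromℤ e ⊗_) (trans (⊗-swapˡ (x ^ᴷ j) x E) (sym (⊗-assoc x (x ^ᴷ j) E))))))

        upTo : ∀ k → ∀ j → j ℕ.< k → Int² (fromℤ e ⊗ x ^ᴷ j)
        upTo (suc k) j j<1+k with n ℕP.≤? j
        ... | no n≰j = low n j (ℕP.<⇒≤ (ℕP.≰⇒> n≰j))
        ... | yes n≤j = subst (λ i → Int² (fromℤ e ⊗ x ^ᴷ i)) (ℕP.m∸n+n≡m n≤j)
          (leading cs (j ℕ.∸ n)
            (subst Int² (sym (trans (cong (λ E → fromℤ e ⊗ (x ^ᴷ (j ℕ.∸ n) ⊗ E)) root) (trans (cong (fromℤ e ⊗_) (⊗-zeroʳ (x ^ᴷ (j ℕ.∸ n)))) (⊗-zeroʳ (fromℤ e))))) (int²-fromℤ 0ℤ))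
            (λ i i<n → upTo k (j ℕ.∸ n ℕ.+ i) (ℕP.<-≤-trans (ℕP.+-monoʳ-< (j ℕ.∸ n) i<n) (subst (ℕ._≤ k) (sym (ℕP.m∸n+n≡m n≤j)) (ℕ.s≤s⁻¹ j<1+k)))))

        power-int² : ∀ k → Int² (fromℤ e ⊗ x ^ᴷ k)
        power-int² k = upTo (suc k) k ℕP.≤-refl

        conj : K → K
        conj (a +√ b) = a +√ (- b)

        conj-⊗ : ∀ x y → conj (x ⊗ y) ≡ conj x ⊗ conj y
        conj-⊗ (a +√ b) (c +√ d) = cong₂ _+√_
          (solve 5 (λ D a b c d → a :* c :+ D :* (b :* d) := a :* c :+ D :* ((:- b) :* (:- d))) refl [ D ] a b c d)
          (solve 4 (λ a b c d → :- (a :* d :+ b :* c) := a :* (:- d) :+ (:- b) :* c) refl a b c d)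

        conj-^ : ∀ x k → conj (x ^ᴷ k) ≡ conj x ^ᴷ k
        conj-^ x zero = refl
        conj-^ x (suc k) = trans (conj-⊗ x (x ^ᴷ k)) (cong (conj x ⊗_) (conj-^ x k))

        conj-power-int² : ∀ k → Int² (fromℤ e ⊗ conj x ^ᴷ k)
        conj-power-int² k = subst Int² (trans (conj-⊗ (fromℤ e) (x ^ᴷ k)) (cong (fromℤ e ⊗_) (conj-^ x k))) (proj₁ (power-int² k) , int-neg (proj₂ (power-int² k)))

        tr : K
        tr = x ⊕ conj x

        mixed : ∀ i j k → Int² (fromℤ (e ℤ.* e) ⊗ ((x ^ᴷ i ⊗ conj x ^ᴷ j) ⊗ tr ^ᴷ k))
        mixed i j zero = subst Int² (sym (trans (cong₂ _⊗_ (fromℤ-⊗ e e) (trans (⊗-comm (x ^ᴷ i ⊗ conj x ^ᴷ j) 1ᴷ) (1ᴷ-⊗ (x ^ᴷ i ⊗ conj x ^ᴷ j)))) (⊗-interchange (fromℤ e) (fromℤ e) (x ^ᴷ i) (conj x ^ᴷ j))))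
          (int²-⊗ {fromℤ e ⊗ x ^ᴷ i} (power-int² i) (conj-power-int² j))
        mixed i j (suc k) = subst Int² (sym expand) (int²-⊕ (mixed (suc i) j k) (mixed i (suc j) k))
          where
          X = x ^ᴷ i
          Y = conj x ^ᴷ j
          expand : fromℤ (e ℤ.* e) ⊗ ((X ⊗ Y) ⊗ (tr ⊗ tr ^ᴷ k)) ≡ fromℤ (e ℤ.* e) ⊗ (((x ⊗ X) ⊗ Y) ⊗ tr ^ᴷ k) ⊕ fromℤ (e ℤ.* e) ⊗ ((X ⊗ (conj x ⊗ Y)) ⊗ tr ^ᴷ k)
          expand = trans (cong (fromℤ (e ℤ.* e) ⊗_) (trans (sym (⊗-assoc (X ⊗ Y) tr (tr ^ᴷ k))) (trans (⊗-comm ((X ⊗ Y) ⊗ tr) (tr ^ᴷ k))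
              (trans (cong (tr ^ᴷ k ⊗_) (⊗-distribˡ (X ⊗ Y) x (conj x)))
              (trans (⊗-distribˡ (tr ^ᴷ k) ((X ⊗ Y) ⊗ x) ((X ⊗ Y) ⊗ conj x)) (cong₂ _⊕_
                (trans (⊗-comm (tr ^ᴷ k) ((X ⊗ Y) ⊗ x)) (cong (_⊗ tr ^ᴷ k) (trans (⊗-comm (X ⊗ Y) x) (sym (⊗-assoc x X Y)))))
                (trans (⊗-comm (tr ^ᴷ k) ((X ⊗ Y) ⊗ conj x)) (cong (_⊗ tr ^ᴷ k) (trans (⊗-assoc X Y (conj x)) (cong (X ⊗_) (⊗-comm Y (conj x))))))))))))
            (⊗-distribˡ (fromℤ (e ℤ.* e)) (((x ⊗ X) ⊗ Y) ⊗ tr ^ᴷ k) ((X ⊗ (conj x ⊗ Y)) ⊗ tr ^ᴷ k))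

        rational-power : ∀ y r → y ≡ fromℚ r → ∀ k → y ^ᴷ k ≡ fromℚ (r ^ k)
        rational-power y r eq zero = refl
        rational-power y r eq (suc k) = trans (cong₂ _⊗_ eq (rational-power y r eq k)) (trans (fromℚ-⊗ r (fromℚ (r ^ k))) (cong (r * r ^ k +√_) (*-zeroʳ r)))

        rational-int : ∀ y r → y ≡ fromℚ r → (∀ k → Int² (fromℤ (e ℤ.* e) ⊗ y ^ᴷ k)) → IsInt r
        rational-int y r eq h = powers⇒int r (e ℤ.* e) (product≢0 e e (C^≢0 n) (C^≢0 n)) (λ k →
          subst IsInt (cong re (trans (cong (fromℤ (e ℤ.* e) ⊗_) (rational-power y r eq k)) (fromℚ-⊗ [ e ℤ.* e ] (fromℚ (r ^ k))))) (proj₁ (h k)))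

      trace-int : IsInt (re x + re x)
      trace-int = rational-int tr (re x + re x) (cong (re x + re x +√_) (+-inverseʳ (im x)))
        (λ k → subst (λ y → Int² (fromℤ (e ℤ.* e) ⊗ y)) (trans (cong (_⊗ tr ^ᴷ k) (1ᴷ-⊗ 1ᴷ)) (1ᴷ-⊗ (tr ^ᴷ k))) (mixed 0 0 k))

      norm-int : IsInt (re x * re x + - ([ D ] * (im x * im x)))
      norm-int = rational-int (x ⊗ conj x) (re x * re x + - ([ D ] * (im x * im x)))
        (cong₂ _+√_ (solve 3 (λ D r s → r :* r :+ D :* (s :* (:- s)) := r :* r :+ :- (D :* (s :* s))) refl [ D ] (re x) (im x))
          (solve 2 (λ r s → r :* (:- s) :+ s :* r := con 0ℚ) refl (re x) (im x)))
        (λ k → subst (λ y → Int² (fromℤ (e ℤ.* e) ⊗ y)) (trans (trans (⊗-comm (x ^ᴷ k ⊗ conj x ^ᴷ k) 1ᴷ) (1ᴷ-⊗ (x ^ᴷ k ⊗ conj x ^ᴷ k))) (product-power k)) (mixed k k 0))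
        where
        product-power : ∀ k → x ^ᴷ k ⊗ conj x ^ᴷ k ≡ (x ⊗ conj x) ^ᴷ k
        product-power zero = 1ᴷ-⊗ 1ᴷ
        product-power (suc k) = trans (⊗-interchange x (x ^ᴷ k) (conj x) (conj x ^ᴷ k)) (cong ((x ⊗ conj x) ⊗_) (product-power k))

    module _ (square-free : SquareFree (suc (suc (suc (m ℕ.* 4))))) where

      abstract
        𝒪-ι : ∀ {x} → 𝒪 x → ∃ λ v → x ≡ ι v
        𝒪-ι {x} (cs , root) = ⟨ U , S ⟩ , cong₂ _+√_ re≡ im≡
          where
          T V : ℤ
          T = proj₁ (Integral.trace-int x cs root)
          V = proj₁ (Integral.norm-int x cs root)
          t≡ : re x + re x ≡ [ T ]
          t≡ = proj₂ (Integral.trace-int x cs root)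
          ν≡ : re x * re x + - ([ D ] * (im x * im x)) ≡ [ V ]
          ν≡ = proj₂ (Integral.norm-int x cs root)
          disc : [ D ] * ((im x + im x) * (im x + im x)) ≡ [ T ℤ.* T ℤ.- + 4 ℤ.* V ]
          disc = trans (lem [ D ] (re x) (im x)) (trans (cong₂ (λ t v → t * t + - ([ + 4 ] * v)) t≡ ν≡)
            (sym (trans ([]-+ (T ℤ.* T) (ℤ.- (+ 4 ℤ.* V))) (cong₂ _+_ ([]-* T T) (trans ([]-neg (+ 4 ℤ.* V)) (cong -_ ([]-* (+ 4) V)))))))
            where
            lem : ∀ D r s → D * ((s + s) * (s + s)) ≡ (r + r) * (r + r) + - ([ + 4 ] * (r * r + - (D * (s * s))))
            lem = solve 3 (λ D r s → D :* ((s :+ s) :* (s :+ s)) := (r :+ r) :* (r :+ r) :+ :- (con [ + 4 ] :* (r :* r :+ :- (D :* (s :* s))))) refl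
          S-int : IsInt (im x + im x)
          S-int = square-free⇒int square-free D (im x + im x) refl (T ℤ.* T ℤ.- + 4 ℤ.* V , disc)
          S : ℤ
          S = proj₁ S-int
          D-int : D ≡ 1ℤ ℤ.- + 4 ℤ.* q
          D-int = []-injective (trans D≡ (sym (trans ([]-+ 1ℤ (ℤ.- (+ 4 ℤ.* q))) (cong (_+_ 1ℚ) (trans ([]-neg (+ 4 ℤ.* q)) (cong -_ ([]-* (+ 4) q)))))))
          relation : D ℤ.* (S ℤ.* S) ≡ T ℤ.* T ℤ.- + 4 ℤ.* V
          relation = []-injective (trans (trans ([]-* D (S ℤ.* S)) (cong ([ D ] *_) (trans ([]-* S S) (cong (λ s → s * s) (sym (proj₂ S-int)))))) disc)
          product-even : + 2 ℤD.∣ (T ℤ.- S) ℤ.* (T ℤ.+ S)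
          product-even = divides (+ 2 ℤ.* (V ℤ.- q ℤ.* (S ℤ.* S))) (trans (lem₁ T S) (trans (cong (λ t → t ℤ.- S ℤ.* S) T²)
            (lem₂ q S V)))
            where
            lem₁ : ∀ T S → (T ℤ.- S) ℤ.* (T ℤ.+ S) ≡ T ℤ.* T ℤ.- S ℤ.* S
            lem₁ = solve-∀
            lem₂ : ∀ q S V → (1ℤ ℤ.- + 4 ℤ.* q) ℤ.* (S ℤ.* S) ℤ.+ + 4 ℤ.* V ℤ.- S ℤ.* S ≡ + 2 ℤ.* (V ℤ.- q ℤ.* (S ℤ.* S)) ℤ.* + 2
            lem₂ = solve-∀
            lem₃ : ∀ a b → a ≡ a ℤ.- b ℤ.+ b
            lem₃ = solve-∀
            T² : T ℤ.* T ≡ (1ℤ ℤ.- + 4 ℤ.* q) ℤ.* (S ℤ.* S) ℤ.+ + 4 ℤ.* V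
            T² = trans (lem₃ (T ℤ.* T) (+ 4 ℤ.* V)) (cong (ℤ._+ + 4 ℤ.* V) (trans (sym relation) (cong (ℤ._* (S ℤ.* S)) D-int)))
          even : + 2 ℤD.∣ T ℤ.- S
          even = [ (λ d → d) , (λ d → ∣-eq (lem T S) (ℤD.∣m∣n⇒∣m-n d (ℤD.∣n⇒∣m*n S (ℤD.∣-refl {+ 2})))) ]′ (∣-prod prime[2] (T ℤ.- S) (T ℤ.+ S) product-even)
            where
            lem : ∀ T S → T ℤ.+ S ℤ.- S ℤ.* + 2 ≡ T ℤ.- S
            lem = solve-∀
          U : ℤ
          U = ℤD.quotient even
          T≡ : T ≡ U ℤ.* + 2 ℤ.+ S
          T≡ = trans (lem T S) (cong (ℤ._+ S) (ℤD._∣_.equality even))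
            where
            lem : ∀ T S → T ≡ T ℤ.- S ℤ.+ S
            lem = solve-∀
          halve : ∀ r → r ≡ ½ * (r + r)
          halve = solve 1 (λ r → r := con ½ :* (r :+ r)) refl
          im≡ : im x ≡ ½ * [ S ]
          im≡ = trans (halve (im x)) (cong (½ *_) (proj₂ S-int))
          re≡ : re x ≡ [ U ] + ½ * [ S ]
          re≡ = trans (halve (re x)) (trans (cong (½ *_) (trans t≡ (trans (cong [_] T≡) (trans ([]-+ (U ℤ.* + 2) S) (cong (_+ [ S ]) ([]-* U (+ 2)))))))
            (solve 2 (λ U S → con ½ :* (U :* con [ + 2 ] :+ S) := U :+ con ½ :* S) refl [ U ] [ S ]))

      open Quad m using (Ideal; Similar; similar-sym; similar-trans; Form; 1ₒ; 1ₒ-⊛; module Hermite)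
      open Ideal renaming (mem to memₒ; mem? to memₒ?; nonzero to nonzeroₒ)
      open Form using (L; L-ideal)

      restrict : NonzeroIdeal → Ideal
      restrict I = record
        { mem = λ v → mem I (ι v)
        ; mem? = λ v → mem? I (ι v)
        ; closed-⊞ = λ {x} {y} p r → subst (mem I) (sym (ι-⊞ x y)) (⊕-closed I p r)
        ; closed-⊛ = λ a {x} p → subst (mem I) (sym (ι-⊛ a x)) (⊗-closed I (ι-∈𝒪 a) p)
        ; nonzero = let x , p , x≢0 = nonzero I ; v , e = 𝒪-ι (integral I p) in
            v , subst (mem I) e p , λ v≡0 → x≢0 (trans e (cong ι v≡0)) }

      image? : ∀ x → Dec (∃ λ v → x ≡ ι v)
      image? x with int? (im x + im x) | int? (re x - im x)
      ... | yes (W , e) | yes (U , f) = yes (⟨ U , W ⟩ , cong₂ _+√_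
          (trans (lem (re x) (im x)) (cong₂ (λ a b → a + ½ * b) f e))
          (trans (halve (im x)) (cong (½ *_) e)))
        where
        halve : ∀ r → r ≡ ½ * (r + r)
        halve = solve 1 (λ r → r := con ½ :* (r :+ r)) refl
        lem : ∀ r s → r ≡ (r - s) + ½ * (s + s)
        lem = solve 2 (λ r s → r := (r :+ :- s) :+ con ½ :* (s :+ s)) refl
      ... | no ¬e | _ = no λ { (v , refl) → ¬e (w v , lem [ w v ]) }
        where
        lem : ∀ r → ½ * r + ½ * r ≡ r
        lem = solve 1 (λ r → con ½ :* r :+ con ½ :* r := r) refl
      ... | yes _ | no ¬f = no λ { (v , refl) → ¬f (u v , lem [ u v ] (½ * [ w v ])) }
        where
        lem : ∀ r s → r + s - s ≡ r
        lem = solve 2 (λ r s → r :+ s :+ :- s := r) refl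

      extend : Ideal → NonzeroIdeal
      extend J = record
        { mem = λ x → ∃ λ v → memₒ J v × x ≡ ι v
        ; mem? = decide
        ; integral = λ { (v , _ , refl) → ι-∈𝒪 v }
        ; ⊕-closed = λ { (v , p , refl) (v′ , p′ , refl) → v ⊞ v′ , closed-⊞ J p p′ , sym (ι-⊞ v v′) }
        ; ⊗-closed = λ { {a} a∈ (v , p , refl) → let b , e = 𝒪-ι a∈ in b ⊛ v , closed-⊛ J b p , trans (cong (_⊗ ι v) e) (sym (ι-⊛ b v)) }
        ; nonzero = let v , p , v≢0 = nonzeroₒ J in ι v , (v , p , refl) , λ e → v≢0 (ι-injective e) }
        where
        decide : ∀ x → Dec (∃ λ v → memₒ J v × x ≡ ι v)
        decide x with image? x
        ... | no ¬i = no λ { (v , _ , e) → ¬i (v , e) }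
        ... | yes (v , e) = map′ (λ p → v , p , e) (λ { (v′ , p′ , e′) → subst (memₒ J) (ι-injective (trans (sym e′) e)) p′ }) (memₒ? J v)

      ∼⇒similar : ∀ {I J} → I ∼ J → Similar (memₒ (restrict I)) (memₒ (restrict J))
      ∼⇒similar {I} {J} (α , β , α∈ , α≢0 , β∈ , β≢0 , sub , sup) = record
        { α = a ; β = b ; α≢0 = λ e → α≢0 (trans ea (cong ι e)) ; β≢0 = λ e → β≢0 (trans eb (cong ι e))
        ; to = λ {x} p → let y , qy , e = sub (ι x , p , refl) ; y′ , ey = 𝒪-ι (integral J qy) in
            y′ , subst (mem J) ey qy , ι-injective (equation x y′ (trans e (cong (β ⊗_) ey)))
        ; from = λ {y} qy → let x , p , e = sup (ι y , qy , refl) ; x′ , ex = 𝒪-ι (integral I p) in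
            x′ , subst (mem I) ex p , ι-injective (equation x′ y (sym (trans e (cong (α ⊗_) ex)))) }
        where
        a = proj₁ (𝒪-ι α∈)
        ea = proj₂ (𝒪-ι α∈)
        b = proj₁ (𝒪-ι β∈)
        eb = proj₂ (𝒪-ι β∈)
        equation : ∀ x y → α ⊗ ι x ≡ β ⊗ ι y → ι (a ⊛ x) ≡ ι (b ⊛ y)
        equation x y e = trans (ι-⊛ a x) (trans (cong (_⊗ ι x) (sym ea)) (trans e (trans (cong (_⊗ ι y) eb) (sym (ι-⊛ b y)))))

      similar⇒∼ : ∀ {I J} → Similar (memₒ (restrict I)) (memₒ (restrict J)) → I ∼ J
      similar⇒∼ {I} {J} s = ι (α s) , ι (β s) , ι-∈𝒪 (α s) , (λ e → α≢0 s (ι-injective e)) , ι-∈𝒪 (β s) , (λ e → β≢0 s (ι-injective e)) ,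
        (λ { (x , p , refl) → let v , e = 𝒪-ι (integral I p) ; y , qy , f = to s {v} (subst (mem I) e p) in
            ι y , qy , trans (cong (ι (α s) ⊗_) e) (trans (sym (ι-⊛ (α s) v)) (trans (cong ι f) (ι-⊛ (β s) y))) }) ,
        (λ { (y , qy , refl) → let v , e = 𝒪-ι (integral J qy) ; x , p , f = from s {v} (subst (mem J) e qy) in
            ι x , p , trans (cong (ι (β s) ⊗_) e) (trans (sym (ι-⊛ (β s) v)) (trans (cong ι (sym f)) (ι-⊛ (α s) x))) })
        where
        open Similar

      extend-similar : ∀ J → Similar (memₒ (restrict (extend J))) (memₒ J)
      extend-similar J = record { α = 1ₒ ; β = 1ₒ ; α≢0 = λ () ; β≢0 = λ ()
        ; to = λ { (v , p , e) → v , p , cong (1ₒ ⊛_) (ι-injective e) }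
        ; from = λ {v} p → v , (v , p , refl) , refl }

      representatives : ∀ {h} → IsClassNumber h → Representatives m h
      representatives (f , injective , surjective) = record
        { F = λ i → Hermite.form (restrict (f i))
        ; complete = λ G → let i , e = surjective (extend (L-ideal G)) in
            i , similar-trans (similar-sym (extend-similar (L-ideal G))) (similar-trans (similar-sym (∼⇒similar {f i} {extend (L-ideal G)} (e refl))) (Hermite.form-similar (restrict (f i))))
        ; distinct = λ {i} {j} s → injective (similar⇒∼ {f i} {f j}
            (similar-trans (Hermite.form-similar (restrict (f i))) (similar-trans s (similar-sym (Hermite.form-similar (restrict (f j))))))) }

open QuadraticOrder
open Field using (module RingOfIntegers)
open import Data.Integer.Base hiding (suc; pred; NonZero; _%_)
open import Data.Integer.Properties
open import Data.Integer.DivMod using (_/ℕ_; n%ℕd<d; a≡a%ℕn+[a/ℕn]*n)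
open import Data.Integer.Divisibility.Signed
  using (_∣_; divides; ∣ᵤ⇒∣; ∣⇒∣ᵤ; ∣m∣n⇒∣m+n; ∣m∣n⇒∣m-n; ∣n⇒∣m*n; ∣m⇒∣m*n; ∣m⇒∣-m; ∣-trans; _∣?_; ∣-refl)
open import Data.Integer.Tactic.RingSolver using (solve-∀)
open import Data.List.Base using (_++_; map; filter; upTo; applyUpTo; foldr; allFin; cartesianProduct)
open import Data.Bool.Base using (true; false; if_then_else_)
open import Data.List.Properties using (length-applyUpTo; length-tabulate)
open import Data.List.Membership.Propositional using (_∈_)
open import Data.List.Membership.Propositional.Properties
  using (∈-map⁺; ∈-map⁻; ∈-filter⁺; ∈-filter⁻; ∈-upTo⁺; ∈-applyUpTo⁺; ∈-applyUpTo⁻; ∈-allFin; ∈-cartesianProduct⁺)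
open import Data.List.Membership.Propositional.Properties.WithK using (unique∧set⇒bag)
open import Data.List.Relation.Binary.BagAndSetEquality using (∼bag⇒↭)
open import Data.List.Relation.Binary.Permutation.Propositional as Perm using (_↭_)
open import Data.List.Relation.Unary.All as All using (All; []; _∷_)
open import Data.List.Relation.Unary.AllPairs using ([]; _∷_)
open import Data.List.Relation.Unary.Any using (here; there)
open import Data.List.Relation.Unary.Unique.Propositional using (Unique)
import Data.List.Relation.Unary.Unique.Propositional.Properties as Uniq
open import Data.Nat.ListAction using (product)
open import Data.Nat.Primality.Factorisation using (factorise; PrimeFactorisation; factorisationHasAllPrimeFactors)
open import Function.Bundles using (mk⇔)

private variable
  𝐀 𝐁 : Set

∑ : ℕ → (ℕ → ℤ) → ℤ
∑ zero    f = 0ℤ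
∑ (suc n) f = ∑ n f + f n

∑-cong : ∀ n {f g} → (∀ k → k ℕ.< n → f k ≡ g k) → ∑ n f ≡ ∑ n g
∑-cong zero eq = refl
∑-cong (suc n) eq = cong₂ _+_ (∑-cong n (λ k k<n → eq k (ℕP.m<n⇒m<1+n k<n))) (eq n ℕP.≤-refl)

∑-cong′ : ∀ n {f g} → (∀ k → f k ≡ g k) → ∑ n f ≡ ∑ n g
∑-cong′ n eq = ∑-cong n (λ k _ → eq k)

∑-0 : ∀ n → ∑ n (λ _ → 0ℤ) ≡ 0ℤ
∑-0 zero = refl
∑-0 (suc n) = trans (+-identityʳ (∑ n (λ _ → 0ℤ))) (∑-0 n)

∑-+ : ∀ n f g → ∑ n (λ k → f k + g k) ≡ ∑ n f + ∑ n g
∑-+ zero f g = refl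
∑-+ (suc n) f g = trans (cong (_+ (f n + g n)) (∑-+ n f g)) (lem (∑ n f) (∑ n g) (f n) (g n))
  where
  lem : ∀ a b c d → a + b + (c + d) ≡ a + c + (b + d)
  lem = solve-∀

∑-* : ∀ n c f → ∑ n (λ k → c * f k) ≡ c * ∑ n f
∑-* zero c f = sym (*-zeroʳ c)
∑-* (suc n) c f = trans (cong (_+ c * f n) (∑-* n c f)) (sym (*-distribˡ-+ c (∑ n f) (f n)))

∑-neg : ∀ n f → ∑ n (λ k → - f k) ≡ - ∑ n f
∑-neg zero f = refl
∑-neg (suc n) f = trans (cong (_+ - f n) (∑-neg n f)) (sym (neg-distrib-+ (∑ n f) (f n)))

∑-- : ∀ n f g → ∑ n (λ k → f k - g k) ≡ ∑ n f - ∑ n g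
∑-- n f g = trans (∑-+ n f (λ k → - g k)) (cong (_+_ (∑ n f)) (∑-neg n g))

∑-swap : ∀ m n (f : ℕ → ℕ → ℤ) → ∑ m (λ i → ∑ n (f i)) ≡ ∑ n (λ j → ∑ m (λ i → f i j))
∑-swap zero n f = sym (∑-0 n)
∑-swap (suc m) n f =
  trans (cong (_+ ∑ n (f m)) (∑-swap m n f)) (sym (∑-+ n (λ j → ∑ m (λ i → f i j)) (f m)))

∑-mono : ∀ n {f g} → (∀ k → k ℕ.< n → f k ≤ g k) → ∑ n f ≤ ∑ n g
∑-mono zero le = ≤-refl
∑-mono (suc n) le = +-mono-≤ (∑-mono n (λ k k<n → le k (ℕP.m<n⇒m<1+n k<n))) (le n ℕP.≤-refl)

∑-nonneg : ∀ n {f} → (∀ k → k ℕ.< n → 0ℤ ≤ f k) → 0ℤ ≤ ∑ n f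
∑-nonneg n {f} nn = subst (_≤ ∑ n f) (∑-0 n) (∑-mono n nn)

∑-bounded : ∀ n {f b} → (∀ k → k ℕ.< n → Bounded (f k) (b k)) → Bounded (∑ n f) (∑ n b)
∑-bounded zero h = bounded ≤-refl ≤-refl
∑-bounded (suc n) h = bounded-+ (∑-bounded n (λ k k<n → h k (ℕP.m<n⇒m<1+n k<n))) (h n ℕP.≤-refl)

∑-const : ∀ n c → ∑ n (λ _ → c) ≡ + n * c
∑-const zero c = refl
∑-const (suc n) c =
  trans (cong (_+ c) (∑-const n c)) (trans (lem (+ n) c) (cong (_* c) (pos-+ 1 n)))
  where
  lem : ∀ m c → m * c + c ≡ (1ℤ + m) * c
  lem = solve-∀

∑-split : ∀ m n f → ∑ (m ℕ.+ n) f ≡ ∑ m f + ∑ n (λ k → f (m ℕ.+ k))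
∑-split m zero f =
  trans (cong (λ j → ∑ j f) (ℕP.+-identityʳ m)) (sym (+-identityʳ (∑ m f)))
∑-split m (suc n) f =
  trans (cong (λ j → ∑ j f) (ℕP.+-suc m n))
  (trans (cong (_+ f (m ℕ.+ n)) (∑-split m n f)) (+-assoc (∑ m f) _ _))

∑-head : ∀ n f → ∑ (suc n) f ≡ f 0 + ∑ n (f ∘ suc)
∑-head n f = trans (∑-split 1 n f) (cong (_+ ∑ n (f ∘ suc)) (+-identityˡ (f 0)))

∑-telescope : ∀ n (f : ℕ → ℤ) → ∑ n (λ k → f k - f (suc k)) ≡ f 0 - f n
∑-telescope zero f = sym (+-inverseʳ (f 0))
∑-telescope (suc n) f =
  trans (cong (_+ (f n - f (suc n))) (∑-telescope n f)) (lem (f 0) (f n) (f (suc n)))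
  where
  lem : ∀ a b c → a - b + (b - c) ≡ a - c
  lem = solve-∀

∑-extend : ∀ {m n f} → m ℕ.≤ n → (∀ k → m ℕ.≤ k → f k ≡ 0ℤ) → ∑ n f ≡ ∑ m f
∑-extend {m} {n} {f} m≤n z = begin
  ∑ n f                                      ≡⟨ cong (λ j → ∑ j f) (sym (ℕP.m+[n∸m]≡n m≤n)) ⟩
  ∑ (m ℕ.+ (n ℕ.∸ m)) f                      ≡⟨ ∑-split m (n ℕ.∸ m) f ⟩
  ∑ m f + ∑ (n ℕ.∸ m) (λ k → f (m ℕ.+ k))    ≡⟨ cong (_+_ (∑ m f)) (∑-cong′ (n ℕ.∸ m) (λ k → z (m ℕ.+ k) (ℕP.m≤m+n m k))) ⟩
  ∑ m f + ∑ (n ℕ.∸ m) (λ _ → 0ℤ)             ≡⟨ cong (_+_ (∑ m f)) (∑-0 (n ℕ.∸ m)) ⟩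
  ∑ m f + 0ℤ                                 ≡⟨ +-identityʳ (∑ m f) ⟩
  ∑ m f                                      ∎
  where open ≡-Reasoning

∑-even-odd : ∀ n f → ∑ (n ℕ.+ n) f ≡ ∑ n (λ k → f (k ℕ.+ k) + f (suc (k ℕ.+ k)))
∑-even-odd zero f = refl
∑-even-odd (suc n) f =
  trans (cong (λ j → ∑ j f + f (n ℕ.+ suc n)) (ℕP.+-suc n n))
  (trans (cong (λ j → ∑ (n ℕ.+ n) f + f (n ℕ.+ n) + f j) (ℕP.+-suc n n))
  (trans (+-assoc (∑ (n ℕ.+ n) f) _ _)
           (cong (_+ (f (n ℕ.+ n) + f (suc (n ℕ.+ n)))) (∑-even-odd n f))))

-- Sums and products over lists

sumL : (𝐀 → ℤ) → List 𝐀 → ℤ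
sumL f []       = 0ℤ
sumL f (x ∷ xs) = f x + sumL f xs

prodL : (𝐀 → ℤ) → List 𝐀 → ℤ
prodL f []       = 1ℤ
prodL f (x ∷ xs) = f x * prodL f xs

sumL-↭ : ∀ (f : 𝐀 → ℤ) {xs ys} → xs ↭ ys → sumL f xs ≡ sumL f ys
sumL-↭ f Perm.refl = refl
sumL-↭ f (Perm.prep x p) = cong (_+_ (f x)) (sumL-↭ f p)
sumL-↭ f (Perm.swap {xs} x y p) =
  trans (lem (f x) (f y) (sumL f xs)) (cong (λ s → f y + (f x + s)) (sumL-↭ f p))
  where
  lem : ∀ a b c → a + (b + c) ≡ b + (a + c)
  lem = solve-∀
sumL-↭ f (Perm.trans p q) = trans (sumL-↭ f p) (sumL-↭ f q)

prodL-↭ : ∀ (f : 𝐀 → ℤ) {xs ys} → xs ↭ ys → prodL f xs ≡ prodL f ys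
prodL-↭ f Perm.refl = refl
prodL-↭ f (Perm.prep x p) = cong (_*_ (f x)) (prodL-↭ f p)
prodL-↭ f (Perm.swap {xs} x y p) =
  trans (lem (f x) (f y) (prodL f xs)) (cong (λ s → f y * (f x * s)) (prodL-↭ f p))
  where
  lem : ∀ a b c → a * (b * c) ≡ b * (a * c)
  lem = solve-∀
prodL-↭ f (Perm.trans p q) = trans (prodL-↭ f p) (prodL-↭ f q)

unique-↭ : ∀ {xs ys : List 𝐀} → Unique xs → Unique ys →
  (∀ {z} → z ∈ xs → z ∈ ys) → (∀ {z} → z ∈ ys → z ∈ xs) → xs ↭ ys
unique-↭ u v f g = ∼bag⇒↭ (unique∧set⇒bag u v (mk⇔ f g))

sumL-map : ∀ (f : 𝐁 → ℤ) (g : 𝐀 → 𝐁) xs → sumL f (map g xs) ≡ sumL (f ∘ g) xs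
sumL-map f g [] = refl
sumL-map f g (x ∷ xs) = cong (_+_ (f (g x))) (sumL-map f g xs)

prodL-map : ∀ (f : 𝐁 → ℤ) (g : 𝐀 → 𝐁) xs → prodL f (map g xs) ≡ prodL (f ∘ g) xs
prodL-map f g [] = refl
prodL-map f g (x ∷ xs) = cong (_*_ (f (g x))) (prodL-map f g xs)

sumL-++ : ∀ (f : 𝐀 → ℤ) xs ys → sumL f (xs ++ ys) ≡ sumL f xs + sumL f ys
sumL-++ f [] ys = sym (+-identityˡ _)
sumL-++ f (x ∷ xs) ys = trans (cong (_+_ (f x)) (sumL-++ f xs ys)) (sym (+-assoc (f x) _ _))

sumL-cong : ∀ {f g : 𝐀 → ℤ} xs → (∀ {x} → x ∈ xs → f x ≡ g x) → sumL f xs ≡ sumL g xs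
sumL-cong [] eq = refl
sumL-cong (x ∷ xs) eq = cong₂ _+_ (eq (here refl)) (sumL-cong xs (eq ∘ there))

prodL-cong : ∀ {f g : 𝐀 → ℤ} xs → (∀ {x} → x ∈ xs → f x ≡ g x) → prodL f xs ≡ prodL g xs
prodL-cong [] eq = refl
prodL-cong (x ∷ xs) eq = cong₂ _*_ (eq (here refl)) (prodL-cong xs (eq ∘ there))

prodL-* : ∀ (f g : 𝐀 → ℤ) xs → prodL (λ x → f x * g x) xs ≡ prodL f xs * prodL g xs
prodL-* f g [] = refl
prodL-* f g (x ∷ xs) =
  trans (cong (_*_ (f x * g x)) (prodL-* f g xs)) (lem (f x) (g x) (prodL f xs) (prodL g xs))
  where
  lem : ∀ a b c d → a * b * (c * d) ≡ a * c * (b * d)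
  lem = solve-∀

sumL-+ : ∀ (f g : 𝐀 → ℤ) xs → sumL (λ x → f x + g x) xs ≡ sumL f xs + sumL g xs
sumL-+ f g [] = refl
sumL-+ f g (x ∷ xs) =
  trans (cong (_+_ (f x + g x)) (sumL-+ f g xs)) (lem (f x) (g x) (sumL f xs) (sumL g xs))
  where
  lem : ∀ a b c d → a + b + (c + d) ≡ a + c + (b + d)
  lem = solve-∀

sumL-* : ∀ c (f : 𝐀 → ℤ) xs → sumL (λ x → c * f x) xs ≡ c * sumL f xs
sumL-* c f [] = sym (*-zeroʳ c)
sumL-* c f (x ∷ xs) = trans (cong (_+_ (c * f x)) (sumL-* c f xs)) (sym (*-distribˡ-+ c (f x) _))

sumL-∑ : ∀ n (f : 𝐀 → ℕ → ℤ) xs → sumL (λ x → ∑ n (f x)) xs ≡ ∑ n (λ k → sumL (λ x → f x k) xs)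
sumL-∑ n f [] = sym (∑-0 n)
sumL-∑ n f (x ∷ xs) =
  trans (cong (_+_ (∑ n (f x))) (sumL-∑ n f xs)) (sym (∑-+ n (f x) (λ k → sumL (λ x → f x k) xs)))

sumL-applyUpTo : ∀ (f : 𝐀 → ℤ) (g : ℕ → 𝐀) n → sumL f (applyUpTo g n) ≡ ∑ n (f ∘ g)
sumL-applyUpTo f g zero = refl
sumL-applyUpTo f g (suc n) =
  trans (cong (_+_ (f (g 0))) (sumL-applyUpTo f (g ∘ suc) n)) (sym (∑-head n (f ∘ g)))

sumL-upTo : ∀ (f : ℕ → ℤ) n → sumL f (upTo n) ≡ ∑ n f
sumL-upTo f n = sumL-applyUpTo f (λ x → x) n

⟦_⟧ : {P : Set} → Dec P → ℤ
⟦ d ⟧ = if does d then 1ℤ else 0ℤ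

sumL-filter : ∀ {P : Pred 𝐀 _} (P? : Decidable P) (f : 𝐀 → ℤ) xs →
  sumL f (filter P? xs) ≡ sumL (λ x → ⟦ P? x ⟧ * f x) xs
sumL-filter P? f [] = refl
sumL-filter P? f (x ∷ xs) with does (P? x)
... | true = cong₂ _+_ (sym (*-identityˡ (f x))) (sumL-filter P? f xs)
... | false = trans (sumL-filter P? f xs) (sym (+-identityˡ _))

count : List 𝐀 → ℤ
count = sumL (λ _ → 1ℤ)

unique-map-on : ∀ (f : 𝐀 → 𝐁) {xs} →
  (∀ {x y} → x ∈ xs → y ∈ xs → f x ≡ f y → x ≡ y) → Unique xs → Unique (map f xs)
unique-map-on f {[]} inj [] = []
unique-map-on f {x ∷ xs} inj (x∉ ∷ u) =
  go x∉ (λ y∈ → inj (here refl) (there y∈)) ∷ unique-map-on f (λ p q → inj (there p) (there q)) u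
  where
  go : ∀ {ys} → All (λ y → ¬ x ≡ y) ys → (∀ {y} → y ∈ ys → f x ≡ f y → x ≡ y) → All (λ z → ¬ f x ≡ z) (map f ys)
  go [] i = []
  go (x≢y ∷ r) i = (λ e → x≢y (i (here refl) e)) ∷ go r (i ∘ there)

sumL-bijection : ∀ (g : 𝐁 → ℤ) (f : 𝐀 → 𝐁) {xs ys} → Unique xs → Unique ys →
  (∀ {x} → x ∈ xs → f x ∈ ys) → (∀ {x y} → x ∈ xs → y ∈ xs → f x ≡ f y → x ≡ y) →
  (∀ {y} → y ∈ ys → ∃ λ x → x ∈ xs × f x ≡ y) → sumL (g ∘ f) xs ≡ sumL g ys
sumL-bijection g f {xs} {ys} ux uy into inj onto = trans (sym (sumL-map g f xs))
  (sumL-↭ g (unique-↭ (unique-map-on f inj ux) uy into′ onto′))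
  where
  into′ : ∀ {z} → z ∈ map f xs → z ∈ ys
  into′ m with ∈-map⁻ f m
  ... | x , x∈ , refl = into x∈
  onto′ : ∀ {z} → z ∈ ys → z ∈ map f xs
  onto′ m with onto m
  ... | x , x∈ , refl = ∈-map⁺ f x∈

count-bijection : ∀ (f : 𝐀 → 𝐁) {xs ys} → Unique xs → Unique ys →
  (∀ {x} → x ∈ xs → f x ∈ ys) → (∀ {x y} → x ∈ xs → y ∈ xs → f x ≡ f y → x ≡ y) →
  (∀ {y} → y ∈ ys → ∃ λ x → x ∈ xs × f x ≡ y) → count xs ≡ count ys
count-bijection f ux uy into inj onto = sumL-bijection (λ _ → 1ℤ) f ux uy into inj onto

-- Inclusion–exclusion for two predicates covering the list.
sumL-cover : ∀ (g : 𝐀 → ℤ) {P R : Pred 𝐀 _} (P? : Decidable P) (R? : Decidable R) xs → (∀ {x} → x ∈ xs → P x ⊎ R x) →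
  sumL g xs ≡ sumL g (filter P? xs) + sumL g (filter R? xs) - sumL g (filter (λ x → P? x ×-dec R? x) xs)
sumL-cover g {P} {R} P? R? xs cover = begin
  sumL g xs
    ≡⟨ sumL-cong xs (λ {x} x∈ → pointwise (g x) (P? x) (R? x) (cover x∈)) ⟩
  sumL (λ x → ⟦ P? x ⟧ * g x + ⟦ R? x ⟧ * g x + -1ℤ * (⟦ P? x ×-dec R? x ⟧ * g x)) xs
    ≡⟨ trans (sumL-+ (λ x → ⟦ P? x ⟧ * g x + ⟦ R? x ⟧ * g x) (λ x → -1ℤ * (⟦ P? x ×-dec R? x ⟧ * g x)) xs)
         (cong₂ _+_ (sumL-+ (λ x → ⟦ P? x ⟧ * g x) (λ x → ⟦ R? x ⟧ * g x) xs) (sumL-* -1ℤ (λ x → ⟦ P? x ×-dec R? x ⟧ * g x) xs)) ⟩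
  sumL (λ x → ⟦ P? x ⟧ * g x) xs + sumL (λ x → ⟦ R? x ⟧ * g x) xs + -1ℤ * sumL (λ x → ⟦ P? x ×-dec R? x ⟧ * g x) xs
    ≡⟨ cong₂ _+_ (cong₂ _+_ (sym (sumL-filter P? g xs)) (sym (sumL-filter R? g xs)))
         (trans (-1*i≡-i (sumL (λ x → ⟦ P? x ×-dec R? x ⟧ * g x) xs)) (cong -_ (sym (sumL-filter (λ x → P? x ×-dec R? x) g xs)))) ⟩
  sumL g (filter P? xs) + sumL g (filter R? xs) - sumL g (filter (λ x → P? x ×-dec R? x) xs) ∎
  where
  open ≡-Reasoning
  pointwise : ∀ {x} v (d : Dec (P x)) (e : Dec (R x)) → P x ⊎ R x →
    v ≡ ⟦ d ⟧ * v + ⟦ e ⟧ * v + -1ℤ * (⟦ d ×-dec e ⟧ * v)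
  pointwise v (yes _) (yes _) _ = lem v
    where
    lem : ∀ v → v ≡ 1ℤ * v + 1ℤ * v + -1ℤ * (1ℤ * v)
    lem = solve-∀
  pointwise v (yes _) (no _) _ = lem v
    where
    lem : ∀ v → v ≡ 1ℤ * v + 0ℤ * v + -1ℤ * (0ℤ * v)
    lem = solve-∀
  pointwise v (no _) (yes _) _ = lem v
    where
    lem : ∀ v → v ≡ 0ℤ * v + 1ℤ * v + -1ℤ * (0ℤ * v)
    lem = solve-∀
  pointwise v (no ¬p) (no ¬r) (inj₁ p) = ⊥-elim (¬p p)
  pointwise v (no ¬p) (no ¬r) (inj₂ r) = ⊥-elim (¬r r)

count-cover : ∀ {P R : Pred 𝐀 _} (P? : Decidable P) (R? : Decidable R) xs → (∀ {x} → x ∈ xs → P x ⊎ R x) →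
  count xs ≡ count (filter P? xs) + count (filter R? xs) - count (filter (λ x → P? x ×-dec R? x) xs)
count-cover P? R? xs cover = sumL-cover (λ _ → 1ℤ) P? R? xs cover

sumL-empty : ∀ (g : 𝐀 → ℤ) (xs : List 𝐀) → (∀ {x} → ¬ (x ∈ xs)) → sumL g xs ≡ 0ℤ
sumL-empty g [] h = refl
sumL-empty g (x ∷ xs) h = ⊥-elim (h (here refl))

count-empty : ∀ (xs : List 𝐀) → (∀ {x} → ¬ (x ∈ xs)) → count xs ≡ 0ℤ
count-empty = sumL-empty (λ _ → 1ℤ)

∣-sub : ∀ {d} x y z → d ∣ x - y → d ∣ y - z → d ∣ x - z
∣-sub x y z p q = ∣-eq (lem x y z) (∣m∣n⇒∣m+n p q)
  where
  lem : ∀ x y z → x - y + (y - z) ≡ x - z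
  lem = solve-∀

∣-sub-sym : ∀ {d} x y → d ∣ x - y → d ∣ y - x
∣-sub-sym x y p = ∣-eq (lem x y) (∣m⇒∣-m p)
  where
  lem : ∀ x y → - (x - y) ≡ y - x
  lem = solve-∀

∣-sub-refl : ∀ {d} x → d ∣ x - x
∣-sub-refl x = divides 0ℤ (+-inverseʳ x)

∣-sub-* : ∀ {d} x y z w → d ∣ x - y → d ∣ z - w → d ∣ x * z - y * w
∣-sub-* x y z w p q = ∣-eq (lem x y z w) (∣m∣n⇒∣m+n (∣m⇒∣m*n z p) (∣n⇒∣m*n y q))
  where
  lem : ∀ x y z w → (x - y) * z + y * (z - w) ≡ x * z - y * w
  lem = solve-∀

∣-sub-^ : ∀ {d} x y n → d ∣ x - y → d ∣ x ^ n - y ^ n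
∣-sub-^ x y zero p = ∣-sub-refl 1ℤ
∣-sub-^ {d} x y (suc n) p = ∣-sub-* {d} x y (x ^ n) (y ^ n) p (∣-sub-^ {d} x y n p)

∣-sub-prodL : ∀ {A : Set} {d} (f g : A → ℤ) xs → (∀ {x} → x ∈ xs → d ∣ f x - g x) →
  d ∣ prodL f xs - prodL g xs
∣-sub-prodL f g [] h = ∣-sub-refl 1ℤ
∣-sub-prodL {d = d} f g (x ∷ xs) h =
  ∣-sub-* {d} (f x) (g x) (prodL f xs) (prodL g xs) (h (here refl)) (∣-sub-prodL {d = d} f g xs (h ∘ there))

^-distrib-* : ∀ x y n → (x * y) ^ n ≡ x ^ n * y ^ n
^-distrib-* x y zero = refl
^-distrib-* x y (suc n) = trans (cong (_*_ (x * y)) (^-distrib-* x y n)) (lem x y (x ^ n) (y ^ n))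
  where
  lem : ∀ a b c d → a * b * (c * d) ≡ a * c * (b * d)
  lem = solve-∀

prodL-scale : ∀ {A : Set} c (f : A → ℤ) xs → prodL (λ x → c * f x) xs ≡ c ^ length xs * prodL f xs
prodL-scale c f [] = refl
prodL-scale c f (x ∷ xs) = trans (cong (_*_ (c * f x)) (prodL-scale c f xs)) (lem c (f x) (c ^ length xs) (prodL f xs))
  where
  lem : ∀ a b c d → a * b * (c * d) ≡ a * c * (b * d)
  lem = solve-∀

-- Polynomial functions of degree at most n, through their difference quotients.

Deg : ℕ → (ℤ → ℤ) → Set
Deg zero    f = ∀ x → f x ≡ f 0ℤ
Deg (suc n) f = ∀ r → ∃ λ g → Deg n g × (∀ x → f x ≡ (x - r) * g x + f r)

deg-const : ∀ n c → Deg n (λ _ → c)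
deg-const zero c x = refl
deg-const (suc n) c r = (λ _ → 0ℤ) , deg-const n 0ℤ , λ x → lem x r c
  where
  lem : ∀ x r c → c ≡ (x - r) * 0ℤ + c
  lem = solve-∀

deg-+ : ∀ n {f g} → Deg n f → Deg n g → Deg n (λ x → f x + g x)
deg-+ zero F G x = cong₂ _+_ (F x) (G x)
deg-+ (suc n) {f} {g} F G r with F r | G r
... | f′ , F′ , ef | g′ , G′ , eg =
  (λ x → f′ x + g′ x) , deg-+ n F′ G′ , λ x → trans (cong₂ _+_ (ef x) (eg x)) (lem x r (f′ x) (f r) (g′ x) (g r))
  where
  lem : ∀ x r a b c d → (x - r) * a + b + ((x - r) * c + d) ≡ (x - r) * (a + c) + (b + d)
  lem = solve-∀

deg-scale : ∀ n c {f} → Deg n f → Deg n (λ x → c * f x)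
deg-scale zero c F x = cong (_*_ c) (F x)
deg-scale (suc n) c {f} F r with F r
... | f′ , F′ , ef = (λ x → c * f′ x) , deg-scale n c F′ , λ x → trans (cong (_*_ c) (ef x)) (lem x r c (f′ x) (f r))
  where
  lem : ∀ x r c a b → c * ((x - r) * a + b) ≡ (x - r) * (c * a) + c * b
  lem = solve-∀

deg-suc : ∀ n {f} → Deg n f → Deg (suc n) f
deg-suc zero {f} F r = (λ _ → 0ℤ) , deg-const 0 0ℤ , λ x → trans (F x) (trans (sym (F r)) (lem x r (f r)))
  where
  lem : ∀ x r c → c ≡ (x - r) * 0ℤ + c
  lem = solve-∀
deg-suc (suc n) F r with F r
... | g , G , eq = g , deg-suc n G , eq

deg-x* : ∀ n {f} → Deg n f → Deg (suc n) (λ x → x * f x)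
deg-x* zero {f} F r = f , F , λ x → trans (lem x r (f x)) (cong (λ t → (x - r) * f x + r * t) (trans (F x) (sym (F r))))
  where
  lem : ∀ x r a → x * a ≡ (x - r) * a + r * a
  lem = solve-∀
deg-x* (suc n) {f} F r with F r
... | g , G , eq = (λ x → f x + r * g x) , deg-+ (suc n) F (deg-suc n (deg-scale n r G)) ,
  λ x → trans (cong (_*_ x) (eq x)) (trans (lem x r (g x) (f r)) (cong (λ t → (x - r) * (t + r * g x) + r * f r) (sym (eq x))))
  where
  lem : ∀ x r a b → x * ((x - r) * a + b) ≡ (x - r) * ((x - r) * a + b + r * a) + r * b
  lem = solve-∀

deg-^ : ∀ n → Deg n (λ x → x ^ n)
deg-^ zero x = refl
deg-^ (suc n) = deg-x* n (deg-^ n)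

root-bound : ∀ {p} → Prime p → ∀ n {f} → Deg n f → (ρ : ℕ → ℤ) →
  (∀ i j → i ℕ.< j → j ℕ.≤ n → ¬ (+ p ∣ ρ i - ρ j)) → (∀ i → i ℕ.≤ n → + p ∣ f (ρ i)) →
  ∀ x → + p ∣ f x
root-bound pp zero F ρ d z x = ∣-eq (trans (F (ρ 0)) (sym (F x))) (z 0 ℕ.z≤n)
root-bound {p} pp (suc n) {f} F ρ d z x with F (ρ (suc n))
... | g , G , eq = ∣-eq (sym (eq x)) (∣m∣n⇒∣m+n (∣n⇒∣m*n (x - ρ (suc n)) (root-bound pp n G ρ d′ z′ x)) (z (suc n) ℕP.≤-refl))
  where
  d′ : ∀ i j → i ℕ.< j → j ℕ.≤ n → ¬ (+ p ∣ ρ i - ρ j)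
  d′ i j i<j j≤n = d i j i<j (ℕP.m≤n⇒m≤1+n j≤n)
  z′ : ∀ i → i ℕ.≤ n → + p ∣ g (ρ i)
  z′ i i≤n = ∣-cancel pp (ρ i - ρ (suc n)) (g (ρ i)) (d i (suc n) (ℕ.s≤s i≤n) ℕP.≤-refl)
    (∣-eq (trans (cong (_- f (ρ (suc n))) (eq (ρ i))) (lem ((ρ i - ρ (suc n)) * g (ρ i)) (f (ρ (suc n)))))
      (∣m∣n⇒∣m-n (z i (ℕP.m≤n⇒m≤1+n i≤n)) (z (suc n) ℕP.≤-refl)))
    where
    lem : ∀ a b → a + b - b ≡ a
    lem = solve-∀

pos-∸ : ∀ {m n} → n ℕ.≤ m → + (m ℕ.∸ n) ≡ + m - + n
pos-∸ {m} {n} n≤m = sym (trans (m-n≡m⊖n m n) (⊖-≥ n≤m))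

IsSign : ℤ → Set
IsSign s = s ≡ 1ℤ ⊎ s ≡ -1ℤ

isSign-square : ∀ {s} → IsSign s → s * s ≡ 1ℤ
isSign-square (inj₁ refl) = refl
isSign-square (inj₂ refl) = refl

isSign-* : ∀ {s t} → IsSign s → IsSign t → IsSign (s * t)
isSign-* (inj₁ refl) (inj₁ refl) = inj₁ refl
isSign-* (inj₁ refl) (inj₂ refl) = inj₂ refl
isSign-* (inj₂ refl) (inj₁ refl) = inj₂ refl
isSign-* (inj₂ refl) (inj₂ refl) = inj₁ refl

isSign-prodL : ∀ {A : Set} (f : A → ℤ) xs → (∀ {x} → x ∈ xs → IsSign (f x)) → IsSign (prodL f xs)
isSign-prodL f [] h = inj₁ refl
isSign-prodL f (x ∷ xs) h = isSign-* (h (here refl)) (isSign-prodL f xs (h ∘ there))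

sgn : ℕ → ℤ
sgn zero = 1ℤ
sgn (suc n) = - sgn n

sgn-+ : ∀ m n → sgn (m ℕ.+ n) ≡ sgn m * sgn n
sgn-+ zero n = sym (*-identityˡ (sgn n))
sgn-+ (suc m) n = trans (cong -_ (sgn-+ m n)) (neg-distribˡ-* (sgn m) (sgn n))

sgn-isSign : ∀ n → IsSign (sgn n)
sgn-isSign zero = inj₁ refl
sgn-isSign (suc n) with sgn-isSign n
... | inj₁ e = inj₂ (cong -_ e)
... | inj₂ e = inj₁ (cong -_ e)

sgn-double : ∀ n → sgn (n ℕ.+ n) ≡ 1ℤ
sgn-double n = trans (sgn-+ n n) (isSign-square (sgn-isSign n))

module OddPrime {p : ℕ} (h : ℕ) (pp : Prime p) (p≡ : p ≡ suc (h ℕ.+ h)) where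

  private instance
    p-nonZero : NonZero p
    p-nonZero = prime⇒nonZero pp

  private
    h<p : h ℕ.< p
    h<p = subst (h ℕ.<_) (sym p≡) (ℕ.s≤s (ℕP.m≤m+n h h))

  h≥1 : 1 ℕ.≤ h
  h≥1 = half≥1 h (subst (1 ℕ.<_) p≡ (ℕ.nonTrivial⇒n>1 p {{prime⇒nonTrivial pp}}))
    where
    half≥1 : ∀ h → 1 ℕ.< suc (h ℕ.+ h) → 1 ℕ.≤ h
    half≥1 zero (ℕ.s≤s ())
    half≥1 (suc h) _ = ℕ.s≤s ℕ.z≤n

  ∤-small : ∀ {x} → 1 ℕ.≤ x → x ℕ.≤ h → ¬ (+ p ∣ + x)
  ∤-small {x} 1≤x x≤h d with ∣-∣∣< d (ℕP.≤-<-trans x≤h h<p)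
  ∤-small {zero} () x≤h d | refl

  sign-coprime : ∀ {s} → IsSign s → ¬ (+ p ∣ s)
  sign-coprime {s} σ d = ∤-small ℕP.≤-refl h≥1 (∣-eq (isSign-square σ) (∣m⇒∣m*n s d))

  sign-determined : ∀ {s t} → IsSign s → IsSign t → + p ∣ s - t → s ≡ t
  sign-determined (inj₁ refl) (inj₁ refl) d = refl
  sign-determined (inj₂ refl) (inj₂ refl) d = refl
  sign-determined (inj₁ refl) (inj₂ refl) d = ⊥-elim (two d)
    where
    two : ¬ (+ p ∣ + 2)
    two d with ∣-∣∣< d (subst (3 ℕ.≤_) (sym p≡) (ℕ.s≤s (ℕP.+-mono-≤ h≥1 h≥1)))
    ... | ()
  sign-determined (inj₂ refl) (inj₁ refl) d = sym (sign-determined (inj₁ refl) (inj₂ refl) (∣m⇒∣-m d))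

  half-system : List ℕ
  half-system = applyUpTo suc h

  half-system-unique : Unique half-system
  half-system-unique = Uniq.applyUpTo⁺₁ suc h (λ i<j _ e → ℕP.<-irrefl (ℕP.suc-injective e) i<j)

  ∈-half⁺ : ∀ {x} → 1 ℕ.≤ x → x ℕ.≤ h → x ∈ half-system
  ∈-half⁺ {suc x} _ x≤h = ∈-applyUpTo⁺ suc x≤h

  ∈-half⁻ : ∀ {x} → x ∈ half-system → 1 ℕ.≤ x × x ℕ.≤ h
  ∈-half⁻ m with ∈-applyUpTo⁻ suc m
  ... | i , i<h , refl = ℕ.s≤s ℕ.z≤n , i<h

  private
    absOf : (r : ℕ) → Dec (r ℕ.≤ h) → ℕ
    absOf r (yes _) = r
    absOf r (no _) = p ℕ.∸ r

    sgnOf : {P : Set} → Dec P → ℤ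
    sgnOf (yes _) = 1ℤ
    sgnOf (no _) = -1ℤ

  abstract
    -- z ≡ foldSgn z · foldAbs z with foldAbs z in the half system.
    foldAbs : ℤ → ℕ
    foldAbs z = absOf (z %ℕ p) (z %ℕ p ℕP.≤? h)

    foldSgn : ℤ → ℤ
    foldSgn z = sgnOf (z %ℕ p ℕP.≤? h)

    foldSgn-sign : ∀ z → IsSign (foldSgn z)
    foldSgn-sign z with z %ℕ p ℕP.≤? h
    ... | yes _ = inj₁ refl
    ... | no _ = inj₂ refl

    fold-≡ : ∀ z → + p ∣ z - foldSgn z * + foldAbs z
    fold-≡ z with z %ℕ p ℕP.≤? h
    ... | yes _ = divides (z /ℕ p) (trans (cong (_- 1ℤ * + (z %ℕ p)) (a≡a%ℕn+[a/ℕn]*n z p)) (lem (+ (z %ℕ p)) (z /ℕ p) (+ p)))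
      where
      lem : ∀ r q p → r + q * p - 1ℤ * r ≡ q * p
      lem = solve-∀
    ... | no _ = divides (z /ℕ p + 1ℤ)
        (trans (cong₂ (λ u v → u - -1ℤ * v) (a≡a%ℕn+[a/ℕn]*n z p) (pos-∸ (ℕP.<⇒≤ (n%ℕd<d z p))))
          (lem (+ (z %ℕ p)) (z /ℕ p) (+ p)))
      where
      lem : ∀ r q p → r + q * p - -1ℤ * (p - r) ≡ (q + 1ℤ) * p
      lem = solve-∀

    fold-range : ∀ z → ¬ (+ p ∣ z) → 1 ℕ.≤ foldAbs z × foldAbs z ℕ.≤ h
    fold-range z p∤z with z %ℕ p ℕP.≤? h
    ... | yes r≤h = ℕP.n≢0⇒n>0 r≢0 , r≤h
      where
      r≢0 : ¬ (z %ℕ p ≡ 0)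
      r≢0 eq = p∤z (divides (z /ℕ p) (trans (a≡a%ℕn+[a/ℕn]*n z p) (trans (cong (λ r → + r + (z /ℕ p) * + p) eq) (+-identityˡ _))))
    ... | no r≰h = ℕP.m<n⇒0<n∸m (n%ℕd<d z p) ,
      subst (p ℕ.∸ z %ℕ p ℕ.≤_) (trans (cong (ℕ._∸ suc h) p≡) (ℕP.m+n∸m≡n h h)) (ℕP.∸-monoʳ-≤ p (ℕP.≰⇒> r≰h))

    foldSgn-≤ : ∀ z → z %ℕ p ℕ.≤ h → foldSgn z ≡ 1ℤ
    foldSgn-≤ z r≤h with z %ℕ p ℕP.≤? h
    ... | yes _ = refl
    ... | no r≰h = ⊥-elim (r≰h r≤h)

    foldSgn-≰ : ∀ z → ¬ (z %ℕ p ℕ.≤ h) → foldSgn z ≡ -1ℤ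
    foldSgn-≰ z r≰h with z %ℕ p ℕP.≤? h
    ... | yes r≤h = ⊥-elim (r≰h r≤h)
    ... | no _ = refl

    foldSgn-parity : ∀ z → sgn (z %ℕ p) ≡ foldSgn z * sgn (foldAbs z)
    foldSgn-parity z with z %ℕ p ℕP.≤? h
    ... | yes _ = sym (*-identityˡ (sgn (z %ℕ p)))
    ... | no _ = lem (sgn (p ℕ.∸ z %ℕ p)) (sgn (z %ℕ p)) (isSign-square (sgn-isSign (p ℕ.∸ z %ℕ p)))
        (trans (sym (sgn-+ (p ℕ.∸ z %ℕ p) (z %ℕ p)))
          (trans (cong sgn (trans (ℕP.m∸n+n≡m (ℕP.<⇒≤ (n%ℕd<d z p))) p≡)) (cong -_ (sgn-double h))))
      where
      lem : ∀ y r → y * y ≡ 1ℤ → y * r ≡ -1ℤ → r ≡ -1ℤ * y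
      lem y r yy yr = trans (sym (*-identityˡ r)) (trans (cong (_* r) (sym yy)) (trans (*-assoc y y r)
        (trans (cong (_*_ y) yr) (*-comm y -1ℤ))))

  fold-unique : ∀ {x y s} → 1 ℕ.≤ x → x ℕ.≤ h → 1 ℕ.≤ y → y ℕ.≤ h → IsSign s → + p ∣ + x - s * + y → x ≡ y
  fold-unique {x} {y} 1≤x x≤h 1≤y y≤h (inj₁ refl) d =
    +-injective (i-j≡0⇒i≡j (+ x) (+ y) (∣-∣∣< (∣-eq (cong (_-_ (+ x)) (*-identityˡ (+ y))) d) lt))
    where
    lt : ∣ + x - + y ∣ ℕ.< p
    lt = ℕP.≤-<-trans (subst (ℕ._≤ x ℕ.⊔ y) (cong ∣_∣ (sym (m-n≡m⊖n x y))) (∣m⊝n∣≤m⊔n x y))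
           (ℕP.≤-<-trans (ℕP.⊔-lub x≤h y≤h) h<p)
  fold-unique {x} {y} 1≤x x≤h 1≤y y≤h (inj₂ refl) d = ⊥-elim (absurd (∣-∣∣< d′ lt))
    where
    d′ : + p ∣ + (x ℕ.+ y)
    d′ = ∣-eq (trans (lem (+ x) (+ y)) (sym (pos-+ x y))) d
      where
      lem : ∀ x y → x - -1ℤ * y ≡ x + y
      lem = solve-∀
    lt : x ℕ.+ y ℕ.< p
    lt = subst (x ℕ.+ y ℕ.<_) (sym p≡) (ℕ.s≤s (ℕP.+-mono-≤ x≤h y≤h))
    absurd : ¬ (+ (x ℕ.+ y) ≡ 0ℤ)
    absurd e = ℕP.<-irrefl (sym (+-injective e)) (ℕP.≤-trans 1≤x (ℕP.m≤m+n x y))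

  ∤-* : ∀ {a b} → ¬ (+ p ∣ a) → ¬ (+ p ∣ b) → ¬ (+ p ∣ a * b)
  ∤-* {a} {b} na nb d = [ na , nb ]′ (∣-prod pp a b d)

  ±-cong : ∀ {x y} a → ¬ (+ p ∣ a) → 1 ℕ.≤ x → x ℕ.≤ h → 1 ℕ.≤ y → y ℕ.≤ h →
    ∀ {s t w} → IsSign s → IsSign t → + p ∣ a * + x - s * w → + p ∣ a * + y - t * w → x ≡ y
  ±-cong {x} {y} a p∤a 1≤x x≤h 1≤y y≤h {s} {t} {w} σ τ dx dy =
    fold-unique 1≤x x≤h 1≤y y≤h (isSign-* σ τ)
      (∣-cancel pp a _ p∤a
        (∣-eq (trans (lem a (+ x) (+ y) s t w)
                (trans (cong (λ u → a * (+ x - s * t * + y) + s * (u - 1ℤ) * w) (isSign-square τ)) (lem′ (a * (+ x - s * t * + y)) s w)))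
          (∣m∣n⇒∣m-n dx (∣n⇒∣m*n (s * t) dy))))
    where
    lem : ∀ a x y s t w → a * x - s * w - s * t * (a * y - t * w) ≡ a * (x - s * t * y) + s * (t * t - 1ℤ) * w
    lem = solve-∀
    lem′ : ∀ A s w → A + s * (1ℤ - 1ℤ) * w ≡ A
    lem′ = solve-∀

  fold-inverse : ∀ a b z s x t y → + p ∣ a * b - 1ℤ → + p ∣ b * z - s * x → + p ∣ a * x - t * y →
    + p ∣ z - s * t * y
  fold-inverse a b z s x t y ab≡1 bz≡ ax≡ = ∣-eq (lem a b z s x t y)
    (∣m∣n⇒∣m+n (∣m∣n⇒∣m-n (∣n⇒∣m*n a bz≡) (∣m⇒∣m*n z ab≡1)) (∣n⇒∣m*n s ax≡))
    where
    lem : ∀ a b z s x t y → a * (b * z - s * x) - (a * b - 1ℤ) * z + s * (a * x - t * y) ≡ z - s * t * y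
    lem = solve-∀

  module _ (a : ℤ) (p∤a : ¬ (+ p ∣ a)) where

    fold-perm : map (λ x → foldAbs (a * + x)) half-system ↭ half-system
    fold-perm = unique-↭ (unique-map-on _ inj half-system-unique) half-system-unique into onto
      where
      ax-coprime : ∀ {x} → x ∈ half-system → ¬ (+ p ∣ a * + x)
      ax-coprime m = ∤-* p∤a (∤-small (proj₁ (∈-half⁻ m)) (proj₂ (∈-half⁻ m)))
      inj : ∀ {x y} → x ∈ half-system → y ∈ half-system → foldAbs (a * + x) ≡ foldAbs (a * + y) → x ≡ y
      inj {x} {y} mx my e =
        ±-cong a p∤a (proj₁ (∈-half⁻ mx)) (proj₂ (∈-half⁻ mx)) (proj₁ (∈-half⁻ my)) (proj₂ (∈-half⁻ my))
          (foldSgn-sign (a * + x)) (foldSgn-sign (a * + y)) (fold-≡ (a * + x))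
          (subst (λ w → + p ∣ a * + y - foldSgn (a * + y) * + w) (sym e) (fold-≡ (a * + y)))
      into : ∀ {z} → z ∈ map (λ x → foldAbs (a * + x)) half-system → z ∈ half-system
      into m with ∈-map⁻ _ m
      ... | x , x∈ , refl with fold-range (a * + x) (ax-coprime x∈)
      ... | lo , hi = ∈-half⁺ lo hi
      onto : ∀ {z} → z ∈ half-system → z ∈ map (λ x → foldAbs (a * + x)) half-system
      onto {z} m = subst (_∈ map (λ x → foldAbs (a * + x)) half-system) found (∈-map⁺ _ x∈)
        where
        b = proj₁ (mod-inverse pp a p∤a)
        ab≡1 = proj₂ (mod-inverse pp a p∤a)
        p∤b : ¬ (+ p ∣ b)
        p∤b d = ∤-small ℕP.≤-refl h≥1 (∣-eq (lem a b) (∣m∣n⇒∣m-n (∣n⇒∣m*n a d) ab≡1))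
          where
          lem : ∀ a b → a * b - (a * b - 1ℤ) ≡ 1ℤ
          lem = solve-∀
        x∈ : foldAbs (b * + z) ∈ half-system
        x∈ = ∈-half⁺ (proj₁ r) (proj₂ r)
          where
          r = fold-range (b * + z) (∤-* p∤b (∤-small (proj₁ (∈-half⁻ m)) (proj₂ (∈-half⁻ m))))
        found : foldAbs (a * + foldAbs (b * + z)) ≡ z
        found = sym (fold-unique (proj₁ (∈-half⁻ m)) (proj₂ (∈-half⁻ m)) (proj₁ r) (proj₂ r)
          (isSign-* (foldSgn-sign (b * + z)) (foldSgn-sign (a * + foldAbs (b * + z))))
          (fold-inverse a b (+ z) (foldSgn (b * + z)) (+ foldAbs (b * + z)) (foldSgn (a * + foldAbs (b * + z))) (+ foldAbs (a * + foldAbs (b * + z))) ab≡1 (fold-≡ (b * + z)) (fold-≡ (a * + foldAbs (b * + z)))))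
          where
          r = fold-range (a * + foldAbs (b * + z)) (ax-coprime x∈)

    gaussSign : ℤ
    gaussSign = prodL (λ x → foldSgn (a * + x)) half-system

    gaussSign-sign : IsSign gaussSign
    gaussSign-sign = isSign-prodL _ half-system (λ {x} _ → foldSgn-sign (a * + x))

    gauss-lemma : + p ∣ a ^ h - gaussSign
    gauss-lemma = ∣-cancel pp W _ (prod-coprime half-system (λ m → ∤-small (proj₁ (∈-half⁻ m)) (proj₂ (∈-half⁻ m))))
      (∣-eq
        (trans (cong₂ _-_
          (trans (prodL-scale a +_ half-system) (cong (λ n → a ^ n * W) (length-applyUpTo suc h)))
          (trans (prodL-* _ _ half-system) (cong (_*_ gaussSign)
            (trans (sym (prodL-map +_ (λ x → foldAbs (a * + x)) half-system)) (prodL-↭ +_ fold-perm)))))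
          (lem (a ^ h) gaussSign W))
        (∣-sub-prodL (λ x → a * + x) (λ x → foldSgn (a * + x) * + foldAbs (a * + x)) half-system (λ {x} _ → fold-≡ (a * + x))))
      where
      W = prodL +_ half-system
      prod-coprime : ∀ xs → (∀ {x} → x ∈ xs → ¬ (+ p ∣ + x)) → ¬ (+ p ∣ prodL +_ xs)
      prod-coprime [] _ = ∤-small ℕP.≤-refl h≥1
      prod-coprime (x ∷ xs) c = ∤-* (c (here refl)) (prod-coprime xs (c ∘ there))
      lem : ∀ A G W → A * W - G * W ≡ W * (A - G)
      lem = solve-∀

  ^h-square : ∀ y → ¬ (+ p ∣ y) → + p ∣ (y * y) ^ h - 1ℤ
  ^h-square y p∤y = ∣-eq
    (cong₂ _-_ (sym (^-distrib-* y y h)) (isSign-square (gaussSign-sign y p∤y)))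
    (∣-sub-* (y ^ h) (gaussSign y p∤y) (y ^ h) (gaussSign y p∤y) (gauss-lemma y p∤y) (gauss-lemma y p∤y))

  square-injective : ∀ {x y} → 1 ℕ.≤ x → x ℕ.≤ h → 1 ℕ.≤ y → y ℕ.≤ h → + p ∣ + x * + x - + y * + y → x ≡ y
  square-injective {x} {y} 1≤x x≤h 1≤y y≤h d = [ same , opposite ]′ (∣-prod pp (+ x - + y) (+ x + + y) (∣-eq (lem (+ x) (+ y)) d))
    where
    lem : ∀ x y → x * x - y * y ≡ (x - y) * (x + y)
    lem = solve-∀
    lem⁺ : ∀ x y → x - y ≡ x - 1ℤ * y
    lem⁺ = solve-∀
    lem⁻ : ∀ x y → x + y ≡ x - -1ℤ * y
    lem⁻ = solve-∀
    same : + p ∣ + x - + y → x ≡ y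
    same d′ = fold-unique 1≤x x≤h 1≤y y≤h (inj₁ refl) (∣-eq (lem⁺ (+ x) (+ y)) d′)
    opposite : + p ∣ + x + + y → x ≡ y
    opposite d′ = fold-unique 1≤x x≤h 1≤y y≤h (inj₂ refl) (∣-eq (lem⁻ (+ x) (+ y)) d′)

  -- The h squares x² with 1 ≤ x ≤ h are already all the roots of X^h − 1.
  ^h-root⇒square : ∀ a → + p ∣ a ^ h - 1ℤ → ¬ (∀ x → 1 ℕ.≤ x → x ℕ.≤ h → ¬ (+ p ∣ + x * + x - a))
  ^h-root⇒square a root nonsq =
    0^h (root-bound pp h (deg-+ h (deg-^ h) (deg-const h -1ℤ)) ρ distinct roots 0ℤ)
    where
    0^ : ∀ n → 1 ℕ.≤ n → 0ℤ ^ n ≡ 0ℤ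
    0^ (suc n) _ = refl
    0^h : ¬ (+ p ∣ 0ℤ ^ h + -1ℤ)
    0^h d = sign-coprime (inj₂ refl) (∣-eq (cong (_+ -1ℤ) (0^ h h≥1)) d)
    rootOf : (i : ℕ) → Dec (i ℕ.< h) → ℤ
    rootOf i (yes _) = + suc i * + suc i
    rootOf i (no _) = a
    ρ : ℕ → ℤ
    ρ i = rootOf i (i ℕP.<? h)
    distinct : ∀ i j → i ℕ.< j → j ℕ.≤ h → ¬ (+ p ∣ ρ i - ρ j)
    distinct i j i<j j≤h d with i ℕP.<? h | j ℕP.<? h
    ... | no i≮h | _ = i≮h (ℕP.<-≤-trans i<j j≤h)
    ... | yes i<h | no _ = nonsq (suc i) (ℕ.s≤s ℕ.z≤n) i<h d
    ... | yes i<h | yes j<h =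
      ℕP.<-irrefl (ℕP.suc-injective (square-injective (ℕ.s≤s ℕ.z≤n) i<h (ℕ.s≤s ℕ.z≤n) j<h d)) i<j
    roots : ∀ i → i ℕ.≤ h → + p ∣ ρ i ^ h + -1ℤ
    roots i i≤h with i ℕP.<? h
    ... | yes i<h = ^h-square (+ suc i) (∤-small (ℕ.s≤s ℕ.z≤n) i<h)
    ... | no _ = root

  dist-∣ : ∀ x y → ℕ.∣ x - y ∣ ≡ ∣ + x - + y ∣
  dist-∣ x y = trans (dist x y) (cong ∣_∣ (sym (m-n≡m⊖n x y)))
    where
    dist : ∀ x y → ℕ.∣ x - y ∣ ≡ ∣ x ⊖ y ∣
    dist zero zero = refl
    dist zero (suc y) = refl
    dist (suc x) zero = refl
    dist (suc x) (suc y) = trans (dist x y) (cong ∣_∣ (sym ([1+m]⊖[1+n]≡m⊖n x y)))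

  legendre-aux : ∀ a (d₁ : Dec (p ℕD.∣ a)) (d₂ : Dec (∃ λ (y : Fin p) → p ℕD.∣ ℕ.∣ toℕ y ℕ.* toℕ y - a ∣)) →
    let l = if does d₁ then 0ℤ else if does d₂ then 1ℤ else -1ℤ in
    (+ p ∣ l - (+ a) ^ h) × (l ≡ 0ℤ ⊎ IsSign l)
  legendre-aux a (yes p∣a) _ = ∣m∣n⇒∣m-n {m = 0ℤ} (divides 0ℤ refl) (^-∣ h h≥1) , inj₁ refl
    where
    ^-∣ : ∀ n → 1 ℕ.≤ n → + p ∣ (+ a) ^ n
    ^-∣ (suc n) _ = ∣m⇒∣m*n {m = + a} ((+ a) ^ n) (∣ᵤ⇒∣ p∣a)
  legendre-aux a (no p∤a) (yes (y , d)) = ∣-sub-sym ((+ a) ^ h) 1ℤ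
      (∣-sub ((+ a) ^ h) ((+ toℕ y * + toℕ y) ^ h) 1ℤ (∣-sub-^ (+ a) (+ toℕ y * + toℕ y) h a≡yy) (^h-square (+ toℕ y) p∤y)) ,
    inj₂ (inj₁ refl)
    where
    a≡yy : + p ∣ + a - + toℕ y * + toℕ y
    a≡yy = ∣-sub-sym (+ toℕ y * + toℕ y) (+ a)
      (∣-eq (cong (_- + a) (pos-* (toℕ y) (toℕ y))) (∣ᵤ⇒∣ (subst (p ℕD.∣_) (dist-∣ (toℕ y ℕ.* toℕ y) a) d)))
    p∤y : ¬ (+ p ∣ + toℕ y)
    p∤y e = p∤a (∣⇒∣ᵤ (∣-eq (lem (+ a) (+ toℕ y * + toℕ y)) (∣m∣n⇒∣m+n a≡yy (∣m⇒∣m*n (+ toℕ y) e))))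
      where
      lem : ∀ x y → x - y + y ≡ x
      lem = solve-∀
  legendre-aux a (no p∤a) (no nonsq) = ∣-sub-sym ((+ a) ^ h) -1ℤ result , inj₂ (inj₂ refl)
    where
    p∤a′ : ¬ (+ p ∣ + a)
    p∤a′ d = p∤a (∣⇒∣ᵤ d)
    result : + p ∣ (+ a) ^ h - -1ℤ
    result with gaussSign-sign (+ a) p∤a′
    ... | inj₂ e = subst (λ t → + p ∣ (+ a) ^ h - t) e (gauss-lemma (+ a) p∤a′)
    ... | inj₁ e = ⊥-elim (^h-root⇒square (+ a) (subst (λ t → + p ∣ (+ a) ^ h - t) e (gauss-lemma (+ a) p∤a′)) none)
      where
      none : ∀ x → 1 ℕ.≤ x → x ℕ.≤ h → ¬ (+ p ∣ + x * + x - + a)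
      none x _ x≤h d = nonsq (fromℕ< x<p , subst (λ y → p ℕD.∣ ℕ.∣ y ℕ.* y - a ∣) (sym (toℕ-fromℕ< x<p))
          (subst (p ℕD.∣_) (sym (dist-∣ (x ℕ.* x) a)) (∣⇒∣ᵤ (∣-eq (cong (_- + a) (sym (pos-* x x))) d))))
        where
        x<p : x ℕ.< p
        x<p = ℕP.≤-<-trans x≤h h<p

  legendre-euler : ∀ a → + p ∣ legendre a p - (+ a) ^ h
  legendre-euler a = proj₁ (legendre-aux a (p ℕD.∣? a) (any? λ y → p ℕD.∣? ℕ.∣ toℕ y ℕ.* toℕ y - a ∣))

  legendre-value : ∀ a → legendre a p ≡ 0ℤ ⊎ IsSign (legendre a p)
  legendre-value a = proj₂ (legendre-aux a (p ℕD.∣? a) (any? λ y → p ℕD.∣? ℕ.∣ toℕ y ℕ.* toℕ y - a ∣))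

  value-determined : ∀ {s t} → s ≡ 0ℤ ⊎ IsSign s → t ≡ 0ℤ ⊎ IsSign t → + p ∣ s - t → s ≡ t
  value-determined (inj₂ σ) (inj₂ τ) d = sign-determined σ τ d
  value-determined (inj₁ refl) (inj₁ refl) d = refl
  value-determined (inj₁ refl) (inj₂ (inj₁ refl)) d = ⊥-elim (sign-coprime (inj₂ refl) d)
  value-determined (inj₁ refl) (inj₂ (inj₂ refl)) d = ⊥-elim (sign-coprime (inj₁ refl) d)
  value-determined (inj₂ (inj₁ refl)) (inj₁ refl) d = ⊥-elim (sign-coprime (inj₁ refl) d)
  value-determined (inj₂ (inj₂ refl)) (inj₁ refl) d = ⊥-elim (sign-coprime (inj₂ refl) d)

  value-* : ∀ {s t} → s ≡ 0ℤ ⊎ IsSign s → t ≡ 0ℤ ⊎ IsSign t → s * t ≡ 0ℤ ⊎ IsSign (s * t)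
  value-* (inj₁ refl) _ = inj₁ refl
  value-* {s} (inj₂ _) (inj₁ refl) = inj₁ (*-zeroʳ s)
  value-* (inj₂ σ) (inj₂ τ) = inj₂ (isSign-* σ τ)

  legendre-char : ∀ a {s} → s ≡ 0ℤ ⊎ IsSign s → + p ∣ s - (+ a) ^ h → legendre a p ≡ s
  legendre-char a {s} v d = value-determined (legendre-value a) v
    (∣-sub (legendre a p) ((+ a) ^ h) s (legendre-euler a) (∣-sub-sym s ((+ a) ^ h) d))

  legendre-* : ∀ a b → legendre (a ℕ.* b) p ≡ legendre a p * legendre b p
  legendre-* a b = legendre-char (a ℕ.* b) (value-* (legendre-value a) (legendre-value b))
    (∣-eq (cong (_-_ (legendre a p * legendre b p)) (trans (sym (^-distrib-* (+ a) (+ b) h)) (cong (_^ h) (sym (pos-* a b)))))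
      (∣-sub-* (legendre a p) ((+ a) ^ h) (legendre b p) ((+ b) ^ h) (legendre-euler a) (legendre-euler b)))

  legendre-cong : ∀ {a b} → + p ∣ + a - + b → legendre a p ≡ legendre b p
  legendre-cong {a} {b} d = legendre-char a (legendre-value b)
    (∣-sub (legendre b p) ((+ b) ^ h) ((+ a) ^ h) (legendre-euler b) (∣-sub-sym ((+ a) ^ h) ((+ b) ^ h) (∣-sub-^ (+ a) (+ b) h d)))

  -1^ : ∀ n → -1ℤ ^ n ≡ sgn n
  -1^ zero = refl
  -1^ (suc n) = trans (cong (_*_ -1ℤ) (-1^ n)) (-1*i≡-i (sgn n))

  legendre-neg : ∀ {a b} → + p ∣ + a + + b → legendre a p ≡ sgn h * legendre b p
  legendre-neg {a} {b} d = legendre-char a (value-* (inj₂ (sgn-isSign h)) (legendre-value b))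
    (∣-sub (sgn h * legendre b p) (sgn h * (+ b) ^ h) ((+ a) ^ h)
      (∣-sub-* (sgn h) (sgn h) (legendre b p) ((+ b) ^ h) (∣-sub-refl (sgn h)) (legendre-euler b))
      (∣-eq (cong (_- (+ a) ^ h) (trans (^-distrib-* -1ℤ (+ b) h) (cong (_* (+ b) ^ h) (-1^ h))))
        (∣-sub-^ (-1ℤ * + b) (+ a) h (∣-eq (lem (+ a) (+ b)) (∣m⇒∣-m d)))))
    where
    lem : ∀ a b → - (a + b) ≡ -1ℤ * b - a
    lem = solve-∀

  legendre-zero : ∀ {a} → + p ∣ + a → legendre a p ≡ 0ℤ
  legendre-zero {a} d = legendre-char a (inj₁ refl) (∣m∣n⇒∣m-n {m = 0ℤ} (divides 0ℤ refl) (^-∣ h h≥1))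
    where
    ^-∣ : ∀ n → 1 ℕ.≤ n → + p ∣ (+ a) ^ n
    ^-∣ (suc n) _ = ∣m⇒∣m*n ((+ a) ^ n) d

  legendre-gauss : ∀ a (p∤a : ¬ (+ p ∣ + a)) → legendre a p ≡ gaussSign (+ a) p∤a
  legendre-gauss a p∤a = legendre-char a (inj₂ (gaussSign-sign (+ a) p∤a))
    (∣-sub-sym ((+ a) ^ h) (gaussSign (+ a) p∤a) (gauss-lemma (+ a) p∤a))

∏ : ℕ → (ℕ → ℤ) → ℤ
∏ zero    f = 1ℤ
∏ (suc n) f = ∏ n f * f n

∏-cong : ∀ n {f g} → (∀ k → k ℕ.< n → f k ≡ g k) → ∏ n f ≡ ∏ n g
∏-cong zero eq = refl
∏-cong (suc n) eq = cong₂ _*_ (∏-cong n (λ k k<n → eq k (ℕP.m<n⇒m<1+n k<n))) (eq n ℕP.≤-refl)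

∏-* : ∀ n f g → ∏ n (λ k → f k * g k) ≡ ∏ n f * ∏ n g
∏-* zero f g = refl
∏-* (suc n) f g = trans (cong (_* (f n * g n)) (∏-* n f g)) (lem (∏ n f) (∏ n g) (f n) (g n))
  where
  lem : ∀ a b c d → a * b * (c * d) ≡ a * c * (b * d)
  lem = solve-∀

∏-1 : ∀ n → ∏ n (λ _ → 1ℤ) ≡ 1ℤ
∏-1 zero = refl
∏-1 (suc n) = trans (*-identityʳ (∏ n (λ _ → 1ℤ))) (∏-1 n)

∏-swap : ∀ m n (f : ℕ → ℕ → ℤ) → ∏ m (λ i → ∏ n (f i)) ≡ ∏ n (λ j → ∏ m (λ i → f i j))
∏-swap zero n f = sym (∏-1 n)
∏-swap (suc m) n f =
  trans (cong (_* ∏ n (f m)) (∏-swap m n f)) (sym (∏-* n (λ j → ∏ m (λ i → f i j)) (f m)))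

∏-head : ∀ n f → ∏ (suc n) f ≡ f 0 * ∏ n (f ∘ suc)
∏-head zero f = trans (*-identityˡ (f 0)) (sym (*-identityʳ (f 0)))
∏-head (suc n) f = trans (cong (_* f (suc n)) (∏-head n f)) (*-assoc (f 0) (∏ n (f ∘ suc)) (f (suc n)))

prodL-applyUpTo : ∀ {A : Set} (f : A → ℤ) (g : ℕ → A) n → prodL f (applyUpTo g n) ≡ ∏ n (f ∘ g)
prodL-applyUpTo f g zero = refl
prodL-applyUpTo f g (suc n) =
  trans (cong (_*_ (f (g 0))) (prodL-applyUpTo f (g ∘ suc) n)) (sym (∏-head n (f ∘ g)))

∏-sgn : ∀ n k → ∏ n (λ _ → sgn k) ≡ sgn (n ℕ.* k)
∏-sgn zero k = refl
∏-sgn (suc n) k = trans (cong (_* sgn k) (∏-sgn n k)) (trans (*-comm (sgn (n ℕ.* k)) (sgn k)) (sym (sgn-+ k (n ℕ.* k))))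

minusIf plusIf : {P : Set} → Dec P → ℤ
minusIf (yes _) = -1ℤ
minusIf (no _) = 1ℤ
plusIf (yes _) = 1ℤ
plusIf (no _) = -1ℤ

minusIf-⇔ : ∀ {P Q : Set} (d : Dec P) (e : Dec Q) → (P → Q) → (Q → P) → minusIf d ≡ minusIf e
minusIf-⇔ (yes p) (yes q) f g = refl
minusIf-⇔ (yes p) (no ¬q) f g = ⊥-elim (¬q (f p))
minusIf-⇔ (no ¬p) (yes q) f g = ⊥-elim (¬p (g q))
minusIf-⇔ (no ¬p) (no ¬q) f g = refl

∏-minusIf : ∀ n f → ∏ n (λ i → minusIf (suc i ℕP.≤? f)) ≡ sgn (n ℕ.⊓ f)
∏-minusIf zero f = refl
∏-minusIf (suc n) f with suc n ℕP.≤? f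
... | yes n<f = trans (cong (_* -1ℤ) (∏-minusIf n f))
  (trans (cong (λ m → sgn m * -1ℤ) (ℕP.m≤n⇒m⊓n≡m (ℕP.<⇒≤ n<f)))
  (trans (*-comm (sgn n) -1ℤ) (trans (-1*i≡-i (sgn n)) (cong sgn (sym (ℕP.m≤n⇒m⊓n≡m n<f))))))
... | no n≮f = trans (cong (_* 1ℤ) (∏-minusIf n f)) (trans (*-identityʳ (sgn (n ℕ.⊓ f)))
  (cong sgn (trans (ℕP.m≥n⇒m⊓n≡n f≤n) (sym (ℕP.m≥n⇒m⊓n≡n (ℕP.m≤n⇒m≤1+n f≤n))))))
  where
  f≤n : f ℕ.≤ n
  f≤n = ℕP.≮⇒≥ n≮f

∏-plusIf : ∀ n f → ∏ n (λ i → plusIf (suc i ℕP.≤? f)) ≡ sgn (n ℕ.∸ f)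
∏-plusIf zero f = cong sgn (sym (ℕP.0∸n≡0 f))
∏-plusIf (suc n) f with suc n ℕP.≤? f
... | yes n<f = trans (cong (_* 1ℤ) (∏-plusIf n f)) (trans (*-identityʳ (sgn (n ℕ.∸ f)))
  (cong sgn (trans (ℕP.m≤n⇒m∸n≡0 (ℕP.<⇒≤ n<f)) (sym (ℕP.m≤n⇒m∸n≡0 n<f)))))
... | no n≮f = trans (cong (_* -1ℤ) (∏-plusIf n f)) (trans (*-comm (sgn (n ℕ.∸ f)) -1ℤ)
  (trans (-1*i≡-i (sgn (n ℕ.∸ f))) (cong sgn (sym (ℕP.+-∸-assoc 1 (ℕP.≮⇒≥ n≮f))))))

sgn-*-odd : ∀ m k → sgn (m ℕ.* suc (k ℕ.+ k)) ≡ sgn m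
sgn-*-odd m k = trans (cong sgn (lem m k)) (trans (sgn-+ m _)
  (trans (cong (_*_ (sgn m)) (sgn-double (m ℕ.* k))) (*-identityʳ (sgn m))))
  where
  lem : ∀ m k → m ℕ.* suc (k ℕ.+ k) ≡ m ℕ.+ (m ℕ.* k ℕ.+ m ℕ.* k)
  lem = ℕSolver.solve-∀

sign-inverse : ∀ {a b} → IsSign b → a * b ≡ 1ℤ → a ≡ b
sign-inverse {a} {b} σ e = trans (sym (*-identityʳ a)) (trans (cong (_*_ a) (sym (isSign-square σ)))
  (trans (sym (*-assoc a b b)) (trans (cong (_* b) e) (*-identityˡ b))))

module Eisenstein {p : ℕ} (h : ℕ) (pp : Prime p) (p≡ : p ≡ suc (h ℕ.+ h))
  (k : ℕ) (p∤q : ¬ (+ p ∣ + suc (k ℕ.+ k))) where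

  open OddPrime h pp p≡

  private
    q : ℕ
    q = suc (k ℕ.+ k)
    instance
      p-nonZero : NonZero p
      p-nonZero = prime⇒nonZero pp
    H : List ℕ
    H = half-system

  floor : ℕ → ℕ
  floor x = (q ℕ.* x) ℕ./ p

  sgn-floor : ∀ x → sgn x ≡ foldSgn (+ q * + x) * sgn (foldAbs (+ q * + x)) * sgn (floor x)
  sgn-floor x = begin
    sgn x ≡⟨ sym (sgn-*-odd x k) ⟩
    sgn (x ℕ.* q) ≡⟨ cong sgn (ℕP.*-comm x q) ⟩
    sgn (q ℕ.* x) ≡⟨ cong sgn (ℕM.m≡m%n+[m/n]*n (q ℕ.* x) p) ⟩
    sgn (q ℕ.* x ℕ.% p ℕ.+ floor x ℕ.* p) ≡⟨ sgn-+ (q ℕ.* x ℕ.% p) _ ⟩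
    sgn (q ℕ.* x ℕ.% p) * sgn (floor x ℕ.* p)
      ≡⟨ cong₂ _*_ (cong (λ z → sgn (z %ℕ p)) (pos-* q x)) (trans (cong (λ n → sgn (floor x ℕ.* n)) p≡) (sgn-*-odd (floor x) h)) ⟩
    sgn ((+ q * + x) %ℕ p) * sgn (floor x) ≡⟨ cong (_* sgn (floor x)) (foldSgn-parity (+ q * + x)) ⟩
    foldSgn (+ q * + x) * sgn (foldAbs (+ q * + x)) * sgn (floor x) ∎
    where open ≡-Reasoning

  gauss-floor : gaussSign (+ q) p∤q ≡ prodL (λ x → sgn (floor x)) H
  gauss-floor = sign-inverse (isSign-prodL _ H (λ {x} _ → sgn-isSign (floor x))) (trans (lem S G F S*S) (trans (cong (_*_ S) (sym S≡)) S*S))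
    where
    G = gaussSign (+ q) p∤q
    F = prodL (λ x → sgn (floor x)) H
    S = prodL sgn H
    S*S : S * S ≡ 1ℤ
    S*S = isSign-square (isSign-prodL sgn H (λ {x} _ → sgn-isSign x))
    S≡ : S ≡ G * S * F
    S≡ = trans (prodL-cong H (λ {x} _ → sgn-floor x))
      (trans (prodL-* (λ x → foldSgn (+ q * + x) * sgn (foldAbs (+ q * + x))) (λ x → sgn (floor x)) H) (cong (_* F) (trans (prodL-* (λ x → foldSgn (+ q * + x)) (λ x → sgn (foldAbs (+ q * + x))) H)
        (cong (_*_ G) (trans (sym (prodL-map sgn (λ x → foldAbs (+ q * + x)) H)) (prodL-↭ sgn (fold-perm (+ q) p∤q)))))))
    lem : ∀ S G F → S * S ≡ 1ℤ → G * F ≡ S * (G * S * F)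
    lem S G F e = trans (sym (*-identityˡ (G * F))) (trans (cong (_* (G * F)) (sym e)) (lem′ S G F))
      where
      lem′ : ∀ S G F → S * S * (G * F) ≡ S * (G * S * F)
      lem′ = solve-∀

  floor≤k : ∀ {x} → x ℕ.≤ h → floor x ℕ.≤ k
  floor≤k {x} x≤h = ℕ.s≤s⁻¹ (ℕM.m<n*o⇒m/o<n {q ℕ.* x} {suc k} {p} lt)
    where
    lt : q ℕ.* x ℕ.< suc k ℕ.* p
    lt = ℕP.≤-<-trans (ℕP.*-monoʳ-≤ q x≤h) (subst (λ n → q ℕ.* h ℕ.< suc k ℕ.* n) (sym p≡)
      (subst (q ℕ.* h ℕ.<_) (lem h k) (ℕP.m<m+n (q ℕ.* h) (ℕ.s≤s ℕ.z≤n))))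
      where
      lem : ∀ h k → suc (k ℕ.+ k) ℕ.* h ℕ.+ suc (k ℕ.+ h) ≡ suc k ℕ.* suc (h ℕ.+ h)
      lem = ℕSolver.solve-∀

  below : ℕ → ℕ → ℤ
  below i j = minusIf (p ℕ.* suc j ℕP.<? q ℕ.* suc i)

  sgn-floor-count : ∀ i → i ℕ.< h → sgn (floor (suc i)) ≡ ∏ k (below i)
  sgn-floor-count i i<h = sym (trans
    (∏-cong k (λ j _ → minusIf-⇔ (p ℕ.* suc j ℕP.<? q ℕ.* suc i) (suc j ℕP.≤? floor (suc i)) (to j) (from j)))
    (trans (∏-minusIf k (floor (suc i))) (cong sgn (ℕP.m≥n⇒m⊓n≡n (floor≤k i<h)))))
    where
    to : ∀ j → p ℕ.* suc j ℕ.< q ℕ.* suc i → suc j ℕ.≤ floor (suc i)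
    to j lt = subst (ℕ._≤ floor (suc i)) (trans (cong (ℕ._/ p) (ℕP.*-comm p (suc j))) (ℕM.m*n/n≡m (suc j) p))
      (ℕM./-monoˡ-≤ p (ℕP.<⇒≤ lt))
    from : ∀ j → suc j ℕ.≤ floor (suc i) → p ℕ.* suc j ℕ.< q ℕ.* suc i
    from j le = ℕP.≤∧≢⇒< (ℕP.≤-trans (ℕP.*-monoʳ-≤ p le)
        (subst (ℕ._≤ q ℕ.* suc i) (ℕP.*-comm (floor (suc i)) p) (ℕM.m/n*n≤m (q ℕ.* suc i) p)))
      (λ e → ∤-* p∤q (∤-small (ℕ.s≤s ℕ.z≤n) i<h)
        (∣-eq (pos-* q (suc i)) (∣ᵤ⇒∣ (ℕD.divides (suc j) (trans (sym e) (ℕP.*-comm p (suc j)))))))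

  legendre-count : legendre q p ≡ ∏ h (λ i → ∏ k (below i))
  legendre-count = trans (legendre-gauss q p∤q) (trans gauss-floor
    (trans (prodL-applyUpTo (sgn ∘ floor) suc h) (∏-cong h sgn-floor-count)))

prime∤prime : ∀ {p q} → Prime p → Prime q → p ≢ q → ¬ (+ p ∣ + q)
prime∤prime pp pq p≢q d with prime⇒irreducible pq (∣⇒∣ᵤ d)
... | inj₂ e = p≢q e
... | inj₁ refl = ⊥-elim (¬prime[1] pp)

reciprocity : ∀ {p q h k} → Prime p → Prime q → p ≢ q → p ≡ suc (h ℕ.+ h) → q ≡ suc (k ℕ.+ k) →
  legendre q p * legendre p q ≡ sgn (h ℕ.* k)
reciprocity {p} {q} {h} {k} pp pq p≢q refl refl = begin
  legendre q p * legendre p q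
    ≡⟨ cong₂ _*_ P.legendre-count (trans Q.legendre-count (∏-swap k h Q.below)) ⟩
  ∏ h (λ i → ∏ k (P.below i)) * ∏ h (λ i → ∏ k (λ j → Q.below j i))
    ≡⟨ sym (∏-* h _ _) ⟩
  ∏ h (λ i → ∏ k (P.below i) * ∏ k (λ j → Q.below j i))
    ≡⟨ ∏-cong h (λ i i<h → trans (sym (∏-* k _ _)) (∏-cong k (λ j _ → opposite i j i<h))) ⟩
  ∏ h (λ i → ∏ k (λ j → sgn 1))
    ≡⟨ ∏-cong h (λ i _ → trans (∏-sgn k 1) (cong sgn (ℕP.*-identityʳ k))) ⟩
  ∏ h (λ i → sgn k)
    ≡⟨ ∏-sgn h k ⟩
  sgn (h ℕ.* k) ∎
  where
  open ≡-Reasoning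
  p∤q = prime∤prime pp pq p≢q
  q∤p = prime∤prime pq pp (p≢q ∘ sym)
  module OP = OddPrime h pp refl
  module P = Eisenstein h pp refl k p∤q
  module Q = Eisenstein k pq refl h q∤p
  opposite : ∀ i j → i ℕ.< h → P.below i j * Q.below j i ≡ -1ℤ
  opposite i j i<h with p ℕ.* suc j ℕP.<? q ℕ.* suc i | q ℕ.* suc i ℕP.<? p ℕ.* suc j
  ... | yes a | yes b = ⊥-elim (ℕP.<-asym a b)
  ... | yes a | no b = refl
  ... | no a | yes b = refl
  ... | no a | no b = ⊥-elim (OP.∤-* p∤q (OP.∤-small (ℕ.s≤s ℕ.z≤n) i<h)
      (∣-eq (pos-* q (suc i)) (∣ᵤ⇒∣ (ℕD.divides (suc j) (trans (ℕP.≤-antisym (ℕP.≮⇒≥ a) (ℕP.≮⇒≥ b)) (ℕP.*-comm p (suc j)))))))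

table₄ table₈ : ℕ → ℤ
table₄ 1 = 1ℤ
table₄ 3 = -1ℤ
table₄ _ = 0ℤ
table₈ 1 = 1ℤ
table₈ 3 = -1ℤ
table₈ 5 = -1ℤ
table₈ 7 = 1ℤ
table₈ _ = 0ℤ

χ₄ χ₈ : ℕ → ℤ
χ₄ n = table₄ (n ℕ.% 4)
χ₈ n = table₈ (n ℕ.% 8)

χ₄-* : ∀ m n → χ₄ (m ℕ.* n) ≡ χ₄ m * χ₄ n
χ₄-* m n = trans (cong table₄ (ℕM.%-distribˡ-* m n 4))
  (Fin-table (ℕM.m%n<n m 4) (ℕM.m%n<n n 4))
  where
  check : ∀ (i j : Fin 4) → table₄ ((toℕ i ℕ.* toℕ j) ℕ.% 4) ≡ table₄ (toℕ i) * table₄ (toℕ j)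
  check = from-yes (all? {n = 4} λ i → all? {n = 4} λ j → table₄ ((toℕ i ℕ.* toℕ j) ℕ.% 4) ≟ table₄ (toℕ i) * table₄ (toℕ j))
  Fin-table : ∀ {i j} → i ℕ.< 4 → j ℕ.< 4 → table₄ ((i ℕ.* j) ℕ.% 4) ≡ table₄ i * table₄ j
  Fin-table p q = subst₂ (λ i j → table₄ ((i ℕ.* j) ℕ.% 4) ≡ table₄ i * table₄ j) (toℕ-fromℕ< p) (toℕ-fromℕ< q)
    (check (fromℕ< p) (fromℕ< q))

χ₈-* : ∀ m n → χ₈ (m ℕ.* n) ≡ χ₈ m * χ₈ n
χ₈-* m n = trans (cong table₈ (ℕM.%-distribˡ-* m n 8))
  (Fin-table (ℕM.m%n<n m 8) (ℕM.m%n<n n 8))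
  where
  check : ∀ (i j : Fin 8) → table₈ ((toℕ i ℕ.* toℕ j) ℕ.% 8) ≡ table₈ (toℕ i) * table₈ (toℕ j)
  check = from-yes (all? {n = 8} λ i → all? {n = 8} λ j → table₈ ((toℕ i ℕ.* toℕ j) ℕ.% 8) ≟ table₈ (toℕ i) * table₈ (toℕ j))
  Fin-table : ∀ {i j} → i ℕ.< 8 → j ℕ.< 8 → table₈ ((i ℕ.* j) ℕ.% 8) ≡ table₈ i * table₈ j
  Fin-table p q = subst₂ (λ i j → table₈ ((i ℕ.* j) ℕ.% 8) ≡ table₈ i * table₈ j) (toℕ-fromℕ< p) (toℕ-fromℕ< q)
    (check (fromℕ< p) (fromℕ< q))

parity : ∀ n → ∃ λ f → n ≡ f ℕ.+ f ⊎ n ≡ suc (f ℕ.+ f)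
parity zero = 0 , inj₁ refl
parity (suc n) with parity n
... | f , inj₁ e = f , inj₂ (cong suc e)
... | f , inj₂ e = suc f , inj₁ (trans (cong suc e) (cong suc (sym (ℕP.+-suc f f))))

χ₄-odd : ∀ h → χ₄ (suc (h ℕ.+ h)) ≡ sgn h
χ₄-odd h with parity h
... | f , inj₁ refl = trans (cong χ₄ (lem f)) (trans (cong table₄ (ℕM.[m+kn]%n≡m%n 1 f 4)) (sym (sgn-double f)))
  where
  lem : ∀ f → suc (f ℕ.+ f ℕ.+ (f ℕ.+ f)) ≡ 1 ℕ.+ f ℕ.* 4
  lem = ℕSolver.solve-∀
... | f , inj₂ refl = trans (cong χ₄ (lem f)) (trans (cong table₄ (ℕM.[m+kn]%n≡m%n 3 f 4)) (sym (cong -_ (sgn-double f))))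
  where
  lem : ∀ f → suc (suc (f ℕ.+ f) ℕ.+ suc (f ℕ.+ f)) ≡ 3 ℕ.+ f ℕ.* 4
  lem = ℕSolver.solve-∀

χ₈-4f+1 : ∀ f → χ₈ (suc (f ℕ.+ f ℕ.+ (f ℕ.+ f))) ≡ sgn f
χ₈-4f+1 f with parity f
... | j , inj₁ refl = trans (cong χ₈ (lem j)) (trans (cong table₈ (ℕM.[m+kn]%n≡m%n 1 j 8)) (sym (sgn-double j)))
  where
  lem : ∀ j → suc (j ℕ.+ j ℕ.+ (j ℕ.+ j) ℕ.+ (j ℕ.+ j ℕ.+ (j ℕ.+ j))) ≡ 1 ℕ.+ j ℕ.* 8
  lem = ℕSolver.solve-∀
... | j , inj₂ refl = trans (cong χ₈ (lem j)) (trans (cong table₈ (ℕM.[m+kn]%n≡m%n 5 j 8)) (sym (cong -_ (sgn-double j))))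
  where
  lem : ∀ j → suc (suc (j ℕ.+ j) ℕ.+ suc (j ℕ.+ j) ℕ.+ (suc (j ℕ.+ j) ℕ.+ suc (j ℕ.+ j))) ≡ 5 ℕ.+ j ℕ.* 8
  lem = ℕSolver.solve-∀

χ₈-4f+3 : ∀ f → χ₈ (suc (suc (f ℕ.+ f) ℕ.+ suc (f ℕ.+ f))) ≡ sgn (suc f)
χ₈-4f+3 f with parity f
... | j , inj₁ refl = trans (cong χ₈ (lem j)) (trans (cong table₈ (ℕM.[m+kn]%n≡m%n 3 j 8)) (sym (cong -_ (sgn-double j))))
  where
  lem : ∀ j → suc (suc (j ℕ.+ j ℕ.+ (j ℕ.+ j)) ℕ.+ suc (j ℕ.+ j ℕ.+ (j ℕ.+ j))) ≡ 3 ℕ.+ j ℕ.* 8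
  lem = ℕSolver.solve-∀
... | j , inj₂ refl = trans (cong χ₈ (lem j)) (trans (cong table₈ (ℕM.[m+kn]%n≡m%n 7 j 8)) (sym (cong (λ s → - - s) (sgn-double j))))
  where
  lem : ∀ j → suc (suc (suc (j ℕ.+ j) ℕ.+ suc (j ℕ.+ j)) ℕ.+ suc (suc (j ℕ.+ j) ℕ.+ suc (j ℕ.+ j))) ≡ 7 ℕ.+ j ℕ.* 8
  lem = ℕSolver.solve-∀

2x≤⇒ : ∀ {x f} → 2 ℕ.* x ℕ.≤ suc (f ℕ.+ f) → x ℕ.≤ f
2x≤⇒ {x} {f} le = ℕP.≮⇒≥ λ f<x → ℕP.1+n≰n (ℕP.≤-trans (subst (ℕ._≤ 2 ℕ.* x) (lem f) (ℕP.*-monoʳ-≤ 2 f<x)) le)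
  where
  lem : ∀ f → 2 ℕ.* suc f ≡ suc (suc (f ℕ.+ f))
  lem = ℕSolver.solve-∀

2x≤⇐ : ∀ {x f} → x ℕ.≤ f → 2 ℕ.* x ℕ.≤ f ℕ.+ f
2x≤⇐ {x} {f} le = subst (2 ℕ.* x ℕ.≤_) (cong (f ℕ.+_) (ℕP.+-identityʳ f)) (ℕP.*-monoʳ-≤ 2 le)

legendre-2 : ∀ {p h} → Prime p → p ≡ suc (h ℕ.+ h) → legendre 2 p ≡ χ₈ p
legendre-2 {p} {h} pp p≡ = trans (legendre-gauss 2 p∤2) (trans (prodL-applyUpTo (λ x → foldSgn (+ 2 * + x)) suc h) (go (parity h)))
  where
  open OddPrime h pp p≡
  instance
    p-nonZero : NonZero p
    p-nonZero = prime⇒nonZero pp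
  p∤2 : ¬ (+ p ∣ + 2)
  p∤2 d with ∣-∣∣< d (subst (3 ℕ.≤_) (sym p≡) (ℕ.s≤s (ℕP.+-mono-≤ h≥1 h≥1)))
  ... | ()
  residue : ∀ i → i ℕ.< h → (+ 2 * + suc i) %ℕ p ≡ 2 ℕ.* suc i
  residue i i<h = trans (cong (_%ℕ p) (sym (pos-* 2 (suc i))))
    (ℕM.m<n⇒m%n≡m (subst (2 ℕ.* suc i ℕ.<_) (sym p≡) (ℕ.s≤s (2x≤⇐ i<h))))
  signs : ∀ f → (∀ x → 2 ℕ.* x ℕ.≤ h → x ℕ.≤ f) → (∀ x → x ℕ.≤ f → 2 ℕ.* x ℕ.≤ h) →
    ∏ h (λ i → foldSgn (+ 2 * + suc i)) ≡ sgn (h ℕ.∸ f)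
  signs f to from = trans (∏-cong h step) (∏-plusIf h f)
    where
    step : ∀ i → i ℕ.< h → foldSgn (+ 2 * + suc i) ≡ plusIf (suc i ℕP.≤? f)
    step i i<h with suc i ℕP.≤? f
    ... | yes le = foldSgn-≤ _ (subst (ℕ._≤ h) (sym (residue i i<h)) (from (suc i) le))
    ... | no nle = foldSgn-≰ _ (λ le → nle (to (suc i) (subst (ℕ._≤ h) (residue i i<h) le)))
  go : (∃ λ f → h ≡ f ℕ.+ f ⊎ h ≡ suc (f ℕ.+ f)) → ∏ h (λ i → foldSgn (+ 2 * + suc i)) ≡ χ₈ p
  go (f , inj₁ e) = trans (signs f (λ x le → 2x≤⇒ (ℕP.m≤n⇒m≤1+n (subst (2 ℕ.* x ℕ.≤_) e le)))
      (λ x le → subst (2 ℕ.* x ℕ.≤_) (sym e) (2x≤⇐ le)))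
    (trans (cong sgn (trans (cong (ℕ._∸ f) e) (ℕP.m+n∸m≡n f f)))
      (sym (trans (cong χ₈ (trans p≡ (cong (λ h → suc (h ℕ.+ h)) e))) (χ₈-4f+1 f))))
  go (f , inj₂ e) = trans (signs f (λ x le → 2x≤⇒ (subst (2 ℕ.* x ℕ.≤_) e le))
      (λ x le → subst (2 ℕ.* x ℕ.≤_) (sym e) (ℕP.m≤n⇒m≤1+n (2x≤⇐ le))))
    (trans (cong sgn (trans (cong (ℕ._∸ f) e) (ℕP.m+n∸n≡m (suc f) f)))
      (sym (trans (cong χ₈ (trans p≡ (cong (λ h → suc (h ℕ.+ h)) e))) (χ₈-4f+3 f))))

prodL-^ : ∀ {A : Set} (f : A → ℤ) k xs → prodL (λ x → f x ^ k) xs ≡ prodL f xs ^ k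
prodL-^ f zero [] = refl
prodL-^ f (suc k) [] = trans (prodL-^ f k []) (sym (*-identityˡ (1ℤ ^ k)))
prodL-^ f k (x ∷ xs) = trans (cong (_*_ (f x ^ k)) (prodL-^ f k xs)) (sym (^-distrib-* (f x) (prodL f xs) k))

prodL-+ : ∀ xs → prodL +_ xs ≡ + product xs
prodL-+ [] = refl
prodL-+ (x ∷ xs) = trans (cong (_*_ (+ x)) (prodL-+ xs)) (sym (pos-* x (product xs)))

prodL-0 : ∀ {A : Set} (f : A → ℤ) {xs x} → x ∈ xs → f x ≡ 0ℤ → prodL f xs ≡ 0ℤ
prodL-0 f {x ∷ xs} (here refl) e = cong (_* prodL f xs) e
prodL-0 f {y ∷ xs} (there m) e = trans (cong (_*_ (f y)) (prodL-0 f m e)) (*-zeroʳ (f y))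

foldr-map-prodL : ∀ {A : Set} (f : A → ℤ) xs → foldr _*_ 1ℤ (map f xs) ≡ prodL f xs
foldr-map-prodL f [] = refl
foldr-map-prodL f (x ∷ xs) = cong (_*_ (f x)) (foldr-map-prodL f xs)

sgn-power : ∀ h k → sgn (h ℕ.* k) ≡ sgn h ^ k
sgn-power h zero = cong sgn (ℕP.*-zeroʳ h)
sgn-power h (suc k) = trans (cong sgn (ℕP.*-suc h k)) (trans (sgn-+ h (h ℕ.* k)) (cong (_*_ (sgn h)) (sgn-power h k)))

∣-product : ∀ {q} xs → q ∈ xs → q ℕD.∣ product xs
∣-product (x ∷ xs) (here refl) = ℕD.m∣m*n (product xs)
∣-product (x ∷ xs) (there m) = ℕD.∣n⇒∣m*n x (∣-product xs m)

prime-power : ∀ {p} → Prime p → ∀ a k → + p ∣ a ^ k → + p ∣ a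
prime-power pp a zero d = ⊥-elim (¬prime[1] (subst Prime (ℕD.∣1⇒≡1 (∣⇒∣ᵤ d)) pp))
prime-power pp a (suc k) d = [ (λ x → x) , prime-power pp a k ]′ (∣-prod pp a (a ^ k) d)

χ₄-prodL : ∀ xs → prodL χ₄ xs ≡ χ₄ (product xs)
χ₄-prodL [] = refl
χ₄-prodL (x ∷ xs) = trans (cong (_*_ (χ₄ x)) (χ₄-prodL xs)) (sym (χ₄-* x (product xs)))

χ₈-prodL : ∀ xs → prodL χ₈ xs ≡ χ₈ (product xs)
χ₈-prodL [] = refl
χ₈-prodL (x ∷ xs) = trans (cong (_*_ (χ₈ x)) (χ₈-prodL xs)) (sym (χ₈-* x (product xs)))

odd-half : ∀ {p} → ¬ (2 ℕD.∣ p) → ∃ λ h → p ≡ suc (h ℕ.+ h)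
odd-half {p} odd with parity p
... | h , inj₂ e = h , e
... | h , inj₁ e = ⊥-elim (odd (ℕD.divides h (trans e (lem h))))
  where
  lem : ∀ h → h ℕ.+ h ≡ h ℕ.* 2
  lem = ℕSolver.solve-∀

module Char (m : ℕ) where

  -- The discriminant is D = −N with N = 4(m + 1) − 1.
  N : ℕ
  N = suc (suc (suc (m ℕ.* 4)))

  N-int : + N ≡ + 4 * + suc m - 1ℤ
  N-int = trans (cong (λ k → + suc (suc (suc k))) (ℕP.*-comm m 4)) (trans (cong (_+_ (+ 3)) (pos-* 4 m)) (trans (lem (+ m)) (cong (λ x → + 4 * x - 1ℤ) (sym (pos-+ 1 m)))))
    where
    lem : ∀ m → + 3 + + 4 * m ≡ + 4 * (1ℤ + m) - 1ℤ
    lem = solve-∀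

  abstract
    χ : ℕ → ℤ
    χ x = jacobi x N

    χ-def : ∀ x → χ x ≡ jacobi x N
    χ-def x = refl

    primes : List ℕ
    primes = PrimeFactorisation.factors (factorise N)

    primes-prime : All Prime primes
    primes-prime = PrimeFactorisation.factorsPrime (factorise N)

    primes-product : product primes ≡ N
    primes-product = sym (PrimeFactorisation.isFactorisation (factorise N))

    χ-prodL : ∀ x → χ x ≡ prodL (legendre x) primes
    χ-prodL x = foldr-map-prodL (legendre x) primes

  prime∣N : ∀ {q} → q ∈ primes → q ℕD.∣ N
  prime∣N q∈ = subst (_ ℕD.∣_) primes-product (∣-product primes q∈)

  prime-∈ : ∀ {q} → Prime q → q ℕD.∣ N → q ∈ primes
  prime-∈ pq d = factorisationHasAllPrimeFactors pq (subst (_ ℕD.∣_) (sym primes-product) d) primes-prime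

  2∤N : ¬ (2 ℕD.∣ N)
  2∤N d with ℕD.∣m+n∣m⇒∣n {2} {2 ℕ.+ m ℕ.* 4} {1} (subst (2 ℕD.∣_) (ℕP.+-comm 1 (2 ℕ.+ m ℕ.* 4)) d)
              (ℕD.∣m∣n⇒∣m+n (ℕD.divides 1 refl) (ℕD.∣n⇒∣m*n m (ℕD.divides 2 refl)))
  ... | ℕD.divides zero ()
  ... | ℕD.divides (suc _) ()

  halves : ∀ {q} → q ∈ primes → ∃ λ h → q ≡ suc (h ℕ.+ h)
  halves q∈ = odd-half (λ 2∣q → 2∤N (ℕD.∣-trans 2∣q (prime∣N q∈)))

  is-prime : ∀ {q} → q ∈ primes → Prime q
  is-prime q∈ = All.lookup primes-prime q∈

  χ-* : ∀ x y → χ (x ℕ.* y) ≡ χ x * χ y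
  χ-* x y = trans (χ-prodL (x ℕ.* y)) (trans
    (prodL-cong primes (λ {q} q∈ → OddPrime.legendre-* (proj₁ (halves q∈)) (is-prime q∈) (proj₂ (halves q∈)) x y))
    (trans (prodL-* (legendre x) (legendre y) primes) (sym (cong₂ _*_ (χ-prodL x) (χ-prodL y)))))

  χ-cong : ∀ {x y} → + N ∣ + x - + y → χ x ≡ χ y
  χ-cong {x} {y} d = trans (χ-prodL x) (trans
    (prodL-cong primes (λ {q} q∈ → OddPrime.legendre-cong (proj₁ (halves q∈)) (is-prime q∈) (proj₂ (halves q∈))
      (∣-trans (∣ᵤ⇒∣ (prime∣N q∈)) d)))
    (sym (χ-prodL y)))

  χ₄-N : prodL χ₄ primes ≡ -1ℤ
  χ₄-N = trans (χ₄-prodL primes) (trans (cong χ₄ primes-product) (cong table₄ (ℕM.[m+kn]%n≡m%n 3 m 4)))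

  χ-neg : ∀ {x y} → + N ∣ + x + + y → χ x ≡ - χ y
  χ-neg {x} {y} d = trans (χ-prodL x) (trans
    (prodL-cong primes (λ {q} q∈ → trans
      (OddPrime.legendre-neg (proj₁ (halves q∈)) (is-prime q∈) (proj₂ (halves q∈)) (∣-trans (∣ᵤ⇒∣ (prime∣N q∈)) d))
      (cong (_* legendre y q) (sym (trans (cong χ₄ (proj₂ (halves q∈))) (χ₄-odd (proj₁ (halves q∈))))))))
    (trans (prodL-* χ₄ (legendre y) primes)
    (trans (cong₂ _*_ χ₄-N (sym (χ-prodL y))) (-1*i≡-i (χ y)))))

  χ-zero : ∀ {p x} → Prime p → p ℕD.∣ N → p ℕD.∣ x → χ x ≡ 0ℤ
  χ-zero {p} {x} pp p∣N p∣x = trans (χ-prodL x) (prodL-0 (legendre x) p∈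
    (OddPrime.legendre-zero (proj₁ (halves p∈)) pp (proj₂ (halves p∈)) (∣ᵤ⇒∣ p∣x)))
    where
    p∈ = prime-∈ pp p∣N

  χ-coprime : ∀ {x} → ¬ Coprime x N → χ x ≡ 0ℤ
  χ-coprime {x} nc = go (factorise g {{nz}})
    where
    g = gcd x N
    nz : NonZero g
    nz = ℕ.≢-nonZero (λ e → ℕP.1+n≢0 (ℕD.0∣⇒≡0 (subst (ℕD._∣ N) e (gcd[m,n]∣n x N))))
    go : PrimeFactorisation g → χ x ≡ 0ℤ
    go f with PrimeFactorisation.factors f | PrimeFactorisation.isFactorisation f | PrimeFactorisation.factorsPrime f
    ... | [] | e | _ = ⊥-elim (nc (gcd≡1⇒coprime e))
    ... | p ∷ ps | e | pp ∷ _ = χ-zero pp (ℕD.∣-trans p∣g (gcd[m,n]∣n x N)) (ℕD.∣-trans p∣g (gcd[m,n]∣m x N))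
      where
      p∣g : p ℕD.∣ g
      p∣g = subst (p ℕD.∣_) (sym e) (ℕD.m∣m*n (product ps))

  χ-2 : χ 2 ≡ χ₈ N
  χ-2 = trans (χ-prodL 2) (trans
    (prodL-cong primes (λ {q} q∈ → legendre-2 {h = proj₁ (halves q∈)} (is-prime q∈) (proj₂ (halves q∈))))
    (trans (χ₈-prodL primes) (cong χ₈ primes-product)))

  χ-euler : ∀ {p k} → Prime p → p ≡ suc (k ℕ.+ k) → ¬ (p ℕD.∣ N) → + p ∣ χ p - (- + N) ^ k
  χ-euler {p} {k} pp p≡ p∤N = ∣-eq (cong₂ _-_ (sym (χ-prodL p)) product≡)
    (∣-sub-prodL (legendre p) (λ q → (χ₄ q * + q) ^ k) primes (λ {q} q∈ → factor q∈ (halves q∈)))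
    where
    module P = OddPrime k pp p≡
    factor : ∀ {q} → q ∈ primes → (∃ λ h → q ≡ suc (h ℕ.+ h)) → + p ∣ legendre p q - (χ₄ q * + q) ^ k
    factor {q} q∈ (h , q≡) = ∣-eq (cong₂ _-_ (sym recip) (sym (trans (cong (λ s → (s * + q) ^ k) (trans (cong χ₄ q≡) (χ₄-odd h))) (^-distrib-* (sgn h) (+ q) k))))
      (∣-sub-* (sgn h ^ k) (sgn h ^ k) (legendre q p) ((+ q) ^ k) (∣-sub-refl (sgn h ^ k)) (P.legendre-euler q))
      where
      p≢q : p ≢ q
      p≢q refl = p∤N (prime∣N q∈)
      p∤q : ¬ (+ p ∣ + q)
      p∤q = prime∤prime pp (is-prime q∈) p≢q
      sq : legendre q p * legendre q p ≡ 1ℤ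
      sq = trans (cong (λ l → l * l) (P.legendre-gauss q p∤q)) (isSign-square (P.gaussSign-sign (+ q) p∤q))
      recip : legendre p q ≡ sgn h ^ k * legendre q p
      recip = begin
        legendre p q ≡⟨ sym (*-identityˡ (legendre p q)) ⟩
        1ℤ * legendre p q ≡⟨ cong (_* legendre p q) (sym sq) ⟩
        legendre q p * legendre q p * legendre p q ≡⟨ lem (legendre q p) (legendre p q) ⟩
        legendre q p * legendre p q * legendre q p ≡⟨ cong (_* legendre q p) (reciprocity {h = k} {k = h} pp (is-prime q∈) p≢q p≡ q≡) ⟩
        sgn (k ℕ.* h) * legendre q p ≡⟨ cong (_* legendre q p) (trans (cong sgn (ℕP.*-comm k h)) (sgn-power h k)) ⟩
        sgn h ^ k * legendre q p ∎
        where
        open ≡-Reasoning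
        lem : ∀ a b → a * a * b ≡ a * b * a
        lem = solve-∀
    product≡ : prodL (λ q → (χ₄ q * + q) ^ k) primes ≡ (- + N) ^ k
    product≡ = trans (prodL-^ (λ q → χ₄ q * + q) k primes) (cong (_^ k)
      (trans (prodL-* χ₄ +_ primes) (trans (cong₂ _*_ χ₄-N (trans (prodL-+ primes) (cong +_ primes-product))) (-1*i≡-i (+ N)))))

  -- The value of χ at p against the factorisation of p in ℤ[ω]; s² + s + (m + 1)
  -- is the norm of s + ω.
  norm₁ : ℤ → ℤ
  norm₁ s = s * s + s + + suc m

  data Splitting (p : ℕ) : Set where
    split    : χ p ≡ 1ℤ → (s : ℤ) → + p ∣ norm₁ s → ¬ (+ p ∣ + 2 * s + 1ℤ) → Splitting p
    ramified : χ p ≡ 0ℤ → (s : ℤ) → + p ∣ norm₁ s → + p ∣ + 2 * s + 1ℤ → p ℕD.∣ N → Splitting p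
    inert    : χ p ≡ -1ℤ → (∀ s → ¬ (+ p ∣ norm₁ s)) → Splitting p

  4norm₁ : ∀ s → + 4 * norm₁ s ≡ (+ 2 * s + 1ℤ) * (+ 2 * s + 1ℤ) + + N
  4norm₁ s = trans (lem s (+ suc m)) (cong (_+_ ((+ 2 * s + 1ℤ) * (+ 2 * s + 1ℤ))) (sym N-int))
    where
    lem : ∀ s q → + 4 * (s * s + s + q) ≡ (+ 2 * s + 1ℤ) * (+ 2 * s + 1ℤ) + (+ 4 * q - 1ℤ)
    lem = solve-∀

  splitting-2 : Splitting 2
  splitting-2 with parity (suc m)
  ... | f , inj₁ e = split (trans χ-2 χ₈N) 0ℤ (divides (+ f) (trans (+-identityˡ (+ suc m)) (trans (cong +_ e) (lem f)))) ∤1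
    where
    lem : ∀ f → + (f ℕ.+ f) ≡ + f * + 2
    lem f = trans (cong +_ (lem′ f)) (pos-* f 2)
      where
      lem′ : ∀ f → f ℕ.+ f ≡ f ℕ.* 2
      lem′ = ℕSolver.solve-∀
    ∤1 : ¬ (+ 2 ∣ 1ℤ)
    ∤1 d with ℕD.∣1⇒≡1 (∣⇒∣ᵤ d)
    ... | ()
    χ₈N : χ₈ N ≡ 1ℤ
    χ₈N = go f e
      where
      go : ∀ f → suc m ≡ f ℕ.+ f → χ₈ N ≡ 1ℤ
      go (suc f) e = trans (cong χ₈ (trans (cong (λ k → suc (suc (suc (k ℕ.* 4)))) (ℕP.suc-injective e)) (lem₂ f)))
        (cong table₈ (ℕM.[m+kn]%n≡m%n 7 f 8))
        where
        lem₂ : ∀ f → suc (suc (suc ((f ℕ.+ suc f) ℕ.* 4))) ≡ 7 ℕ.+ f ℕ.* 8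
        lem₂ = ℕSolver.solve-∀
  ... | f , inj₂ e = inert (trans χ-2 χ₈N) norm-odd
    where
    χ₈N : χ₈ N ≡ -1ℤ
    χ₈N = trans (cong χ₈ (trans (cong (λ k → suc (suc (suc (k ℕ.* 4)))) (ℕP.suc-injective e)) (lem₂ f)))
        (cong table₈ (ℕM.[m+kn]%n≡m%n 3 f 8))
      where
      lem₂ : ∀ f → suc (suc (suc ((f ℕ.+ f) ℕ.* 4))) ≡ 3 ℕ.+ f ℕ.* 8
      lem₂ = ℕSolver.solve-∀
    s²+s-even : ∀ s → + 2 ∣ s * s + s
    s²+s-even (+ n) with parity n
    ... | f , inj₁ refl = ∣-eq (lem (+ f) (+ (f ℕ.+ f)) (pos-+ f f)) (∣m⇒∣m*n (+ f * (+ 2 * + f + 1ℤ)) ∣-refl)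
      where
      lem : ∀ f n → n ≡ f + f → + 2 * (f * (+ 2 * f + 1ℤ)) ≡ n * n + n
      lem f n refl = lem′ f
        where
        lem′ : ∀ f → + 2 * (f * (+ 2 * f + 1ℤ)) ≡ (f + f) * (f + f) + (f + f)
        lem′ = solve-∀
    ... | f , inj₂ refl = ∣-eq (lem (+ f) (+ suc (f ℕ.+ f)) (trans (pos-+ 1 (f ℕ.+ f)) (cong (_+_ 1ℤ) (pos-+ f f)))) (∣m⇒∣m*n ((+ f + 1ℤ) * (+ 2 * + f + 1ℤ)) ∣-refl)
      where
      lem : ∀ f n → n ≡ 1ℤ + (f + f) → + 2 * ((f + 1ℤ) * (+ 2 * f + 1ℤ)) ≡ n * n + n
      lem f n refl = lem′ f
        where
        lem′ : ∀ f → + 2 * ((f + 1ℤ) * (+ 2 * f + 1ℤ)) ≡ (1ℤ + (f + f)) * (1ℤ + (f + f)) + (1ℤ + (f + f))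
        lem′ = solve-∀
    s²+s-even -[1+ n ] = ∣-eq (lem (+ n) -[1+ n ] (neg-suc-int n)) (s²+s-even (+ n))
      where
      neg-suc-int : ∀ n → -[1+ n ] ≡ - (1ℤ + + n)
      neg-suc-int n = cong -_ (pos-+ 1 n)
      lem : ∀ n s → s ≡ - (1ℤ + n) → n * n + n ≡ s * s + s
      lem n s refl = lem′ n
        where
        lem′ : ∀ n → n * n + n ≡ - (1ℤ + n) * - (1ℤ + n) + - (1ℤ + n)
        lem′ = solve-∀
    norm-odd : ∀ s → ¬ (+ 2 ∣ norm₁ s)
    norm-odd s d = odd f e (∣⇒∣ᵤ (∣-eq (lem (s * s + s) (+ suc m)) (∣m∣n⇒∣m-n d (s²+s-even s))))
      where
      lem : ∀ a q → a + q - a ≡ q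
      lem = solve-∀
      odd : ∀ f → suc m ≡ suc (f ℕ.+ f) → ¬ (2 ℕD.∣ suc m)
      odd f e d with ℕD.∣1⇒≡1 (ℕD.∣m+n∣m⇒∣n (subst (2 ℕD.∣_) (trans e (lem₃ f)) d) (ℕD.∣n⇒∣m*n f ℕD.∣-refl))
        where
        lem₃ : ∀ f → suc (f ℕ.+ f) ≡ f ℕ.* 2 ℕ.+ 1
        lem₃ = ℕSolver.solve-∀
      ... | ()

  splitting-odd : ∀ {p k} → Prime p → p ≡ suc (k ℕ.+ k) → Splitting p
  splitting-odd {p} {k} pp p≡ = go (p ℕD.∣? N)
    where
    open OddPrime k pp p≡
    p-int : + p ≡ + 2 * + k + 1ℤ
    p-int = trans (cong +_ p≡) (trans (pos-+ 1 (k ℕ.+ k)) (trans (cong (_+_ 1ℤ) (pos-+ k k)) (lem (+ k))))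
      where
      lem : ∀ k → 1ℤ + (k + k) ≡ + 2 * k + 1ℤ
      lem = solve-∀
    p∤4 : ¬ (+ p ∣ + 4)
    p∤4 = ∤-* {+ 2} {+ 2} p∤2 p∤2
      where
      p∤2 : ¬ (+ p ∣ + 2)
      p∤2 d with ∣-∣∣< d (subst (3 ℕ.≤_) (sym p≡) (ℕ.s≤s (ℕP.+-mono-≤ h≥1 h≥1)))
      ... | ()
    norm⇐ : ∀ s → + p ∣ (+ 2 * s + 1ℤ) * (+ 2 * s + 1ℤ) + + N → + p ∣ norm₁ s
    norm⇐ s d = ∣-cancel pp (+ 4) (norm₁ s) p∤4 (∣-eq (sym (4norm₁ s)) d)
    go : Dec (p ℕD.∣ N) → Splitting p
    go (yes p∣N) = ramified (χ-zero pp p∣N ℕD.∣-refl) (+ k)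
        (norm⇐ (+ k) (∣m∣n⇒∣m+n (∣m⇒∣m*n (+ 2 * + k + 1ℤ) p∣2k+1) (∣ᵤ⇒∣ p∣N))) p∣2k+1 p∣N
      where
      p∣2k+1 : + p ∣ + 2 * + k + 1ℤ
      p∣2k+1 = ∣-eq p-int ∣-refl
    go (no p∤N) = go′ (value primes (χ-prodL p))
      where
      p∤N′ : ¬ (+ p ∣ + N)
      p∤N′ d = p∤N (∣⇒∣ᵤ d)
      euler : + p ∣ χ p - (- + N) ^ k
      euler = χ-euler {k = k} pp p≡ p∤N
      2s+1-coprime : ∀ s → + p ∣ norm₁ s → ¬ (+ p ∣ + 2 * s + 1ℤ)
      2s+1-coprime s d e = p∤N′ (∣-eq (trans (cong (_- w * w) (4norm₁ s)) (lem (w * w) (+ N)))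
          (∣m∣n⇒∣m-n (∣n⇒∣m*n (+ 4) d) (∣m⇒∣m*n w e)))
        where
        w = + 2 * s + 1ℤ
        lem : ∀ a b → a + b - a ≡ b
        lem = solve-∀
      value : ∀ xs → χ p ≡ prodL (legendre p) xs → χ p ≡ 0ℤ ⊎ IsSign (χ p)
      value _ _ = subst (λ x → x ≡ 0ℤ ⊎ IsSign x) (sym (χ-prodL p)) (values primes (λ q∈ → q∈))
        where
        values : ∀ xs → (∀ {q} → q ∈ xs → q ∈ primes) → prodL (legendre p) xs ≡ 0ℤ ⊎ IsSign (prodL (legendre p) xs)
        values [] _ = inj₂ (inj₁ refl)
        values (q ∷ xs) sub = value-* (OddPrime.legendre-value (proj₁ (halves q∈)) (is-prime q∈) (proj₂ (halves q∈)) p)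
            (values xs (sub ∘ there))
          where
          q∈ = sub (here refl)
      go′ : χ p ≡ 0ℤ ⊎ IsSign (χ p) → Splitting p
      go′ (inj₁ e) = ⊥-elim (p∤N′ (∣-eq (neg-involutive (+ N)) (∣m⇒∣-m (prime-power pp (- + N) k
          (∣-eq (lem ((- + N) ^ k)) (∣m⇒∣-m (subst (λ c → + p ∣ c - (- + N) ^ k) e euler)))))))
        where
        lem : ∀ a → - (0ℤ - a) ≡ a
        lem = solve-∀
      go′ (inj₂ (inj₁ e)) = found (any? (λ (y : Fin p) → + p ∣? + toℕ y * + toℕ y - - + N))
        where
        found : Dec (∃ λ (y : Fin p) → + p ∣ + toℕ y * + toℕ y - - + N) → Splitting p
        found (no none) = ⊥-elim (^h-root⇒square (- + N) (∣-sub-sym 1ℤ ((- + N) ^ k) (subst (λ c → + p ∣ c - (- + N) ^ k) e euler))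
          (λ x _ x≤k d → let x<p = ℕP.≤-<-trans x≤k (subst (k ℕ.<_) (sym p≡) (ℕ.s≤s (ℕP.m≤m+n k k))) in
            none (fromℕ< x<p , subst (λ y → + p ∣ + y * + y - - + N) (sym (toℕ-fromℕ< x<p)) d)))
        found (yes (y , d)) = split e s (norm⇐ s f) (2s+1-coprime s (norm⇐ s f))
          where
          -- k + 1 is the inverse of 2 modulo p.
          s = (+ toℕ y - 1ℤ) * (+ k + 1ℤ)
          f : + p ∣ (+ 2 * s + 1ℤ) * (+ 2 * s + 1ℤ) + + N
          f = ∣-eq (trans (cong (λ P → + toℕ y * + toℕ y - - + N + P * ((+ toℕ y - 1ℤ) * (+ 2 * + toℕ y + (+ toℕ y - 1ℤ) * P))) p-int) (lem (+ toℕ y) (+ k) (+ N)))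
            (∣m∣n⇒∣m+n d (∣m⇒∣m*n ((+ toℕ y - 1ℤ) * (+ 2 * + toℕ y + (+ toℕ y - 1ℤ) * + p)) ∣-refl))
            where
            lem : ∀ y k N → y * y - - N + (+ 2 * k + 1ℤ) * ((y - 1ℤ) * (+ 2 * y + (y - 1ℤ) * (+ 2 * k + 1ℤ)))
              ≡ (+ 2 * ((y - 1ℤ) * (k + 1ℤ)) + 1ℤ) * (+ 2 * ((y - 1ℤ) * (k + 1ℤ)) + 1ℤ) + N
            lem = solve-∀
      go′ (inj₂ (inj₂ e)) = inert e none
        where
        none : ∀ s → ¬ (+ p ∣ norm₁ s)
        none s d = absurd (sign-determined (inj₂ refl) (inj₁ refl)
            (∣-sub -1ℤ ((- + N) ^ k) 1ℤ (subst (λ c → + p ∣ c - (- + N) ^ k) e euler)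
              (∣-sub ((- + N) ^ k) ((w * w) ^ k) 1ℤ (∣-sub-^ (- + N) (w * w) k w²) (^h-square w (2s+1-coprime s d)))))
          where
          w = + 2 * s + 1ℤ
          absurd : -1ℤ ≢ 1ℤ
          absurd ()
          w² : + p ∣ - + N - w * w
          w² = ∣-eq (trans (cong -_ (4norm₁ s)) (lem (w * w) (+ N))) (∣m⇒∣-m (∣n⇒∣m*n (+ 4) d))
            where
            lem : ∀ a b → - (a + b) ≡ - b - a
            lem = solve-∀

  splitting : ∀ {p} → Prime p → Splitting p
  splitting {p} pp with parity p
  ... | f , inj₂ e = splitting-odd {k = f} pp e
  ... | f , inj₁ e with prime⇒irreducible pp (ℕD.divides f (trans e (lem f)))
    where
    lem : ∀ f → f ℕ.+ f ≡ f ℕ.* 2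
    lem = ℕSolver.solve-∀
  ... | inj₁ ()
  ... | inj₂ refl = splitting-2

module PrimeIdeals (m : ℕ) where
  open Quad m
  open Similar
  open Form

  ⊛-swap : ∀ x y z → x ⊛ (y ⊛ z) ≡ y ⊛ (x ⊛ z)
  ⊛-swap x y z = trans (sym (⊛-assoc x y z)) (trans (cong (_⊛ z) (⊛-comm x y)) (⊛-assoc y x z))

  opaque
    unfolding _•_

    •-distrib-⊞ : ∀ k v v′ → k • (v ⊞ v′) ≡ k • v ⊞ k • v′
    •-distrib-⊞ k ⟨ a , b ⟩ ⟨ c , d ⟩ = cong₂ ⟨_,_⟩ (*-distribˡ-+ k a c) (*-distribˡ-+ k b d)

    divisible? : ∀ k v → k ≢ 0ℤ → Dec (∃ λ y → v ≡ k • y)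
    divisible? k ⟨ s , t ⟩ k≢0 = map′ (λ { (divides i e , divides j f) → ⟨ i , j ⟩ , cong₂ ⟨_,_⟩ (trans e (*-comm i k)) (trans f (*-comm j k)) })
      (λ { (⟨ i , j ⟩ , e) → divides i (trans (cong u e) (*-comm k i)) , divides j (trans (cong w e) (*-comm k j)) })
      (k ∣? s ×-dec k ∣? t)

    divide-by : ∀ b t k p v z → t * b - 1ℤ ≡ k * p → t * v ≡ p * z → v ≡ p * (b * z + - k * v)
    divide-by b t k p v z e f = sym (trans (lem₁ b k p v z) (trans (cong₂ (λ r s → b * r - s * v) (sym f) (sym e)) (lem₂ b t v)))
      where
      lem₁ : ∀ b k p v z → p * (b * z + - k * v) ≡ b * (p * z) - k * p * v
      lem₁ = solve-∀
      lem₂ : ∀ b t v → b * (t * v) - (t * b - 1ℤ) * v ≡ v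
      lem₂ = solve-∀

    •-0ₒ : ∀ k → k • 0ₒ ≡ 0ₒ
    •-0ₒ k = cong₂ ⟨_,_⟩ (*-zeroʳ k) (*-zeroʳ k)

    •-divide-by : ∀ b t k p v z → t * b - 1ℤ ≡ k * p → t • v ≡ p • z → v ≡ p • (b • z ⊞ (- k) • v)
    •-divide-by b t k p v z f e = cong₂ ⟨_,_⟩ (divide-by b t k p (u v) (u z) f (cong u e)) (divide-by b t k p (w v) (w z) f (cong w e))

  module _ {p : ℕ} (pp : Prime p) where

    private
      p≢0 : + p ≢ 0ℤ
      p≢0 e = ℕ.≢-nonZero⁻¹ p {{prime⇒nonZero pp}} (+-injective e)

    -- For η = conj θ with p ∥ N(θ) this is the product of I and the prime ideal (p, θ).
    Over : O → (O → Set) → O → Set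
    Over η P v = P v × ∃ λ y → P y × η ⊛ v ≡ + p • y

    over : O → Ideal → Ideal
    over η I = record
      { mem = Over η (mem I)
      ; mem? = mem-over?
      ; closed-⊞ = λ { {v} {v′} (pv , y , py , e) (pv′ , y′ , py′ , e′) → closed-⊞ I pv pv′ , y ⊞ y′ , closed-⊞ I py py′ ,
          trans (⊛-distribˡ η v v′) (trans (cong₂ _⊞_ e e′) (sym (•-distrib-⊞ (+ p) y y′))) }
      ; closed-⊛ = λ { a {v} (pv , y , py , e) → closed-⊛ I a pv , a ⊛ y , closed-⊛ I a py ,
          trans (⊛-swap η a v) (trans (cong (a ⊛_) e) (⊛-• a (+ p) y)) }
      ; nonzero = let z , pz , z≢0 = nonzero I in + p • z , over-• pz , λ e → z≢0 (•-cancel (+ p) p≢0 (trans e (sym (•-0ₒ (+ p)))))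
      }
      where
      over-• : ∀ {z} → mem I z → Over η (mem I) (+ p • z)
      over-• {z} pz = closed-• I (+ p) pz , η ⊛ z , closed-⊛ I η pz , ⊛-• η (+ p) z
      mem-over? : ∀ v → Dec (Over η (mem I) v)
      mem-over? v with mem? I v | divisible? (+ p) (η ⊛ v) p≢0
      ... | no ¬pv | _ = no (λ o → ¬pv (proj₁ o))
      ... | yes pv | no ¬d = no (λ { (_ , y , _ , e) → ¬d (y , e) })
      ... | yes pv | yes (y , e) = map′ (λ py → pv , y , py , e)
        (λ { (_ , y′ , py′ , e′) → subst (mem I) (•-cancel (+ p) p≢0 (trans (sym e′) e)) py′ }) (mem? I y)

    over-• : ∀ η I {z} → mem I z → Over η (mem I) (+ p • z)
    over-• η I {z} pz = closed-• I (+ p) pz , η ⊛ z , closed-⊛ I η pz , ⊛-• η (+ p) z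

    over-similar : ∀ η {P Q} → Similar P Q → Similar (Over η P) (Over η Q)
    over-similar η {P} {Q} s = record { α = α s ; β = β s ; α≢0 = α≢0 s ; β≢0 = β≢0 s
      ; to = λ { {v} (pv , y , py , e) → let v′ , qv′ , f = to s pv ; y′ , qy′ , g = to s py in
          v′ , (qv′ , y′ , qy′ , ⊛-cancel (β≢0 s) (lem (α s) (β s) v y v′ y′ e f g)) , f }
      ; from = λ { {v} (qv , y , qy , e) → let v′ , pv′ , f = from s qv ; y′ , py′ , g = from s qy in
          v′ , (pv′ , y′ , py′ , ⊛-cancel (α≢0 s) (lem (β s) (α s) v y v′ y′ e (sym f) (sym g))) , f } }
      where
      lem : ∀ α β v y v′ y′ → η ⊛ v ≡ + p • y → α ⊛ v ≡ β ⊛ v′ → α ⊛ y ≡ β ⊛ y′ → β ⊛ (η ⊛ v′) ≡ β ⊛ (+ p • y′)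
      lem α β v y v′ y′ e f g = begin
        β ⊛ (η ⊛ v′) ≡⟨ ⊛-swap β η v′ ⟩
        η ⊛ (β ⊛ v′) ≡⟨ cong (η ⊛_) (sym f) ⟩
        η ⊛ (α ⊛ v) ≡⟨ ⊛-swap η α v ⟩
        α ⊛ (η ⊛ v) ≡⟨ cong (α ⊛_) e ⟩
        α ⊛ (+ p • y) ≡⟨ ⊛-• α (+ p) y ⟩
        + p • (α ⊛ y) ≡⟨ cong (+ p •_) g ⟩
        + p • (β ⊛ y′) ≡⟨ sym (⊛-• β (+ p) y′) ⟩
        β ⊛ (+ p • y′) ∎
        where open ≡-Reasoning

    coprime-divide : ∀ I t {v z} → mem I v → mem I z → ¬ (+ p ∣ t) → t • v ≡ + p • z → ∃ λ v′ → mem I v′ × v ≡ + p • v′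
    coprime-divide I t {v} {z} pv pz p∤t e = v′ , closed-⊞ I {t⁻¹ • z} {(- k) • v} (closed-• I t⁻¹ {z} pz) (closed-• I (- k) {v} pv) , v≡
      where
      t⁻¹ = proj₁ (mod-inverse pp t p∤t)
      k = _∣_.quotient (proj₂ (mod-inverse pp t p∤t))
      f : t * t⁻¹ - 1ℤ ≡ k * + p
      f = _∣_.equality (proj₂ (mod-inverse pp t p∤t))
      v′ : O
      v′ = t⁻¹ • z ⊞ (- k) • v
      v≡ : v ≡ + p • v′
      v≡ = •-divide-by t⁻¹ t k (+ p) v z f e

    module _ (θ : O) (t : ℤ) (nrm≡ : nrm θ ≡ + p * t) (p∤t : ¬ (+ p ∣ t)) where

      private
        θ̄θ : ∀ v → conj θ ⊛ (θ ⊛ v) ≡ + p • t • v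
        θ̄θ v = trans (conj-⊛-⊛ θ v) (trans (cong (_• v) nrm≡) (sym (•-assoc (+ p) t v)))

        θθ̄ : ∀ v → θ ⊛ (conj θ ⊛ v) ≡ + p • t • v
        θθ̄ v = trans (⊛-swap θ (conj θ) v) (θ̄θ v)

        -- Each of (θ, conj θ) and (conj θ, θ) multiplies to p·t.
        back : ∀ η η′ → (∀ v → η ⊛ (η′ ⊛ v) ≡ + p • t • v) → ∀ I → Similar (Over η′ (Over η (mem I))) (mem I)
        back η η′ ηη′ I = record { α = 1ₒ ; β = ⟨ + p , 0ℤ ⟩ ; α≢0 = λ () ; β≢0 = λ e → p≢0 (cong u e)
          ; to = λ { {v} ((pv , _) , y , (_ , y₂ , py₂ , e₂) , e) →
              let v′ , pv′ , f = coprime-divide I t pv py₂ p∤t (•-cancel (+ p) p≢0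
                    (trans (sym (ηη′ v)) (trans (cong (η ⊛_) e) (trans (⊛-• η (+ p) y) (cong (+ p •_) e₂)))))
              in v′ , pv′ , trans (1ₒ-⊛ v) (trans f (sym (•-⊛ (+ p) v′))) }
          ; from = λ {y} py → + p • y ,
              ((closed-• I (+ p) py , η ⊛ y , closed-⊛ I η py , ⊛-• η (+ p) y) ,
                η′ ⊛ y , (closed-⊛ I η′ py , t • y , closed-• I t py , ηη′ y) , ⊛-• η′ (+ p) y) ,
              trans (1ₒ-⊛ (+ p • y)) (sym (•-⊛ (+ p) y)) }

      over-conj-over : ∀ I → Similar (Over θ (Over (conj θ) (mem I))) (mem I)
      over-conj-over = back (conj θ) θ θ̄θ

      over-over-conj : ∀ I → Similar (Over (conj θ) (Over θ (mem I))) (mem I)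
      over-over-conj = back θ (conj θ) θθ̄

  norm₁ : ℤ → ℤ
  norm₁ s = s * s + s + q

  nrm-⟨s,1⟩ : ∀ s → nrm ⟨ s , 1ℤ ⟩ ≡ norm₁ s
  nrm-⟨s,1⟩ s = trans (nrm-def s 1ℤ) (lem q s)
    where
    lem : ∀ q s → s * s + s * 1ℤ + q * (1ℤ * 1ℤ) ≡ s * s + s + q
    lem = solve-∀

  module _ (F : Form) where

    -- The coordinates of conj θ · v and θ · v, for θ = s + ω and v = vec F i j.
    R₁ R₂ S₁ S₂ : ℤ → ℤ → ℤ → ℤ
    R₁ s i j = i * (s + 1ℤ + x F) + j * c F
    R₂ s i j = - (a F * i) + j * (s - x F)
    S₁ s i j = i * (s - x F) - j * c F
    S₂ s i j = a F * i + j * (s + 1ℤ + x F)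

    opaque
      unfolding _⊛_
      conj-⊛-vec : ∀ s i j → conj ⟨ s , 1ℤ ⟩ ⊛ vec F i j ≡ vec F (R₁ s i j) (R₂ s i j)
      conj-⊛-vec s i j = cong₂ ⟨_,_⟩
        (trans (lem₁ q s i j (a F) (x F)) (trans (cong (λ r → i * (s + 1ℤ + x F) * a F + j * r + R₂ s i j * x F) (sym (ac≡ F))) (lem₃ s i j (a F) (x F) (c F))))
        (lem₂ s i j (a F) (x F))
        where
        lem₁ : ∀ q s i j a x → (s + 1ℤ) * (i * a + j * x) - q * (-1ℤ * j)
          ≡ i * (s + 1ℤ + x) * a + j * (x * x + x + q) + (- (a * i) + j * (s - x)) * x
        lem₁ = solve-∀
        lem₃ : ∀ s i j a x c → i * (s + 1ℤ + x) * a + j * (a * c) + (- (a * i) + j * (s - x)) * x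
          ≡ (i * (s + 1ℤ + x) + j * c) * a + (- (a * i) + j * (s - x)) * x
        lem₃ = solve-∀
        lem₂ : ∀ s i j a x → (s + 1ℤ) * j + -1ℤ * (i * a + j * x) + -1ℤ * j ≡ - (a * i) + j * (s - x)
        lem₂ = solve-∀

      ⊛-vec : ∀ s i j → ⟨ s , 1ℤ ⟩ ⊛ vec F i j ≡ vec F (S₁ s i j) (S₂ s i j)
      ⊛-vec s i j = cong₂ ⟨_,_⟩
        (trans (lem₁ q s i j (a F) (x F)) (trans (cong (λ r → i * (s - x F) * a F - j * r + S₂ s i j * x F) (sym (ac≡ F))) (lem₃ s i j (a F) (x F) (c F))))
        (lem₂ s i j (a F) (x F))
        where
        lem₁ : ∀ q s i j a x → s * (i * a + j * x) - q * (1ℤ * j)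
          ≡ i * (s - x) * a - j * (x * x + x + q) + (a * i + j * (s + 1ℤ + x)) * x
        lem₁ = solve-∀
        lem₃ : ∀ s i j a x c → i * (s - x) * a - j * (a * c) + (a * i + j * (s + 1ℤ + x)) * x
          ≡ (i * (s - x) - j * c) * a + (a * i + j * (s + 1ℤ + x)) * x
        lem₃ = solve-∀
        lem₂ : ∀ s i j a x → s * j + 1ℤ * (i * a + j * x) + 1ℤ * j ≡ a * i + j * (s + 1ℤ + x)
        lem₂ = solve-∀

      vec-• : ∀ k i j → vec F (i * k) (j * k) ≡ k • vec F i j
      vec-• k i j = cong₂ ⟨_,_⟩ (lem k i j (a F) (x F)) (*-comm j k)
        where
        lem : ∀ k i j a x → i * k * a + j * k * x ≡ k * (i * a + j * x)
        lem = solve-∀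

    norm₁≡ : ∀ s → norm₁ s ≡ s * s + s + (a F * c F - x F * x F - x F)
    norm₁≡ s = trans (lem s (x F) q) (cong (λ r → s * s + s + (r - x F * x F - x F)) (sym (ac≡ F)))
      where
      lem : ∀ s x q → s * s + s + q ≡ s * s + s + (x * x + x + q - x * x - x)
      lem = solve-∀

    module _ {p : ℕ} (pp : Prime p) (s i j : ℤ) (p∣norm : + p ∣ norm₁ s) (p∣Q : + p ∣ Q F i j) where

      private
        combo : ∀ {e} k l → k * Q F i j + l * (s * s + s + (a F * c F - x F * x F - x F)) ≡ e → + p ∣ e
        combo k l eq = ∣-eq eq (∣m∣n⇒∣m+n (∣n⇒∣m*n k p∣Q) (∣n⇒∣m*n l (∣-eq (norm₁≡ s) p∣norm)))

        R₁S₁ : + p ∣ R₁ s i j * S₁ s i j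
        R₁S₁ = combo (- c F) (i * i) (lem (a F) (x F) (c F) s i j)
          where
          lem : ∀ a x c s i j → - c * (a * (i * i) + (+ 2 * x + 1ℤ) * (i * j) + c * (j * j)) + i * i * (s * s + s + (a * c - x * x - x))
            ≡ (i * (s + 1ℤ + x) + j * c) * (i * (s - x) - j * c)
          lem = solve-∀

        R₁S₂ : + p ∣ R₁ s i j * S₂ s i j
        R₁S₂ = combo (s + 1ℤ + x F) (i * j) (lem (a F) (x F) (c F) s i j)
          where
          lem : ∀ a x c s i j → (s + 1ℤ + x) * (a * (i * i) + (+ 2 * x + 1ℤ) * (i * j) + c * (j * j)) + i * j * (s * s + s + (a * c - x * x - x))
            ≡ (i * (s + 1ℤ + x) + j * c) * (a * i + j * (s + 1ℤ + x))
          lem = solve-∀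

        R₂S₁ : + p ∣ R₂ s i j * S₁ s i j
        R₂S₁ = combo (- (s - x F)) (i * j) (lem (a F) (x F) (c F) s i j)
          where
          lem : ∀ a x c s i j → - (s - x) * (a * (i * i) + (+ 2 * x + 1ℤ) * (i * j) + c * (j * j)) + i * j * (s * s + s + (a * c - x * x - x))
            ≡ (- (a * i) + j * (s - x)) * (i * (s - x) - j * c)
          lem = solve-∀

        R₂S₂ : + p ∣ R₂ s i j * S₂ s i j
        R₂S₂ = combo (- a F) (j * j) (lem (a F) (x F) (c F) s i j)
          where
          lem : ∀ a x c s i j → - a * (a * (i * i) + (+ 2 * x + 1ℤ) * (i * j) + c * (j * j)) + j * j * (s * s + s + (a * c - x * x - x))
            ≡ (- (a * i) + j * (s - x)) * (a * i + j * (s + 1ℤ + x))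
          lem = solve-∀

        inR : + p ∣ R₁ s i j → + p ∣ R₂ s i j → Over pp (conj ⟨ s , 1ℤ ⟩) (L F) (vec F i j)
        inR (divides k e) (divides l f) = L-vec F i j , vec F k l , L-vec F k l ,
          trans (conj-⊛-vec s i j) (trans (cong₂ (vec F) e f) (vec-• (+ p) k l))

        inS : + p ∣ S₁ s i j → + p ∣ S₂ s i j → Over pp ⟨ s , 1ℤ ⟩ (L F) (vec F i j)
        inS (divides k e) (divides l f) = L-vec F i j , vec F k l , L-vec F k l ,
          trans (⊛-vec s i j) (trans (cong₂ (vec F) e f) (vec-• (+ p) k l))

        choose : ∀ r₁ r₂ s₁ s₂ → + p ∣ r₁ * s₁ → + p ∣ r₁ * s₂ → + p ∣ r₂ * s₁ → + p ∣ r₂ * s₂ →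
          ((+ p ∣ r₁) × (+ p ∣ r₂)) ⊎ ((+ p ∣ s₁) × (+ p ∣ s₂))
        choose r₁ r₂ s₁ s₂ d₁₁ d₁₂ d₂₁ d₂₂ with + p ∣? r₁ | + p ∣? r₂
        ... | yes p∣r₁ | yes p∣r₂ = inj₁ (p∣r₁ , p∣r₂)
        ... | no p∤r₁ | _ = inj₂ (∣-cancel pp r₁ s₁ p∤r₁ d₁₁ , ∣-cancel pp r₁ s₂ p∤r₁ d₁₂)
        ... | yes _ | no p∤r₂ = inj₂ (∣-cancel pp r₂ s₁ p∤r₂ d₂₁ , ∣-cancel pp r₂ s₂ p∤r₂ d₂₂)

      norm-divisible⇒over : Over pp (conj ⟨ s , 1ℤ ⟩) (L F) (vec F i j) ⊎ Over pp ⟨ s , 1ℤ ⟩ (L F) (vec F i j)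
      norm-divisible⇒over = [ (λ d → inj₁ (inR (proj₁ d) (proj₂ d))) , (λ d → inj₂ (inS (proj₁ d) (proj₂ d))) ]′
        (choose (R₁ s i j) (R₂ s i j) (S₁ s i j) (S₂ s i j) R₁S₁ R₁S₂ R₂S₁ R₂S₂)

    inert⇒divisible : ∀ {p} → Prime p → (∀ s → ¬ (+ p ∣ norm₁ s)) → ∀ i j → + p ∣ Q F i j → (+ p ∣ i) × (+ p ∣ j)
    inert⇒divisible {p} pp none i j p∣Q = cases (+ p ∣? j)
     where
     cases : Dec (+ p ∣ j) → (+ p ∣ i) × (+ p ∣ j)
     cases (yes p∣j) = [ (λ p∣a → ⊥-elim (none (x F) (∣-eq (ac≡ F) (∣m⇒∣m*n (c F) p∣a)))) ,
           [ (λ p∣i → p∣i) , (λ p∣i → p∣i) ]′ ∘ ∣-prod pp i i ]′ (∣-prod pp (a F) (i * i) p∣aii) , p∣j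
       where
       p∣aii : + p ∣ a F * (i * i)
       p∣aii = ∣-eq (lem (a F) (b F) (c F) i j) (∣m∣n⇒∣m-n p∣Q (∣n⇒∣m*n (b F * i + c F * j) p∣j))
         where
         lem : ∀ a b c i j → a * (i * i) + b * (i * j) + c * (j * j) - (b * i + c * j) * j ≡ a * (i * i)
         lem = solve-∀
     cases (no p∤j) = ⊥-elim (none ((i * a F + j * x F) * j⁻¹)
         (∣-eq (lem q (i * a F + j * x F) j j⁻¹)
           (∣m∣n⇒∣m-n (∣n⇒∣m*n (j⁻¹ * j⁻¹) (∣-eq Q≡ (∣n⇒∣m*n (a F) p∣Q)))
             (∣n⇒∣m*n ((i * a F + j * x F) * j⁻¹ + q * (j * j⁻¹ + 1ℤ)) (proj₂ (mod-inverse pp j p∤j))))))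
       where
       j⁻¹ = proj₁ (mod-inverse pp j p∤j)
       Q≡ : a F * Q F i j ≡ (i * a F + j * x F) * (i * a F + j * x F) + (i * a F + j * x F) * j + q * (j * j)
       Q≡ = trans (sym (nrm-vec F i j)) (nrm-def (i * a F + j * x F) j)
       lem : ∀ q U j b → b * b * (U * U + U * j + q * (j * j)) - (U * b + q * (j * b + 1ℤ)) * (j * b - 1ℤ) ≡ U * b * (U * b) + U * b + q
       lem = solve-∀

  opaque
    unfolding _⊛_
    trace-⊛ : ∀ s v → (conj ⟨ s , 1ℤ ⟩ ⊛ v) ⊞ (⟨ s , 1ℤ ⟩ ⊛ v) ≡ (+ 2 * s + 1ℤ) • v
    trace-⊛ s ⟨ y , z ⟩ = cong₂ ⟨_,_⟩ (lem₁ q s y z) (lem₂ s y z)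
      where
      lem₁ : ∀ q s y z → (s + 1ℤ) * y - q * (-1ℤ * z) + (s * y - q * (1ℤ * z)) ≡ (+ 2 * s + 1ℤ) * y
      lem₁ = solve-∀
      lem₂ : ∀ s y z → (s + 1ℤ) * z + -1ℤ * y + -1ℤ * z + (s * z + 1ℤ * y + 1ℤ * z) ≡ (+ 2 * s + 1ℤ) * z
      lem₂ = solve-∀

    ⊞-solve : ∀ {x y z} → x ⊞ y ≡ z → y ≡ z ⊞ -1ℤ • x
    ⊞-solve {⟨ x₁ , x₂ ⟩} {⟨ y₁ , y₂ ⟩} refl = cong₂ ⟨_,_⟩ (lem x₁ y₁) (lem x₂ y₂)
      where
      lem : ∀ x y → y ≡ x + y + -1ℤ * x
      lem = solve-∀

    conj-conj : ∀ x → conj (conj x) ≡ x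
    conj-conj ⟨ x₁ , x₂ ⟩ = cong₂ ⟨_,_⟩ (lem x₁ x₂) (neg-involutive x₂)
      where
      lem : ∀ x y → x + y + - y ≡ x
      lem = solve-∀

    ⊞-comm : ∀ x y → x ⊞ y ≡ y ⊞ x
    ⊞-comm ⟨ x₁ , x₂ ⟩ ⟨ y₁ , y₂ ⟩ = cong₂ ⟨_,_⟩ (+-comm x₁ y₁) (+-comm x₂ y₂)

  over-both : ∀ {p} (pp : Prime p) s I → ¬ (+ p ∣ + 2 * s + 1ℤ) → ∀ {v} →
    Over pp (conj ⟨ s , 1ℤ ⟩) (mem I) v → Over pp ⟨ s , 1ℤ ⟩ (mem I) v → ∃ λ v′ → mem I v′ × v ≡ + p • v′
  over-both {p} pp s I p∤tr {v} (pv , y , py , e) (_ , y′ , py′ , e′) =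
    coprime-divide pp I (+ 2 * s + 1ℤ) {v} {y ⊞ y′} pv (closed-⊞ I py py′) p∤tr
      (trans (sym (trace-⊛ s v)) (trans (cong₂ _⊞_ e e′) (sym (•-distrib-⊞ (+ p) y y′))))

  over-ramified : ∀ {p} (pp : Prime p) s I → + p ∣ + 2 * s + 1ℤ → ∀ {v} →
    Over pp ⟨ s , 1ℤ ⟩ (mem I) v → Over pp (conj ⟨ s , 1ℤ ⟩) (mem I) v
  over-ramified {p} pp s I (divides k tr) {v} (pv , y , py , e) = pv , k • v ⊞ -1ℤ • y , closed-⊞ I (closed-• I k pv) (closed-• I -1ℤ py) ,
    (begin
      conj ⟨ s , 1ℤ ⟩ ⊛ v ≡⟨ ⊞-solve (trans (⊞-comm (⟨ s , 1ℤ ⟩ ⊛ v) (conj ⟨ s , 1ℤ ⟩ ⊛ v)) (trace-⊛ s v)) ⟩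
      (+ 2 * s + 1ℤ) • v ⊞ -1ℤ • (⟨ s , 1ℤ ⟩ ⊛ v) ≡⟨ cong₂ (λ r t → r • v ⊞ -1ℤ • t) (trans tr (*-comm k (+ p))) e ⟩
      (+ p * k) • v ⊞ -1ℤ • + p • y ≡⟨ cong₂ _⊞_ (sym (•-assoc (+ p) k v)) (•-comm -1ℤ (+ p) y) ⟩
      + p • k • v ⊞ + p • -1ℤ • y ≡⟨ sym (•-distrib-⊞ (+ p) (k • v) (-1ℤ • y)) ⟩
      + p • (k • v ⊞ -1ℤ • y) ∎)
    where open ≡-Reasoning

  -- Content: the positive generator of the ideal of ℤ generated by the norms.
  data Combination (P : O → Set) : ℤ → Set where
    norm : ∀ {v} → P v → Combination P (nrm v)
    sum  : ∀ {a b} → Combination P a → Combination P b → Combination P (a + b)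
    mult : ∀ k {a} → Combination P a → Combination P (k * a)

  record Content (P : O → Set) (c : ℤ) : Set where
    field
      nonneg : 0ℤ ≤ c
      common : ∀ {v} → P v → c ∣ nrm v
      combination : Combination P c
  open Content

  *-monoʳ-∣ : ∀ k {i j} → i ∣ j → k * i ∣ k * j
  *-monoʳ-∣ k {i} (divides r refl) = divides r (lem k r i)
    where
    lem : ∀ k r i → k * (r * i) ≡ r * (k * i)
    lem = solve-∀

  content-similar : ∀ {P Q c d} (s : Similar P Q) → Content P c → Content Q d → nrm (α s) * c ≡ nrm (β s) * d
  content-similar {P} {Q} {c} {d} s C D = ∣-antisym-pos
      (0≤* (0≤nrm (α s)) (nonneg C)) (0≤* (0≤nrm (β s)) (nonneg D))
      (half (similar-sym s) D C) (half s C D)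
    where
    half : ∀ {P Q c d} (s : Similar P Q) → Content P c → Content Q d → nrm (β s) * d ∣ nrm (α s) * c
    half {P} {Q} {c} {d} s C D = go (combination C)
      where
      step : ∀ v y → α s ⊛ v ≡ β s ⊛ y → d ∣ nrm y → nrm (β s) * d ∣ nrm (α s) * nrm v
      step v y e g = subst (nrm (β s) * d ∣_) norms (*-monoʳ-∣ (nrm (β s)) g)
        where
        norms : nrm (β s) * nrm y ≡ nrm (α s) * nrm v
        norms = trans (sym (nrm-⊛ (β s) y)) (trans (cong nrm (sym e)) (nrm-⊛ (α s) v))
      go : ∀ {e} → Combination P e → nrm (β s) * d ∣ nrm (α s) * e
      go (norm {v} pv) = step v (proj₁ (to s pv)) (proj₂ (proj₂ (to s pv))) (common D (proj₁ (proj₂ (to s pv))))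
      go (sum {a} {b} x y) = ∣-eq (sym (*-distribˡ-+ (nrm (α s)) a b)) (∣m∣n⇒∣m+n (go x) (go y))
      go (mult k {a} x) = ∣-eq (lem k (nrm (α s)) a) (∣n⇒∣m*n k (go x))
        where
        lem : ∀ k n a → k * (n * a) ≡ n * (k * a)
        lem = solve-∀

  combination-≡ : ∀ {P a b} → a ≡ b → Combination P a → Combination P b
  combination-≡ refl x = x

  module _ (square-free : ∀ d → + d * + d ∣ N → d ≡ 1) where

    form-primitive : ∀ F → ∃ λ k₁ → ∃ λ k₂ → ∃ λ k₃ → k₁ * a F + k₂ * b F + k₃ * c F ≡ 1ℤ
    form-primitive F with gcd-combination (a F) (b F)
    ... | g , g∣a , g∣b , x₁ , y₁ , e₁ with gcd-combination (+ g) (c F)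
    ... | d , d∣g , d∣c , x₂ , y₂ , e₂ = x₂ * x₁ , x₂ * y₁ , y₂ ,
      trans (lem (a F) (b F) (c F) x₁ y₁ x₂ y₂) (trans (cong (λ r → x₂ * r + y₂ * c F) e₁) (trans e₂ (cong +_ (square-free d d²∣N))))
      where
      lem : ∀ a b c x₁ y₁ x₂ y₂ → x₂ * x₁ * a + x₂ * y₁ * b + y₂ * c ≡ x₂ * (x₁ * a + y₁ * b) + y₂ * c
      lem = solve-∀
      *-mono-∣ : ∀ {i j k l} → i ∣ j → k ∣ l → i * k ∣ j * l
      *-mono-∣ {i} {k = k} (divides r refl) (divides s refl) = divides (r * s) (lem′ r s i k)
        where
        lem′ : ∀ r s i k → r * i * (s * k) ≡ r * s * (i * k)
        lem′ = solve-∀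
      disc : + 4 * (a F * c F) - b F * b F ≡ N
      disc = trans (cong (λ r → + 4 * r - b F * b F) (ac≡ F)) (lem′ (x F) q)
        where
        lem′ : ∀ x q → + 4 * (x * x + x + q) - (+ 2 * x + 1ℤ) * (+ 2 * x + 1ℤ) ≡ + 4 * q - 1ℤ
        lem′ = solve-∀
      d²∣N : + d * + d ∣ N
      d²∣N = ∣-eq disc (∣m∣n⇒∣m-n (∣n⇒∣m*n (+ 4) (*-mono-∣ (∣-trans d∣g g∣a) d∣c)) (*-mono-∣ (∣-trans d∣g g∣b) (∣-trans d∣g g∣b)))

    form-content : ∀ F → Content (L F) (a F)
    form-content F = record
      { nonneg = <⇒≤ (0<a F)
      ; common = λ {v} l → let i , j , e = vec-L F {v} l in
          ∣-eq (sym (trans (cong nrm e) (nrm-vec F i j))) (∣m⇒∣m*n (Q F i j) ∣-refl)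
      ; combination = combination-≡ total
          (sum (mult k₁ n₁) (sum (mult k₂ (sum n₃ (sum (mult -1ℤ n₁) (mult -1ℤ n₂)))) (mult k₃ n₂))) }
      where
      k₁ = proj₁ (form-primitive F)
      k₂ = proj₁ (proj₂ (form-primitive F))
      k₃ = proj₁ (proj₂ (proj₂ (form-primitive F)))
      rep : ∀ i j r → Q F i j ≡ r → Combination (L F) (a F * r)
      rep i j r e = combination-≡ (trans (nrm-vec F i j) (cong (_*_ (a F)) e)) (norm {v = vec F i j} (L-vec F i j))
      n₁ : Combination (L F) (a F * a F)
      n₁ = rep 1ℤ 0ℤ (a F) (lem (a F) (b F) (c F))
        where
        lem : ∀ a b c → a * (1ℤ * 1ℤ) + b * (1ℤ * 0ℤ) + c * (0ℤ * 0ℤ) ≡ a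
        lem = solve-∀
      n₂ : Combination (L F) (a F * c F)
      n₂ = rep 0ℤ 1ℤ (c F) (lem (a F) (b F) (c F))
        where
        lem : ∀ a b c → a * (0ℤ * 0ℤ) + b * (0ℤ * 1ℤ) + c * (1ℤ * 1ℤ) ≡ c
        lem = solve-∀
      n₃ : Combination (L F) (a F * (a F + b F + c F))
      n₃ = rep 1ℤ 1ℤ (a F + b F + c F) (lem (a F) (b F) (c F))
        where
        lem : ∀ a b c → a * (1ℤ * 1ℤ) + b * (1ℤ * 1ℤ) + c * (1ℤ * 1ℤ) ≡ a + b + c
        lem = solve-∀
      total : k₁ * (a F * a F) + (k₂ * (a F * (a F + b F + c F) + (-1ℤ * (a F * a F) + -1ℤ * (a F * c F))) + k₃ * (a F * c F)) ≡ a F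
      total = trans (lem k₁ k₂ k₃ (a F) (b F) (c F)) (trans (cong (_*_ (a F)) (proj₂ (proj₂ (proj₂ (form-primitive F))))) (*-identityʳ (a F)))
        where
        lem : ∀ k₁ k₂ k₃ a b c → k₁ * (a * a) + (k₂ * (a * (a + b + c) + (-1ℤ * (a * a) + -1ℤ * (a * c))) + k₃ * (a * c))
          ≡ a * (k₁ * a + k₂ * b + k₃ * c)
        lem = solve-∀

    -- θL ⊆ 𝔭L contributes p·t·a and pL contributes p²·a.
    scaled-θ : ∀ {p} (pp : Prime p) θ t → nrm θ ≡ + p * t → ∀ F {e} →
      Combination (L F) e → Combination (Over pp (conj θ) (L F)) (nrm θ * e)
    scaled-θ {p} pp θ t nrm≡ F (norm {v} l) = combination-≡ (nrm-⊛ θ v) (norm {v = θ ⊛ v} (closed-⊛ (L-ideal F) θ {v} l ,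
      t • v , closed-• (L-ideal F) t {v} l , trans (conj-⊛-⊛ θ v) (trans (cong (_• v) nrm≡) (sym (•-assoc (+ p) t v)))))
    scaled-θ pp θ t nrm≡ F (sum {a} {b} x y) = combination-≡ (sym (*-distribˡ-+ (nrm θ) a b))
      (sum (scaled-θ pp θ t nrm≡ F x) (scaled-θ pp θ t nrm≡ F y))
    scaled-θ pp θ t nrm≡ F (mult k {a} x) = combination-≡ (lem k (nrm θ) a) (mult k (scaled-θ pp θ t nrm≡ F x))
      where
      lem : ∀ k n a → k * (n * a) ≡ n * (k * a)
      lem = solve-∀

    scaled-p : ∀ {p} (pp : Prime p) η F {e} → Combination (L F) e → Combination (Over pp η (L F)) (+ p * + p * e)
    scaled-p {p} pp η F (norm {v} l) = combination-≡ (nrm-• (+ p) v) (norm {v = + p • v} (over-• pp η (L-ideal F) {v} l))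
    scaled-p {p} pp η F (sum {a} {b} x y) = combination-≡ (sym (*-distribˡ-+ (+ p * + p) a b)) (sum (scaled-p pp η F x) (scaled-p pp η F y))
    scaled-p {p} pp η F (mult k {a} x) = combination-≡ (lem k (+ p * + p) a) (mult k (scaled-p pp η F x))
      where
      lem : ∀ k n a → k * (n * a) ≡ n * (k * a)
      lem = solve-∀

    over-combination : ∀ {p} (pp : Prime p) θ t → nrm θ ≡ + p * t → ¬ (+ p ∣ t) → ∀ F →
      Combination (Over pp (conj θ) (L F)) (+ p * a F)
    over-combination {p} pp θ t nrm≡ p∤t F = combination-≡
        (total (+ p) t (a F) t⁻¹ k (nrm θ) nrm≡ (_∣_.equality (proj₂ (mod-inverse pp t p∤t))))
        (sum (mult t⁻¹ (scaled-θ pp θ t nrm≡ F (combination (form-content F))))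
             (mult (- k) (scaled-p pp (conj θ) F (combination (form-content F)))))
      where
      t⁻¹ = proj₁ (mod-inverse pp t p∤t)
      k = _∣_.quotient (proj₂ (mod-inverse pp t p∤t))
      total : ∀ p t a b k n → n ≡ p * t → t * b - 1ℤ ≡ k * p → b * (n * a) + - k * (p * p * a) ≡ p * a
      total p t a b k n refl e = trans (lem p t a b k) (trans (cong (λ r → p * a * (r - k * p + 1ℤ)) e) (lem′ (p * a) (k * p)))
        where
        lem : ∀ p t a b k → b * (p * t * a) + - k * (p * p * a) ≡ p * a * (t * b - 1ℤ - k * p + 1ℤ)
        lem = solve-∀
        lem′ : ∀ A r → A * (r - r + 1ℤ) ≡ A
        lem′ = solve-∀

    over-content : ∀ {p} (pp : Prime p) θ t → nrm θ ≡ + p * t → ¬ (+ p ∣ t) → ∀ F →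
      Content (Over pp (conj θ) (L F)) (+ p * a F)
    over-content {p} pp θ t nrm≡ p∤t F = record
      { nonneg = 0≤* {+ p} 0≤ℕ (<⇒≤ (0<a F))
      ; common = λ { {v} (l , y , ly , e) → common′ v y l ly e }
      ; combination = over-combination pp θ t nrm≡ p∤t F }
      where
      p≢0 : + p ≢ 0ℤ
      p≢0 e = ℕ.≢-nonZero⁻¹ p {{prime⇒nonZero pp}} (+-injective e)
      common″ : ∀ v y i j r → v ≡ vec F i j → nrm y ≡ r * a F → conj θ ⊛ v ≡ + p • y → + p * a F ∣ nrm v
      common″ v y i j r f g e = subst (+ p * a F ∣_) (sym nrmv≡) (subst (_∣ a F * Q F i j) (*-comm (a F) (+ p)) (*-monoʳ-∣ (a F) p∣Q))
        where
        nrmv≡ : nrm v ≡ a F * Q F i j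
        nrmv≡ = trans (cong nrm f) (nrm-vec F i j)
        norms : nrm θ * nrm v ≡ + p * + p * nrm y
        norms = trans (cong (_* nrm v) (sym (nrm-conj θ))) (trans (sym (nrm-⊛ (conj θ) v)) (trans (cong nrm e) (nrm-• (+ p) y)))
        cancelled : ∀ p a t Q r n n′ l → l ≡ p * t → n ≡ a * Q → n′ ≡ r * a → l * n ≡ p * p * n′ → p * a * (t * Q) ≡ p * a * (p * r)
        cancelled p a t Q r _ _ _ refl refl refl e = trans (lem₁ p a t Q) (trans e (lem₃ p r a))
          where
          lem₁ : ∀ p a t Q → p * a * (t * Q) ≡ p * t * (a * Q)
          lem₁ = solve-∀
          lem₃ : ∀ p r a → p * p * (r * a) ≡ p * a * (p * r)
          lem₃ = solve-∀
        tQ≡pr : t * Q F i j ≡ + p * r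
        tQ≡pr = *-cancelˡ-≢0 (+ p * a F) (product≢0 (+ p) (a F) p≢0 (a≢0 F))
          (cancelled (+ p) (a F) t (Q F i j) r (nrm v) (nrm y) (nrm θ) nrm≡ nrmv≡ g norms)
        p∣Q : + p ∣ Q F i j
        p∣Q = ∣-cancel pp t (Q F i j) p∤t (subst (+ p ∣_) (sym tQ≡pr) (∣m⇒∣m*n r ∣-refl))
      common′ : ∀ v y → L F v → L F y → conj θ ⊛ v ≡ + p • y → + p * a F ∣ nrm v
      common′ v y l ly e = common″ v y (proj₁ r) (proj₁ (proj₂ r)) (_∣_.quotient s) (proj₂ (proj₂ r)) (_∣_.equality s) e
        where
        r = vec-L F {v} l
        s : a F ∣ nrm y
        s = common (form-content F) {y} ly

square-bound : ∀ {a b} → 0ℤ ≤ b → a * a ≤ b * b → Bounded a b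
square-bound {a} {b} 0≤b le = bounded (≮⇒≥ lower) (≮⇒≥ upper)
  where
  upper : ¬ (b < a)
  upper b<a = <⇒≱ (<-from (b * d + b * d + b + b + d * d + d + d)
      (0≤+ (0≤+ (0≤+ (0≤+ (0≤+ (0≤+ (0≤* 0≤b 0≤d) (0≤* 0≤b 0≤d)) 0≤b) 0≤b) (0≤sq d)) 0≤d) 0≤d) (trans (cong (λ x → x * x) a≡) (lem b d))) le
    where
    d = a - b - 1ℤ
    0≤d = 0≤-< b<a
    a≡ : a ≡ b + d + 1ℤ
    a≡ = lem₀ a b
      where
      lem₀ : ∀ a b → a ≡ b + (a - b - 1ℤ) + 1ℤ
      lem₀ = solve-∀
    lem : ∀ b d → (b + d + 1ℤ) * (b + d + 1ℤ) ≡ b * b + 1ℤ + (b * d + b * d + b + b + d * d + d + d)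
    lem = solve-∀
  lower : ¬ (a < - b)
  lower a<-b = <⇒≱ (<-from (b * d + b * d + b + b + d * d + d + d)
      (0≤+ (0≤+ (0≤+ (0≤+ (0≤+ (0≤+ (0≤* 0≤b 0≤d) (0≤* 0≤b 0≤d)) 0≤b) 0≤b) (0≤sq d)) 0≤d) 0≤d) (trans (cong (λ x → x * x) a≡) (lem b d))) le
    where
    d = - b - a - 1ℤ
    0≤d = 0≤-< a<-b
    a≡ : a ≡ - (b + d + 1ℤ)
    a≡ = lem₀ a b
      where
      lem₀ : ∀ a b → a ≡ - (b + (- b - a - 1ℤ) + 1ℤ)
      lem₀ = solve-∀
    lem : ∀ b d → - (b + d + 1ℤ) * - (b + d + 1ℤ) ≡ b * b + 1ℤ + (b * d + b * d + b + b + d * d + d + d)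
    lem = solve-∀

ints : ℕ → List ℤ
ints R = map (λ k → + k - + R) (upTo (R ℕ.+ R))

ints-unique : ∀ R → Unique (ints R)
ints-unique R = Uniq.map⁺ (λ {x} {y} e → +-injective (trans (lem (+ x) (+ R)) (trans (cong (_+ + R) e) (sym (lem (+ y) (+ R)))))) (Uniq.upTo⁺ (R ℕ.+ R))
  where
  lem : ∀ x r → x ≡ x - r + r
  lem = solve-∀

∈-ints : ∀ {R z} → - + R ≤ z → z < + R → z ∈ ints R
∈-ints {R} {z} lo hi with z + + R in eq
... | + k = subst (_∈ ints R) (trans (cong (_- + R) (sym eq)) (lem z (+ R))) (∈-map⁺ (λ k → + k - + R) (∈-upTo⁺ k<))
  where
  lem : ∀ z r → z + r - r ≡ z
  lem = solve-∀
  k< : k ℕ.< R ℕ.+ R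
  k< = drop‿+<+ (subst₂ _<_ eq (sym (pos-+ R R)) (+-monoˡ-< (+ R) hi))
... | -[1+ k ] = ⊥-elim (≤⇒≯ (subst (0ℤ ≤_) (lem z (+ R)) (0≤- lo)) (subst (_< 0ℤ) (sym eq) -<+))
  where
  lem : ∀ z r → z - - r ≡ z + r
  lem = solve-∀

grid : ℕ → List (ℤ × ℤ)
grid R = cartesianProduct (ints R) (ints R)

grid-unique : ∀ R → Unique (grid R)
grid-unique R = Uniq.cartesianProduct⁺ (ints-unique R) (ints-unique R)

Fin-bound : ∀ {h} (f : Fin h → ℕ) → ∃ λ K → ∀ i → f i ℕ.≤ K
Fin-bound {zero} f = 0 , λ ()
Fin-bound {suc h} f with Fin-bound (f ∘ Fin.suc)
... | K , le = f Fin.zero ℕ.+ K , λ { Fin.zero → ℕP.m≤m+n (f Fin.zero) K ; (Fin.suc i) → ℕP.≤-trans (le i) (ℕP.m≤n+m K (f Fin.zero)) }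

module FormBounds (m : ℕ) where
  open Quad m
  open Form

  0<c : ∀ F → 0ℤ < c F
  0<c F = factor (subst (0ℤ <_) (sym (ac≡ F)) 0<norm)
    where
    0<norm : 0ℤ < x F * x F + x F + q
    0<norm = subst (0ℤ <_) (trans (nrm-def (x F) 1ℤ) (lem (x F) q)) (0<nrm {⟨ x F , 1ℤ ⟩} (λ ()))
      where
      lem : ∀ x q → x * x + x * 1ℤ + q * (1ℤ * 1ℤ) ≡ x * x + x + q
      lem = solve-∀
    factor : 0ℤ < a F * c F → 0ℤ < c F
    factor lt = *-cancelˡ-<-nonNeg (a F) {{nonNegative (<⇒≤ (0<a F))}} (subst (_< a F * c F) (sym (*-zeroʳ (a F))) lt)

  4aQ : ∀ F i j → + 4 * a F * Q F i j ≡ (+ 2 * a F * i + b F * j) * (+ 2 * a F * i + b F * j) + N * (j * j)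
  4aQ F i j = trans (lem (a F) (b F) (c F) i j) (cong (_+_ ((+ 2 * a F * i + b F * j) * (+ 2 * a F * i + b F * j)))
    (cong (_* (j * j)) (trans (cong (λ r → + 4 * r - b F * b F) (ac≡ F)) (lem′ (x F) q))))
    where
    lem : ∀ a b c i j → + 4 * a * (a * (i * i) + b * (i * j) + c * (j * j)) ≡ (+ 2 * a * i + b * j) * (+ 2 * a * i + b * j) + (+ 4 * (a * c) - b * b) * (j * j)
    lem = solve-∀
    lem′ : ∀ x q → + 4 * (x * x + x + q) - (+ 2 * x + 1ℤ) * (+ 2 * x + 1ℤ) ≡ + 4 * q - 1ℤ
    lem′ = solve-∀

  4cQ : ∀ F i j → + 4 * c F * Q F i j ≡ (+ 2 * c F * j + b F * i) * (+ 2 * c F * j + b F * i) + N * (i * i)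
  4cQ F i j = trans (lem (a F) (b F) (c F) i j) (cong (_+_ ((+ 2 * c F * j + b F * i) * (+ 2 * c F * j + b F * i)))
    (cong (_* (i * i)) (trans (cong (λ r → + 4 * r - b F * b F) (ac≡ F)) (lem′ (x F) q))))
    where
    lem : ∀ a b c i j → + 4 * c * (a * (i * i) + b * (i * j) + c * (j * j)) ≡ (+ 2 * c * j + b * i) * (+ 2 * c * j + b * i) + (+ 4 * (a * c) - b * b) * (i * i)
    lem = solve-∀
    lem′ : ∀ x q → + 4 * (x * x + x + q) - (+ 2 * x + 1ℤ) * (+ 2 * x + 1ℤ) ≡ + 4 * q - 1ℤ
    lem′ = solve-∀

  private
    -- z² ≤ N z² ≤ 4dQ ≤ (2dT)²
    bound : ∀ d z e V T → 0ℤ < d → + 4 * d * V ≡ e * e + N * (z * z) → V ≤ T * T → z * z ≤ (+ 2 * d * T) * (+ 2 * d * T)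
    bound d z e V T 0<d eq V≤ = ≤-from (e * e + (N - 0ℤ - 1ℤ) * (z * z) + + 4 * d * (T * T - V) + + 4 * d * (d - 0ℤ - 1ℤ) * (T * T))
      (0≤+ (0≤+ (0≤+ (0≤sq e) (0≤* (0≤-< 0<N) (0≤sq z))) (0≤* 0≤4d (0≤- V≤))) (0≤* (0≤* 0≤4d (0≤-< 0<d)) (0≤sq T)))
      (trans (lem₁ d T V) (trans (cong (λ r → r + + 4 * d * (T * T - V) + + 4 * d * (d - 0ℤ - 1ℤ) * (T * T)) eq) (lem₂ d T V e N z)))
      where
      0≤4d : 0ℤ ≤ + 4 * d
      0≤4d = 0≤* {+ 4} 0≤ℕ (<⇒≤ 0<d)
      lem₁ : ∀ d T V → (+ 2 * d * T) * (+ 2 * d * T) ≡ + 4 * d * V + + 4 * d * (T * T - V) + + 4 * d * (d - 0ℤ - 1ℤ) * (T * T)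
      lem₁ = solve-∀
      lem₂ : ∀ d T V e N z → e * e + N * (z * z) + + 4 * d * (T * T - V) + + 4 * d * (d - 0ℤ - 1ℤ) * (T * T)
        ≡ z * z + (e * e + (N - 0ℤ - 1ℤ) * (z * z) + + 4 * d * (T * T - V) + + 4 * d * (d - 0ℤ - 1ℤ) * (T * T))
      lem₂ = solve-∀

  boxBound : Form → ℤ
  boxBound F = + 2 * (a F + c F)

  Q-bound : ∀ F i j T → 0ℤ ≤ T → Q F i j ≤ T * T → Bounded i (boxBound F * T) × Bounded j (boxBound F * T)
  Q-bound F i j T 0≤T le =
    bounded-≤ (≤-from (+ 2 * a F * T) (0≤* (0≤* {+ 2} 0≤ℕ (<⇒≤ (0<a F))) 0≤T) (lem₁ (a F) (c F) T))
      (square-bound (0≤* (0≤* {+ 2} 0≤ℕ (<⇒≤ (0<c F))) 0≤T)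
        (bound (c F) i (+ 2 * c F * j + b F * i) (Q F i j) T (0<c F) (4cQ F i j) le)) ,
    bounded-≤ (≤-from (+ 2 * c F * T) (0≤* (0≤* {+ 2} 0≤ℕ (<⇒≤ (0<c F))) 0≤T) (lem₂ (a F) (c F) T))
      (square-bound (0≤* (0≤* {+ 2} 0≤ℕ (<⇒≤ (0<a F))) 0≤T)
        (bound (a F) j (+ 2 * a F * i + b F * j) (Q F i j) T (0<a F) (4aQ F i j) le))
    where
    lem₁ : ∀ a c T → + 2 * (a + c) * T ≡ + 2 * c * T + + 2 * a * T
    lem₁ = solve-∀
    lem₂ : ∀ a c T → + 2 * (a + c) * T ≡ + 2 * a * T + + 2 * c * T
    lem₂ = solve-∀

  0≤Q : ∀ F i j → 0ℤ ≤ Q F i j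
  0≤Q F i j = *-cancelˡ-≤-pos 0ℤ (Q F i j) (a F) {{positive (0<a F)}}
    (subst₂ _≤_ (sym (*-zeroʳ (a F))) (nrm-vec F i j) (0≤nrm (vec F i j)))

module Counting (m : ℕ) (1≤m : 1 ℕ.≤ m) (square-free : ∀ d → + d * + d ∣ Quad.N m → d ≡ 1)
  {h : ℕ} (reps : Representatives m h) where

  open Quad m
  open PrimeIdeals m
  open FormBounds m
  open Form
  open Similar
  open Representatives reps

  Point : Set
  Point = Fin h × (ℤ × ℤ)

  value : Point → ℤ
  value (i , (j , k)) = Q (F i) j k

  vector : Point → O
  vector (i , (j , k)) = vec (F i) j k

  radius : ℕ
  radius = proj₁ (Fin-bound (λ i → ∣ boxBound (F i) ∣))

  box : ℕ → List Point
  box R = cartesianProduct (allFin h) (grid R)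

  box-unique : ∀ R → Unique (box R)
  box-unique R = Uniq.cartesianProduct⁺ (Uniq.allFin⁺ h) (grid-unique R)

  0≤boxBound : ∀ i → 0ℤ ≤ boxBound (F i)
  0≤boxBound i = 0≤* {+ 2} 0≤ℕ (0≤+ (<⇒≤ (0<a (F i))) (<⇒≤ (0<c (F i))))

  value-bounded : ∀ i j k T → Q (F i) j k ≤ + T * + T → Bounded j (+ (radius ℕ.* T)) × Bounded k (+ (radius ℕ.* T))
  value-bounded i j k T le = bounded-≤ step (proj₁ r) , bounded-≤ step (proj₂ r)
    where
    r = Q-bound (F i) j k (+ T) 0≤ℕ le
    step : boxBound (F i) * + T ≤ + (radius ℕ.* T)
    step = subst (boxBound (F i) * + T ≤_) (sym (pos-* radius T))
      (*-mono {boxBound (F i)} {+ radius} {+ T} {+ T} (0≤boxBound i) 0≤ℕ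
        (subst (_≤ + radius) (0≤i⇒+∣i∣≡i (0≤boxBound i)) (+≤+ (proj₂ (Fin-bound (λ i → ∣ boxBound (F i) ∣)) i))) ≤-refl)

  ∈-box : ∀ {R T} v → radius ℕ.* T ℕ.< R → value v ≤ + T * + T → v ∈ box R
  ∈-box {R} {T} (i , (j , k)) lt le = ∈-cartesianProduct⁺ (∈-allFin i) (∈-cartesianProduct⁺ (inside (proj₁ r)) (inside (proj₂ r)))
    where
    r = value-bounded i j k T le
    inside : ∀ {z} → Bounded z (+ (radius ℕ.* T)) → z ∈ ints R
    inside (bounded lo hi) = ∈-ints (≤-trans (neg-mono-≤ (+≤+ (ℕP.<⇒≤ lt))) lo) (≤-<-trans hi (+<+ lt))

  solutions : ℕ → List Point
  solutions n = filter (λ v → value v ≟ + n) (box (suc (radius ℕ.* n)))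

  solutions-unique : ∀ n → Unique (solutions n)
  solutions-unique n = Uniq.filter⁺ _ (box-unique (suc (radius ℕ.* n)))

  ∈-solutions⁺ : ∀ {n} v → value v ≡ + n → v ∈ solutions n
  ∈-solutions⁺ {n} v e = ∈-filter⁺ (λ v → value v ≟ + n) (∈-box {T = n} v ℕP.≤-refl (subst (_≤ + n * + n) (sym e) (n≤n*n n))) e
    where
    n≤n*n : ∀ n → + n ≤ + n * + n
    n≤n*n zero = ≤-refl
    n≤n*n (suc n) = +≤+ (ℕP.m≤m*n (suc n) (suc n))

  ∈-solutions⁻ : ∀ {n v} → v ∈ solutions n → value v ≡ + n
  ∈-solutions⁻ {n} v∈ = proj₂ (∈-filter⁻ (λ v → value v ≟ + n) {xs = box (suc (radius ℕ.* n))} v∈)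

  r : ℕ → ℤ
  r n = count (solutions n)

  vector-L : ∀ v → L (F (proj₁ v)) (vector v)
  vector-L (i , (j , k)) = L-vec (F i) j k

  nrm-vector : ∀ v → nrm (vector v) ≡ a (F (proj₁ v)) * value v
  nrm-vector (i , (j , k)) = nrm-vec (F i) j k

  point : ∀ i {v} → L (F i) v → Point
  point i {v} l = i , (proj₁ (vec-L (F i) {v} l) , proj₁ (proj₂ (vec-L (F i) {v} l)))

  vector-point : ∀ i {v} (l : L (F i) v) → vector (point i {v} l) ≡ v
  vector-point i {v} l = sym (proj₂ (proj₂ (vec-L (F i) {v} l)))

  vector-injective : ∀ {v v′} → proj₁ v ≡ proj₁ v′ → vector v ≡ vector v′ → v ≡ v′
  vector-injective {i , (j , k)} {_ , (j′ , k′)} refl e =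
    cong (i ,_) (cong₂ _,_ (proj₁ (vec-injective (F i) {j} {k} {j′} {k′} e)) (proj₂ (vec-injective (F i) {j} {k} {j′} {k′} e)))

  cancel-value : ∀ A B c d p z z′ e e′ → A ≢ 0ℤ → c ≢ 0ℤ → A * (p * c) ≡ B * d → e ≡ c * z → e′ ≡ d * z′ → A * e ≡ B * e′ → z ≡ p * z′
  cancel-value A B c d p z z′ _ _ A≢0 c≢0 h refl refl g = *-cancelˡ-≢0 (A * c) (product≢0 A c A≢0 c≢0)
    (trans (*-assoc A c z) (trans g (trans (sym (*-assoc B d z′)) (trans (cong (_* z′) (sym h)) (lem A c p z′)))))
    where
    lem : ∀ A c p z → A * (p * c) * z ≡ A * c * (p * z)
    lem = solve-∀

  nrm≡ : ∀ {α β x y} → α ⊛ x ≡ β ⊛ y → nrm α * nrm x ≡ nrm β * nrm y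
  nrm≡ {α} {β} {x} {y} e = trans (sym (nrm-⊛ α x)) (trans (cong nrm e) (nrm-⊛ β y))

  module Prime-step {p : ℕ} (pp : Prime p) where

    p≢0 : + p ≢ 0ℤ
    p≢0 e = ℕ.≢-nonZero⁻¹ p {{prime⇒nonZero pp}} (+-injective e)

    InOver : O → Point → Set
    InOver η v = Over pp η (L (F (proj₁ v))) (vector v)

    inOver? : ∀ η v → Dec (InOver η v)
    inOver? η v = mem? (over pp η (L-ideal (F (proj₁ v)))) (vector v)

    -- Multiplication by the prime ideal permutes the classes: σ i is the class of 𝔭̄ I_i.
    module Shift (η η′ : O)
      (content : ∀ G → Content (Over pp η (L G)) (+ p * a G))
      (ηη′ : ∀ I → Similar (Over pp η (Over pp η′ (mem I))) (mem I))
      (η′η : ∀ I → Similar (Over pp η′ (Over pp η (mem I))) (mem I)) where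

      reduceForm : ∀ ζ G → ∃ λ i → Similar (Over pp ζ (L G)) (L (F i))
      reduceForm ζ G = proj₁ rep , similar-trans (Hermite.form-similar (over pp ζ (L-ideal G))) (proj₂ rep)
        where
        rep = complete (Hermite.form (over pp ζ (L-ideal G)))

      abstract
        σ : Fin h → Fin h
        σ i = proj₁ (reduceForm η′ (F i))

        sim : ∀ i → Similar (Over pp η (L (F (σ i)))) (L (F i))
        sim i = similar-trans (over-similar pp η (similar-sym (proj₂ (reduceForm η′ (F i))))) (ηη′ (L-ideal (F i)))

      σ-injective : ∀ {i j} → σ i ≡ σ j → i ≡ j
      σ-injective {i} {j} e = distinct (similar-trans (similar-sym (sim i))
        (subst (λ k → Similar (Over pp η (L (F k))) (L (F j))) (sym e) (sim j)))

      σ-surjective : ∀ j → ∃ λ i → σ i ≡ j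
      σ-surjective j = i , distinct
          (similar-trans (similar-sym (η′η (L-ideal (F (σ i)))))
          (similar-trans (over-similar pp η′ (similar-trans (sim i) (similar-sym s)))
          (η′η (L-ideal (F j)))))
        where
        i = proj₁ (reduceForm η (F j))
        s = proj₂ (reduceForm η (F j))

      private
        pre : (v : Point) → ∃ λ y → Over pp η (L (F (σ (proj₁ v)))) y × α (sim (proj₁ v)) ⊛ y ≡ β (sim (proj₁ v)) ⊛ vector v
        pre v = from (sim (proj₁ v)) (vector-L v)

      ψ : Point → Point
      ψ v = point (σ (proj₁ v)) {proj₁ (pre v)} (proj₁ (proj₁ (proj₂ (pre v))))

      vector-ψ : ∀ v → vector (ψ v) ≡ proj₁ (pre v)
      vector-ψ v = vector-point (σ (proj₁ v)) {proj₁ (pre v)} (proj₁ (proj₁ (proj₂ (pre v))))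

      ψ-over : ∀ v → InOver η (ψ v)
      ψ-over v = subst (Over pp η (L (F (σ (proj₁ v))))) (sym (vector-ψ v)) (proj₁ (proj₂ (pre v)))

      ψ-equation : ∀ v → α (sim (proj₁ v)) ⊛ vector (ψ v) ≡ β (sim (proj₁ v)) ⊛ vector v
      ψ-equation v = trans (cong (α (sim (proj₁ v)) ⊛_) (vector-ψ v)) (proj₂ (proj₂ (pre v)))

      value-related : ∀ i v w → proj₁ v ≡ i → proj₁ w ≡ σ i → α (sim i) ⊛ vector w ≡ β (sim i) ⊛ vector v → value w ≡ + p * value v
      value-related i v w refl e eq = cancel-value (nrm (α (sim i))) (nrm (β (sim i))) (a (F (σ i))) (a (F i)) (+ p)
          (value w) (value v) (nrm (vector w)) (nrm (vector v))
          (pos-≢0 (0<nrm (α≢0 (sim i)))) (a≢0 (F (σ i)))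
          (content-similar (sim i) (content (F (σ i))) (form-content square-free (F i)))
          (trans (nrm-vector w) (cong (λ k → a (F k) * value w) e)) (nrm-vector v) (nrm≡ eq)

      ψ-value : ∀ v → value (ψ v) ≡ + p * value v
      ψ-value v = value-related (proj₁ v) v (ψ v) refl refl (ψ-equation v)

      ψ-injective : ∀ {v w} → ψ v ≡ ψ w → v ≡ w
      ψ-injective {v} {w} e = vector-injective i≡ (⊛-cancel (β≢0 (sim (proj₁ v)))
          (trans (sym (ψ-equation v)) (trans (cong (α (sim (proj₁ v)) ⊛_) (cong vector e))
            (subst (λ i → α (sim i) ⊛ vector (ψ w) ≡ β (sim i) ⊛ vector w) (sym i≡) (ψ-equation w)))))
        where
        i≡ : proj₁ v ≡ proj₁ w
        i≡ = σ-injective (cong proj₁ e)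

      ψ-surjective : ∀ w → InOver η w → ∃ λ v → ψ v ≡ w × value w ≡ + p * value v
      ψ-surjective w over-w = v , ψv≡w , value-related i v w refl (sym σi≡) (trans (proj₂ (proj₂ pre-w)) (cong (β (sim i) ⊛_) (sym (vector-point i {proj₁ pre-w} (proj₁ (proj₂ pre-w))))))
        where
        i = proj₁ (σ-surjective (proj₁ w))
        σi≡ : σ i ≡ proj₁ w
        σi≡ = proj₂ (σ-surjective (proj₁ w))
        pre-w : ∃ λ y → L (F i) y × α (sim i) ⊛ vector w ≡ β (sim i) ⊛ y
        pre-w = to (sim i) (subst (λ k → Over pp η (L (F k)) (vector w)) (sym σi≡) over-w)
        v : Point
        v = point i {proj₁ pre-w} (proj₁ (proj₂ pre-w))
        ψv≡w : ψ v ≡ w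
        ψv≡w = vector-injective σi≡ (⊛-cancel (α≢0 (sim i))
          (trans (ψ-equation v) (trans (cong (β (sim i) ⊛_) (vector-point i {proj₁ pre-w} (proj₁ (proj₂ pre-w)))) (sym (proj₂ (proj₂ pre-w))))))

      over-solutions : ℕ → List Point
      over-solutions n = filter (inOver? η) (solutions (p ℕ.* n))

      over-count : ∀ n → count (over-solutions n) ≡ r n
      over-count n = sym (count-bijection ψ (solutions-unique n) (Uniq.filter⁺ (inOver? η) (solutions-unique (p ℕ.* n)))
        (λ {v} v∈ → ∈-filter⁺ (inOver? η) (∈-solutions⁺ (ψ v) (trans (ψ-value v) (trans (cong (_*_ (+ p)) (∈-solutions⁻ v∈)) (sym (pos-* p n))))) (ψ-over v))
        (λ _ _ → ψ-injective)
        (λ {w} w∈ → let w∈′ , o = ∈-filter⁻ (inOver? η) {xs = solutions (p ℕ.* n)} w∈ ; v , e , f = ψ-surjective w o in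
          v , ∈-solutions⁺ v (*-cancelˡ-≢0 (+ p) p≢0 (trans (sym f) (trans (∈-solutions⁻ w∈′) (pos-* p n)))) , e))

    multiple : Point → Point
    multiple (i , (j , k)) = i , (+ p * j , + p * k)

    value-multiple : ∀ v → value (multiple v) ≡ + p * (+ p * value v)
    value-multiple (i , (j , k)) = lem (a (F i)) (b (F i)) (c (F i)) j k (+ p)
      where
      lem : ∀ a b c j k p → a * (p * j * (p * j)) + b * (p * j * (p * k)) + c * (p * k * (p * k)) ≡ p * (p * (a * (j * j) + b * (j * k) + c * (k * k)))
      lem = solve-∀

    multiple-injective : ∀ {v w} → multiple v ≡ multiple w → v ≡ w
    multiple-injective {i , (j , k)} {i′ , (j′ , k′)} e =
      cong₂ _,_ (cong proj₁ e) (cong₂ _,_ (*-cancelˡ-≢0 (+ p) p≢0 (cong (proj₁ ∘ proj₂) e)) (*-cancelˡ-≢0 (+ p) p≢0 (cong (proj₂ ∘ proj₂) e)))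

    vector-multiple : ∀ v → vector (multiple v) ≡ + p • vector v
    vector-multiple (i , (j , k)) = trans (cong₂ (vec (F i)) (*-comm (+ p) j) (*-comm (+ p) k)) (vec-• (F i) (+ p) j k)

    -- d is the number of solutions of value = p n that are multiples of p.
    data DivisibleCount (n : ℕ) (d : ℤ) : Set where
      divisible   : ∀ n′ → n ≡ p ℕ.* n′ → d ≡ r n′ → DivisibleCount n d
      indivisible : ¬ (p ℕD.∣ n) → d ≡ 0ℤ → DivisibleCount n d

    divisible-count : ∀ {n d} xs → Unique xs → (∀ {w} → w ∈ xs → value w ≡ + (p ℕ.* n) × ∃ λ v → multiple v ≡ w) →
      (∀ v → value (multiple v) ≡ + (p ℕ.* n) → multiple v ∈ xs) → DivisibleCount n d → count xs ≡ d
    divisible-count {n} xs ux sound full (divisible n′ n≡ refl) = sym (count-bijection multiple (solutions-unique n′) ux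
      (λ {v} v∈ → full v (trans (value-multiple v) (trans (cong (λ t → + p * (+ p * t)) (∈-solutions⁻ v∈)) pp*)))
      (λ _ _ → multiple-injective)
      (λ {w} w∈ → let e , v , f = sound w∈ in v ,
        ∈-solutions⁺ v (*-cancelˡ-≢0 (+ p) p≢0 (*-cancelˡ-≢0 (+ p) p≢0 (trans (sym (value-multiple v)) (trans (cong value f) (trans e (sym pp*)))))) , f))
      where
      pp* : + p * (+ p * + n′) ≡ + (p ℕ.* n)
      pp* = trans (cong (_*_ (+ p)) (sym (pos-* p n′))) (trans (sym (pos-* p (p ℕ.* n′))) (cong (λ k → + (p ℕ.* k)) (sym n≡)))
    divisible-count {n} xs ux sound full (indivisible p∤n refl) = count-empty xs (λ {w} w∈ →
      let e , v , f = sound w∈ in p∤n (∣⇒∣ᵤ (divides (value v)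
        (trans (*-cancelˡ-≢0 (+ p) p≢0 (trans (sym (pos-* p n)) (trans (sym e) (trans (sym (cong value f)) (value-multiple v))))) (*-comm (+ p) (value v))))))

    ∈-multiple : ∀ {w y} → L (F (proj₁ w)) y → vector w ≡ + p • y → ∃ λ v → multiple v ≡ w
    ∈-multiple {w} {y} l e = point (proj₁ w) {y} l , vector-injective refl
      (trans (vector-multiple (point (proj₁ w) {y} l)) (trans (cong (+ p •_) (vector-point (proj₁ w) {y} l)) (sym e)))

    -- A root of norm₁ modulo p with p ∥ norm₁ s.
    exact-root-ramified : ∀ s → + p ∣ norm₁ s → + p ∣ + 2 * s + 1ℤ → ∃ λ t → nrm ⟨ s , 1ℤ ⟩ ≡ + p * t × ¬ (+ p ∣ t)
    exact-root-ramified s (divides t e) p∣tr = t , trans (nrm-⟨s,1⟩ s) (trans e (*-comm t (+ p))) , p∤t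
      where
      p∤t : ¬ (+ p ∣ t)
      p∤t p∣t = ⊥-elim (¬prime[1] (subst Prime (square-free p p²∣N) pp))
        where
        *-∣-* : ∀ {i j k l} → i ∣ j → k ∣ l → i * k ∣ j * l
        *-∣-* {i} {k = k} (divides r refl) (divides s refl) = divides (r * s) (lem r s i k)
          where
          lem : ∀ r s i k → r * i * (s * k) ≡ r * s * (i * k)
          lem = solve-∀
        p²∣N : + p * + p ∣ N
        p²∣N = ∣-eq (lem s q) (∣m∣n⇒∣m-n (∣n⇒∣m*n (+ 4) (∣-eq (sym e) (*-∣-* p∣t ∣-refl))) (*-∣-* p∣tr p∣tr))
          where
          lem : ∀ s q → + 4 * (s * s + s + q) - (+ 2 * s + 1ℤ) * (+ 2 * s + 1ℤ) ≡ + 4 * q - 1ℤ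
          lem = solve-∀
    exact-root-split : ∀ s → + p ∣ norm₁ s → ¬ (+ p ∣ + 2 * s + 1ℤ) →
      ∃₂ λ s t → nrm ⟨ s , 1ℤ ⟩ ≡ + p * t × ¬ (+ p ∣ t) × ¬ (+ p ∣ + 2 * s + 1ℤ)
    exact-root-split s (divides t e) p∤tr = cases (+ p ∣? t)
      where
      cases : Dec (+ p ∣ t) → ∃₂ λ s t → nrm ⟨ s , 1ℤ ⟩ ≡ + p * t × ¬ (+ p ∣ t) × ¬ (+ p ∣ + 2 * s + 1ℤ)
      cases (no p∤t) = s , t , trans (nrm-⟨s,1⟩ s) (trans e (*-comm t (+ p))) , p∤t , p∤tr
      cases (yes p∣t) = s + + p , t + (+ 2 * s + 1ℤ) + + p ,
        trans (nrm-⟨s,1⟩ (s + + p)) (trans (lem s (+ p) q) (trans (cong (_+ + p * (+ 2 * s + 1ℤ + + p)) e) (lem′ s t (+ p)))) ,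
        (λ d → p∤tr (∣-eq (lem″ s t (+ p)) (∣m∣n⇒∣m-n d (∣m∣n⇒∣m+n p∣t ∣-refl)))) ,
        (λ d → p∤tr (∣-eq (lem‴ s (+ p)) (∣m∣n⇒∣m-n d (∣n⇒∣m*n (+ 2) ∣-refl))))
        where
        lem : ∀ s p q → (s + p) * (s + p) + (s + p) + q ≡ s * s + s + q + p * (+ 2 * s + 1ℤ + p)
        lem = solve-∀
        lem′ : ∀ s t p → t * p + p * (+ 2 * s + 1ℤ + p) ≡ p * (t + (+ 2 * s + 1ℤ) + p)
        lem′ = solve-∀
        lem″ : ∀ s t p → t + (+ 2 * s + 1ℤ) + p - (t + p) ≡ + 2 * s + 1ℤ
        lem″ = solve-∀
        lem‴ : ∀ s p → + 2 * (s + p) + 1ℤ - + 2 * p ≡ + 2 * s + 1ℤ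
        lem‴ = solve-∀

    module Root (s t : ℤ) (nrm≡pt : nrm ⟨ s , 1ℤ ⟩ ≡ + p * t) (p∤t : ¬ (+ p ∣ t)) where

      private
        θ : O
        θ = ⟨ s , 1ℤ ⟩

        content-conj : ∀ G → Content (Over pp (conj θ) (L G)) (+ p * a G)
        content-conj = over-content square-free pp θ t nrm≡pt p∤t

        content-θ : ∀ G → Content (Over pp θ (L G)) (+ p * a G)
        content-θ G = subst (λ η → Content (Over pp η (L G)) (+ p * a G)) (conj-conj θ)
          (over-content square-free pp (conj θ) t (trans (nrm-conj θ) nrm≡pt) p∤t G)

        module C = Shift (conj θ) θ content-conj (over-over-conj pp θ t nrm≡pt p∤t) (over-conj-over pp θ t nrm≡pt p∤t)
        module T = Shift θ (conj θ) content-θ (over-conj-over pp θ t nrm≡pt p∤t) (over-over-conj pp θ t nrm≡pt p∤t)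

        p∣norm₁ : + p ∣ norm₁ s
        p∣norm₁ = ∣-eq (nrm-⟨s,1⟩ s) (subst (+ p ∣_) (sym nrm≡pt) (∣m⇒∣m*n t ∣-refl))

        cover : ∀ {n w} → w ∈ solutions (p ℕ.* n) → InOver (conj θ) w ⊎ InOver θ w
        cover {n} {i , (j , k)} w∈ = norm-divisible⇒over (F i) pp s j k p∣norm₁
          (subst (+ p ∣_) (sym (trans (∈-solutions⁻ w∈) (pos-* p n))) (∣m⇒∣m*n (+ n) ∣-refl))

      ramified-step : + p ∣ + 2 * s + 1ℤ → ∀ n → r (p ℕ.* n) ≡ r n
      ramified-step p∣tr n = trans (sym (count-bijection (λ w → w) (Uniq.filter⁺ (inOver? (conj θ)) (solutions-unique (p ℕ.* n))) (solutions-unique (p ℕ.* n))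
          (λ w∈ → proj₁ (∈-filter⁻ (inOver? (conj θ)) {xs = solutions (p ℕ.* n)} w∈)) (λ _ _ e → e)
          (λ {w} w∈ → w , ∈-filter⁺ (inOver? (conj θ)) w∈ (all w (cover {n} w∈)) , refl)))
        (C.over-count n)
        where
        all : ∀ w → InOver (conj θ) w ⊎ InOver θ w → InOver (conj θ) w
        all w (inj₁ o) = o
        all w (inj₂ o) = over-ramified pp s (L-ideal (F (proj₁ w))) p∣tr {vector w} o

      split-step : ¬ (+ p ∣ + 2 * s + 1ℤ) → ∀ n {d} → DivisibleCount n d → r (p ℕ.* n) ≡ r n + r n - d
      split-step p∤tr n {d} D = trans (count-cover (inOver? (conj θ)) (inOver? θ) (solutions (p ℕ.* n)) (λ {w} w∈ → cover {n} w∈))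
        (cong₂ _-_ (cong₂ _+_ (C.over-count n) (T.over-count n))
          (divisible-count (filter both? (solutions (p ℕ.* n))) (Uniq.filter⁺ both? (solutions-unique (p ℕ.* n))) sound full D))
        where
        both? : ∀ w → Dec (InOver (conj θ) w × InOver θ w)
        both? w = inOver? (conj θ) w ×-dec inOver? θ w
        sound : ∀ {w} → w ∈ filter both? (solutions (p ℕ.* n)) → value w ≡ + (p ℕ.* n) × ∃ λ v → multiple v ≡ w
        sound {w} w∈ = ∈-solutions⁻ (proj₁ split-w) , ∈-multiple {w} {proj₁ o} (proj₁ (proj₂ o)) (proj₂ (proj₂ o))
          where
          split-w = ∈-filter⁻ both? {xs = solutions (p ℕ.* n)} w∈
          o = over-both pp s (L-ideal (F (proj₁ w))) p∤tr {vector w} (proj₁ (proj₂ split-w)) (proj₂ (proj₂ split-w))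
        full : ∀ v → value (multiple v) ≡ + (p ℕ.* n) → multiple v ∈ filter both? (solutions (p ℕ.* n))
        full v e = ∈-filter⁺ both? (∈-solutions⁺ (multiple v) e) (over-multiple (conj θ) , over-multiple θ)
          where
          over-multiple : ∀ η → InOver η (multiple v)
          over-multiple η = subst (Over pp η (L (F (proj₁ v)))) (sym (vector-multiple v)) (over-• pp η (L-ideal (F (proj₁ v))) {vector v} (vector-L v))

    inert-step : (∀ s → ¬ (+ p ∣ norm₁ s)) → ∀ n {d} → DivisibleCount n d → r (p ℕ.* n) ≡ d
    inert-step none n = divisible-count (solutions (p ℕ.* n)) (solutions-unique (p ℕ.* n)) sound (λ v → ∈-solutions⁺ (multiple v))
      where
      sound : ∀ {w} → w ∈ solutions (p ℕ.* n) → value w ≡ + (p ℕ.* n) × ∃ λ v → multiple v ≡ w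
      sound {i , (j , k)} w∈ = ∈-solutions⁻ w∈ , found (inert⇒divisible (F i) pp none j k
          (subst (+ p ∣_) (sym (trans (∈-solutions⁻ w∈) (pos-* p n))) (∣m⇒∣m*n (+ n) ∣-refl)))
        where
        found : (+ p ∣ j) × (+ p ∣ k) → ∃ λ v → multiple v ≡ (i , (j , k))
        found (divides j′ ej , divides k′ ek) = (i , (j′ , k′)) , cong (i ,_) (cong₂ _,_ (trans (*-comm (+ p) j′) (sym ej)) (trans (*-comm (+ p) k′) (sym ek)))

  opaque
    unfolding _⊛_
    conj-vec-⊛-vec : ∀ G i j k l →
      conj (vec G i j) ⊛ vec G k l ≡ a G • ⟨ i * k * a G + i * l * x G + j * k * (x G + 1ℤ) + j * l * c G , i * l - j * k ⟩
    conj-vec-⊛-vec G i j k l = cong₂ ⟨_,_⟩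
      (trans (lem₁ q i j k l (a G) (x G)) (trans (cong (λ t → a G * (i * k * a G + i * l * x G + j * k * (x G + 1ℤ)) + j * l * t) (sym (ac≡ G))) (lem₂ i j k l (a G) (x G) (c G))))
      (lem₃ i j k l (a G) (x G))
      where
      lem₁ : ∀ q i j k l a x → (i * a + j * x + j) * (k * a + l * x) - q * (- j * l)
        ≡ a * (i * k * a + i * l * x + j * k * (x + 1ℤ)) + j * l * (x * x + x + q)
      lem₁ = solve-∀
      lem₂ : ∀ i j k l a x c → a * (i * k * a + i * l * x + j * k * (x + 1ℤ)) + j * l * (a * c) ≡ a * (i * k * a + i * l * x + j * k * (x + 1ℤ) + j * l * c)
      lem₂ = solve-∀
      lem₃ : ∀ i j k l a x → (i * a + j * x + j) * l + - j * (k * a + l * x) + - j * l ≡ a * (i * l - j * k)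
      lem₃ = solve-∀

  private
    F₀ : Form
    F₀ = record { a = 1ℤ ; x = 0ℤ ; c = q ; 0<a = +<+ (ℕ.s≤s ℕ.z≤n) ; ac≡ = lem q }
      where
      lem : ∀ q → 1ℤ * q ≡ 0ℤ * 0ℤ + 0ℤ + q
      lem = solve-∀

    L-F₀ : ∀ v → L F₀ v
    L-F₀ v = divides (u v - w v * 0ℤ) (sym (*-identityʳ (u v - w v * 0ℤ)))

    i₀ : Fin h
    i₀ = proj₁ (complete F₀)

    s₀ : Similar (L F₀) (L (F i₀))
    s₀ = proj₂ (complete F₀)

    -1ₒ : O
    -1ₒ = ⟨ -1ℤ , 0ℤ ⟩

    units : List O
    units = 1ₒ ∷ -1ₒ ∷ []

    units-unique : Unique units
    units-unique = ((λ ()) ∷ []) ∷ ([] ∷ [])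

    unit-nrm : ∀ {v} → v ∈ units → nrm v ≡ 1ℤ
    unit-nrm (here refl) = trans (nrm-def 1ℤ 0ℤ) (lem q)
      where
      lem : ∀ q → 1ℤ * 1ℤ + 1ℤ * 0ℤ + q * (0ℤ * 0ℤ) ≡ 1ℤ
      lem = solve-∀
    unit-nrm (there (here refl)) = trans (nrm-def -1ℤ 0ℤ) (lem q)
      where
      lem : ∀ q → -1ℤ * -1ℤ + -1ℤ * 0ℤ + q * (0ℤ * 0ℤ) ≡ 1ℤ
      lem = solve-∀

    5≤N : + 5 ≤ N
    5≤N = ≤-from (+ 4 * (+ m - 1ℤ) + + 2) (0≤+ (0≤* {+ 4} 0≤ℕ (0≤- (+≤+ 1≤m))) 0≤ℕ) (trans (cong (λ t → + 4 * t - 1ℤ) (pos-+ 1 m)) (lem (+ m)))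
      where
      lem : ∀ m → + 4 * (1ℤ + m) - 1ℤ ≡ + 5 + (+ 4 * (m - 1ℤ) + + 2)
      lem = solve-∀

    square≥1 : ∀ z → z ≢ 0ℤ → 1ℤ ≤ z * z
    square≥1 z z≢0 = i<j⇒suc[i]≤j (≤∧≢⇒< (0≤sq z) (λ e → z≢0 (square-0 (sym e))))

    nrm-1⇒w : ∀ y z → nrm ⟨ y , z ⟩ ≡ 1ℤ → z ≡ 0ℤ
    nrm-1⇒w y z e with z ≟ 0ℤ
    ... | yes z≡0 = z≡0
    ... | no z≢0 = ⊥-elim (<⇒≱ {+ 4} {N * (z * z)} (<-≤-trans (+<+ ℕP.≤-refl) (≤-trans 5≤N
          (≤-from (N * (z * z - 1ℤ)) (0≤* (<⇒≤ 0<N) (0≤- (square≥1 z z≢0))) (lem N (z * z)))))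
        (≤-from ((+ 2 * y + z) * (+ 2 * y + z)) (0≤sq (+ 2 * y + z))
          (trans (cong (_*_ (+ 4)) (sym e)) (trans (4nrm y z) (+-comm ((+ 2 * y + z) * (+ 2 * y + z)) (N * (z * z)))))))
      where
      lem : ∀ N t → N * t ≡ N + N * (t - 1ℤ)
      lem = solve-∀

    nrm-1⇒unit : ∀ v → nrm v ≡ 1ℤ → v ∈ units
    nrm-1⇒unit ⟨ y , z ⟩ e = signs (i*j≡0⇒i≡0∨j≡0 (y - 1ℤ) (trans (lem y) (cong (_- 1ℤ) y²≡1)))
      where
      z≡0 = nrm-1⇒w y z e
      y²≡1 : y * y ≡ 1ℤ
      y²≡1 = trans (lem q y) (trans (cong (λ z → y * y + y * z + q * (z * z)) (sym z≡0)) (trans (sym (nrm-def y z)) e))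
        where
        lem : ∀ q y → y * y ≡ y * y + y * 0ℤ + q * (0ℤ * 0ℤ)
        lem = solve-∀
      lem : ∀ y → (y - 1ℤ) * (y + 1ℤ) ≡ y * y - 1ℤ
      lem = solve-∀
      signs : y - 1ℤ ≡ 0ℤ ⊎ y + 1ℤ ≡ 0ℤ → ⟨ y , z ⟩ ∈ units
      signs (inj₁ e) = here (cong₂ ⟨_,_⟩ (i-j≡0⇒i≡j y 1ℤ e) z≡0)
      signs (inj₂ e) = there (here (cong₂ ⟨_,_⟩ (i-j≡0⇒i≡j y -1ℤ e) z≡0))

    principal : ∀ v → value v ≡ 1ℤ → Similar (L F₀) (L (F (proj₁ v)))
    principal v e = record { α = vector v ; β = 1ₒ ; α≢0 = y≢0 ; β≢0 = λ ()
      ; to = λ {z} _ → vector v ⊛ z , subst (L (F i)) (⊛-comm z (vector v)) (closed-⊛ (L-ideal (F i)) z {vector v} (vector-L v)) , sym (1ₒ-⊛ (vector v ⊛ z))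
      ; from = λ {z} l → quotient′ z l , L-F₀ (quotient′ z l) , trans (•-cancel (a (F i)) (a≢0 (F i)) (equation z l)) (sym (1ₒ-⊛ z)) }
      where
      i = proj₁ v
      nrm≡a : nrm (vector v) ≡ a (F i)
      nrm≡a = trans (nrm-vector v) (trans (cong (_*_ (a (F i))) e) (*-identityʳ (a (F i))))
      y≢0 : vector v ≢ 0ₒ
      y≢0 e = a≢0 (F i) (trans (sym nrm≡a) (trans (cong nrm e) nrm-0ₒ))
      divide : ∀ z → L (F i) z → ∃ λ t → conj (vector v) ⊛ z ≡ a (F i) • t
      divide z l = _ , trans (cong (conj (vector v) ⊛_) (proj₂ (proj₂ (vec-L (F i) {z} l))))
        (conj-vec-⊛-vec (F i) (proj₁ (proj₂ v)) (proj₂ (proj₂ v)) (proj₁ (vec-L (F i) {z} l)) (proj₁ (proj₂ (vec-L (F i) {z} l))))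
      quotient′ : ∀ z → L (F i) z → O
      quotient′ z l = proj₁ (divide z l)
      equation : ∀ z l → a (F i) • (vector v ⊛ quotient′ z l) ≡ a (F i) • z
      equation z l = trans (sym (⊛-• (vector v) (a (F i)) (quotient′ z l))) (trans (cong (vector v ⊛_) (sym (proj₂ (divide z l))))
        (trans (⊛-swap (vector v) (conj (vector v)) z) (trans (conj-⊛-⊛ (vector v) z) (cong (_• z) nrm≡a))))

    image : O → Point
    image v = point i₀ {proj₁ (to s₀ {v} (L-F₀ v))} (proj₁ (proj₂ (to s₀ {v} (L-F₀ v))))

    image-equation : ∀ v → α s₀ ⊛ v ≡ β s₀ ⊛ vector (image v)
    image-equation v = trans (proj₂ (proj₂ (to s₀ {v} (L-F₀ v)))) (cong (β s₀ ⊛_) (sym (vector-point i₀ {proj₁ (to s₀ {v} (L-F₀ v))} (proj₁ (proj₂ (to s₀ {v} (L-F₀ v)))))))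

    image-nrm : ∀ v z → proj₁ z ≡ i₀ → α s₀ ⊛ v ≡ β s₀ ⊛ vector z → nrm v ≡ value z
    image-nrm v z refl e = trans (cancel-value (nrm (α s₀)) (nrm (β s₀)) 1ℤ (a (F i₀)) 1ℤ (nrm v) (value z) (nrm v) (nrm (vector z))
      (pos-≢0 (0<nrm (α≢0 s₀))) (λ ())
      (trans (cong (_*_ (nrm (α s₀))) (*-identityˡ 1ℤ)) (content-similar s₀ (form-content square-free F₀) (form-content square-free (F i₀))))
      (sym (*-identityˡ (nrm v))) (nrm-vector z) (nrm≡ e)) (*-identityˡ (value z))

  r-1 : r 1 ≡ + 2
  r-1 = sym (count-bijection image units-unique (solutions-unique 1)
    (λ {v} v∈ → ∈-solutions⁺ (image v) (trans (sym (image-nrm v (image v) refl (image-equation v))) (unit-nrm v∈)))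
    (λ {v} {v′} _ _ e → ⊛-cancel (α≢0 s₀) (trans (image-equation v) (trans (cong (λ z → β s₀ ⊛ vector z) e) (sym (image-equation v′)))))
    onto)
    where
    onto : ∀ {z} → z ∈ solutions 1 → ∃ λ v → v ∈ units × image v ≡ z
    onto {z} z∈ = v , nrm-1⇒unit v (trans (image-nrm v z (sym i≡) e) (∈-solutions⁻ z∈)) ,
        vector-injective i≡ (⊛-cancel (β≢0 s₀) (trans (sym (image-equation v)) e))
      where
      i≡ : i₀ ≡ proj₁ z
      i≡ = distinct (similar-trans (similar-sym s₀) (principal z (∈-solutions⁻ z∈)))
      pre : ∃ λ v → L F₀ v × α s₀ ⊛ v ≡ β s₀ ⊛ vector z
      pre = from s₀ (subst (λ i → L (F i) (vector z)) (sym i≡) (vector-L z))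
      v = proj₁ pre
      e = proj₂ (proj₂ pre)

divisors : ℕ → List ℕ
divisors n = filter (ℕD._∣? n) (applyUpTo suc n)

divisors-unique : ∀ n → Unique (divisors n)
divisors-unique n = Uniq.filter⁺ (ℕD._∣? n) (Uniq.applyUpTo⁺₁ suc n (λ i<j _ e → ℕP.<-irrefl (ℕP.suc-injective e) i<j))

∈-divisors⁺ : ∀ {n d} → 1 ℕ.≤ n → d ℕD.∣ n → d ∈ divisors n
∈-divisors⁺ {suc n} {zero} _ d = ⊥-elim (ℕP.1+n≢0 (ℕD.0∣⇒≡0 d))
∈-divisors⁺ {suc n} {suc d} _ d∣n = ∈-filter⁺ (ℕD._∣? suc n) (∈-applyUpTo⁺ suc (ℕD.∣⇒≤ d∣n)) d∣n

∈-divisors⁻ : ∀ {n d} → d ∈ divisors n → d ℕD.∣ n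
∈-divisors⁻ {n} d∈ = proj₂ (∈-filter⁻ (ℕD._∣? n) {xs = applyUpTo suc n} d∈)

prime-factor : ∀ n → 2 ℕ.≤ n → ∃₂ λ p n₁ → Prime p × n ≡ p ℕ.* n₁
prime-factor n@(suc (suc _)) _ = go (factorise n)
  where
  go : PrimeFactorisation n → ∃₂ λ p n₁ → Prime p × n ≡ p ℕ.* n₁
  go f with PrimeFactorisation.factors f | PrimeFactorisation.isFactorisation f | PrimeFactorisation.factorsPrime f
  ... | p ∷ ps | e | pp ∷ _ = p , product ps , pp , e
prime-factor (suc zero) (ℕ.s≤s ())

module DivisorSums (m : ℕ) where
  open Char m

  ρ : ℕ → ℤ
  ρ n = sumL χ (divisors n)

  χ-1 : χ 1 ≡ 1ℤ
  χ-1 = trans (χ-prodL 1) (ones primes (λ q∈ → q∈))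
    where
    1^ : ∀ k → 1ℤ ^ k ≡ 1ℤ
    1^ zero = refl
    1^ (suc k) = trans (*-identityˡ (1ℤ ^ k)) (1^ k)
    ones : ∀ xs → (∀ {q} → q ∈ xs → q ∈ primes) → prodL (legendre 1) xs ≡ 1ℤ
    ones [] _ = refl
    ones (q ∷ xs) sub = trans (cong₂ _*_
        (OddPrime.legendre-char k (is-prime q∈) (proj₂ (halves q∈)) 1 (inj₂ (inj₁ refl)) (subst (λ y → + q ∣ 1ℤ - y) (sym (1^ k)) (∣-sub-refl 1ℤ)))
        (ones xs (λ z → sub (there z)))) refl
      where
      q∈ = sub (here refl)
      k = proj₁ (halves q∈)

  module _ {p : ℕ} (pp : Prime p) where

    private instance
      p-nonZero : NonZero p
      p-nonZero = prime⇒nonZero pp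

    data DivisibleSum (n : ℕ) (d : ℤ) : Set where
      divisible   : ∀ n′ → 1 ℕ.≤ n′ → n ≡ p ℕ.* n′ → d ≡ ρ n′ → DivisibleSum n d
      indivisible : ¬ (p ℕD.∣ n) → d ≡ 0ℤ → DivisibleSum n d

    private
      multiples : ∀ n′ {xs} → 1 ℕ.≤ n′ → Unique xs → (∀ {d} → d ∈ xs → p ℕD.∣ d × d ℕD.∣ p ℕ.* n′) →
        (∀ {d} → d ℕD.∣ n′ → p ℕ.* d ∈ xs) → sumL χ xs ≡ χ p * ρ n′
      multiples n′ {xs} 1≤n′ ux sound full = trans (sym (sumL-bijection χ (p ℕ.*_) (divisors-unique n′) ux
          (λ d∈ → full (∈-divisors⁻ d∈)) (λ {d} {d′} _ _ e → ℕP.*-cancelˡ-≡ d d′ p e)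
          (λ {d} d∈ → onto d (proj₁ (sound d∈)) (proj₂ (sound d∈)))))
        (trans (sumL-cong (divisors n′) (λ {d} _ → χ-* p d)) (sumL-* (χ p) χ (divisors n′)))
        where
        onto : ∀ d → p ℕD.∣ d → d ℕD.∣ p ℕ.* n′ → ∃ λ d′ → d′ ∈ divisors n′ × p ℕ.* d′ ≡ d
        onto _ (ℕD.divides k refl) d∣ = k , ∈-divisors⁺ 1≤n′ (ℕD.*-cancelˡ-∣ p (subst (ℕD._∣ p ℕ.* n′) (ℕP.*-comm k p) d∣)) , ℕP.*-comm p k

    ρ-recursion : ∀ n {d} → 1 ℕ.≤ n → DivisibleSum n d → ρ (p ℕ.* n) ≡ ρ n + χ p * ρ n - χ p * d
    ρ-recursion n {d} 1≤n D = trans (sumL-cover χ (ℕD._∣? n) (p ℕD.∣?_) (divisors (p ℕ.* n)) cover)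
      (cong₂ _-_ (cong₂ _+_ left right) (both D))
      where
      1≤pn : 1 ℕ.≤ p ℕ.* n
      1≤pn = ℕP.*-mono-≤ (ℕ.>-nonZero⁻¹ p) 1≤n
      cover : ∀ {d} → d ∈ divisors (p ℕ.* n) → d ℕD.∣ n ⊎ p ℕD.∣ d
      cover {d} d∈ with p ℕD.∣? d
      ... | yes p∣d = inj₂ p∣d
      ... | no p∤d = inj₁ (coprime-divisor {d} {p} {n} coprime (∈-divisors⁻ d∈))
        where
        coprime : Coprimality.Coprime d p
        coprime {e} (e∣d , e∣p) with prime⇒irreducible pp e∣p
        ... | inj₁ e≡1 = e≡1
        ... | inj₂ refl = ⊥-elim (p∤d e∣d)
      left : sumL χ (filter (ℕD._∣? n) (divisors (p ℕ.* n))) ≡ ρ n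
      left = sumL-bijection χ (λ d → d) (Uniq.filter⁺ (ℕD._∣? n) (divisors-unique (p ℕ.* n))) (divisors-unique n)
        (λ d∈ → ∈-divisors⁺ 1≤n (proj₂ (∈-filter⁻ (ℕD._∣? n) {xs = divisors (p ℕ.* n)} d∈))) (λ _ _ e → e)
        (λ {d} d∈ → d , ∈-filter⁺ (ℕD._∣? n) (∈-divisors⁺ 1≤pn (ℕD.∣n⇒∣m*n p (∈-divisors⁻ d∈))) (∈-divisors⁻ d∈) , refl)
      right : sumL χ (filter (p ℕD.∣?_) (divisors (p ℕ.* n))) ≡ χ p * ρ n
      right = multiples n 1≤n (Uniq.filter⁺ (p ℕD.∣?_) (divisors-unique (p ℕ.* n)))
        (λ d∈ → let d∈′ , p∣d = ∈-filter⁻ (p ℕD.∣?_) {xs = divisors (p ℕ.* n)} d∈ in p∣d , ∈-divisors⁻ d∈′)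
        (λ {d} d∣n → ∈-filter⁺ (p ℕD.∣?_) (∈-divisors⁺ 1≤pn (ℕD.*-monoʳ-∣ p d∣n)) (ℕD.m∣m*n d))
      both? : ∀ d → Dec (d ℕD.∣ n × p ℕD.∣ d)
      both? d = (d ℕD.∣? n) ×-dec (p ℕD.∣? d)
      both : DivisibleSum n d → sumL χ (filter both? (divisors (p ℕ.* n))) ≡ χ p * d
      both (divisible n′ 1≤n′ n≡ refl) = multiples n′ 1≤n′ (Uniq.filter⁺ both? (divisors-unique (p ℕ.* n)))
        (λ {d} d∈ → let _ , d∣n , p∣d = ∈-filter⁻ both? {xs = divisors (p ℕ.* n)} d∈ in p∣d , subst (d ℕD.∣_) n≡ d∣n)
        (λ {d} d∣n′ → let pd∣n = subst (p ℕ.* d ℕD.∣_) (sym n≡) (ℕD.*-monoʳ-∣ p d∣n′) in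
          ∈-filter⁺ both? (∈-divisors⁺ 1≤pn (ℕD.∣n⇒∣m*n p pd∣n)) (pd∣n , ℕD.m∣m*n d))
      both (indivisible p∤n refl) = trans (sumL-empty χ (filter both? (divisors (p ℕ.* n)))
        (λ {d} d∈ → let _ , d∣n , p∣d = ∈-filter⁻ both? {xs = divisors (p ℕ.* n)} d∈ in p∤n (ℕD.∣-trans p∣d d∣n))) (sym (*-zeroʳ (χ p)))

module Representations (m : ℕ) (1≤m : 1 ℕ.≤ m) (square-free : ∀ d → + d * + d ∣ Quad.N m → d ≡ 1)
  {h : ℕ} (reps : Representatives m h) where

  open Char m
  open DivisorSums m
  open Counting m 1≤m square-free reps using (r; r-1; module Prime-step)

  r-recursion : ∀ {p} (pp : Prime p) n {d} → Prime-step.DivisibleCount pp n d → r (p ℕ.* n) ≡ r n + χ p * r n - χ p * d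
  r-recursion {p} pp n {d} D = go (splitting pp)
    where
    open Prime-step pp
    go : Splitting p → r (p ℕ.* n) ≡ r n + χ p * r n - χ p * d
    go (split e s p∣ p∤tr) = trans (Root.split-step s′ t nrm≡ p∤t p∤tr′ n D) (trans (lem (r n) d) (cong (λ c → r n + c * r n - c * d) (sym e)))
      where
      root = exact-root-split s p∣ p∤tr
      s′ = proj₁ root
      t = proj₁ (proj₂ root)
      nrm≡ = proj₁ (proj₂ (proj₂ root))
      p∤t = proj₁ (proj₂ (proj₂ (proj₂ root)))
      p∤tr′ = proj₂ (proj₂ (proj₂ (proj₂ root)))
      lem : ∀ r d → r + r - d ≡ r + 1ℤ * r - 1ℤ * d
      lem = solve-∀
    go (ramified e s p∣ p∣tr _) = trans (Root.ramified-step s (proj₁ root) (proj₁ (proj₂ root)) (proj₂ (proj₂ root)) p∣tr n)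
        (trans (lem (r n) d) (cong (λ c → r n + c * r n - c * d) (sym e)))
      where
      root = exact-root-ramified s p∣ p∣tr
      lem : ∀ r d → r ≡ r + 0ℤ * r - 0ℤ * d
      lem = solve-∀
    go (inert e none) = trans (inert-step none n D) (trans (lem (r n) d) (cong (λ c → r n + c * r n - c * d) (sym e)))
      where
      lem : ∀ r d → d ≡ r + -1ℤ * r - -1ℤ * d
      lem = solve-∀

  -- Dirichlet's theorem on the number of representations, by the common recursion of both sides.
  r≡2ρ : ∀ n → 1 ℕ.≤ n → r n ≡ + 2 * ρ n
  r≡2ρ = <-rec (λ n → 1 ℕ.≤ n → r n ≡ + 2 * ρ n) step
    where
    step : ∀ n → (∀ {k} → k ℕ.< n → 1 ℕ.≤ k → r k ≡ + 2 * ρ k) → 1 ℕ.≤ n → r n ≡ + 2 * ρ n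
    step 1 _ _ = trans r-1 (cong (_*_ (+ 2)) (sym (trans (+-identityʳ (χ 1)) χ-1)))
    step n@(suc (suc _)) ih 1≤n with prime-factor n (ℕ.s≤s (ℕ.s≤s ℕ.z≤n))
    ... | p , n₁ , pp , n≡ = trans (cong r n≡) (trans (recurse (p ℕD.∣? n₁)) (cong (λ k → + 2 * ρ k) (sym n≡)))
      where
      instance
        p-nz : NonZero p
        p-nz = prime⇒nonZero pp
      positive-factor : ∀ {a b} → 1 ℕ.≤ a ℕ.* b → 1 ℕ.≤ b
      positive-factor {a} {zero} le = ⊥-elim (ℕP.<-irrefl refl (subst (1 ℕ.≤_) (ℕP.*-zeroʳ a) le))
      positive-factor {a} {suc b} _ = ℕ.s≤s ℕ.z≤n
      smaller : ∀ k → 1 ℕ.≤ k → k ℕ.< p ℕ.* k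
      smaller k 1≤k = subst (ℕ._< p ℕ.* k) (ℕP.*-identityˡ k) (ℕP.*-monoˡ-< k {{ℕ.>-nonZero 1≤k}} (ℕ.nonTrivial⇒n>1 p {{prime⇒nonTrivial pp}}))
      1≤n₁ : 1 ℕ.≤ n₁
      1≤n₁ = positive-factor {p} (subst (1 ℕ.≤_) n≡ 1≤n)
      n₁<n : n₁ ℕ.< n
      n₁<n = subst (n₁ ℕ.<_) (sym n≡) (smaller n₁ 1≤n₁)
      linear : ∀ {R P d e} c → R ≡ + 2 * P → d ≡ + 2 * e → R + c * R - c * d ≡ + 2 * (P + c * P - c * e)
      linear {P = P} {e = e} c refl refl = lem P e c
        where
        lem : ∀ P e c → + 2 * P + c * (+ 2 * P) - c * (+ 2 * e) ≡ + 2 * (P + c * P - c * e)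
        lem = solve-∀
      recurse : Dec (p ℕD.∣ n₁) → r (p ℕ.* n₁) ≡ + 2 * ρ (p ℕ.* n₁)
      recurse (no p∤n₁) = trans (r-recursion pp n₁ (Prime-step.indivisible p∤n₁ refl))
        (trans (linear (χ p) (ih n₁<n 1≤n₁) refl) (cong (_*_ (+ 2)) (sym (ρ-recursion pp n₁ 1≤n₁ (indivisible p∤n₁ refl)))))
      recurse (yes (ℕD.divides n₂ e)) = trans (r-recursion pp n₁ (Prime-step.divisible n₂ e′ refl))
        (trans (linear (χ p) (ih n₁<n 1≤n₁) (ih (ℕP.<-trans n₂<n₁ n₁<n) 1≤n₂)) (cong (_*_ (+ 2)) (sym (ρ-recursion pp n₁ 1≤n₁ (divisible n₂ 1≤n₂ e′ refl)))))
        where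
        e′ : n₁ ≡ p ℕ.* n₂
        e′ = trans e (ℕP.*-comm n₂ p)
        1≤n₂ : 1 ℕ.≤ n₂
        1≤n₂ = positive-factor {p} (subst (1 ℕ.≤_) e′ 1≤n₁)
        n₂<n₁ : n₂ ℕ.< n₁
        n₂<n₁ = subst (n₂ ℕ.<_) (sym e′) (smaller n₂ 1≤n₂)

cube : ℤ → ℤ
cube t = t * t * t

opaque
  g : ℤ → ℤ
  g (+ n) = + n * + n * + n
  g -[1+ n ] = 0ℤ

  g-pos : ∀ {t} → 0ℤ ≤ t → g t ≡ cube t
  g-pos {+ n} _ = refl

  g-neg : ∀ {t} → t ≤ 0ℤ → g t ≡ 0ℤ
  g-neg {+ zero} _ = refl
  g-neg { -[1+ n ]} _ = refl
  g-neg {+ suc n} (+≤+ ())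

0≤cube : ∀ {t} → 0ℤ ≤ t → 0ℤ ≤ cube t
0≤cube {t} 0≤t = 0≤* {t * t} {t} (0≤sq t) 0≤t

0≤g : ∀ t → 0ℤ ≤ g t
0≤g t with ≤-total 0ℤ t
... | inj₁ 0≤t = subst (0ℤ ≤_) (sym (g-pos 0≤t)) (0≤cube 0≤t)
... | inj₂ t≤0 = subst (0ℤ ≤_) (sym (g-neg t≤0)) ≤-refl

g-scale : ∀ c t → 0ℤ ≤ c → g (c * t) ≡ cube c * g t
g-scale c t 0≤c with ≤-total 0ℤ t
... | inj₁ 0≤t = trans (g-pos (0≤* 0≤c 0≤t)) (trans (lem c t) (cong (_*_ (cube c)) (sym (g-pos 0≤t))))
  where
  lem : ∀ c t → c * t * (c * t) * (c * t) ≡ c * c * c * (t * t * t)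
  lem = solve-∀
... | inj₂ t≤0 = trans (g-neg (subst (c * t ≤_) (*-zeroʳ c) (*-monoˡ c 0≤c t≤0))) (sym (trans (cong (_*_ (cube c)) (g-neg t≤0)) (*-zeroʳ (cube c))))

private
  0≤k* : ∀ k {x} → 0ℤ ≤ x → 0ℤ ≤ + k * x
  0≤k* k {x} = 0≤* {+ k} {x} 0≤ℕ

  form : ℕ → ℕ → ℕ → ℕ → ℤ → ℤ → ℤ
  form k₀ k₁ k₂ k₃ a b = + k₀ * (a * a * a) + + k₁ * (a * a * b) + + k₂ * (a * b * b) + + k₃ * (b * b * b)

  0≤form : ∀ k₀ k₁ k₂ k₃ {a b} → 0ℤ ≤ a → 0ℤ ≤ b → 0ℤ ≤ form k₀ k₁ k₂ k₃ a b
  0≤form k₀ k₁ k₂ k₃ {a} {b} 0≤a 0≤b = 0≤+ (0≤+ (0≤+ (0≤k* k₀ (0≤cube 0≤a)) (0≤k* k₁ (0≤* {a * a} {b} (0≤sq a) 0≤b)))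
    (0≤k* k₂ (0≤* {a * b} {b} (0≤* 0≤a 0≤b) 0≤b))) (0≤k* k₃ (0≤cube 0≤b))

Δ¹ Δ² Δ³ : ℤ → ℤ → ℤ
Δ¹ t s = g t - g (t - s)
Δ² t s = g t - + 2 * g (t - s) + g (t - + 2 * s)
Δ³ t s = g t - + 3 * g (t - s) + + 3 * g (t - + 2 * s) - g (t - + 3 * s)

private
  -- The position of t among the multiples of s determines the values of g at t, t − s, t − 2s, t − 3s.
  data Position (t s : ℤ) : Set where
    below    : t ≤ 0ℤ → Position t s
    zeroth   : 0ℤ ≤ t → 0ℤ ≤ s - t → Position t s
    first    : 0ℤ ≤ t - s → 0ℤ ≤ + 2 * s - t → Position t s
    second   : 0ℤ ≤ t - + 2 * s → 0ℤ ≤ + 3 * s - t → Position t s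
    above    : 0ℤ ≤ t - + 3 * s → Position t s

  position : ∀ t s → Position t s
  position t s with ≤-total t 0ℤ | ≤-total t s | ≤-total t (+ 2 * s) | ≤-total t (+ 3 * s)
  ... | inj₁ p | _ | _ | _ = below p
  ... | inj₂ p | inj₁ r | _ | _ = zeroth p (0≤- r)
  ... | _ | inj₂ p | inj₁ r | _ = first (0≤- p) (0≤- r)
  ... | _ | _ | inj₂ p | inj₁ r = second (0≤- p) (0≤- r)
  ... | _ | _ | _ | inj₂ p = above (0≤- p)

  nonpos : ∀ {x} → 0ℤ ≤ - x → x ≤ 0ℤ
  nonpos {x} p = subst (_≤ 0ℤ) (neg-involutive x) (neg-mono-≤ p)

  values : ∀ t s (P : ℤ → ℤ → ℤ → ℤ → Set) {v₀ v₁ v₂ v₃} → g t ≡ v₀ → g (t - s) ≡ v₁ → g (t - + 2 * s) ≡ v₂ → g (t - + 3 * s) ≡ v₃ →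
    P v₀ v₁ v₂ v₃ → P (g t) (g (t - s)) (g (t - + 2 * s)) (g (t - + 3 * s))
  values t s P refl refl refl refl p = p

  by-position : ∀ t s → 0ℤ ≤ s → (P : ℤ → ℤ → ℤ → ℤ → Set) →
    (t ≤ 0ℤ → P 0ℤ 0ℤ 0ℤ 0ℤ) →
    (0ℤ ≤ t → 0ℤ ≤ s - t → P (cube t) 0ℤ 0ℤ 0ℤ) →
    (0ℤ ≤ t - s → 0ℤ ≤ + 2 * s - t → P (cube t) (cube (t - s)) 0ℤ 0ℤ) →
    (0ℤ ≤ t - + 2 * s → 0ℤ ≤ + 3 * s - t → P (cube t) (cube (t - s)) (cube (t - + 2 * s)) 0ℤ) →
    (0ℤ ≤ t - + 3 * s → P (cube t) (cube (t - s)) (cube (t - + 2 * s)) (cube (t - + 3 * s))) →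
    P (g t) (g (t - s)) (g (t - + 2 * s)) (g (t - + 3 * s))
  by-position t s 0≤s P p₀ p₁ p₂ p₃ p₄ with position t s
  ... | below t≤0 = values t s P (g-neg t≤0) (g-neg (nonpos (subst (0ℤ ≤_) (l₁ t s) (0≤+ 0≤s (0≤- t≤0)))))
      (g-neg (nonpos (subst (0ℤ ≤_) (l₂ t s) (0≤+ (0≤k* 2 0≤s) (0≤- t≤0))))) (g-neg (nonpos (subst (0ℤ ≤_) (l₃ t s) (0≤+ (0≤k* 3 0≤s) (0≤- t≤0))))) (p₀ t≤0)
    where
    l₁ : ∀ t s → s + (0ℤ - t) ≡ - (t - s)
    l₁ = solve-∀
    l₂ : ∀ t s → + 2 * s + (0ℤ - t) ≡ - (t - + 2 * s)
    l₂ = solve-∀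
    l₃ : ∀ t s → + 3 * s + (0ℤ - t) ≡ - (t - + 3 * s)
    l₃ = solve-∀
  ... | zeroth a b = values t s P (g-pos a) (g-neg (nonpos (subst (0ℤ ≤_) (l₁ t s) b)))
      (g-neg (nonpos (subst (0ℤ ≤_) (l₂ t s) (0≤+ b 0≤s)))) (g-neg (nonpos (subst (0ℤ ≤_) (l₃ t s) (0≤+ b (0≤k* 2 0≤s))))) (p₁ a b)
    where
    l₁ : ∀ t s → s - t ≡ - (t - s)
    l₁ = solve-∀
    l₂ : ∀ t s → s - t + s ≡ - (t - + 2 * s)
    l₂ = solve-∀
    l₃ : ∀ t s → s - t + + 2 * s ≡ - (t - + 3 * s)
    l₃ = solve-∀
  ... | first a b = values t s P (g-pos (subst (0ℤ ≤_) (l₀ t s) (0≤+ a 0≤s))) (g-pos a) (g-neg (nonpos (subst (0ℤ ≤_) (l₂ t s) b)))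
      (g-neg (nonpos (subst (0ℤ ≤_) (l₃ t s) (0≤+ b 0≤s)))) (p₂ a b)
    where
    l₀ : ∀ t s → t - s + s ≡ t
    l₀ = solve-∀
    l₂ : ∀ t s → + 2 * s - t ≡ - (t - + 2 * s)
    l₂ = solve-∀
    l₃ : ∀ t s → + 2 * s - t + s ≡ - (t - + 3 * s)
    l₃ = solve-∀
  ... | second a b = values t s P (g-pos (subst (0ℤ ≤_) (l₀ t s) (0≤+ a (0≤k* 2 0≤s)))) (g-pos (subst (0ℤ ≤_) (l₁ t s) (0≤+ a 0≤s))) (g-pos a)
      (g-neg (nonpos (subst (0ℤ ≤_) (l₃ t s) b))) (p₃ a b)
    where
    l₀ : ∀ t s → t - + 2 * s + + 2 * s ≡ t
    l₀ = solve-∀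
    l₁ : ∀ t s → t - + 2 * s + s ≡ t - s
    l₁ = solve-∀
    l₃ : ∀ t s → + 3 * s - t ≡ - (t - + 3 * s)
    l₃ = solve-∀
  ... | above a = values t s P (g-pos (subst (0ℤ ≤_) (l₀ t s) (0≤+ a (0≤k* 3 0≤s)))) (g-pos (subst (0ℤ ≤_) (l₁ t s) (0≤+ a (0≤k* 2 0≤s))))
      (g-pos (subst (0ℤ ≤_) (l₂ t s) (0≤+ a 0≤s))) (g-pos a) (p₄ a)
    where
    l₀ : ∀ t s → t - + 3 * s + + 3 * s ≡ t
    l₀ = solve-∀
    l₁ : ∀ t s → t - + 3 * s + + 2 * s ≡ t - s
    l₁ = solve-∀
    l₂ : ∀ t s → t - + 3 * s + s ≡ t - + 2 * s
    l₂ = solve-∀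

0≤Δ³ : ∀ t s → 0ℤ ≤ s → 0ℤ ≤ Δ³ t s
0≤Δ³ t s 0≤s = by-position t s 0≤s (λ v₀ v₁ v₂ v₃ → 0ℤ ≤ v₀ - + 3 * v₁ + + 3 * v₂ - v₃)
  (λ _ → ≤-refl)
  (λ a _ → subst (0ℤ ≤_) (l₁ t) (0≤cube a))
  (λ a b → subst (0ℤ ≤_) (l₂ t s) (0≤form 5 12 6 1 a b))
  (λ a b → subst (0ℤ ≤_) (l₃ t s) (0≤form 6 18 18 5 a b))
  (λ a → subst (0ℤ ≤_) (l₄ t s) (0≤k* 6 (0≤cube 0≤s)))
  where
  l₁ : ∀ t → t * t * t ≡ t * t * t - + 3 * 0ℤ + + 3 * 0ℤ - 0ℤ
  l₁ = solve-∀
  l₂ : ∀ t s → + 5 * ((t - s) * (t - s) * (t - s)) + + 12 * ((t - s) * (t - s) * (+ 2 * s - t)) + + 6 * ((t - s) * (+ 2 * s - t) * (+ 2 * s - t)) + + 1 * ((+ 2 * s - t) * (+ 2 * s - t) * (+ 2 * s - t))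
    ≡ t * t * t - + 3 * ((t - s) * (t - s) * (t - s)) + + 3 * 0ℤ - 0ℤ
  l₂ = solve-∀
  l₃ : ∀ t s → + 6 * ((t - + 2 * s) * (t - + 2 * s) * (t - + 2 * s)) + + 18 * ((t - + 2 * s) * (t - + 2 * s) * (+ 3 * s - t)) + + 18 * ((t - + 2 * s) * (+ 3 * s - t) * (+ 3 * s - t)) + + 5 * ((+ 3 * s - t) * (+ 3 * s - t) * (+ 3 * s - t))
    ≡ t * t * t - + 3 * ((t - s) * (t - s) * (t - s)) + + 3 * ((t - + 2 * s) * (t - + 2 * s) * (t - + 2 * s)) - 0ℤ
  l₃ = solve-∀
  l₄ : ∀ t s → + 6 * (s * s * s) ≡ t * t * t - + 3 * ((t - s) * (t - s) * (t - s)) + + 3 * ((t - + 2 * s) * (t - + 2 * s) * (t - + 2 * s)) - (t - + 3 * s) * (t - + 3 * s) * (t - + 3 * s)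
  l₄ = solve-∀

private
  Δ²-interior : ∀ t s → 0ℤ ≤ s → 0ℤ ≤ t - + 2 * s → 0ℤ ≤ cube t - + 2 * cube (t - s) + cube (t - + 2 * s)
  Δ²-interior t s 0≤s a = subst (0ℤ ≤_) (lem t s) (0≤+ (0≤k* 6 (0≤cube 0≤s)) (0≤k* 6 (0≤* {s * s} {t - + 2 * s} (0≤sq s) a)))
    where
    lem : ∀ t s → + 6 * (s * s * s) + + 6 * (s * s * (t - + 2 * s)) ≡ t * t * t - + 2 * ((t - s) * (t - s) * (t - s)) + (t - + 2 * s) * (t - + 2 * s) * (t - + 2 * s)
    lem = solve-∀

  weaken : ∀ t s → 0ℤ ≤ s → 0ℤ ≤ t - + 3 * s → 0ℤ ≤ t - + 2 * s
  weaken t s 0≤s a = subst (0ℤ ≤_) (lem t s) (0≤+ a 0≤s)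
    where
    lem : ∀ t s → t - + 3 * s + s ≡ t - + 2 * s
    lem = solve-∀

0≤Δ² : ∀ t s → 0ℤ ≤ s → 0ℤ ≤ Δ² t s
0≤Δ² t s 0≤s = by-position t s 0≤s (λ v₀ v₁ v₂ _ → 0ℤ ≤ v₀ - + 2 * v₁ + v₂)
  (λ _ → ≤-refl)
  (λ a _ → subst (0ℤ ≤_) (l₁ t) (0≤cube a))
  (λ a b → subst (0ℤ ≤_) (l₂ t s) (0≤form 6 12 6 1 a b))
  (λ a b → Δ²-interior t s 0≤s a)
  (λ a → Δ²-interior t s 0≤s (weaken t s 0≤s a))
  where
  l₁ : ∀ t → t * t * t ≡ t * t * t - + 2 * 0ℤ + 0ℤ
  l₁ = solve-∀
  l₂ : ∀ t s → + 6 * ((t - s) * (t - s) * (t - s)) + + 12 * ((t - s) * (t - s) * (+ 2 * s - t)) + + 6 * ((t - s) * (+ 2 * s - t) * (+ 2 * s - t)) + + 1 * ((+ 2 * s - t) * (+ 2 * s - t) * (+ 2 * s - t))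
    ≡ t * t * t - + 2 * ((t - s) * (t - s) * (t - s)) + 0ℤ
  l₂ = solve-∀

private
  Δ²-interior-≤ : ∀ t s Y → 0ℤ ≤ s → t ≤ Y → cube t - + 2 * cube (t - s) + cube (t - + 2 * s) ≤ + 6 * (s * s * Y)
  Δ²-interior-≤ t s Y 0≤s t≤Y = ≤-from (+ 6 * (s * s * (Y - t)) + + 6 * (s * s * s))
      (0≤+ (0≤k* 6 (0≤* {s * s} {Y - t} (0≤sq s) (0≤- t≤Y))) (0≤k* 6 (0≤cube 0≤s))) (lem t s Y)
    where
    lem : ∀ t s Y → + 6 * (s * s * Y) ≡ t * t * t - + 2 * ((t - s) * (t - s) * (t - s)) + (t - + 2 * s) * (t - + 2 * s) * (t - + 2 * s) + (+ 6 * (s * s * (Y - t)) + + 6 * (s * s * s))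
    lem = solve-∀

Δ²≤ : ∀ t s Y → 0ℤ ≤ s → 0ℤ ≤ Y → t ≤ Y → Δ² t s ≤ + 6 * (s * s * Y)
Δ²≤ t s Y 0≤s 0≤Y t≤Y = by-position t s 0≤s (λ v₀ v₁ v₂ _ → v₀ - + 2 * v₁ + v₂ ≤ + 6 * (s * s * Y))
  (λ _ → 0≤k* 6 (0≤* {s * s} {Y} (0≤sq s) 0≤Y))
  (λ a b → ≤-from (+ 5 * (s * s * Y) + s * s * (Y - t) + t * (s - t) * (s - t) + + 2 * (t * t * (s - t)))
      (0≤+ (0≤+ (0≤+ (0≤k* 5 (0≤* {s * s} {Y} (0≤sq s) 0≤Y)) (0≤* {s * s} {Y - t} (0≤sq s) (0≤- t≤Y))) (0≤* {t * (s - t)} {s - t} (0≤* a b) b)) (0≤k* 2 (0≤* {t * t} {s - t} (0≤sq t) b))) (l₁ t s Y))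
  (λ a b → ≤-from (+ 6 * (s * s * (Y - t)) + form 6 18 18 5 (t - s) (+ 2 * s - t))
      (0≤+ (0≤k* 6 (0≤* {s * s} {Y - t} (0≤sq s) (0≤- t≤Y))) (0≤form 6 18 18 5 a b)) (l₂ t s Y))
  (λ a b → Δ²-interior-≤ t s Y 0≤s t≤Y)
  (λ a → Δ²-interior-≤ t s Y 0≤s t≤Y)
  where
  l₁ : ∀ t s Y → + 6 * (s * s * Y) ≡ t * t * t - + 2 * 0ℤ + 0ℤ + (+ 5 * (s * s * Y) + s * s * (Y - t) + t * (s - t) * (s - t) + + 2 * (t * t * (s - t)))
  l₁ = solve-∀
  l₂ : ∀ t s Y → + 6 * (s * s * Y) ≡ t * t * t - + 2 * ((t - s) * (t - s) * (t - s)) + 0ℤ + (+ 6 * (s * s * (Y - t)) +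
    (+ 6 * ((t - s) * (t - s) * (t - s)) + + 18 * ((t - s) * (t - s) * (+ 2 * s - t)) + + 18 * ((t - s) * (+ 2 * s - t) * (+ 2 * s - t)) + + 5 * ((+ 2 * s - t) * (+ 2 * s - t) * (+ 2 * s - t))))
  l₂ = solve-∀

private
  Δ¹-interior : ∀ t s → 0ℤ ≤ s → 0ℤ ≤ t - s → 0ℤ ≤ cube t - cube (t - s)
  Δ¹-interior t s 0≤s a = subst (0ℤ ≤_) (lem t s) (0≤form 0 3 3 1 a 0≤s)
    where
    lem : ∀ t s → + 0 * ((t - s) * (t - s) * (t - s)) + + 3 * ((t - s) * (t - s) * s) + + 3 * ((t - s) * s * s) + + 1 * (s * s * s) ≡ t * t * t - (t - s) * (t - s) * (t - s)
    lem = solve-∀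

  Δ¹-interior-≤ : ∀ t s Y → 0ℤ ≤ s → 0ℤ ≤ t - s → 0ℤ ≤ Y → t ≤ Y → cube t - cube (t - s) ≤ + 3 * (s * (Y * Y))
  Δ¹-interior-≤ t s Y 0≤s a 0≤Y t≤Y = ≤-from (+ 3 * (s * ((Y - t) * (Y + t))) + (+ 3 * ((t - s) * s * s) + + 2 * (s * s * s)))
      (0≤+ (0≤k* 3 (0≤* 0≤s (0≤* (0≤- t≤Y) (0≤+ 0≤Y (subst (0ℤ ≤_) (lem′ t s) (0≤+ a 0≤s)))))) (0≤+ (0≤k* 3 (0≤* {(t - s) * s} {s} (0≤* a 0≤s) 0≤s)) (0≤k* 2 (0≤cube 0≤s)))) (lem t s Y)
    where
    lem′ : ∀ t s → t - s + s ≡ t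
    lem′ = solve-∀
    lem : ∀ t s Y → + 3 * (s * (Y * Y)) ≡ t * t * t - (t - s) * (t - s) * (t - s) + (+ 3 * (s * ((Y - t) * (Y + t))) + (+ 3 * ((t - s) * s * s) + + 2 * (s * s * s)))
    lem = solve-∀

  above-first : ∀ t s k → 0ℤ ≤ s → 0ℤ ≤ t - (1ℤ + + k) * s → 0ℤ ≤ t - s
  above-first t s k 0≤s a = subst (0ℤ ≤_) (lem t s (+ k)) (0≤+ a (0≤k* k 0≤s))
    where
    lem : ∀ t s k → t - (1ℤ + k) * s + k * s ≡ t - s
    lem = solve-∀

0≤Δ¹ : ∀ t s → 0ℤ ≤ s → 0ℤ ≤ Δ¹ t s
0≤Δ¹ t s 0≤s = by-position t s 0≤s (λ v₀ v₁ _ _ → 0ℤ ≤ v₀ - v₁)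
  (λ _ → ≤-refl)
  (λ a _ → subst (0ℤ ≤_) (sym (+-identityʳ (cube t))) (0≤cube a))
  (λ a b → Δ¹-interior t s 0≤s a)
  (λ a b → Δ¹-interior t s 0≤s (above-first t s 1 0≤s a))
  (λ a → Δ¹-interior t s 0≤s (above-first t s 2 0≤s a))

Δ¹≤ : ∀ t s Y → 0ℤ ≤ s → 0ℤ ≤ Y → t ≤ Y → Δ¹ t s ≤ + 3 * (s * (Y * Y))
Δ¹≤ t s Y 0≤s 0≤Y t≤Y = by-position t s 0≤s (λ v₀ v₁ _ _ → v₀ - v₁ ≤ + 3 * (s * (Y * Y)))
  (λ _ → 0≤k* 3 (0≤* 0≤s (0≤sq Y)))
  (λ a b → ≤-from (+ 2 * (s * (Y * Y)) + s * ((Y - t) * (Y + t)) + t * t * (s - t))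
    (0≤+ (0≤+ (0≤k* 2 (0≤* 0≤s (0≤sq Y))) (0≤* 0≤s (0≤* (0≤- t≤Y) (0≤+ 0≤Y a)))) (0≤* {t * t} {s - t} (0≤sq t) b)) (l₁ t s Y))
  (λ a b → Δ¹-interior-≤ t s Y 0≤s a 0≤Y t≤Y)
  (λ a b → Δ¹-interior-≤ t s Y 0≤s (above-first t s 1 0≤s a) 0≤Y t≤Y)
  (λ a → Δ¹-interior-≤ t s Y 0≤s (above-first t s 2 0≤s a) 0≤Y t≤Y)
  where
  l₁ : ∀ t s Y → + 3 * (s * (Y * Y)) ≡ t * t * t - 0ℤ + (+ 2 * (s * (Y * Y)) + s * ((Y - t) * (Y + t)) + t * t * (s - t))
  l₁ = solve-∀

g-mono : ∀ {x y} → x ≤ y → g x ≤ g y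
g-mono {x} {y} x≤y = ≤-from (Δ¹ y (y - x)) (0≤Δ¹ y (y - x) (0≤- x≤y)) (trans (lem (g y) (g x)) (cong (λ t → g x + (g y - g t)) (lem′ x y)))
  where
  lem : ∀ a b → a ≡ b + (a - b)
  lem = solve-∀
  lem′ : ∀ x y → x ≡ y - (y - x)
  lem′ = solve-∀

-- Alternating sums

alt : ℕ → ℤ
alt zero = 1ℤ
alt (suc k) = - alt k

∇ : (ℕ → ℤ) → ℕ → ℤ
∇ f k = f k - f (suc k)

∑-alt-step : ∀ n f → ∑ n (λ k → alt k * ∇ f k) ≡ + 2 * ∑ n (λ k → alt k * f k) - f 0 + alt n * f n
∑-alt-step zero f = lem (f 0)
  where
  lem : ∀ x → 0ℤ ≡ + 2 * 0ℤ - x + 1ℤ * x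
  lem = solve-∀
∑-alt-step (suc n) f = trans (cong (_+ alt n * ∇ f n) (∑-alt-step n f)) (lem (∑ n (λ k → alt k * f k)) (f 0) (alt n) (f n) (f (suc n)))
  where
  lem : ∀ S x a y z → + 2 * S - x + a * y + a * (y - z) ≡ + 2 * (S + a * y) - x + - a * z
  lem = solve-∀

∑-alt : ∀ n f → (∀ k → n ℕ.≤ k → f k ≡ 0ℤ) →
  + 8 * ∑ n (λ k → alt k * f k) ≡ + 4 * f 0 + + 2 * ∇ f 0 + ∇ (∇ f) 0 + ∑ n (λ k → alt k * ∇ (∇ (∇ f)) k)
∑-alt n f z = trans (lem (∑ n (λ k → alt k * f k)) (∑ n (λ k → alt k * ∇ f k)) (∑ n (λ k → alt k * ∇ (∇ f) k)) (∑ n (λ k → alt k * ∇ (∇ (∇ f)) k)) (f 0) (∇ f 0) (∇ (∇ f) 0)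
    (step f z) (step (∇ f) (∇-0 f z)) (step (∇ (∇ f)) (∇-0 (∇ f) (∇-0 f z)))) refl
  where
  ∇-0 : ∀ f → (∀ k → n ℕ.≤ k → f k ≡ 0ℤ) → ∀ k → n ℕ.≤ k → ∇ f k ≡ 0ℤ
  ∇-0 f z k n≤k = cong₂ _-_ (z k n≤k) (z (suc k) (ℕP.m≤n⇒m≤1+n n≤k))
  step : ∀ f → (∀ k → n ℕ.≤ k → f k ≡ 0ℤ) → ∑ n (λ k → alt k * ∇ f k) ≡ + 2 * ∑ n (λ k → alt k * f k) - f 0
  step f z = trans (∑-alt-step n f) (trans (cong (_+_ (+ 2 * ∑ n (λ k → alt k * f k) - f 0)) (trans (cong (_*_ (alt n)) (z n ℕP.≤-refl)) (*-zeroʳ (alt n)))) (+-identityʳ (+ 2 * ∑ n (λ k → alt k * f k) - f 0)))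
  lem : ∀ A B C D a b c → B ≡ + 2 * A - a → C ≡ + 2 * B - b → D ≡ + 2 * C - c → + 8 * A ≡ + 4 * a + + 2 * b + c + D
  lem A _ _ _ a b c refl refl refl = lem′ A a b c
    where
    lem′ : ∀ A a b c → + 8 * A ≡ + 4 * a + + 2 * b + c + (+ 2 * (+ 2 * (+ 2 * A - a) - b) - c)
    lem′ = solve-∀

bounded-alt : ∀ k {x b} → Bounded x b → Bounded (alt k * x) b
bounded-alt zero {x} p = subst (λ y → Bounded y _) (sym (*-identityˡ x)) p
bounded-alt (suc k) {x} p = subst (λ y → Bounded y _) (neg-distribˡ-* (alt k) x) (bounded-neg (bounded-alt k p))

opaque
  nat⁺ : ℕ → ℤ
  nat⁺ k = + suc k

  nat⁺-def : ∀ k → nat⁺ k ≡ + suc k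
  nat⁺-def k = refl

  nat⁺-suc : ∀ k → nat⁺ (suc k) ≡ nat⁺ k + 1ℤ
  nat⁺-suc k = +-comm 1ℤ (+ suc k)

  0≤nat⁺ : ∀ k → 0ℤ ≤ nat⁺ k
  0≤nat⁺ k = 0≤ℕ

  nat⁺≤ : ∀ {k n} → k ℕ.< n → nat⁺ k ≤ + n
  nat⁺≤ k<n = +≤+ k<n

-- Abel summation

abel : ∀ n (c H : ℕ → ℤ) → ∑ n (λ k → c k * H k) ≡ ∑ n c * H n + ∑ n (λ k → ∑ (suc k) c * ∇ H k)
abel zero c H = lem (H 0)
  where
  lem : ∀ h → 0ℤ ≡ 0ℤ * h + 0ℤ
  lem = solve-∀
abel (suc n) c H = trans (cong (_+ c n * H n) (abel n c H)) (lem (∑ n c) (H n) (∑ n (λ k → ∑ (suc k) c * ∇ H k)) (c n) (H (suc n)))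
  where
  lem : ∀ s h A c h′ → s * h + A + c * h ≡ (s + c) * h′ + (A + (s + c) * (h - h′))
  lem = solve-∀

abel-0 : ∀ n (c H : ℕ → ℤ) → H n ≡ 0ℤ → ∑ n (λ k → c k * H k) ≡ ∑ n (λ k → ∑ (suc k) c * ∇ H k)
abel-0 n c H z = trans (abel n c H) (trans (cong (λ h → ∑ n c * h + ∑ n (λ k → ∑ (suc k) c * ∇ H k)) z)
  (trans (cong (_+ ∑ n (λ k → ∑ (suc k) c * ∇ H k)) (*-zeroʳ (∑ n c))) (+-identityˡ (∑ n (λ k → ∑ (suc k) c * ∇ H k)))))

partial : (ℕ → ℤ) → ℕ → ℤ
partial c k = ∑ (suc k) c

Periodic : ℕ → (ℕ → ℤ) → Set
Periodic N c = ∀ k → c (N ℕ.+ k) ≡ c k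

partial-periodic : ∀ {N c} → Periodic N c → ∑ N c ≡ 0ℤ → Periodic N (partial c)
partial-periodic {N} {c} per z k = trans (cong (λ j → ∑ j c) (sym (ℕP.+-suc N k))) (trans (∑-split N (suc k) c)
  (trans (cong₂ _+_ z (∑-cong′ (suc k) per)) (+-identityˡ (∑ (suc k) c))))

∑-term : ∀ n f → (∀ k → 0ℤ ≤ f k) → ∀ k → k ℕ.< n → f k ≤ ∑ n f
∑-term (suc n) f nn k k<1+n with ℕP.m≤n⇒m<n∨m≡n (ℕ.s≤s⁻¹ k<1+n)
... | inj₁ k<n = ≤-from (∑ n f - f k + f n) (0≤+ (0≤- (∑-term n f nn k k<n)) (nn n)) (lem (∑ n f) (f n) (f k))
  where
  lem : ∀ s a b → s + a ≡ b + (s - b + a)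
  lem = solve-∀
... | inj₂ refl = ≤-from (∑ n f) (∑-nonneg n (λ k _ → nn k)) (+-comm (∑ n f) (f n))

periodic-bounded : ∀ N {c} .{{_ : NonZero N}} → Periodic N c → ∀ k → Bounded (c k) (∑ N (λ j → + ∣ c j ∣))
periodic-bounded N {c} per k = subst (λ x → Bounded x (∑ N (λ j → + ∣ c j ∣))) (sym reduce)
  (bounded-≤ (∑-term N (λ j → + ∣ c j ∣) (λ _ → 0≤ℕ) (k ℕ.% N) (ℕM.m%n<n k N)) (bounded-∣∣ (c (k ℕ.% N))))
  where
  periods : ∀ i j → c (i ℕ.* N ℕ.+ j) ≡ c j
  periods zero j = refl
  periods (suc i) j = trans (cong c (ℕP.+-assoc N (i ℕ.* N) j)) (trans (per (i ℕ.* N ℕ.+ j)) (periods i j))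
  reduce : c k ≡ c (k ℕ.% N)
  reduce = trans (cong c (trans (ℕM.m≡m%n+[m/n]*n k N) (ℕP.+-comm (k ℕ.% N) ((k ℕ./ N) ℕ.* N)))) (periods (k ℕ./ N) (k ℕ.% N))

-- Differences of the cutoff along an arithmetic progression

module Progression (v : ℕ → ℤ) (s : ℤ) (v-suc : ∀ k → v (suc k) ≡ v k - s) where

  private
    G : ℕ → ℤ
    G k = g (v k)

    v₂ : ∀ k → v (suc (suc k)) ≡ v k - + 2 * s
    v₂ k = trans (v-suc (suc k)) (trans (cong (_- s) (v-suc k)) (lem (v k) s))
      where
      lem : ∀ v s → v - s - s ≡ v - + 2 * s
      lem = solve-∀

    v₃ : ∀ k → v (suc (suc (suc k))) ≡ v k - + 3 * s
    v₃ k = trans (v-suc (suc (suc k))) (trans (cong (_- s) (v₂ k)) (lem (v k) s))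
      where
      lem : ∀ v s → v - + 2 * s - s ≡ v - + 3 * s
      lem = solve-∀

  ∇¹ : ∀ k → ∇ G k ≡ Δ¹ (v k) s
  ∇¹ k = cong (λ t → g (v k) - g t) (v-suc k)

  ∇² : ∀ k → ∇ (∇ G) k ≡ Δ² (v k) s
  ∇² k = trans (cong₂ (λ t r → g (v k) - g t - (g t - g r)) (v-suc k) (v₂ k)) (lem (g (v k)) (g (v k - s)) (g (v k - + 2 * s)))
    where
    lem : ∀ a b c → a - b - (b - c) ≡ a - + 2 * b + c
    lem = solve-∀

  ∇³ : ∀ k → ∇ (∇ (∇ G)) k ≡ Δ³ (v k) s
  ∇³ k = trans (cong₂ (λ t r → g (v k) - g t - (g t - g r) - (g t - g r - (g r - g (v (suc (suc (suc k))))))) (v-suc k) (v₂ k))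
    (trans (cong (λ w → g (v k) - g (v k - s) - (g (v k - s) - g (v k - + 2 * s)) - (g (v k - s) - g (v k - + 2 * s) - (g (v k - + 2 * s) - g w))) (v₃ k))
      (lem (g (v k)) (g (v k - s)) (g (v k - + 2 * s)) (g (v k - + 3 * s))))
    where
    lem : ∀ a b c d → a - b - (b - c) - (b - c - (c - d)) ≡ a - + 3 * b + + 3 * c - d
    lem = solve-∀

  module _ (0≤s : 0ℤ ≤ s) (Y : ℤ) (0≤Y : 0ℤ ≤ Y) (v≤Y : v 0 ≤ Y) where

    v-bounded : ∀ k → v k ≤ Y
    v-bounded zero = v≤Y
    v-bounded (suc k) = ≤-trans (subst (_≤ v k) (sym (v-suc k)) (≤-from s 0≤s (lem (v k) s))) (v-bounded k)
      where
      lem : ∀ v s → v ≡ v - s + s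
      lem = solve-∀

    -- Each sum telescopes, and the next lower difference is nonnegative.
    ∑∇² : ∀ n → ∑ n (∇ (∇ G)) ≤ + 3 * (s * (Y * Y))
    ∑∇² n = ≤-trans (subst (_≤ ∇ G 0) (sym (∑-telescope n (∇ G)))
      (≤-from (∇ G n) (subst (0ℤ ≤_) (sym (∇¹ n)) (0≤Δ¹ (v n) s 0≤s)) (lem (∇ G 0) (∇ G n))))
      (subst (_≤ + 3 * (s * (Y * Y))) (sym (∇¹ 0)) (Δ¹≤ (v 0) s Y 0≤s 0≤Y v≤Y))
      where
      lem : ∀ a b → a ≡ a - b + b
      lem = solve-∀

    ∑∇³ : ∀ n → ∑ n (∇ (∇ (∇ G))) ≤ + 6 * (s * s * Y)
    ∑∇³ n = ≤-trans (subst (_≤ ∇ (∇ G) 0) (sym (∑-telescope n (∇ (∇ G))))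
      (≤-from (∇ (∇ G) n) (subst (0ℤ ≤_) (sym (∇² n)) (0≤Δ² (v n) s 0≤s)) (lem (∇ (∇ G) 0) (∇ (∇ G) n))))
      (subst (_≤ + 6 * (s * s * Y)) (sym (∇² 0)) (Δ²≤ (v 0) s Y 0≤s 0≤Y v≤Y))
      where
      lem : ∀ a b → a ≡ a - b + b
      lem = solve-∀

    0≤∇² : ∀ k → 0ℤ ≤ ∇ (∇ G) k
    0≤∇² k = subst (0ℤ ≤_) (sym (∇² k)) (0≤Δ² (v k) s 0≤s)

    0≤∇³ : ∀ k → 0ℤ ≤ ∇ (∇ (∇ G)) k
    0≤∇³ k = subst (0ℤ ≤_) (sym (∇³ k)) (0≤Δ³ (v k) s 0≤s)

-- The hyperbola sum

φ : ℤ → ℕ → ℕ → ℤ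
φ Y k l = g (Y - nat⁺ k * nat⁺ l)

module Rows (Y : ℤ) (0≤Y : 0ℤ ≤ Y) where

  private
    row-suc : ∀ l k → Y - nat⁺ (suc k) * nat⁺ l ≡ Y - nat⁺ k * nat⁺ l - nat⁺ l
    row-suc l k = trans (cong (λ a → Y - a * nat⁺ l) (nat⁺-suc k)) (lem Y (nat⁺ k) (nat⁺ l))
      where
      lem : ∀ Y a b → Y - (a + 1ℤ) * b ≡ Y - a * b - b
      lem = solve-∀

    column-suc : ∀ k l → Y - nat⁺ k * nat⁺ (suc l) ≡ Y - nat⁺ k * nat⁺ l - nat⁺ k
    column-suc k l = trans (cong (λ b → Y - nat⁺ k * b) (nat⁺-suc l)) (lem Y (nat⁺ k) (nat⁺ l))
      where
      lem : ∀ Y a b → Y - a * (b + 1ℤ) ≡ Y - a * b - a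
      lem = solve-∀

    below-Y : ∀ k l → Y - nat⁺ k * nat⁺ l ≤ Y
    below-Y k l = ≤-from (nat⁺ k * nat⁺ l) (0≤* (0≤nat⁺ k) (0≤nat⁺ l)) (lem Y (nat⁺ k * nat⁺ l))
      where
      lem : ∀ Y p → Y ≡ Y - p + p
      lem = solve-∀

  module Row (k₀ l : ℕ) where
    private module P = Progression (λ k → Y - nat⁺ (k₀ ℕ.+ k) * nat⁺ l) (nat⁺ l) (λ k → trans (cong (λ j → Y - nat⁺ j * nat⁺ l) (ℕP.+-suc k₀ k)) (row-suc l (k₀ ℕ.+ k)))

    0≤∇∇ : ∀ k → 0ℤ ≤ ∇ (∇ (λ k → φ Y (k₀ ℕ.+ k) l)) k
    0≤∇∇ = P.0≤∇² (0≤nat⁺ l) Y 0≤Y (below-Y (k₀ ℕ.+ 0) l)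

    ∑∇∇ : ∀ n → ∑ n (∇ (∇ (λ k → φ Y (k₀ ℕ.+ k) l))) ≤ + 3 * (nat⁺ l * (Y * Y))
    ∑∇∇ = P.∑∇² (0≤nat⁺ l) Y 0≤Y (below-Y (k₀ ℕ.+ 0) l)

  module Column (k : ℕ) where
    private module P = Progression (λ l → Y - nat⁺ k * nat⁺ l) (nat⁺ k) (column-suc k)

    ∇∇∇-bounded : ∀ n → Bounded (∑ n (λ l → alt l * ∇ (∇ (∇ (φ Y k))) l)) (+ 6 * (nat⁺ k * nat⁺ k * Y))
    ∇∇∇-bounded n = bounded-≤ (P.∑∇³ (0≤nat⁺ k) Y 0≤Y (below-Y k 0) n)
      (∑-bounded n (λ l _ → bounded-alt l (bounded-nonneg (P.0≤∇³ (0≤nat⁺ k) Y 0≤Y (below-Y k 0) l) ≤-refl)))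

module Asymptotic (c : ℕ → ℤ) (N : ℕ) {{_ : NonZero N}} (periodic : Periodic N c) (zero-sum : ∑ N c ≡ 0ℤ) where

  M : ℤ
  M = ∑ N (partial c)

  private
    b : ℕ → ℤ
    b k = + N * partial c k - M

    b-periodic : Periodic N b
    b-periodic k = cong (λ s → + N * s - M) (partial-periodic {N} periodic zero-sum k)

    b-zero-sum : ∑ N b ≡ 0ℤ
    b-zero-sum = trans (∑-- N (λ k → + N * partial c k) (λ _ → M)) (trans (cong₂ _-_ (∑-* N (+ N) (partial c)) (∑-const N M)) (+-inverseʳ (+ N * M)))

  C : ℤ
  C = ∑ N (λ j → + ∣ partial b j ∣)

  0≤C : 0ℤ ≤ C
  0≤C = ∑-nonneg N (λ _ _ → 0≤ℕ)

  T-bounded : ∀ k → Bounded (partial b k) C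
  T-bounded = periodic-bounded N (partial-periodic {N} b-periodic b-zero-sum)

  weighted : ∀ n H → (∀ k → n ℕ.≤ k → H k ≡ 0ℤ) → + N * ∑ n (λ k → c k * H k) ≡ M * H 0 + ∑ n (λ k → partial b k * ∇ (∇ H) k)
  weighted n H z = begin
    + N * ∑ n (λ k → c k * H k) ≡⟨ cong (_*_ (+ N)) (abel-0 n c H (z n ℕP.≤-refl)) ⟩
    + N * ∑ n (λ k → partial c k * ∇ H k) ≡⟨ sym (∑-* n (+ N) (λ k → partial c k * ∇ H k)) ⟩
    ∑ n (λ k → + N * (partial c k * ∇ H k)) ≡⟨ ∑-cong′ n (λ k → lem (+ N) (partial c k) M (∇ H k)) ⟩
    ∑ n (λ k → M * ∇ H k + b k * ∇ H k) ≡⟨ ∑-+ n (λ k → M * ∇ H k) (λ k → b k * ∇ H k) ⟩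
    ∑ n (λ k → M * ∇ H k) + ∑ n (λ k → b k * ∇ H k)
      ≡⟨ cong₂ _+_ (trans (∑-* n M (∇ H)) (cong (_*_ M) (trans (∑-telescope n H) (trans (cong (_-_ (H 0)) (z n ℕP.≤-refl)) (+-identityʳ (H 0))))))
           (abel-0 n b (∇ H) (cong₂ _-_ (z n ℕP.≤-refl) (z (suc n) (ℕP.n≤1+n n)))) ⟩
    M * H 0 + ∑ n (λ k → partial b k * ∇ (∇ H) k) ∎
    where
    open ≡-Reasoning
    lem : ∀ N p M h → N * (p * h) ≡ M * h + (N * p - M) * h
    lem = solve-∀

  W : ℕ → ℤ
  W n = ∑ n (λ k → c k * ∑ n (λ l → alt l * φ (+ n) k l))

  K : ℤ
  K = + 60 * + ∣ M ∣ + + 294 * C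

  0≤K : 0ℤ ≤ K
  0≤K = 0≤+ (0≤* {+ 60} {+ ∣ M ∣} 0≤ℕ 0≤ℕ) (0≤* {+ 294} 0≤ℕ 0≤C)

  module Estimate (n d e : ℕ) (1≤d : 1 ℕ.≤ d) (1≤e : 1 ℕ.≤ e) (n≤de : n ℕ.≤ d ℕ.* e) (d≤n : d ℕ.≤ n) (e≤n : e ℕ.≤ n) where

    private
      Y : ℤ
      Y = + n

      0≤Y : 0ℤ ≤ Y
      0≤Y = 0≤ℕ

      open Rows Y 0≤Y

      φ-zero : ∀ k l → n ℕ.≤ suc k ℕ.* suc l → φ Y k l ≡ 0ℤ
      φ-zero k l le = g-neg (subst (_≤ 0ℤ) (cong (_-_ Y) (trans (pos-* (suc k) (suc l)) (sym (cong₂ _*_ (nat⁺-def k) (nat⁺-def l)))))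
        (i≤j⇒i-j≤0 (+≤+ le)))

      H : ℕ → ℤ
      H k = ∑ n (λ l → alt l * φ Y k l)

      H-zero : ∀ k → n ℕ.≤ k → H k ≡ 0ℤ
      H-zero k n≤k = trans (∑-cong′ n (λ l → trans (cong (_*_ (alt l)) (φ-zero k l (ℕP.≤-trans (ℕP.m≤n⇒m≤1+n n≤k) (ℕP.m≤m*n (suc k) (suc l))))) (*-zeroʳ (alt l)))) (∑-0 n)

      A : ℕ → ℤ
      A k = ∑ n (λ l → alt l * ∇ (∇ (∇ (φ Y k))) l)

      P : ℕ → ℕ → ℤ
      P j k = φ Y k j

      8H : ∀ k → + 8 * H k ≡ + 7 * P 0 k - + 4 * P 1 k + P 2 k + A k
      8H k = trans (∑-alt n (φ Y k) (λ l n≤l → φ-zero k l (ℕP.≤-trans (ℕP.m≤n⇒m≤1+n n≤l) (ℕP.m≤n*m (suc l) (suc k)))))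
        (lem (φ Y k 0) (φ Y k 1) (φ Y k 2) (A k))
        where
        lem : ∀ a b c A → + 4 * a + + 2 * (a - b) + (a - b - (b - c)) + A ≡ + 7 * a - + 4 * b + c + A
        lem = solve-∀

      8∇∇H : ∀ k → + 8 * ∇ (∇ H) k ≡ + 7 * ∇ (∇ (P 0)) k - + 4 * ∇ (∇ (P 1)) k + ∇ (∇ (P 2)) k + (A k - A (suc k) - (A (suc k) - A (suc (suc k))))
      8∇∇H k = combine (H k) (H (suc k)) (H (suc (suc k))) (P 0 k) (P 0 (suc k)) (P 0 (suc (suc k))) (P 1 k) (P 1 (suc k)) (P 1 (suc (suc k)))
          (P 2 k) (P 2 (suc k)) (P 2 (suc (suc k))) (A k) (A (suc k)) (A (suc (suc k))) (8H k) (8H (suc k)) (8H (suc (suc k)))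
        where
        combine : ∀ h₀ h₁ h₂ a₀ a₁ a₂ b₀ b₁ b₂ c₀ c₁ c₂ x₀ x₁ x₂ →
          + 8 * h₀ ≡ + 7 * a₀ - + 4 * b₀ + c₀ + x₀ → + 8 * h₁ ≡ + 7 * a₁ - + 4 * b₁ + c₁ + x₁ → + 8 * h₂ ≡ + 7 * a₂ - + 4 * b₂ + c₂ + x₂ →
          + 8 * (h₀ - h₁ - (h₁ - h₂)) ≡ + 7 * (a₀ - a₁ - (a₁ - a₂)) - + 4 * (b₀ - b₁ - (b₁ - b₂)) + (c₀ - c₁ - (c₁ - c₂)) + (x₀ - x₁ - (x₁ - x₂))
        combine h₀ h₁ h₂ a₀ a₁ a₂ b₀ b₁ b₂ c₀ c₁ c₂ x₀ x₁ x₂ e₀ e₁ e₂ = trans (lem h₀ h₁ h₂)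
          (trans (cong₂ (λ s t → s - + 2 * t + + 8 * h₂) e₀ e₁) (trans (cong (λ t → + 7 * a₀ - + 4 * b₀ + c₀ + x₀ - + 2 * (+ 7 * a₁ - + 4 * b₁ + c₁ + x₁) + t) e₂)
            (lem′ a₀ a₁ a₂ b₀ b₁ b₂ c₀ c₁ c₂ x₀ x₁ x₂)))
          where
          lem : ∀ h₀ h₁ h₂ → + 8 * (h₀ - h₁ - (h₁ - h₂)) ≡ + 8 * h₀ - + 2 * (+ 8 * h₁) + + 8 * h₂
          lem = solve-∀
          lem′ : ∀ a₀ a₁ a₂ b₀ b₁ b₂ c₀ c₁ c₂ x₀ x₁ x₂ → + 7 * a₀ - + 4 * b₀ + c₀ + x₀ - + 2 * (+ 7 * a₁ - + 4 * b₁ + c₁ + x₁) + (+ 7 * a₂ - + 4 * b₂ + c₂ + x₂)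
            ≡ + 7 * (a₀ - a₁ - (a₁ - a₂)) - + 4 * (b₀ - b₁ - (b₁ - b₂)) + (c₀ - c₁ - (c₁ - c₂)) + (x₀ - x₁ - (x₁ - x₂))
          lem′ = solve-∀

      -- Small k: third differences in l.
      D : ℤ
      D = + d + + 2

      a-bound : ∀ k → k ℕ.< d ℕ.+ 2 → + 6 * (nat⁺ k * nat⁺ k * Y) ≤ + 6 * (D * D * Y)
      a-bound k k< = *-monoˡ (+ 6) 0≤ℕ (*-mono {nat⁺ k * nat⁺ k} {D * D} {Y} {Y} (0≤sq (nat⁺ k)) 0≤Y
          (*-mono {nat⁺ k} {D} {nat⁺ k} {D} (0≤nat⁺ k) (0≤+ {+ d} 0≤ℕ 0≤ℕ) a≤D a≤D) ≤-refl)
        where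
        a≤D : nat⁺ k ≤ D
        a≤D = subst (nat⁺ k ≤_) (pos-+ d 2) (nat⁺≤ k<)

      A-bounded : ∀ k → k ℕ.< d ℕ.+ 2 → Bounded (A k) (+ 6 * (D * D * Y))
      A-bounded k k< = bounded-≤ (a-bound k k<) (Column.∇∇∇-bounded k n)

      β : ℕ → ℤ
      β k = + 7 * ∇ (∇ (P 0)) k + + 4 * ∇ (∇ (P 1)) k + ∇ (∇ (P 2)) k + + 24 * (D * D * Y)

      P-nonneg : ∀ j k → 0ℤ ≤ ∇ (∇ (P j)) k
      P-nonneg j = Row.0≤∇∇ 0 j

      small : ∀ k → k ℕ.< d → Bounded (+ 8 * ∇ (∇ H) k) (β k)
      small k k<d = subst₂ Bounded (sym (8∇∇H k)) (lem (∇ (∇ (P 0)) k) (∇ (∇ (P 1)) k) (∇ (∇ (P 2)) k) (D * D * Y))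
        (bounded-+ (bounded-+ (bounded-- (exact 7 (P-nonneg 0 k)) (exact 4 (P-nonneg 1 k))) (bounded-nonneg (P-nonneg 2 k) ≤-refl))
          (bounded-- (bounded-- (A-bounded k (within 0 ℕ.z≤n)) (A-bounded (suc k) (within 1 ℕP.≤-refl)))
            (bounded-- (A-bounded (suc k) (within 1 ℕP.≤-refl)) (A-bounded (suc (suc k)) (ℕP.<-≤-trans (ℕ.s≤s (ℕ.s≤s k<d)) (ℕP.≤-reflexive (ℕP.+-comm 2 d)))))))
        where
        exact : ∀ j {x} → 0ℤ ≤ x → Bounded (+ j * x) (+ j * x)
        exact j 0≤x = bounded-nonneg (0≤* {+ j} 0≤ℕ 0≤x) ≤-refl
        within : ∀ j → j ℕ.≤ 1 → j ℕ.+ k ℕ.< d ℕ.+ 2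
        within j j≤1 = ℕP.≤-trans (ℕ.s≤s (ℕP.+-mono-≤ j≤1 (ℕP.<⇒≤ k<d))) (ℕP.≤-reflexive (ℕP.+-comm 2 d))
        lem : ∀ a b c x → + 7 * a + + 4 * b + c + (+ 6 * x + + 6 * x + (+ 6 * x + + 6 * x)) ≡ + 7 * a + + 4 * b + c + + 24 * x
        lem = solve-∀

      small-sum : ∑ d β ≤ + 54 * (Y * Y) + + d * (+ 24 * (D * D * Y))
      small-sum = ≤-trans (≤-reflexive (trans (∑-+ d (λ k → + 7 * ∇ (∇ (P 0)) k + + 4 * ∇ (∇ (P 1)) k + ∇ (∇ (P 2)) k) (λ _ → + 24 * (D * D * Y)))
          (cong₂ _+_ (trans (∑-+ d (λ k → + 7 * ∇ (∇ (P 0)) k + + 4 * ∇ (∇ (P 1)) k) (∇ (∇ (P 2)))) (cong (_+ ∑ d (∇ (∇ (P 2))))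
            (trans (∑-+ d (λ k → + 7 * ∇ (∇ (P 0)) k) (λ k → + 4 * ∇ (∇ (P 1)) k)) (cong₂ _+_ (∑-* d (+ 7) (∇ (∇ (P 0)))) (∑-* d (+ 4) (∇ (∇ (P 1)))))))) (∑-const d (+ 24 * (D * D * Y))))))
        (+-mono-≤ (≤-trans (+-mono-≤ (+-mono-≤ (*-monoˡ (+ 7) 0≤ℕ (bound 0 1 (nat⁺-def 0))) (*-monoˡ (+ 4) 0≤ℕ (bound 1 2 (nat⁺-def 1)))) (bound 2 3 (nat⁺-def 2)))
          (≤-reflexive (lem (Y * Y)))) ≤-refl)
        where
        bound : ∀ j b → nat⁺ j ≡ + b → ∑ d (∇ (∇ (P j))) ≤ + 3 * (+ b * (Y * Y))
        bound j b eq = subst (λ t → ∑ d (∇ (∇ (P j))) ≤ + 3 * (t * (Y * Y))) eq (Row.∑∇∇ 0 j d)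
        lem : ∀ y → + 7 * (+ 3 * (+ 1 * y)) + + 4 * (+ 3 * (+ 2 * y)) + + 3 * (+ 3 * y) ≡ + 54 * y
        lem = solve-∀

      -- Large k: second differences in k; only l < e contribute.
      γ : ℕ → ℤ
      γ k = ∑ e (λ l → ∇ (∇ (λ k → φ Y (d ℕ.+ k) l)) k)

      large : ∀ k → Bounded (∇ (∇ H) (d ℕ.+ k)) (γ k)
      large k = subst (λ x → Bounded x (γ k)) (sym expand) (∑-bounded e (λ l _ → bounded-alt l (bounded-nonneg (Row.0≤∇∇ d l k) ≤-refl)))
        where
        H-cut : ∀ k → d ℕ.≤ k → H k ≡ ∑ e (λ l → alt l * φ Y k l)
        H-cut k d≤k = ∑-extend e≤n (λ l e≤l → trans (cong (_*_ (alt l)) (φ-zero k l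
            (ℕP.≤-trans n≤de (ℕP.*-mono-≤ (ℕP.m≤n⇒m≤1+n d≤k) (ℕP.m≤n⇒m≤1+n e≤l))))) (*-zeroʳ (alt l)))
        h : ℕ → ℤ
        h k = ∑ e (λ l → alt l * φ Y (d ℕ.+ k) l)
        expand : ∇ (∇ H) (d ℕ.+ k) ≡ ∑ e (λ l → alt l * ∇ (∇ (λ k → φ Y (d ℕ.+ k) l)) k)
        expand = begin
          ∇ (∇ H) (d ℕ.+ k)
            ≡⟨ cong₂ (λ s t → s - t - (t - H (suc (suc (d ℕ.+ k))))) (H-cut (d ℕ.+ k) (ℕP.m≤m+n d k)) (shifted 1) ⟩
          h k - h (suc k) - (h (suc k) - H (suc (suc (d ℕ.+ k)))) ≡⟨ cong (λ t → h k - h (suc k) - (h (suc k) - t)) (shifted 2) ⟩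
          h k - h (suc k) - (h (suc k) - h (suc (suc k)))
            ≡⟨ cong₂ _-_ (sym (∑-- e (λ l → alt l * φ Y (d ℕ.+ k) l) (λ l → alt l * φ Y (d ℕ.+ suc k) l)))
                 (sym (∑-- e (λ l → alt l * φ Y (d ℕ.+ suc k) l) (λ l → alt l * φ Y (d ℕ.+ suc (suc k)) l))) ⟩
          ∑ e (λ l → alt l * φ Y (d ℕ.+ k) l - alt l * φ Y (d ℕ.+ suc k) l) - ∑ e (λ l → alt l * φ Y (d ℕ.+ suc k) l - alt l * φ Y (d ℕ.+ suc (suc k)) l)
            ≡⟨ sym (∑-- e (λ l → alt l * φ Y (d ℕ.+ k) l - alt l * φ Y (d ℕ.+ suc k) l) (λ l → alt l * φ Y (d ℕ.+ suc k) l - alt l * φ Y (d ℕ.+ suc (suc k)) l)) ⟩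
          ∑ e (λ l → alt l * φ Y (d ℕ.+ k) l - alt l * φ Y (d ℕ.+ suc k) l - (alt l * φ Y (d ℕ.+ suc k) l - alt l * φ Y (d ℕ.+ suc (suc k)) l))
            ≡⟨ ∑-cong′ e (λ l → lem (alt l) (φ Y (d ℕ.+ k) l) (φ Y (d ℕ.+ suc k) l) (φ Y (d ℕ.+ suc (suc k)) l)) ⟩
          ∑ e (λ l → alt l * ∇ (∇ (λ k → φ Y (d ℕ.+ k) l)) k) ∎
          where
          open ≡-Reasoning
          shifted : ∀ j → H (j ℕ.+ (d ℕ.+ k)) ≡ h (j ℕ.+ k)
          shifted j = trans (cong H (trans (sym (ℕP.+-assoc j d k)) (trans (cong (ℕ._+ k) (ℕP.+-comm j d)) (ℕP.+-assoc d j k)))) (H-cut (d ℕ.+ (j ℕ.+ k)) (ℕP.m≤m+n d (j ℕ.+ k)))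
          lem : ∀ a x y z → a * x - a * y - (a * y - a * z) ≡ a * (x - y - (y - z))
          lem = solve-∀

      large-sum : ∀ r → ∑ r γ ≤ + 3 * (+ e * + e * (Y * Y))
      large-sum r = ≤-trans (≤-reflexive (∑-swap r e (λ k l → ∇ (∇ (λ k → φ Y (d ℕ.+ k) l)) k)))
        (≤-trans (∑-mono e {g = λ _ → + 3 * (+ e * (Y * Y))} (λ l l<e → ≤-trans (Row.∑∇∇ d l r) (*-monoˡ (+ 3) 0≤ℕ (*-mono {nat⁺ l} {+ e} {Y * Y} {Y * Y} (0≤nat⁺ l) (0≤sq Y) (nat⁺≤ l<e) ≤-refl))))
        (≤-reflexive (trans (∑-const e (+ 3 * (+ e * (Y * Y)))) (lem (+ e) (Y * Y)))))
        where
        lem : ∀ e y → e * (+ 3 * (e * y)) ≡ + 3 * (e * e * y)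
        lem = solve-∀

      H0-bounded : Bounded (+ 8 * H 0 - + 4 * cube Y) (+ 60 * (Y * Y))
      H0-bounded = subst₂ Bounded (sym equation) (lem (Y * Y)) (bounded-≤ (+-monoʳ-≤ (+ 7 * (+ 3 * (+ 1 * (Y * Y))) + + 4 * (+ 3 * (+ 2 * (Y * Y))) + + 3 * (+ 3 * (Y * Y))) six)
        (bounded-+ (bounded-- (bounded-+ (bounded-neg (part 7 1)) (part 4 2)) (first-part 3)) (Column.∇∇∇-bounded 0 n)))
        where
        first-part : ∀ b → Bounded (Δ¹ Y (+ b)) (+ 3 * (+ b * (Y * Y)))
        first-part b = bounded-nonneg (0≤Δ¹ Y (+ b) 0≤ℕ) (Δ¹≤ Y (+ b) Y 0≤ℕ 0≤Y ≤-refl)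
        part : ∀ j b → Bounded (+ j * Δ¹ Y (+ b)) (+ j * (+ 3 * (+ b * (Y * Y))))
        part j b = bounded-nonneg (0≤* {+ j} 0≤ℕ (0≤Δ¹ Y (+ b) 0≤ℕ)) (*-monoˡ (+ j) 0≤ℕ (Δ¹≤ Y (+ b) Y 0≤ℕ 0≤Y ≤-refl))
        six : + 6 * (nat⁺ 0 * nat⁺ 0 * Y) ≤ + 6 * (Y * Y)
        six = *-monoˡ (+ 6) 0≤ℕ (*-mono {nat⁺ 0 * nat⁺ 0} {Y} {Y} {Y} (0≤sq (nat⁺ 0)) 0≤Y (subst (λ t → t * t ≤ Y) (sym (nat⁺-def 0)) (+≤+ (ℕP.≤-trans 1≤d d≤n))) ≤-refl)
        lem : ∀ y → + 7 * (+ 3 * (+ 1 * y)) + + 4 * (+ 3 * (+ 2 * y)) + + 3 * (+ 3 * y) + + 6 * y ≡ + 60 * y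
        lem = solve-∀
        P≡ : ∀ j b → nat⁺ j ≡ + b → P j 0 ≡ g (Y - + b)
        P≡ j b eq = cong g (trans (cong₂ (λ s t → Y - s * t) (nat⁺-def 0) eq) (cong (_-_ Y) (*-identityˡ (+ b))))
        equation : + 8 * H 0 - + 4 * cube Y ≡ - (+ 7 * Δ¹ Y (+ 1)) + + 4 * Δ¹ Y (+ 2) - Δ¹ Y (+ 3) + A 0
        equation = trans (cong₂ (λ s t → s - + 4 * t) (8H 0) (sym (g-pos 0≤Y)))
          (trans (cong₂ (λ s t → + 7 * s - + 4 * t + P 2 0 + A 0 - + 4 * g Y) (P≡ 0 1 (nat⁺-def 0)) (P≡ 1 2 (nat⁺-def 1)))
          (trans (cong (λ s → + 7 * g (Y - + 1) - + 4 * g (Y - + 2) + s + A 0 - + 4 * g Y) (P≡ 2 3 (nat⁺-def 2)))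
            (lem′ (g Y) (g (Y - + 1)) (g (Y - + 2)) (g (Y - + 3)) (A 0))))
          where
          lem′ : ∀ y a b c A → + 7 * a - + 4 * b + c + A - + 4 * y ≡ - (+ 7 * (y - a)) + + 4 * (y - b) - (y - c) + A
          lem′ = solve-∀

      r : ℕ
      r = n ℕ.∸ d

      S : ℤ
      S = + 54 * (Y * Y) + + d * (+ 24 * (D * D * Y)) + + 24 * (+ e * + e * (Y * Y))

      remainder : Bounded (∑ n (λ k → partial b k * (+ 8 * ∇ (∇ H) k))) (C * S)
      remainder = subst (λ x → Bounded x (C * S)) (sym split) (bounded-≤ total (bounded-+
          (∑-bounded d (λ k k<d → bounded-* (T-bounded k) (small k k<d)))
          (∑-bounded r (λ k _ → bounded-* (T-bounded (d ℕ.+ k)) (bounded-* (bounded-nonneg {+ 8} 0≤ℕ ≤-refl) (large k))))))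
        where
        split : ∑ n (λ k → partial b k * (+ 8 * ∇ (∇ H) k)) ≡ ∑ d (λ k → partial b k * (+ 8 * ∇ (∇ H) k)) + ∑ r (λ k → partial b (d ℕ.+ k) * (+ 8 * ∇ (∇ H) (d ℕ.+ k)))
        split = trans (cong (λ j → ∑ j (λ k → partial b k * (+ 8 * ∇ (∇ H) k))) (sym (ℕP.m+[n∸m]≡n d≤n))) (∑-split d r (λ k → partial b k * (+ 8 * ∇ (∇ H) k)))
        total : ∑ d (λ k → C * β k) + ∑ r (λ k → C * (+ 8 * γ k)) ≤ C * S
        total = ≤-trans (≤-reflexive (trans (cong₂ _+_ (∑-* d C β) (trans (∑-* r C (λ k → + 8 * γ k)) (cong (_*_ C) (∑-* r (+ 8) γ)))) (sym (*-distribˡ-+ C (∑ d β) (+ 8 * ∑ r γ)))))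
          (*-monoˡ C 0≤C (≤-trans (+-mono-≤ small-sum (*-monoˡ (+ 8) 0≤ℕ (large-sum r))) (≤-reflexive (lem (+ 54 * (Y * Y) + + d * (+ 24 * (D * D * Y))) (+ e * + e * (Y * Y))))))
          where
          lem : ∀ x y → x + + 8 * (+ 3 * y) ≡ x + + 24 * y
          lem = solve-∀

      main : + 8 * (+ N * W n) - + 4 * M * cube Y ≡ M * (+ 8 * H 0 - + 4 * cube Y) + ∑ n (λ k → partial b k * (+ 8 * ∇ (∇ H) k))
      main = trans (cong (λ t → + 8 * t - + 4 * M * cube Y) (weighted n H H-zero))
        (trans (lem M (H 0) (∑ n (λ k → partial b k * ∇ (∇ H) k)) (cube Y)) (cong (_+_ (M * (+ 8 * H 0 - + 4 * cube Y)))
          (trans (sym (∑-* n (+ 8) (λ k → partial b k * ∇ (∇ H) k))) (∑-cong′ n (λ k → lem′ (partial b k) (∇ (∇ H) k))))))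
        where
        lem : ∀ M h s y → + 8 * (M * h + s) - + 4 * M * y ≡ M * (+ 8 * h - + 4 * y) + + 8 * s
        lem = solve-∀
        lem′ : ∀ b h → + 8 * (b * h) ≡ b * (+ 8 * h)
        lem′ = solve-∀

    hyperbola-asymptotic : Bounded (+ 8 * (+ N * W n) - + 4 * M * cube (+ n)) (K * (+ d * + d * + d * + n + + e * + e * (+ n * + n)))
    hyperbola-asymptotic = subst (λ x → Bounded x (K * (+ d * + d * + d * Y + + e * + e * (Y * Y)))) (sym main)
      (bounded-≤ final (bounded-+ (bounded-* (bounded-∣∣ M) H0-bounded) remainder))
      where
      final : + ∣ M ∣ * (+ 60 * (Y * Y)) + C * S ≤ K * (+ d * + d * + d * Y + + e * + e * (Y * Y))
      final = ≤-from (+ 60 * + ∣ M ∣ * (X₁ + X₂) + C * (+ 54 * X₂ + + 24 * X₃ + + 78 * X₁ + + 216 * X₄))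
        (0≤+ (0≤* (0≤* {+ 60} {+ ∣ M ∣} 0≤ℕ 0≤ℕ) (0≤+ 0≤X₁ 0≤X₂)) (0≤* 0≤C (0≤+ (0≤+ (0≤+ (0≤* {+ 54} 0≤ℕ 0≤X₂) (0≤* {+ 24} 0≤ℕ 0≤X₃)) (0≤* {+ 78} 0≤ℕ 0≤X₁)) (0≤* {+ 216} 0≤ℕ 0≤X₄))))
        (lem (+ ∣ M ∣) C (+ d) (+ e) Y)
        where
        δ ε X₁ X₂ X₃ X₄ : ℤ
        δ = + d - 1ℤ
        ε = + e - 1ℤ
        X₁ = + d * + d * + d * Y
        X₂ = (+ e * ε + ε) * (Y * Y)
        X₃ = + d * δ * (+ 8 * + d + + 4) * Y
        X₄ = + e * + e * (Y * Y)
        0≤δ : 0ℤ ≤ δ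
        0≤δ = 0≤- (+≤+ 1≤d)
        0≤ε : 0ℤ ≤ ε
        0≤ε = 0≤- (+≤+ 1≤e)
        0≤X₁ : 0ℤ ≤ X₁
        0≤X₁ = 0≤* (0≤* {+ d * + d} {+ d} (0≤sq (+ d)) 0≤ℕ) 0≤Y
        0≤X₂ : 0ℤ ≤ X₂
        0≤X₂ = 0≤* (0≤+ (0≤* {+ e} 0≤ℕ 0≤ε) 0≤ε) (0≤sq Y)
        0≤X₃ : 0ℤ ≤ X₃
        0≤X₃ = 0≤* (0≤* (0≤* {+ d} 0≤ℕ 0≤δ) (0≤+ (0≤* {+ 8} {+ d} 0≤ℕ 0≤ℕ) 0≤ℕ)) 0≤Y
        0≤X₄ : 0ℤ ≤ X₄
        0≤X₄ = 0≤* (0≤sq (+ e)) (0≤sq Y)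
        lem : ∀ M C d e Y → (+ 60 * M + + 294 * C) * (d * d * d * Y + e * e * (Y * Y))
          ≡ M * (+ 60 * (Y * Y)) + C * (+ 54 * (Y * Y) + d * (+ 24 * ((d + + 2) * (d + + 2) * Y)) + + 24 * (e * e * (Y * Y)))
            + (+ 60 * M * (d * d * d * Y + (e * (e - 1ℤ) + (e - 1ℤ)) * (Y * Y)) + C * (+ 54 * ((e * (e - 1ℤ) + (e - 1ℤ)) * (Y * Y)) + + 24 * (d * (d - 1ℤ) * (+ 8 * d + + 4) * Y) + + 78 * (d * d * d * Y) + + 216 * (e * e * (Y * Y))))
        lem = solve-∀

alt-even : ∀ k → alt (k ℕ.+ k) ≡ 1ℤ
alt-even zero = refl
alt-even (suc k) = trans (cong (λ j → - alt j) (ℕP.+-suc k k)) (trans (neg-involutive (alt (k ℕ.+ k))) (alt-even k))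

∑-even : ∀ m (f : ℕ → ℤ) → ∑ (m ℕ.+ m) (λ k → (1ℤ + alt k) * f k) ≡ + 2 * ∑ m (λ k → f (k ℕ.+ k))
∑-even m f = trans (∑-even-odd m (λ k → (1ℤ + alt k) * f k))
  (trans (∑-cong′ m (λ k → trans (cong (λ e → (1ℤ + e) * f (k ℕ.+ k) + (1ℤ + - e) * f (suc (k ℕ.+ k))) (alt-even k)) (lem (f (k ℕ.+ k)) (f (suc (k ℕ.+ k))))))
    (∑-* m (+ 2) (λ k → f (k ℕ.+ k))))
  where
  lem : ∀ x y → (1ℤ + 1ℤ) * x + (1ℤ + - 1ℤ) * y ≡ + 2 * x
  lem = solve-∀

-- Third differences of g along a quadratic progression

module Third (τ s k : ℤ) (1≤τ : 1ℤ ≤ τ) (1≤s : 1ℤ ≤ s) (k≡12s : k ≡ + 12 * s) where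

  private
    0≤τ : 0ℤ ≤ τ
    0≤τ = ≤-trans 0≤ℕ 1≤τ

    0≤s : 0ℤ ≤ s
    0≤s = ≤-trans 0≤ℕ 1≤s

    ss≥0 : 0ℤ ≤ s * s
    ss≥0 = 0≤sq s

    sss≥0 : 0ℤ ≤ s * s * s
    sss≥0 = 0≤* ss≥0 0≤s

    x₁ : s * s * (τ * τ * τ) ≤ (s * s * s * (τ * τ * τ))
    x₁ = ≤-from ((s - 1ℤ) * (s * s) * (τ * τ * τ)) (0≤* (0≤* (0≤- 1≤s) ss≥0) (0≤* (0≤sq τ) 0≤τ)) (lem s τ)
      where
      lem : ∀ s τ → s * s * s * (τ * τ * τ) ≡ s * s * (τ * τ * τ) + (s - 1ℤ) * (s * s) * (τ * τ * τ)
      lem = solve-∀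

    x₂ : s * s * (τ * τ) ≤ (s * s * s * (τ * τ * τ))
    x₂ = ≤-trans (≤-from ((τ - 1ℤ) * (s * s * (τ * τ))) (0≤* (0≤- 1≤τ) (0≤* ss≥0 (0≤sq τ))) (lem s τ)) x₁
      where
      lem : ∀ s τ → s * s * (τ * τ * τ) ≡ s * s * (τ * τ) + (τ - 1ℤ) * (s * s * (τ * τ))
      lem = solve-∀

    x₃ : s * s * s * (τ * τ) ≤ (s * s * s * (τ * τ * τ))
    x₃ = ≤-from ((τ - 1ℤ) * (s * s * s * (τ * τ))) (0≤* (0≤- 1≤τ) (0≤* sss≥0 (0≤sq τ))) (lem s τ)
      where
      lem : ∀ s τ → s * s * s * (τ * τ * τ) ≡ s * s * s * (τ * τ) + (τ - 1ℤ) * (s * s * s * (τ * τ))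
      lem = solve-∀

    x₄ : s * s * s * τ ≤ (s * s * s * (τ * τ * τ))
    x₄ = ≤-trans (≤-from ((τ - 1ℤ) * (s * s * s * τ)) (0≤* (0≤- 1≤τ) (0≤* sss≥0 0≤τ)) (lem s τ)) x₃
      where
      lem : ∀ s τ → s * s * s * (τ * τ) ≡ s * s * s * τ + (τ - 1ℤ) * (s * s * s * τ)
      lem = solve-∀

    x₅ : s * s * s ≤ (s * s * s * (τ * τ * τ))
    x₅ = ≤-trans (≤-from ((τ - 1ℤ) * (s * s * s)) (0≤* (0≤- 1≤τ) sss≥0) (lem s τ)) x₄
      where
      lem : ∀ s τ → s * s * s * τ ≡ s * s * s + (τ - 1ℤ) * (s * s * s)
      lem = solve-∀

    0≤X : 0ℤ ≤ (s * s * s * (τ * τ * τ))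
    0≤X = ≤-trans sss≥0 x₅

    0≤k : 0ℤ ≤ k
    0≤k = subst (0ℤ ≤_) (sym k≡12s) (0≤* {+ 12} {s} 0≤ℕ 0≤s)

    nn : ∀ k x → 0ℤ ≤ x → 0ℤ ≤ + k * x
    nn k x 0≤x = 0≤* {+ k} {x} 0≤ℕ 0≤x

  module _ (A B C : ℤ) (A≤ : A ≤ + 4 * (τ * τ)) (B≤ : Bounded B (s * τ)) (C≤ : Bounded C s) where

    v₀ v₁ v₂ v₃ : ℤ
    v₀ = A
    v₁ = A - B - C
    v₂ = A - + 2 * B - + 4 * C
    v₃ = A - + 3 * B - + 9 * C

    Θ : ℤ
    Θ = + 1680 * (s * s * s * (τ * τ * τ)) + + 8 * (k * k * k * (τ * τ * τ))

    third : ℤ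
    third = g v₀ - + 3 * g v₁ + + 3 * g v₂ - g v₃

    private
      k* : ∀ k x b → Bounded x b → Bounded (+ k * x) (+ k * b)
      k* k x b p = bounded-* {+ k} {x} {+ k} {b} (bounded-nonneg {+ k} {+ k} 0≤ℕ ≤-refl) p

      Goal : Set
      Goal = Bounded third Θ

      inside : 0ℤ ≤ v₀ → 0ℤ ≤ v₁ → 0ℤ ≤ v₂ → 0ℤ ≤ v₃ → Goal
      inside p₀ p₁ p₂ p₃ = subst (λ x → Bounded x Θ) (sym value) (bounded-≤ total
        (bounded-+ (bounded-+ (bounded-+ (bounded-+ (bounded-+
          (k* 36 (- (A * B * C)) (+ 4 * (τ * τ) * (s * τ) * s) (bounded-neg {A * B * C} (bounded-* {A * B} {C} {+ 4 * (τ * τ) * (s * τ)} {s} (bounded-* {A} {B} {+ 4 * (τ * τ)} {s * τ} A′ B≤) C≤)))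
          (k* 108 (- (A * C * C)) (+ 4 * (τ * τ) * s * s) (bounded-neg {A * C * C} (bounded-* {A * C} {C} {+ 4 * (τ * τ) * s} {s} (bounded-* {A} {C} {+ 4 * (τ * τ)} {s} A′ C≤) C≤))))
          (k* 6 (B * B * B) (s * τ * (s * τ) * (s * τ)) (bounded-* {B * B} {B} {s * τ * (s * τ)} {s * τ} (bounded-* {B} {B} {s * τ} {s * τ} B≤ B≤) B≤)))
          (k* 108 (B * B * C) (s * τ * (s * τ) * s) (bounded-* {B * B} {C} {s * τ * (s * τ)} {s} (bounded-* {B} {B} {s * τ} {s * τ} B≤ B≤) C≤)))
          (k* 450 (B * C * C) (s * τ * s * s) (bounded-* {B * C} {C} {s * τ * s} {s} (bounded-* {B} {C} {s * τ} {s} B≤ C≤) C≤)))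
          (k* 540 (C * C * C) (s * s * s) (bounded-* {C * C} {C} {s * s} {s} (bounded-* {C} {C} {s} {s} C≤ C≤) C≤))))
        where
        A′ : Bounded A (+ 4 * (τ * τ))
        A′ = bounded-nonneg p₀ A≤
        value : third ≡ + 36 * - (A * B * C) + + 108 * - (A * C * C) + + 6 * (B * B * B) + + 108 * (B * B * C) + + 450 * (B * C * C) + + 540 * (C * C * C)
        value = trans (cong₂ (λ x y → x - + 3 * y + + 3 * g v₂ - g v₃) (g-pos p₀) (g-pos p₁))
          (trans (cong₂ (λ x y → cube v₀ - + 3 * cube v₁ + + 3 * x - y) (g-pos p₂) (g-pos p₃)) (lem A B C))
          where
          lem : ∀ A B C → A * A * A - + 3 * ((A - B - C) * (A - B - C) * (A - B - C)) + + 3 * ((A - + 2 * B - + 4 * C) * (A - + 2 * B - + 4 * C) * (A - + 2 * B - + 4 * C)) - (A - + 3 * B - + 9 * C) * (A - + 3 * B - + 9 * C) * (A - + 3 * B - + 9 * C)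
            ≡ + 36 * - (A * B * C) + + 108 * - (A * C * C) + + 6 * (B * B * B) + + 108 * (B * B * C) + + 450 * (B * C * C) + + 540 * (C * C * C)
          lem = solve-∀
        total : + 36 * (+ 4 * (τ * τ) * (s * τ) * s) + + 108 * (+ 4 * (τ * τ) * s * s) + + 6 * (s * τ * (s * τ) * (s * τ)) + + 108 * (s * τ * (s * τ) * s) + + 450 * (s * τ * s * s) + + 540 * (s * s * s) ≤ Θ
        total = ≤-trans (+-mono-≤ (+-mono-≤ (+-mono-≤ (+-mono-≤ (+-mono-≤
            (scale 36 4 (+ 4 * (τ * τ) * (s * τ) * s) (s * s * (τ * τ * τ)) (l₁ s τ) x₁)
            (scale 108 4 (+ 4 * (τ * τ) * s * s) (s * s * (τ * τ)) (l₂ s τ) x₂))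
            (scale 6 1 (s * τ * (s * τ) * (s * τ)) (s * s * s * (τ * τ * τ)) (l₃ s τ) ≤-refl))
            (scale 108 1 (s * τ * (s * τ) * s) (s * s * s * (τ * τ)) (l₄ s τ) x₃))
            (scale 450 1 (s * τ * s * s) (s * s * s * τ) (l₅ s τ) x₄))
            (scale 540 1 (s * s * s) (s * s * s) (l₆ s) x₅))
          sum
          where
          scale : ∀ k j y x → y ≡ + j * x → x ≤ (s * s * s * (τ * τ * τ)) → + k * y ≤ + k * (+ j * (s * s * s * (τ * τ * τ)))
          scale k j y x e le = *-monoˡ {y} {+ j * (s * s * s * (τ * τ * τ))} (+ k) 0≤ℕ (subst (_≤ + j * (s * s * s * (τ * τ * τ))) (sym e) (*-monoˡ {x} {(s * s * s * (τ * τ * τ))} (+ j) 0≤ℕ le))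
          sum : + 36 * (+ 4 * (s * s * s * (τ * τ * τ))) + + 108 * (+ 4 * (s * s * s * (τ * τ * τ))) + + 6 * (+ 1 * (s * s * s * (τ * τ * τ))) + + 108 * (+ 1 * (s * s * s * (τ * τ * τ))) + + 450 * (+ 1 * (s * s * s * (τ * τ * τ))) + + 540 * (+ 1 * (s * s * s * (τ * τ * τ))) ≤ Θ
          sum = ≤-from (+ 8 * (k * k * k * (τ * τ * τ))) (nn 8 (k * k * k * (τ * τ * τ)) (0≤* (0≤* (0≤sq k) 0≤k) (0≤* (0≤sq τ) 0≤τ))) (lem (s * s * s * (τ * τ * τ)) (+ 8 * (k * k * k * (τ * τ * τ))))
            where
            lem : ∀ z y → + 1680 * z + y ≡ + 36 * (+ 4 * z) + + 108 * (+ 4 * z) + + 6 * (+ 1 * z) + + 108 * (+ 1 * z) + + 450 * (+ 1 * z) + + 540 * (+ 1 * z) + y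
            lem = solve-∀
          l₁ : ∀ s τ → + 4 * (τ * τ) * (s * τ) * s ≡ + 4 * (s * s * (τ * τ * τ))
          l₁ = solve-∀
          l₂ : ∀ s τ → + 4 * (τ * τ) * s * s ≡ + 4 * (s * s * (τ * τ))
          l₂ = solve-∀
          l₃ : ∀ s τ → s * τ * (s * τ) * (s * τ) ≡ + 1 * (s * s * s * (τ * τ * τ))
          l₃ = solve-∀
          l₄ : ∀ s τ → s * τ * (s * τ) * s ≡ + 1 * (s * s * s * (τ * τ))
          l₄ = solve-∀
          l₅ : ∀ s τ → s * τ * s * s ≡ + 1 * (s * s * s * τ)
          l₅ = solve-∀
          l₆ : ∀ s → s * s * s ≡ + 1 * (s * s * s)
          l₆ = solve-∀

      -- When some value is nonpositive all four are at most 12sτ.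
      outside : v₀ ≤ k * τ → v₁ ≤ k * τ → v₂ ≤ k * τ → v₃ ≤ k * τ → Goal
      outside q₀ q₁ q₂ q₃ = bounded-≤ (≤-from (+ 1680 * (s * s * s * (τ * τ * τ))) (nn 1680 (s * s * s * (τ * τ * τ)) 0≤X) (lem (s * s * s * (τ * τ * τ)) k τ))
        (bounded-- (bounded-+ (bounded-- (small q₀) (k* 3 (g v₁) (k * τ * (k * τ) * (k * τ)) (small q₁))) (k* 3 (g v₂) (k * τ * (k * τ) * (k * τ)) (small q₂))) (small q₃))
        where
        0≤z : 0ℤ ≤ k * τ
        0≤z = 0≤* 0≤k 0≤τ
        small : ∀ {v} → v ≤ k * τ → Bounded (g v) (k * τ * (k * τ) * (k * τ))
        small {v} le = bounded-nonneg (0≤g v) (subst (g v ≤_) (g-pos 0≤z) (g-mono le))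
        lem : ∀ z k τ → + 1680 * z + + 8 * (k * k * k * (τ * τ * τ)) ≡ k * τ * (k * τ) * (k * τ) + + 3 * (k * τ * (k * τ) * (k * τ)) + + 3 * (k * τ * (k * τ) * (k * τ)) + k * τ * (k * τ) * (k * τ) + + 1680 * z
        lem = solve-∀

      C′ : Bounded C (s * τ)
      C′ = bounded-≤ (≤-from (s * (τ - 1ℤ)) (0≤* 0≤s (0≤- 1≤τ)) (lem s τ)) C≤
        where
        lem : ∀ s τ → s * τ ≡ s + s * (τ - 1ℤ)
        lem = solve-∀

      near : ∀ x y i j → x ≡ y + (+ i * B + + j * C) ⊎ x ≡ y - (+ i * B + + j * C) → i ℕ.≤ 3 → j ℕ.≤ 9 → y ≤ 0ℤ → x ≤ k * τ
      near x y i j e i≤ j≤ y≤0 = step e (bounded-≤ weights (bounded-+ (k* i B (s * τ) B≤) (k* j C (s * τ) C′)))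
        where
        weights : + i * (s * τ) + + j * (s * τ) ≤ k * τ
        weights = ≤-from ((+ 3 - + i) * (s * τ) + (+ 9 - + j) * (s * τ)) (0≤+ (0≤* (0≤- (+≤+ i≤)) (0≤* 0≤s 0≤τ)) (0≤* (0≤- (+≤+ j≤)) (0≤* 0≤s 0≤τ)))
            (trans (cong (_* τ) k≡12s) (lem (+ i) (+ j) s τ))
          where
          lem : ∀ i j s τ → + 12 * s * τ ≡ i * (s * τ) + j * (s * τ) + ((+ 3 - i) * (s * τ) + (+ 9 - j) * (s * τ))
          lem = solve-∀
        step : x ≡ y + (+ i * B + + j * C) ⊎ x ≡ y - (+ i * B + + j * C) → Bounded (+ i * B + + j * C) (k * τ) → x ≤ k * τ
        step (inj₁ e) (bounded _ hi) = ≤-trans (≤-reflexive e) (≤-trans (+-mono-≤ y≤0 hi) (≤-reflexive (+-identityˡ (k * τ))))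
        step (inj₂ e) p with bounded-neg p
        ... | bounded _ hi = ≤-trans (≤-reflexive e) (≤-trans (+-mono-≤ y≤0 hi) (≤-reflexive (+-identityˡ (k * τ))))

    private
      Sign : ℤ → Set
      Sign v = 0ℤ ≤ v ⊎ v ≤ 0ℤ

      by-signs : Sign v₀ → Sign v₁ → Sign v₂ → Sign v₃ → Goal
      by-signs (inj₁ p₀) (inj₁ p₁) (inj₁ p₂) (inj₁ p₃) = inside p₀ p₁ p₂ p₃
      by-signs (inj₂ q) _ _ _ = outside
          (near v₀ v₀ 0 0 (inj₁ (l₀ A B C)) (le 0) (le 0) q) (near v₁ v₀ 1 1 (inj₂ (l₁ A B C)) (le 1) (le 1) q)
          (near v₂ v₀ 2 4 (inj₂ (l₂ A B C)) (le 2) (le 4) q) (near v₃ v₀ 3 9 (inj₂ (l₃ A B C)) (le 3) (le 9) q)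
        where
        le : ∀ j {k} → j ℕ.≤ j ℕ.+ k
        le j {k} = ℕP.m≤m+n j k
        l₀ : ∀ A B C → A ≡ A + (+ 0 * B + + 0 * C)
        l₀ = solve-∀
        l₁ : ∀ A B C → A - B - C ≡ A - (+ 1 * B + + 1 * C)
        l₁ = solve-∀
        l₂ : ∀ A B C → A - + 2 * B - + 4 * C ≡ A - (+ 2 * B + + 4 * C)
        l₂ = solve-∀
        l₃ : ∀ A B C → A - + 3 * B - + 9 * C ≡ A - (+ 3 * B + + 9 * C)
        l₃ = solve-∀
      by-signs _ (inj₂ q) _ _ = outside
          (near v₀ v₁ 1 1 (inj₁ (l₀ A B C)) (le 1) (le 1) q) (near v₁ v₁ 0 0 (inj₁ (l₁ A B C)) (le 0) (le 0) q)
          (near v₂ v₁ 1 3 (inj₂ (l₂ A B C)) (le 1) (le 3) q) (near v₃ v₁ 2 8 (inj₂ (l₃ A B C)) (le 2) (le 8) q)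
        where
        le : ∀ j {k} → j ℕ.≤ j ℕ.+ k
        le j {k} = ℕP.m≤m+n j k
        l₀ : ∀ A B C → A ≡ A - B - C + (+ 1 * B + + 1 * C)
        l₀ = solve-∀
        l₁ : ∀ A B C → A - B - C ≡ A - B - C + (+ 0 * B + + 0 * C)
        l₁ = solve-∀
        l₂ : ∀ A B C → A - + 2 * B - + 4 * C ≡ A - B - C - (+ 1 * B + + 3 * C)
        l₂ = solve-∀
        l₃ : ∀ A B C → A - + 3 * B - + 9 * C ≡ A - B - C - (+ 2 * B + + 8 * C)
        l₃ = solve-∀
      by-signs _ _ (inj₂ q) _ = outside
          (near v₀ v₂ 2 4 (inj₁ (l₀ A B C)) (le 2) (le 4) q) (near v₁ v₂ 1 3 (inj₁ (l₁ A B C)) (le 1) (le 3) q)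
          (near v₂ v₂ 0 0 (inj₁ (l₂ A B C)) (le 0) (le 0) q) (near v₃ v₂ 1 5 (inj₂ (l₃ A B C)) (le 1) (le 5) q)
        where
        le : ∀ j {k} → j ℕ.≤ j ℕ.+ k
        le j {k} = ℕP.m≤m+n j k
        l₀ : ∀ A B C → A ≡ A - + 2 * B - + 4 * C + (+ 2 * B + + 4 * C)
        l₀ = solve-∀
        l₁ : ∀ A B C → A - B - C ≡ A - + 2 * B - + 4 * C + (+ 1 * B + + 3 * C)
        l₁ = solve-∀
        l₂ : ∀ A B C → A - + 2 * B - + 4 * C ≡ A - + 2 * B - + 4 * C + (+ 0 * B + + 0 * C)
        l₂ = solve-∀
        l₃ : ∀ A B C → A - + 3 * B - + 9 * C ≡ A - + 2 * B - + 4 * C - (+ 1 * B + + 5 * C)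
        l₃ = solve-∀
      by-signs _ _ _ (inj₂ q) = outside
          (near v₀ v₃ 3 9 (inj₁ (l₀ A B C)) (le 3) (le 9) q) (near v₁ v₃ 2 8 (inj₁ (l₁ A B C)) (le 2) (le 8) q)
          (near v₂ v₃ 1 5 (inj₁ (l₂ A B C)) (le 1) (le 5) q) (near v₃ v₃ 0 0 (inj₁ (l₃ A B C)) (le 0) (le 0) q)
        where
        le : ∀ j {k} → j ℕ.≤ j ℕ.+ k
        le j {k} = ℕP.m≤m+n j k
        l₀ : ∀ A B C → A ≡ A - + 3 * B - + 9 * C + (+ 3 * B + + 9 * C)
        l₀ = solve-∀
        l₁ : ∀ A B C → A - B - C ≡ A - + 3 * B - + 9 * C + (+ 2 * B + + 8 * C)
        l₁ = solve-∀
        l₂ : ∀ A B C → A - + 2 * B - + 4 * C ≡ A - + 3 * B - + 9 * C + (+ 1 * B + + 5 * C)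
        l₂ = solve-∀
        l₃ : ∀ A B C → A - + 3 * B - + 9 * C ≡ A - + 3 * B - + 9 * C + (+ 0 * B + + 0 * C)
        l₃ = solve-∀

    third-bounded : Bounded third Θ
    third-bounded = by-signs (≤-total 0ℤ v₀) (≤-total 0ℤ v₁) (≤-total 0ℤ v₂) (≤-total 0ℤ v₃)

quad : ℤ → ℤ → ℤ → ℤ → ℤ → ℤ
quad a b c i j = a * (i * i) + b * (i * j) + c * (j * j)

quad-swap : ∀ a b c i j → quad a b c i j ≡ quad c b a j i
quad-swap = lem
  where
  lem : ∀ a b c i j → a * (i * i) + b * (i * j) + c * (j * j) ≡ c * (j * j) + b * (j * i) + a * (i * i)
  lem = solve-∀

opaque
  coord : ℕ → ℕ → ℤ
  coord R k = + k - + R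

  coord-def : ∀ R k → coord R k ≡ + k - + R
  coord-def R k = refl

  coord-suc : ∀ R k → coord R (suc k) ≡ coord R k + 1ℤ
  coord-suc R k = trans (cong (_- + R) (pos-+ 1 k)) (lem (+ k) (+ R))
    where
    lem : ∀ k r → 1ℤ + k - r ≡ k - r + 1ℤ
    lem = solve-∀

  coord-bounded : ∀ R k → k ℕ.< R ℕ.+ R → Bounded (coord R k) (+ R)
  coord-bounded R k k< = bounded (≤-from (+ k) 0≤ℕ (+-comm (+ k) (- + R)))
    (≤-from (+ R + + R - + k) (0≤- (≤-trans (+≤+ (ℕP.<⇒≤ k<)) (≤-reflexive (pos-+ R R)))) (lem (+ k) (+ R)))
    where
    lem : ∀ k r → r ≡ k - r + (r + r - k)
    lem = solve-∀

  coord-double : ∀ P k → coord (P ℕ.+ P) (k ℕ.+ k) ≡ + 2 * coord P k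
  coord-double P k = trans (cong₂ _-_ (pos-+ k k) (pos-+ P P)) (lem (+ k) (+ P))
    where
    lem : ∀ k p → k + k - (p + p) ≡ + 2 * (k - p)
    lem = solve-∀

boxSum : ℤ → ℤ → ℤ → ℕ → ℤ → ℤ
boxSum a b c R Y = ∑ (R ℕ.+ R) (λ k → ∑ (R ℕ.+ R) (λ l → g (Y - quad a b c (coord R k) (coord R l))))

module LatticeRows (κ T : ℕ) (1≤T : 1 ℕ.≤ T) (s : ℤ) (1≤s : 1ℤ ≤ s) where

  τ Y k : ℤ
  τ = + T
  Y = + 4 * (τ * τ)
  k = + 12 * s

  P R n : ℕ
  P = κ ℕ.* T ℕ.+ 2
  R = P ℕ.+ P
  n = R ℕ.+ R

  ρ : ℤ
  ρ = + 2 * + κ + + 4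

  Θ : ℤ
  Θ = + 1680 * (s * s * s * (τ * τ * τ)) + + 8 * (k * k * k * (τ * τ * τ))

  0≤τ : 0ℤ ≤ τ
  0≤τ = 0≤ℕ

  R-int : + R ≡ + 2 * (+ κ * τ) + + 4
  R-int = trans (pos-+ P P) (trans (cong (λ p → p + p) (trans (pos-+ (κ ℕ.* T) 2) (cong (_+ + 2) (pos-* κ T)))) (lem (+ κ * τ)))
    where
    lem : ∀ x → x + + 2 + (x + + 2) ≡ + 2 * x + + 4
    lem = solve-∀

  in-range : ∀ j → j ℕ.< n → Bounded (coord R j) (ρ * τ)
  in-range j j<n = bounded-≤ (≤-from (+ 4 * (τ - 1ℤ)) (0≤* {+ 4} 0≤ℕ (0≤- (+≤+ 1≤T))) (trans (lem (+ κ) τ) (cong (_+ + 4 * (τ - 1ℤ)) (sym R-int))))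
      (coord-bounded R j j<n)
    where
    lem : ∀ κ τ → (+ 2 * κ + + 4) * τ ≡ + 2 * (κ * τ) + + 4 + + 4 * (τ - 1ℤ)
    lem = solve-∀

  κ2T : + (κ ℕ.* (T ℕ.+ T)) ≡ + 2 * (+ κ * τ)
  κ2T = trans (pos-* κ (T ℕ.+ T)) (trans (cong (_*_ (+ κ)) (pos-+ T T)) (lem (+ κ) τ))
    where
    lem : ∀ κ τ → κ * (τ + τ) ≡ + 2 * (κ * τ)
    lem = solve-∀

  module Row (a b c : ℤ) (0≤Q : ∀ i j → 0ℤ ≤ quad a b c i j)
    (inBox : ∀ i j → quad a b c i j ≤ Y → Bounded i (+ (κ ℕ.* (T ℕ.+ T))))
    (a≤s : Bounded a s) (s-bound : (+ 2 * + ∣ a ∣ + + ∣ b ∣) * ρ ≤ s)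
    (j : ℤ) (j-range : Bounded j (ρ * τ)) where

    private
      G : ℕ → ℤ
      G l = g (Y - quad a b c (coord R l) j)

      outside : ∀ i → ¬ Bounded i (+ (κ ℕ.* (T ℕ.+ T))) → g (Y - quad a b c i j) ≡ 0ℤ
      outside i nb = g-neg (i≤j⇒i-j≤0 (≮⇒≥ (λ lt → nb (inBox i j (<⇒≤ lt)))))

      right-end : ∀ l → n ℕ.≤ l → G l ≡ 0ℤ
      right-end l n≤l = outside (coord R l) λ { (bounded _ hi) → <⇒≱ (<-from (+ 3 + (+ l - (+ R + + R))) (0≤+ {+ 3} 0≤ℕ (0≤- (≤-trans (≤-reflexive (sym (pos-+ R R))) (+≤+ n≤l))))
          (trans (coord-def R l) (trans (lem (+ l) (+ R)) (trans (cong (λ r → r + (+ l - (+ R + + R))) R-int) (trans (lem′ (+ κ * τ) (+ l - (+ R + + R))) (cong (λ x → x + 1ℤ + (+ 3 + (+ l - (+ R + + R)))) (sym κ2T))))))) hi }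
        where
        lem : ∀ l r → l - r ≡ r + (l - (r + r))
        lem = solve-∀
        lem′ : ∀ x y → + 2 * x + + 4 + y ≡ + 2 * x + 1ℤ + (+ 3 + y)
        lem′ = solve-∀

      left-end : ∀ l → l ℕ.≤ 2 → G l ≡ 0ℤ
      left-end l l≤2 = outside (coord R l) λ { (bounded lo _) → <⇒≱ (<-from (+ 1 + (+ 2 - + l)) (0≤+ {+ 1} 0≤ℕ (0≤- (+≤+ l≤2)))
          (trans (cong -_ κ2T) (trans (lem (+ κ * τ) (+ l)) (trans (cong (λ r → + l - r + 1ℤ + (+ 1 + (+ 2 - + l))) (sym R-int)) (cong (λ x → x + 1ℤ + (+ 1 + (+ 2 - + l))) (sym (coord-def R l))))))) lo }
        where
        lem : ∀ x l → - (+ 2 * x) ≡ l - (+ 2 * x + + 4) + 1ℤ + (+ 1 + (+ 2 - l))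
        lem = solve-∀

      differences : ∀ l → l ℕ.< n → Bounded (∇ (∇ (∇ G)) l) Θ
      differences l l<n = subst (λ x → Bounded x Θ) (sym expand)
          (Third.third-bounded τ s k (+≤+ 1≤T) 1≤s refl (Y - quad a b c i j) B a
            (≤-from (quad a b c i j) (0≤Q i j) (lem₀ Y (quad a b c i j))) B-bounded a≤s)
        where
        i : ℤ
        i = coord R l
        lem₀ : ∀ Y q → Y ≡ Y - q + q
        lem₀ = solve-∀
        B : ℤ
        B = + 2 * a * i + b * j
        B-bounded : Bounded B (s * τ)
        B-bounded = bounded-≤ (≤-trans (≤-reflexive (lem (+ ∣ a ∣) (+ ∣ b ∣) ρ τ)) (*-mono {(+ 2 * + ∣ a ∣ + + ∣ b ∣) * ρ} {s} {τ} {τ}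
              (0≤* (0≤+ (0≤* {+ 2} {+ ∣ a ∣} 0≤ℕ 0≤ℕ) 0≤ℕ) (0≤+ (0≤* {+ 2} {+ κ} 0≤ℕ 0≤ℕ) 0≤ℕ)) 0≤τ s-bound ≤-refl))
            (bounded-+ (bounded-* {+ 2 * a} {i} {+ 2 * + ∣ a ∣} {ρ * τ} (bounded-* {+ 2} {a} {+ 2} {+ ∣ a ∣} (bounded-nonneg {+ 2} {+ 2} 0≤ℕ ≤-refl) (bounded-∣∣ a)) (in-range l l<n))
              (bounded-* {b} {j} {+ ∣ b ∣} {ρ * τ} (bounded-∣∣ b) j-range))
          where
          lem : ∀ a b ρ τ → + 2 * a * (ρ * τ) + b * (ρ * τ) ≡ (+ 2 * a + b) * ρ * τ
          lem = solve-∀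
        next₁ : Y - quad a b c (coord R (suc l)) j ≡ Y - quad a b c i j - B - a
        next₁ = trans (cong (λ i → Y - quad a b c i j) (coord-suc R l)) (lem a b c Y i j)
          where
          lem : ∀ a b c Y i j → Y - (a * ((i + 1ℤ) * (i + 1ℤ)) + b * ((i + 1ℤ) * j) + c * (j * j)) ≡ Y - (a * (i * i) + b * (i * j) + c * (j * j)) - (+ 2 * a * i + b * j) - a
          lem = solve-∀
        next₂ : Y - quad a b c (coord R (suc (suc l))) j ≡ Y - quad a b c i j - + 2 * B - + 4 * a
        next₂ = trans (cong (λ i → Y - quad a b c i j) (trans (coord-suc R (suc l)) (cong (_+ 1ℤ) (coord-suc R l)))) (lem a b c Y i j)
          where
          lem : ∀ a b c Y i j → Y - (a * ((i + 1ℤ + 1ℤ) * (i + 1ℤ + 1ℤ)) + b * ((i + 1ℤ + 1ℤ) * j) + c * (j * j)) ≡ Y - (a * (i * i) + b * (i * j) + c * (j * j)) - + 2 * (+ 2 * a * i + b * j) - + 4 * a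
          lem = solve-∀
        next₃ : Y - quad a b c (coord R (suc (suc (suc l)))) j ≡ Y - quad a b c i j - + 3 * B - + 9 * a
        next₃ = trans (cong (λ i → Y - quad a b c i j) (trans (coord-suc R (suc (suc l))) (cong (_+ 1ℤ) (trans (coord-suc R (suc l)) (cong (_+ 1ℤ) (coord-suc R l)))))) (lem a b c Y i j)
          where
          lem : ∀ a b c Y i j → Y - (a * ((i + 1ℤ + 1ℤ + 1ℤ) * (i + 1ℤ + 1ℤ + 1ℤ)) + b * ((i + 1ℤ + 1ℤ + 1ℤ) * j) + c * (j * j)) ≡ Y - (a * (i * i) + b * (i * j) + c * (j * j)) - + 3 * (+ 2 * a * i + b * j) - + 9 * a
          lem = solve-∀
        expand : ∇ (∇ (∇ G)) l ≡ Third.third τ s k (+≤+ 1≤T) 1≤s refl (Y - quad a b c i j) B a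
            (≤-from (quad a b c i j) (0≤Q i j) (lem₀ Y (quad a b c i j))) B-bounded a≤s
        expand = trans (lem (G l) (G (suc l)) (G (suc (suc l))) (G (suc (suc (suc l)))))
          (trans (cong₂ (λ x y → G l - + 3 * g x + + 3 * g y - G (suc (suc (suc l)))) next₁ next₂)
            (cong (λ x → G l - + 3 * g (Y - quad a b c i j - B - a) + + 3 * g (Y - quad a b c i j - + 2 * B - + 4 * a) - g x) next₃))
          where
          lem : ∀ x y z w → x - y - (y - z) - (y - z - (z - w)) ≡ x - + 3 * y + + 3 * z - w
          lem = solve-∀

    row : Bounded (+ 8 * ∑ n (λ l → alt l * G l)) (+ n * Θ)
    row = subst₂ Bounded (sym (trans (∑-alt n G right-end) (trans (cong₂ (λ x y → + 4 * x + + 2 * (x - y) + (x - y - (y - G 2)) + ∑ n (λ l → alt l * ∇ (∇ (∇ G)) l)) (left-end 0 ℕ.z≤n) (left-end 1 (ℕ.s≤s ℕ.z≤n)))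
        (trans (cong (λ z → + 4 * 0ℤ + + 2 * (0ℤ - 0ℤ) + (0ℤ - 0ℤ - (0ℤ - z)) + ∑ n (λ l → alt l * ∇ (∇ (∇ G)) l)) (left-end 2 ℕP.≤-refl)) (+-identityˡ (∑ n (λ l → alt l * ∇ (∇ (∇ G)) l))))))) (∑-const n Θ)
      (∑-bounded n (λ l l<n → bounded-alt l (differences l l<n)))

private
  0≤sextic : ∀ s k τ → 0ℤ ≤ s → 0ℤ ≤ k → 0ℤ ≤ τ → 0ℤ ≤ + 1680 * (s * s * s * (τ * τ * τ)) + + 8 * (k * k * k * (τ * τ * τ))
  0≤sextic s k τ 0≤s 0≤k 0≤τ = 0≤+ (0≤* {+ 1680} {s * s * s * (τ * τ * τ)} 0≤ℕ (term s 0≤s)) (0≤* {+ 8} {k * k * k * (τ * τ * τ)} 0≤ℕ (term k 0≤k))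
    where
    term : ∀ x → 0ℤ ≤ x → 0ℤ ≤ x * x * x * (τ * τ * τ)
    term x 0≤x = 0≤* {x * x * x} {τ * τ * τ} (0≤cube 0≤x) (0≤cube 0≤τ)

  collect : ∀ n e s k τ → 0ℤ ≤ n → 0ℤ ≤ e → 0ℤ ≤ s → 0ℤ ≤ k → 0ℤ ≤ τ → n ≤ e * τ → ∀ Θ →
    Θ ≡ + 1680 * (s * s * s * (τ * τ * τ)) + + 8 * (k * k * k * (τ * τ * τ)) →
    n * (n * Θ) + n * (n * Θ) + n * (n * Θ) ≤ + 3 * (e * e * (+ 1680 * (s * s * s) + + 8 * (k * k * k))) * (τ * τ * τ * τ * τ)
  collect n e s k τ 0≤n 0≤e 0≤s 0≤k 0≤τ n≤ Θ Θ≡ = ≤-trans (+-mono-≤ (+-mono-≤ step step) step)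
      (≤-reflexive (trans (cong (λ x → x + x + x) value) (triple (e * e * θ) (τ * τ * τ * τ * τ))))
    where
    0≤eτ : 0ℤ ≤ e * τ
    0≤eτ = 0≤* {e} {τ} 0≤e 0≤τ
    0≤Θ : 0ℤ ≤ Θ
    0≤Θ = subst (0ℤ ≤_) (sym Θ≡) (0≤sextic s k τ 0≤s 0≤k 0≤τ)
    step : n * (n * Θ) ≤ e * τ * (e * τ * Θ)
    step = *-mono {n} {e * τ} {n * Θ} {e * τ * Θ} 0≤n (0≤* {e * τ} {Θ} 0≤eτ 0≤Θ) n≤ (*-mono {n} {e * τ} {Θ} {Θ} 0≤n 0≤Θ n≤ ≤-refl)
    θ : ℤ
    θ = + 1680 * (s * s * s) + + 8 * (k * k * k)
    factor : ∀ x y t → + 1680 * (x * t) + + 8 * (y * t) ≡ (+ 1680 * x + + 8 * y) * t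
    factor = solve-∀
    lem : ∀ e τ θ → e * τ * (e * τ * (θ * (τ * τ * τ))) ≡ e * e * θ * (τ * τ * τ * τ * τ)
    lem = solve-∀
    triple : ∀ x t → x * t + x * t + x * t ≡ + 3 * x * t
    triple = solve-∀
    value : e * τ * (e * τ * Θ) ≡ e * e * θ * (τ * τ * τ * τ * τ)
    value = trans (cong (λ Θ → e * τ * (e * τ * Θ)) (trans Θ≡ (factor (s * s * s) (k * k * k) (τ * τ * τ)))) (lem e τ θ)

  constant : ℤ → ℤ → ℤ
  constant e s = + 3 * (e * e * (+ 1680 * (s * s * s) + + 8 * (+ 12 * s * (+ 12 * s) * (+ 12 * s))))

  0≤constant : ∀ e s → 0ℤ ≤ s → 0ℤ ≤ constant e s
  0≤constant e s 0≤s = 0≤* {+ 3} {e * e * (+ 1680 * (s * s * s) + + 8 * (+ 12 * s * (+ 12 * s) * (+ 12 * s)))} 0≤ℕ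
    (0≤* {e * e} {+ 1680 * (s * s * s) + + 8 * (+ 12 * s * (+ 12 * s) * (+ 12 * s))} (0≤sq e)
      (0≤+ (0≤* {+ 1680} {s * s * s} 0≤ℕ (0≤cube 0≤s)) (0≤* {+ 8} {+ 12 * s * (+ 12 * s) * (+ 12 * s)} 0≤ℕ (0≤cube {+ 12 * s} (0≤* {+ 12} {s} 0≤ℕ 0≤s)))))

module Box (a b c : ℤ) (κ : ℕ) (0≤Q : ∀ i j → 0ℤ ≤ quad a b c i j)
  (inBox : ∀ T i j → quad a b c i j ≤ + T * + T → Bounded i (+ (κ ℕ.* T)) × Bounded j (+ (κ ℕ.* T))) where

  private
    A B C ρ : ℤ
    A = + ∣ a ∣
    B = + ∣ b ∣
    C = + ∣ c ∣
    ρ = + 2 * + κ + + 4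

    0≤ρ : 0ℤ ≤ ρ
    0≤ρ = 0≤+ (0≤* {+ 2} {+ κ} 0≤ℕ 0≤ℕ) 0≤ℕ

    opaque
      s e : ℤ
      s = (+ 2 * A + B + + 2 * C + 1ℤ) * ρ
      e = + 4 * + κ + + 8

      s-def : s ≡ (+ 2 * A + B + + 2 * C + 1ℤ) * ρ
      s-def = refl

      e-def : e ≡ + 4 * + κ + + 8
      e-def = refl

    twice : ∀ x → 0ℤ ≤ + 2 * + x
    twice x = 0≤* {+ 2} {+ x} 0≤ℕ 0≤ℕ

    1≤s : 1ℤ ≤ s
    1≤s = ≤-from ((+ 2 * A + B + + 2 * C) * ρ + (+ 2 * + κ + + 3)) (0≤+ (0≤* (0≤+ (0≤+ (twice ∣ a ∣) 0≤ℕ) (twice ∣ c ∣)) 0≤ρ) (0≤+ (twice κ) 0≤ℕ)) (trans s-def (lem A B C (+ κ)))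
      where
      lem : ∀ a b c κ → (+ 2 * a + b + + 2 * c + 1ℤ) * (+ 2 * κ + + 4) ≡ 1ℤ + ((+ 2 * a + b + + 2 * c) * (+ 2 * κ + + 4) + (+ 2 * κ + + 3))
      lem = solve-∀

    bound-a : (+ 2 * A + B) * ρ ≤ s
    bound-a = ≤-from ((+ 2 * C + 1ℤ) * ρ) (0≤* (0≤+ (twice ∣ c ∣) 0≤ℕ) 0≤ρ) (trans s-def (lem A B C ρ))
      where
      lem : ∀ a b c ρ → (+ 2 * a + b + + 2 * c + 1ℤ) * ρ ≡ (+ 2 * a + b) * ρ + (+ 2 * c + 1ℤ) * ρ
      lem = solve-∀

    bound-c : (+ 2 * C + B) * ρ ≤ s
    bound-c = ≤-from ((+ 2 * A + 1ℤ) * ρ) (0≤* (0≤+ (twice ∣ a ∣) 0≤ℕ) 0≤ρ) (trans s-def (lem A B C ρ))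
      where
      lem : ∀ a b c ρ → (+ 2 * a + b + + 2 * c + 1ℤ) * ρ ≡ (+ 2 * c + b) * ρ + (+ 2 * a + 1ℤ) * ρ
      lem = solve-∀

    small : ∀ x y → (+ 2 * + ∣ x ∣ + + ∣ y ∣) * ρ ≤ s → Bounded x s
    small x y le = bounded-≤ (≤-trans (≤-from (+ ∣ x ∣ * (+ 4 * + κ + + 7) + + ∣ y ∣ * ρ) (0≤+ (0≤* {+ ∣ x ∣} 0≤ℕ (0≤+ (0≤* {+ 4} {+ κ} 0≤ℕ 0≤ℕ) 0≤ℕ)) (0≤* {+ ∣ y ∣} 0≤ℕ 0≤ρ)) (lem (+ ∣ x ∣) (+ ∣ y ∣) (+ κ))) le) (bounded-∣∣ x)
      where
      lem : ∀ x y κ → (+ 2 * x + y) * (+ 2 * κ + + 4) ≡ x + (x * (+ 4 * κ + + 7) + y * (+ 2 * κ + + 4))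
      lem = solve-∀

  errorConstant : ℤ
  errorConstant = constant e s

  private
    0≤s : 0ℤ ≤ s
    0≤s = ≤-trans 0≤ℕ 1≤s

    0≤e : 0ℤ ≤ e
    0≤e = subst (0ℤ ≤_) (sym e-def) (0≤+ (0≤* {+ 4} {+ κ} 0≤ℕ 0≤ℕ) 0≤ℕ)

  0≤errorConstant : 0ℤ ≤ errorConstant
  0≤errorConstant = 0≤constant e s 0≤s

  module _ (T : ℕ) (1≤T : 1 ℕ.≤ T) where

    open LatticeRows κ T 1≤T s 1≤s using (τ; Y; P; R; n; Θ; k; module Row; in-range; 0≤τ)

    private
      F : ℕ → ℕ → ℤ
      F k l = g (Y - quad a b c (coord R k) (coord R l))

      square : + (T ℕ.+ T) * + (T ℕ.+ T) ≡ Y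
      square = trans (cong (λ t → t * t) (pos-+ T T)) (lem τ)
        where
        lem : ∀ t → (t + t) * (t + t) ≡ + 4 * (t * t)
        lem = solve-∀

      inside : ∀ i j → quad a b c i j ≤ Y → Bounded i (+ (κ ℕ.* (T ℕ.+ T))) × Bounded j (+ (κ ℕ.* (T ℕ.+ T)))
      inside i j le = inBox (T ℕ.+ T) i j (≤-trans le (≤-reflexive (sym square)))

      column : ∀ l → l ℕ.< n → Bounded (+ 8 * ∑ n (λ k → alt k * F k l)) (+ n * Θ)
      column l l<n = Row.row a b c 0≤Q (λ i j le → proj₁ (inside i j le)) (small a b bound-a) bound-a (coord R l) (in-range l l<n)

      row : ∀ k → k ℕ.< n → Bounded (+ 8 * ∑ n (λ l → alt l * F k l)) (+ n * Θ)
      row k k<n = subst (λ x → Bounded (+ 8 * x) (+ n * Θ)) (∑-cong′ n (λ l → cong (λ q → alt l * g (Y - q)) (quad-swap c b a (coord R l) (coord R k))))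
        (Row.row c b a (λ i j → subst (0ℤ ≤_) (quad-swap a b c j i) (0≤Q j i))
          (λ i j le → proj₂ (inside j i (≤-trans (≤-reflexive (quad-swap a b c j i)) le))) (small c b bound-c) bound-c (coord R k) (in-range k k<n))

      E₁ E₂ E₃ : ℤ
      E₁ = ∑ n (λ k → ∑ n (λ l → alt l * F k l))
      E₂ = ∑ n (λ k → alt k * ∑ n (λ l → F k l))
      E₃ = ∑ n (λ k → alt k * ∑ n (λ l → alt l * F k l))

      bound₁ : Bounded (+ 8 * E₁) (+ n * (+ n * Θ))
      bound₁ = subst₂ Bounded (∑-* n (+ 8) (λ k → ∑ n (λ l → alt l * F k l))) (∑-const n (+ n * Θ)) (∑-bounded n row)

      bound₂ : Bounded (+ 8 * E₂) (+ n * (+ n * Θ))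
      bound₂ = subst₂ Bounded (trans (∑-* n (+ 8) (λ l → ∑ n (λ k → alt k * F k l))) (cong (_*_ (+ 8)) exchange)) (∑-const n (+ n * Θ)) (∑-bounded n column)
        where
        exchange : ∑ n (λ l → ∑ n (λ k → alt k * F k l)) ≡ E₂
        exchange = trans (∑-swap n n (λ l k → alt k * F k l)) (∑-cong′ n (λ k → ∑-* n (alt k) (F k)))

      bound₃ : Bounded (+ 8 * E₃) (+ n * (+ n * Θ))
      bound₃ = subst₂ Bounded (trans (∑-cong′ n (λ k → lem (alt k) (∑ n (λ l → alt l * F k l)))) (∑-* n (+ 8) (λ k → alt k * ∑ n (λ l → alt l * F k l))))
          (∑-const n (+ n * Θ)) (∑-bounded n (λ k k<n → bounded-alt k (row k k<n)))
        where
        lem : ∀ e x → e * (+ 8 * x) ≡ + 8 * (e * x)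
        lem = solve-∀

      even-terms : ∀ k l → F (k ℕ.+ k) (l ℕ.+ l) ≡ + 64 * g (τ * τ - quad a b c (coord P k) (coord P l))
      even-terms k l = trans (cong₂ (λ x y → g (Y - quad a b c x y)) (coord-double P k) (coord-double P l))
        (trans (cong g (lem a b c τ (coord P k) (coord P l))) (g-scale (+ 4) (τ * τ - quad a b c (coord P k) (coord P l)) 0≤ℕ))
        where
        lem : ∀ a b c τ x y → + 4 * (τ * τ) - (a * (+ 2 * x * (+ 2 * x)) + b * (+ 2 * x * (+ 2 * y)) + c * (+ 2 * y * (+ 2 * y))) ≡ + 4 * (τ * τ - (a * (x * x) + b * (x * y) + c * (y * y)))
        lem = solve-∀

      expand : boxSum a b c R Y + E₁ + E₂ + E₃ ≡ ∑ n (λ k → (1ℤ + alt k) * ∑ n (λ l → (1ℤ + alt l) * F k l))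
      expand = trans (cong (λ x → x + E₂ + E₃) (sym (∑-+ n (λ k → ∑ n (F k)) (λ k → ∑ n (λ l → alt l * F k l)))))
        (trans (cong (_+ E₃) (sym (∑-+ n (λ k → ∑ n (F k) + ∑ n (λ l → alt l * F k l)) (λ k → alt k * ∑ n (F k)))))
        (trans (sym (∑-+ n (λ k → ∑ n (F k) + ∑ n (λ l → alt l * F k l) + alt k * ∑ n (F k)) (λ k → alt k * ∑ n (λ l → alt l * F k l))))
        (∑-cong′ n (λ k → trans (lem (alt k) (∑ n (F k)) (∑ n (λ l → alt l * F k l)))
          (cong (_*_ (1ℤ + alt k)) (trans (sym (∑-+ n (F k) (λ l → alt l * F k l))) (∑-cong′ n (λ l → lem′ (alt l) (F k l)))))))))
        where
        lem : ∀ e x y → x + y + e * x + e * y ≡ (1ℤ + e) * (x + y)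
        lem = solve-∀
        lem′ : ∀ e x → x + e * x ≡ (1ℤ + e) * x
        lem′ = solve-∀

      even : boxSum a b c R Y + E₁ + E₂ + E₃ ≡ + 256 * boxSum a b c P (τ * τ)
      even = trans expand (trans (∑-even R (λ k → ∑ n (λ l → (1ℤ + alt l) * F k l)))
        (trans (cong (_*_ (+ 2)) (trans (∑-cong′ R (λ k → trans (∑-even R (F (k ℕ.+ k))) (cong (_*_ (+ 2)) (trans (∑-cong′ R (even-terms k)) (∑-* R (+ 64) (λ l → g (τ * τ - quad a b c (coord P k) (coord P l))))))))
            (trans (∑-* R (+ 2) (λ k → + 64 * ∑ R (λ l → g (τ * τ - quad a b c (coord P k) (coord P l))))) (cong (_*_ (+ 2)) (∑-* R (+ 64) (λ k → ∑ R (λ l → g (τ * τ - quad a b c (coord P k) (coord P l)))))))))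
          (lem (boxSum a b c P (τ * τ)))))
        where
        lem : ∀ x → + 2 * (+ 2 * (+ 64 * x)) ≡ + 256 * x
        lem = solve-∀

      n≤ : + n ≤ e * τ
      n≤ = ≤-from (+ 8 * (τ - 1ℤ)) (0≤* {+ 8} 0≤ℕ (0≤- (+≤+ 1≤T)))
        (trans (cong (_* τ) e-def) (trans (lem (+ κ) τ) (cong (_+ + 8 * (τ - 1ℤ)) (sym (trans (pos-+ R R) (trans (cong (λ r → r + r) (pos-+ P P)) (cong (λ p → p + p + (p + p)) (trans (pos-+ (κ ℕ.* T) 2) (cong (_+ + 2) (pos-* κ T))))))))))
        where
        lem : ∀ κ τ → (+ 4 * κ + + 8) * τ ≡ κ * τ + + 2 + (κ * τ + + 2) + (κ * τ + + 2 + (κ * τ + + 2)) + + 8 * (τ - 1ℤ)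
        lem = solve-∀

    box-scaling : Bounded (+ 8 * (boxSum a b c R Y - + 256 * boxSum a b c P (τ * τ))) (errorConstant * (τ * τ * τ * τ * τ))
    box-scaling = subst (λ x → Bounded x (errorConstant * (τ * τ * τ * τ * τ))) value
      (bounded-≤ total (bounded-neg (bounded-+ (bounded-+ bound₁ bound₂) bound₃)))
      where
      value : - (+ 8 * E₁ + + 8 * E₂ + + 8 * E₃) ≡ + 8 * (boxSum a b c R Y - + 256 * boxSum a b c P (τ * τ))
      value = trans (lem (boxSum a b c R Y) E₁ E₂ E₃) (cong (λ x → + 8 * (boxSum a b c R Y - x)) even)
        where
        lem : ∀ s x y z → - (+ 8 * x + + 8 * y + + 8 * z) ≡ + 8 * (s - (s + x + y + z))
        lem = solve-∀
      total : + n * (+ n * Θ) + + n * (+ n * Θ) + + n * (+ n * Θ) ≤ errorConstant * (τ * τ * τ * τ * τ)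
      total = collect (+ n) e s k τ 0≤ℕ 0≤e 0≤s (0≤* {+ 12} {s} 0≤ℕ 0≤s) 0≤τ n≤ Θ refl

⟦⟧-yes : ∀ {P : Set} (d : Dec P) → P → ⟦ d ⟧ ≡ 1ℤ
⟦⟧-yes d p = cong (λ b → if b then 1ℤ else 0ℤ) (dec-true d p)

⟦⟧-no : ∀ {P : Set} (d : Dec P) → ¬ P → ⟦ d ⟧ ≡ 0ℤ
⟦⟧-no d ¬p = cong (λ b → if b then 1ℤ else 0ℤ) (dec-false d ¬p)

∑-zero : ∀ n {f} → (∀ k → k ℕ.< n → f k ≡ 0ℤ) → ∑ n f ≡ 0ℤ
∑-zero n eq = trans (∑-cong n eq) (∑-0 n)

∑-indicator : ∀ z n (f : ℤ → ℤ) → 0ℤ ≤ z → (+ n ≤ z → f z ≡ 0ℤ) → ∑ n (λ k → ⟦ z ≟ + k ⟧ * f (+ k)) ≡ f z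
∑-indicator (+ z) n f _ beyond = go (ℕP.<-≤-connex z n)
  where
  G : ℕ → ℤ
  G k = ⟦ + z ≟ + k ⟧ * f (+ k)
  miss : ∀ k → ¬ (z ≡ k) → G k ≡ 0ℤ
  miss k z≢k = cong (_* f (+ k)) (⟦⟧-no (+ z ≟ + k) (z≢k ∘ +-injective))
  go : z ℕ.< n ⊎ n ℕ.≤ z → ∑ n G ≡ f (+ z)
  go (inj₂ n≤z) = trans (∑-zero n (λ k k<n → miss k (λ { refl → ℕP.<⇒≱ k<n n≤z }))) (sym (beyond (+≤+ n≤z)))
  go (inj₁ z<n) = begin
    ∑ n G ≡⟨ ∑-upto n z<n ⟩
    ∑ z G + G z ≡⟨ cong₂ _+_ (∑-zero z (λ k k<z → miss k (λ { refl → ℕP.<-irrefl refl k<z }))) (trans (cong (_* f (+ z)) (⟦⟧-yes (+ z ≟ + z) refl)) (*-identityˡ (f (+ z)))) ⟩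
    0ℤ + f (+ z) ≡⟨ +-identityˡ (f (+ z)) ⟩
    f (+ z) ∎
    where
    open ≡-Reasoning
    ∑-upto : ∀ n → z ℕ.< n → ∑ n G ≡ ∑ (suc z) G
    ∑-upto (suc n) z<1+n with ℕP.m≤n⇒m<n∨m≡n (ℕ.s≤s⁻¹ z<1+n)
    ... | inj₂ refl = refl
    ... | inj₁ z<n = trans (cong₂ _+_ (∑-upto n z<n) (miss n (λ { refl → ℕP.<-irrefl refl z<n }))) (+-identityʳ (∑ (suc z) G))

module _ {A B : Set} where

  sumL-cartesianProduct : ∀ (f : A × B → ℤ) xs ys → sumL f (cartesianProduct xs ys) ≡ sumL (λ x → sumL (λ y → f (x , y)) ys) xs
  sumL-cartesianProduct f [] ys = refl
  sumL-cartesianProduct f (x ∷ xs) ys = trans (sumL-++ f (map (x ,_) ys) (cartesianProduct xs ys))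
    (cong₂ _+_ (sumL-map f (x ,_) ys) (sumL-cartesianProduct f xs ys))

sumL-bounded : ∀ {A : Set} {f b : A → ℤ} xs → (∀ x → Bounded (f x) (b x)) → Bounded (sumL f xs) (sumL b xs)
sumL-bounded [] p = bounded ≤-refl ≤-refl
sumL-bounded (x ∷ xs) p = bounded-+ (p x) (sumL-bounded xs p)

sumL-swap : ∀ {A : Set} c (f : A → ℤ) xs → sumL (λ x → f x * c) xs ≡ sumL f xs * c
sumL-swap c f xs = trans (sumL-cong xs (λ {x} _ → *-comm (f x) c)) (trans (sumL-* c f xs) (*-comm c (sumL f xs)))

count-allFin : ∀ h → count (allFin h) ≡ + h
count-allFin h = trans (go (allFin h)) (cong +_ (length-tabulate (λ i → i)))
  where
  go : ∀ {A : Set} (xs : List A) → count xs ≡ + length xs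
  go [] = refl
  go (x ∷ xs) = cong (_+_ 1ℤ) (go xs)

-- Summation over the multiples of a fixed number

∑-multiples : ∀ k n (f : ℕ → ℤ) → (∀ j → n ℕ.< j → f j ≡ 0ℤ) →
  ∑ n (λ j → ⟦ suc k ℕD.∣? suc j ⟧ * f (suc j)) ≡ ∑ n (λ l → f (suc k ℕ.* suc l))
∑-multiples k n f vanish = begin
  ∑ n (λ j → ⟦ suc k ℕD.∣? suc j ⟧ * f (suc j)) ≡⟨ sumL-applyUpTo (λ j → ⟦ suc k ℕD.∣? j ⟧ * f j) suc n ⟨
  sumL (λ j → ⟦ suc k ℕD.∣? j ⟧ * f j) (applyUpTo suc n) ≡⟨ sumL-filter (suc k ℕD.∣?_) f (applyUpTo suc n) ⟨
  sumL f (filter (suc k ℕD.∣?_) (applyUpTo suc n))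
    ≡⟨ sumL-bijection f (λ l → suc k ℕ.* suc l) {filter small? (upTo n)} {filter (suc k ℕD.∣?_) (applyUpTo suc n)}
         (Uniq.filter⁺ small? (Uniq.upTo⁺ n)) (Uniq.filter⁺ (suc k ℕD.∣?_) (Uniq.applyUpTo⁺₁ suc n (λ i<j _ e → ℕP.<-irrefl (ℕP.suc-injective e) i<j)))
         (λ {l} l∈ → ∈-filter⁺ (suc k ℕD.∣?_) (∈-applyUpTo⁺ suc (proj₂ (∈-filter⁻ small? {xs = upTo n} l∈))) (ℕD.m∣m*n (suc l)))
         (λ {l} {l′} _ _ e → ℕP.suc-injective (ℕP.*-cancelˡ-≡ (suc l) (suc l′) (suc k) e))
         onto ⟨
  sumL (λ l → f (suc k ℕ.* suc l)) (filter small? (upTo n)) ≡⟨ sumL-filter small? (λ l → f (suc k ℕ.* suc l)) (upTo n) ⟩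
  sumL (λ l → ⟦ small? l ⟧ * f (suc k ℕ.* suc l)) (upTo n) ≡⟨ sumL-upTo (λ l → ⟦ small? l ⟧ * f (suc k ℕ.* suc l)) n ⟩
  ∑ n (λ l → ⟦ small? l ⟧ * f (suc k ℕ.* suc l)) ≡⟨ ∑-cong′ n drop ⟩
  ∑ n (λ l → f (suc k ℕ.* suc l)) ∎
  where
  open ≡-Reasoning
  small? : ∀ l → Dec (suc k ℕ.* suc l ℕ.≤ n)
  small? l = suc k ℕ.* suc l ℕP.≤? n
  drop : ∀ l → ⟦ small? l ⟧ * f (suc k ℕ.* suc l) ≡ f (suc k ℕ.* suc l)
  drop l with ℕP.≤-<-connex (suc k ℕ.* suc l) n
  ... | inj₁ le = trans (cong (_* f (suc k ℕ.* suc l)) (⟦⟧-yes (small? l) le)) (*-identityˡ (f (suc k ℕ.* suc l)))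
  ... | inj₂ gt = trans (cong (_* f (suc k ℕ.* suc l)) (⟦⟧-no (small? l) (ℕP.<⇒≱ gt))) (sym (vanish (suc k ℕ.* suc l) gt))
  onto : ∀ {j} → j ∈ filter (suc k ℕD.∣?_) (applyUpTo suc n) → ∃ λ l → l ∈ filter small? (upTo n) × suc k ℕ.* suc l ≡ j
  onto {j} j∈ = step (proj₂ split) (∈-applyUpTo⁻ suc (proj₁ split))
    where
    split : j ∈ applyUpTo suc n × suc k ℕD.∣ j
    split = ∈-filter⁻ (suc k ℕD.∣?_) {xs = applyUpTo suc n} j∈
    step : suc k ℕD.∣ j → (∃ λ i → i ℕ.< n × j ≡ suc i) → ∃ λ l → l ∈ filter small? (upTo n) × suc k ℕ.* suc l ≡ j
    step (ℕD.divides zero refl) (_ , _ , ())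
    step (ℕD.divides (suc l) refl) (i , i<n , e) = l , ∈-filter⁺ small? (∈-upTo⁺ (ℕP.≤-trans (ℕP.m≤n*m (suc l) (suc k)) le)) le , ℕP.*-comm (suc k) (suc l)
      where
      le : suc k ℕ.* suc l ℕ.≤ n
      le = subst (ℕ._≤ n) (trans (sym e) (ℕP.*-comm (suc l) (suc k))) i<n

module Theta (m : ℕ) (1≤m : 1 ℕ.≤ m) (square-free : ∀ d → + d * + d ∣ Quad.N m → d ≡ 1)
  {h : ℕ} (reps : Representatives m h) where

  open Quad m using (Form)
  open Form
  open FormBounds m using (0≤Q)
  open Counting m 1≤m square-free reps
  open Representatives reps using (F)
  open Char m using (χ)
  open DivisorSums m using (ρ)
  open Representations m 1≤m square-free reps using (r≡2ρ)

  U : ℕ → ℤ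
  U n = ∑ n (λ k → r k * g (+ n - + k))

  V : ℕ → ℤ
  V n = ∑ n (λ k → χ (suc k) * ∑ n (λ l → φ (+ n) k l))

  0≤value : ∀ v → 0ℤ ≤ value v
  0≤value (i , (j , k)) = 0≤Q (F i) j k

  box-count : ∀ T R → radius ℕ.* T ℕ.< R → ∀ n → + n ≤ + T * + T → count (filter (λ v → value v ≟ + n) (box R)) ≡ r n
  box-count T R lt n n≤ = count-bijection (λ v → v) (Uniq.filter⁺ (λ v → value v ≟ + n) (box-unique R)) (solutions-unique n)
    (λ {v} v∈ → ∈-solutions⁺ v (proj₂ (∈-filter⁻ (λ v → value v ≟ + n) {xs = box R} v∈)))
    (λ _ _ e → e)
    (λ {v} v∈ → v , ∈-filter⁺ (λ v → value v ≟ + n) (∈-box {R} {T} v lt (≤-trans (≤-reflexive (∈-solutions⁻ v∈)) n≤)) (∈-solutions⁻ v∈) , refl)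

  formSum : ℕ → ℤ → ℤ
  formSum R Y = sumL (λ i → boxSum (a (F i)) (b (F i)) (c (F i)) R Y) (allFin h)

  formSum-box : ∀ R Y → formSum R Y ≡ sumL (λ v → g (Y - value v)) (box R)
  formSum-box R Y = sym (trans (sumL-cartesianProduct (λ v → g (Y - value v)) (allFin h) (grid R)) (sumL-cong (allFin h) (λ {i} _ → one i)))
    where
    over-ints : ∀ (f : ℤ → ℤ) → sumL f (ints R) ≡ ∑ (R ℕ.+ R) (λ k → f (coord R k))
    over-ints f = trans (sumL-map f (λ k → + k - + R) (upTo (R ℕ.+ R))) (trans (sumL-upTo (λ k → f (+ k - + R)) (R ℕ.+ R))
      (∑-cong′ (R ℕ.+ R) (λ k → cong f (sym (coord-def R k)))))
    one : ∀ i → sumL (λ jk → g (Y - value (i , jk))) (grid R) ≡ boxSum (a (F i)) (b (F i)) (c (F i)) R Y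
    one i = trans (sumL-cartesianProduct (λ jk → g (Y - value (i , jk))) (ints R) (ints R))
      (trans (over-ints (λ j → sumL (λ k → g (Y - value (i , (j , k)))) (ints R)))
        (∑-cong′ (R ℕ.+ R) (λ k → over-ints (λ l → g (Y - value (i , (coord R k , l)))))))

  formSum-U : ∀ T R → radius ℕ.* T ℕ.< R → formSum R (+ (T ℕ.* T)) ≡ U (T ℕ.* T)
  formSum-U T R lt = begin
    formSum R (+ n) ≡⟨ formSum-box R (+ n) ⟩
    sumL (λ v → g (+ n - value v)) (box R)
      ≡⟨ sumL-cong (box R) (λ {v} _ → sym (∑-indicator (value v) n (λ z → g (+ n - z)) (0≤value v) (λ le → g-neg (i≤j⇒i-j≤0 le)))) ⟩
    sumL (λ v → ∑ n (λ k → ⟦ value v ≟ + k ⟧ * g (+ n - + k))) (box R) ≡⟨ sumL-∑ n (λ v k → ⟦ value v ≟ + k ⟧ * g (+ n - + k)) (box R) ⟩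
    ∑ n (λ k → sumL (λ v → ⟦ value v ≟ + k ⟧ * g (+ n - + k)) (box R)) ≡⟨ ∑-cong n term ⟩
    U n ∎
    where
    open ≡-Reasoning
    n = T ℕ.* T
    term : ∀ k → k ℕ.< n → sumL (λ v → ⟦ value v ≟ + k ⟧ * g (+ n - + k)) (box R) ≡ r k * g (+ n - + k)
    term k k<n = trans (sumL-swap (g (+ n - + k)) (λ v → ⟦ value v ≟ + k ⟧) (box R))
      (cong (_* g (+ n - + k)) (trans (sumL-cong (box R) (λ {v} _ → sym (*-identityʳ ⟦ value v ≟ + k ⟧)))
        (trans (sym (sumL-filter (λ v → value v ≟ + k) (λ _ → 1ℤ) (box R)))
          (box-count T R lt k (subst (+ k ≤_) (pos-* T T) (+≤+ (ℕP.<⇒≤ k<n)))))))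

  module _ (i : Fin h) where
    module FormBox = Box (a (F i)) (b (F i)) (c (F i)) radius (0≤Q (F i)) (λ T j k le → value-bounded i j k T le)

  K : ℤ
  K = sumL FormBox.errorConstant (allFin h)

  0≤K : 0ℤ ≤ K
  0≤K = go (allFin h)
    where
    go : ∀ xs → 0ℤ ≤ sumL FormBox.errorConstant xs
    go [] = ≤-refl
    go (i ∷ xs) = 0≤+ (FormBox.0≤errorConstant i) (go xs)

  lattice-scaling : ∀ T → 1 ℕ.≤ T → Bounded (+ 8 * (U ((T ℕ.+ T) ℕ.* (T ℕ.+ T)) - + 256 * U (T ℕ.* T))) (K * (+ T * + T * + T * + T * + T))
  lattice-scaling T 1≤T = subst₂ Bounded value′ (sumL-swap τ⁵ FormBox.errorConstant (allFin h))
      (sumL-bounded (allFin h) (λ i → FormBox.box-scaling i T 1≤T))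
    where
    τ⁵ : ℤ
    τ⁵ = + T * + T * + T * + T * + T
    P R : ℕ
    P = radius ℕ.* T ℕ.+ 2
    R = P ℕ.+ P
    S S′ : Fin h → ℤ
    S i = boxSum (a (F i)) (b (F i)) (c (F i)) R (+ 4 * (+ T * + T))
    S′ i = boxSum (a (F i)) (b (F i)) (c (F i)) P (+ T * + T)
    T< : radius ℕ.* T ℕ.< P
    T< = ℕP.m<m+n (radius ℕ.* T) (ℕ.s≤s ℕ.z≤n)
    2T< : radius ℕ.* (T ℕ.+ T) ℕ.< R
    2T< = subst (ℕ._< R) (sym (ℕP.*-distribˡ-+ radius T T)) (ℕP.+-mono-< T< T<)
    big : sumL S (allFin h) ≡ U ((T ℕ.+ T) ℕ.* (T ℕ.+ T))
    big = trans (cong (formSum R) (trans (lem (+ T)) (trans (sym (cong (λ t → t * t) (pos-+ T T))) (sym (pos-* (T ℕ.+ T) (T ℕ.+ T)))))) (formSum-U (T ℕ.+ T) R 2T<)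
      where
      lem : ∀ t → + 4 * (t * t) ≡ (t + t) * (t + t)
      lem = solve-∀
    small : sumL S′ (allFin h) ≡ U (T ℕ.* T)
    small = trans (cong (formSum P) (sym (pos-* T T))) (formSum-U T P T<)
    value′ : sumL (λ i → + 8 * (S i - + 256 * S′ i)) (allFin h) ≡ + 8 * (U ((T ℕ.+ T) ℕ.* (T ℕ.+ T)) - + 256 * U (T ℕ.* T))
    value′ = trans (sumL-cong (allFin h) (λ {i} _ → lem (S i) (S′ i))) (trans (sumL-* (+ 8) (λ i → S i + -[1+ 255 ] * S′ i) (allFin h)) (cong (_*_ (+ 8))
      (trans (sumL-+ S (λ i → -[1+ 255 ] * S′ i) (allFin h)) (trans (cong₂ _+_ big (trans (sumL-* -[1+ 255 ] S′ (allFin h)) (cong (_*_ -[1+ 255 ]) small)))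
        (lem′ (U ((T ℕ.+ T) ℕ.* (T ℕ.+ T))) (U (T ℕ.* T)))))))
      where
      lem : ∀ x y → + 8 * (x - + 256 * y) ≡ + 8 * (x + -[1+ 255 ] * y)
      lem = solve-∀
      lem′ : ∀ x y → x + -[1+ 255 ] * y ≡ x - + 256 * y
      lem′ = solve-∀

  r-0 : r 0 ≡ + h
  r-0 = trans (sym (count-bijection (λ i → i , (0ℤ , 0ℤ)) (Uniq.allFin⁺ h) (solutions-unique 0)
      (λ {i} _ → ∈-solutions⁺ (i , (0ℤ , 0ℤ)) (lem (a (F i)) (b (F i)) (c (F i)))) (λ _ _ e → cong proj₁ e) onto)) (count-allFin h)
    where
    lem : ∀ a b c → a * 0ℤ + b * 0ℤ + c * 0ℤ ≡ 0ℤ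
    lem = solve-∀
    zero-point : ∀ {z} → Bounded z (+ (radius ℕ.* 0)) → 0ℤ ≡ z
    zero-point {z} p with subst (λ x → Bounded z (+ x)) (ℕP.*-zeroʳ radius) p
    ... | bounded lo hi = ≤-antisym lo hi
    onto : ∀ {v} → v ∈ solutions 0 → ∃ λ i → i ∈ allFin h × (i , (0ℤ , 0ℤ)) ≡ v
    onto {i , (j , k)} v∈ = i , ∈-allFin i , cong₂ (λ j k → i , (j , k)) (zero-point (proj₁ bounds)) (zero-point (proj₂ bounds))
      where
      bounds = value-bounded i j k 0 (≤-reflexive (∈-solutions⁻ v∈))

  U≡ : ∀ n → U n ≡ + h * cube (+ n) + + 2 * V n
  U≡ n = begin
    U n ≡⟨ +-identityʳ (U n) ⟨
    U n + 0ℤ ≡⟨ cong (_+_ (U n)) (trans (cong (_*_ (r n)) (g-neg (≤-reflexive (+-inverseʳ (+ n))))) (*-zeroʳ (r n))) ⟨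
    ∑ (suc n) (λ k → r k * g (+ n - + k)) ≡⟨ ∑-head n (λ k → r k * g (+ n - + k)) ⟩
    r 0 * g (+ n - 0ℤ) + ∑ n (λ k → r (suc k) * g (+ n - + suc k))
      ≡⟨ cong₂ _+_ (cong₂ _*_ r-0 (trans (cong g (+-identityʳ (+ n))) (g-pos 0≤ℕ))) (∑-cong′ n (λ k → trans (cong (_* G (suc k)) (r≡2ρ (suc k) (ℕ.s≤s ℕ.z≤n))) (*-assoc (+ 2) (ρ (suc k)) (G (suc k))))) ⟩
    + h * cube (+ n) + ∑ n (λ k → + 2 * (ρ (suc k) * G (suc k))) ≡⟨ cong (_+_ (+ h * cube (+ n))) (trans (∑-* n (+ 2) (λ k → ρ (suc k) * G (suc k))) (cong (_*_ (+ 2)) double)) ⟩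
    + h * cube (+ n) + + 2 * V n ∎
    where
    open ≡-Reasoning
    G : ℕ → ℤ
    G j = g (+ n - + j)
    expand : ∀ j → j ℕ.< n → ρ (suc j) * G (suc j) ≡ ∑ n (λ k → χ (suc k) * (⟦ suc k ℕD.∣? suc j ⟧ * G (suc j)))
    expand j j<n = trans (*-comm (ρ (suc j)) (G (suc j))) (trans (cong (_*_ (G (suc j))) divisor-sum) (trans (sym (∑-* n (G (suc j)) (λ k → ⟦ suc k ℕD.∣? suc j ⟧ * χ (suc k))))
        (∑-cong′ n (λ k → lem (G (suc j)) ⟦ suc k ℕD.∣? suc j ⟧ (χ (suc k))))))
      where
      lem : ∀ x y z → x * (y * z) ≡ z * (y * x)
      lem = solve-∀
      divisor-sum : ρ (suc j) ≡ ∑ n (λ k → ⟦ suc k ℕD.∣? suc j ⟧ * χ (suc k))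
      divisor-sum = trans (sumL-filter (ℕD._∣? suc j) χ (applyUpTo suc (suc j))) (trans (sumL-applyUpTo (λ d → ⟦ d ℕD.∣? suc j ⟧ * χ d) suc (suc j))
        (sym (∑-extend {suc j} {n} j<n (λ k j<k → cong (_* χ (suc k)) (⟦⟧-no (suc k ℕD.∣? suc j) (λ d → ℕP.<⇒≱ (ℕ.s≤s j<k) (ℕD.∣⇒≤ d)))))))
    double : ∑ n (λ j → ρ (suc j) * G (suc j)) ≡ V n
    double = trans (∑-cong n expand) (trans (∑-swap n n (λ j k → χ (suc k) * (⟦ suc k ℕD.∣? suc j ⟧ * G (suc j))))
      (∑-cong′ n (λ k → trans (∑-* n (χ (suc k)) (λ j → ⟦ suc k ℕD.∣? suc j ⟧ * G (suc j)))
        (cong (_*_ (χ (suc k))) (trans (∑-multiples k n G (λ j n<j → g-neg (i≤j⇒i-j≤0 (+≤+ (ℕP.<⇒≤ n<j)))))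
          (∑-cong′ n (λ l → cong (λ x → g (+ n - x)) (trans (pos-* (suc k) (suc l)) (sym (cong₂ _*_ (nat⁺-def k) (nat⁺-def l)))))))))))

∑-reverse : ∀ n f → ∑ n f ≡ ∑ n (λ k → f (n ∸ suc k))
∑-reverse zero f = refl
∑-reverse (suc n) f = trans (cong (_+ f n) (∑-reverse n f)) (trans (+-comm (∑ n (λ k → f (n ∸ suc k))) (f n)) (sym (∑-head n (λ k → f (n ∸ k)))))

x≡-x⇒x≡0 : ∀ {x} → x ≡ - x → x ≡ 0ℤ
x≡-x⇒x≡0 {x} e = *-cancelˡ-≢0 (+ 2) (λ ()) (trans (lem x) (trans (cong (_+_ x) e) (trans (+-inverseʳ x) (sym (*-zeroʳ (+ 2))))))
  where
  lem : ∀ x → + 2 * x ≡ x + x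
  lem = solve-∀

bounded-cancel : ∀ {x b} p → 0ℤ < p → Bounded (x * p) (b * p) → Bounded x b
bounded-cancel {x} {b} p 0<p (bounded lo hi) = bounded (*-cancelʳ-≤-pos (- b) x p {{positive 0<p}} (≤-trans (≤-reflexive (sym (neg-distribˡ-* b p))) lo))
  (*-cancelʳ-≤-pos x b p {{positive 0<p}} hi)

unbounded-multiples : ∀ x C → (∀ z → Bounded (x * (+ suc z * + suc z)) C) → x ≡ 0ℤ
unbounded-multiples x C bounds with x ≟ 0ℤ
... | yes e = e
... | no x≢0 = ⊥-elim (ℕP.<⇒≱ C< (drop‿+≤+ (≤-trans (size (bounds ∣ C ∣)) (C≤ C))))
  where
  w = suc ∣ C ∣
  C≤ : ∀ C → C ≤ + ∣ C ∣
  C≤ (+ n) = ≤-refl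
  C≤ -[1+ n ] = -≤+
  size : Bounded (x * (+ w * + w)) C → + ∣ x * (+ w * + w) ∣ ≤ C
  size (bounded lo hi) with ∣i∣≡i⊎∣i∣≡-i (x * (+ w * + w))
    where

    ∣i∣≡i⊎∣i∣≡-i : ∀ i → + ∣ i ∣ ≡ i ⊎ + ∣ i ∣ ≡ - i
    ∣i∣≡i⊎∣i∣≡-i (+ n) = inj₁ refl
    ∣i∣≡i⊎∣i∣≡-i -[1+ n ] = inj₂ refl
  ... | inj₁ e = ≤-trans (≤-reflexive e) hi
  ... | inj₂ e = ≤-trans (≤-reflexive e) (subst (- (x * (+ w * + w)) ≤_) (neg-involutive C) (neg-mono-≤ lo))
  1≤∣x∣ : 1 ℕ.≤ ∣ x ∣
  1≤∣x∣ = ℕP.n≢0⇒n>0 (λ e → x≢0 (∣i∣≡0⇒i≡0 e))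
  C< : ∣ C ∣ ℕ.< ∣ x * (+ w * + w) ∣
  C< = subst (w ℕ.≤_) (sym (abs-* x (+ w * + w))) (ℕP.≤-trans (ℕP.m≤m*n w w) (ℕP.≤-trans (ℕP.≤-reflexive (sym (abs-* (+ w) (+ w)))) (ℕP.m≤n*m ∣ + w * + w ∣ ∣ x ∣ {{ℕ.>-nonZero 1≤∣x∣}})))

private
  leading-coefficient : ∀ n κ κ′ h m y w₄ w₂ p z →
    Bounded (n * (+ 8 * (- (+ 192 * (h * y)) + + 2 * w₄ + + 32 * w₂))) (n * (κ * p)) →
    Bounded (+ 8 * (n * w₄) - + 256 * m * y) (κ′ * (+ 260 * p)) → Bounded (+ 8 * (n * w₂) - + 32 * m * y) (κ′ * (+ 18 * p)) →
    y ≡ z * p → 0ℤ < p → Bounded (+ 1536 * (m - n * h) * z) (n * κ + + 1096 * κ′)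
  leading-coefficient n κ κ′ h m y w₄ w₂ p z b₁ b₄ b₂ y≡ 0<p = bounded-cancel p 0<p (subst₂ Bounded
      (trans (lem n h m y w₄ w₂) (trans (cong (_*_ (+ 1536 * (m - n * h))) y≡) (sym (*-assoc (+ 1536 * (m - n * h)) z p)))) (total n κ κ′ p)
      (bounded-- (bounded-- b₁ (multiple 2 b₄)) (multiple 32 b₂)))
    where
    multiple : ∀ k {x b} → Bounded x b → Bounded (+ k * x) (+ k * b)
    multiple k {x} {b} p = bounded-* {+ k} {x} {+ k} {b} (bounded-nonneg {+ k} {+ k} 0≤ℕ ≤-refl) p
    lem : ∀ n h m y w₄ w₂ → n * (+ 8 * (- (+ 192 * (h * y)) + + 2 * w₄ + + 32 * w₂)) - + 2 * (+ 8 * (n * w₄) - + 256 * m * y) - + 32 * (+ 8 * (n * w₂) - + 32 * m * y) ≡ + 1536 * (m - n * h) * y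
    lem = solve-∀
    total : ∀ n κ κ′ p → n * (κ * p) + + 2 * (κ′ * (+ 260 * p)) + + 32 * (κ′ * (+ 18 * p)) ≡ (n * κ + + 1096 * κ′) * p
    total = solve-∀

module CharacterSum (m : ℕ) where

  open Char m

  c : ℕ → ℤ
  c k = χ (suc k)

  periodic : Periodic N c
  periodic k = χ-cong (divides 1ℤ (trans (cong (_- + suc k) (trans (cong +_ (sym (ℕP.+-suc N k))) (pos-+ N (suc k)))) (lem (+ N) (+ suc k))))
    where
    lem : ∀ n k → n + k - k ≡ 1ℤ * n
    lem = solve-∀

  χ-reflect : ∀ k → k ℕ.≤ N → χ (N ∸ k) ≡ - χ k
  χ-reflect k k≤N = χ-neg (divides 1ℤ (trans (trans (sym (pos-+ (N ∸ k) k)) (cong +_ (ℕP.m∸n+n≡m k≤N))) (sym (*-identityˡ (+ N)))))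

  χ-0 : χ 0 ≡ 0ℤ
  χ-0 = x≡-x⇒x≡0 (χ-neg {0} {0} (divides 0ℤ refl))

  χ-N : χ N ≡ 0ℤ
  χ-N = trans (χ-reflect 0 ℕ.z≤n) (cong -_ χ-0)

  zero-sum : ∑ N c ≡ 0ℤ
  zero-sum = x≡-x⇒x≡0 (begin
    ∑ N c ≡⟨ ∑-reverse N c ⟩
    ∑ N (λ k → c (N ∸ suc k)) ≡⟨ ∑-cong N (λ k k<N → trans (cong χ (sym (ℕP.+-∸-assoc 1 k<N))) (χ-reflect k (ℕP.<⇒≤ k<N))) ⟩
    ∑ N (λ k → - χ k) ≡⟨ ∑-neg N χ ⟩
    - ∑ N χ ≡⟨ cong -_ shift ⟩
    - ∑ N c ∎)
    where
    open ≡-Reasoning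
    shift : ∑ N χ ≡ ∑ N c
    shift = trans (sym (trans (cong (_+_ (∑ N χ)) χ-N) (+-identityʳ (∑ N χ)))) (trans (∑-head N χ) (trans (cong (_+ ∑ N c) χ-0) (+-identityˡ (∑ N c))))

module MassFormula (m : ℕ) (1≤m : 1 ℕ.≤ m) (square-free : ∀ d → + d * + d ∣ Quad.N m → d ≡ 1)
  {h : ℕ} (reps : Representatives m h) where

  open Char m
  open Theta m 1≤m square-free reps using (U; V; U≡; lattice-scaling; 0≤K) renaming (K to K′)

  open CharacterSum m
  open Asymptotic c N periodic zero-sum using (M; W; module Estimate) renaming (K to K″; 0≤K to 0≤K″)

  alt-odd : ∀ k → alt (suc (k ℕ.+ k)) ≡ -1ℤ
  alt-odd k = cong -_ (alt-even k)

  V-double : ∀ n → V (n ℕ.+ n) ≡ W (n ℕ.+ n) + + 16 * V n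
  V-double n = sym (begin
    W (n ℕ.+ n) + + 16 * V n ≡⟨ cong (W (n ℕ.+ n) +ᶻ_) (sym odd-part) ⟩
    W (n ℕ.+ n) + ∑ (n ℕ.+ n) (λ k → c k * ∑ (n ℕ.+ n) (λ l → (1ℤ - alt l) * Φ k l)) ≡⟨ ∑-+ (n ℕ.+ n) (λ k → c k * ∑ (n ℕ.+ n) (λ l → alt l * Φ k l)) (λ k → c k * ∑ (n ℕ.+ n) (λ l → (1ℤ - alt l) * Φ k l)) ⟨
    ∑ (n ℕ.+ n) (λ k → c k * ∑ (n ℕ.+ n) (λ l → alt l * Φ k l) + c k * ∑ (n ℕ.+ n) (λ l → (1ℤ - alt l) * Φ k l))
      ≡⟨ ∑-cong′ (n ℕ.+ n) (λ k → trans (sym (*-distribˡ-+ (c k) (∑ (n ℕ.+ n) (λ l → alt l * Φ k l)) (∑ (n ℕ.+ n) (λ l → (1ℤ - alt l) * Φ k l))))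
           (cong (_*_ (c k)) (trans (sym (∑-+ (n ℕ.+ n) (λ l → alt l * Φ k l) (λ l → (1ℤ - alt l) * Φ k l))) (∑-cong′ (n ℕ.+ n) (λ l → lem (alt l) (Φ k l)))))) ⟩
    V (n ℕ.+ n) ∎)
    where
    open ≡-Reasoning
    _+ᶻ_ : ℤ → ℤ → ℤ
    _+ᶻ_ = _+_
    Φ : ℕ → ℕ → ℤ
    Φ = φ (+ (n ℕ.+ n))
    lem : ∀ e x → e * x + (1ℤ - e) * x ≡ x
    lem = solve-∀
    odd-term : ∀ k l → Φ k (suc (l ℕ.+ l)) ≡ + 8 * φ (+ n) k l
    odd-term k l = trans (cong g (trans (cong₂ (λ x y → x - nat⁺ k * y) (pos-+ n n) (trans (nat⁺-def (suc (l ℕ.+ l))) (trans (trans (cong +_ (cong suc (sym (ℕP.+-suc l l)))) (pos-+ (suc l) (suc l))) (sym (cong₂ _+_ (nat⁺-def l) (nat⁺-def l))))))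
        (lem₁ (+ n) (nat⁺ k) (nat⁺ l)))) (g-scale (+ 2) (+ n - nat⁺ k * nat⁺ l) 0≤ℕ)
      where
      lem₁ : ∀ n k l → n + n - k * (l + l) ≡ + 2 * (n - k * l)
      lem₁ = solve-∀
    inner : ∀ k → ∑ (n ℕ.+ n) (λ l → (1ℤ - alt l) * Φ k l) ≡ + 16 * ∑ n (λ l → φ (+ n) k l)
    inner k = trans (∑-even-odd n (λ l → (1ℤ - alt l) * Φ k l)) (trans (∑-cong′ n term) (∑-* n (+ 16) (φ (+ n) k)))
      where
      lem₂ : ∀ x y → (1ℤ - 1ℤ) * x + (1ℤ - -1ℤ) * (+ 8 * y) ≡ + 16 * y
      lem₂ = solve-∀
      term : ∀ l → (1ℤ - alt (l ℕ.+ l)) * Φ k (l ℕ.+ l) + (1ℤ - alt (suc (l ℕ.+ l))) * Φ k (suc (l ℕ.+ l)) ≡ + 16 * φ (+ n) k l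
      term l = trans (cong₂ (λ e f → (1ℤ - e) * Φ k (l ℕ.+ l) + (1ℤ - f) * Φ k (suc (l ℕ.+ l))) (alt-even l) (alt-odd l))
        (trans (cong (λ x → (1ℤ - 1ℤ) * Φ k (l ℕ.+ l) + (1ℤ - -1ℤ) * x) (odd-term k l)) (lem₂ (Φ k (l ℕ.+ l)) (φ (+ n) k l)))
    large : ∀ k → n ℕ.≤ k → ∀ l → φ (+ n) k l ≡ 0ℤ
    large k n≤k l = g-neg (i≤j⇒i-j≤0 (subst (+ n ≤_) (trans (pos-* (suc k) (suc l)) (sym (cong₂ _*_ (nat⁺-def k) (nat⁺-def l))))
      (+≤+ (ℕP.≤-trans n≤k (ℕP.≤-trans (ℕP.n≤1+n k) (ℕP.m≤m*n (suc k) (suc l)))))))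
    odd-part : ∑ (n ℕ.+ n) (λ k → c k * ∑ (n ℕ.+ n) (λ l → (1ℤ - alt l) * Φ k l)) ≡ + 16 * V n
    odd-part = trans (∑-cong′ (n ℕ.+ n) (λ k → trans (cong (_*_ (c k)) (inner k)) (lem₃ (c k) (∑ n (φ (+ n) k)))))
      (trans (∑-* (n ℕ.+ n) (+ 16) (λ k → c k * ∑ n (φ (+ n) k))) (cong (_*_ (+ 16))
        (∑-extend {n} {n ℕ.+ n} (ℕP.m≤m+n n n) (λ k n≤k → trans (cong (_*_ (c k)) (trans (∑-cong′ n (large k n≤k)) (∑-0 n))) (*-zeroʳ (c k))))))
      where
      lem₃ : ∀ c x → c * (+ 16 * x) ≡ + 16 * (c * x)
      lem₃ = solve-∀

  module AtScale (z : ℕ) where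

    opaque
      pw : ℕ → ℕ
      pw a = suc z ℕ.^ a

      pw-+ : ∀ a b → pw (a ℕ.+ b) ≡ pw a ℕ.* pw b
      pw-+ a b = ℕP.^-distribˡ-+-* (suc z) a b

      pw-mono : ∀ {a b} → a ℕ.≤ b → pw a ℕ.≤ pw b
      pw-mono le = ℕP.^-monoʳ-≤ (suc z) le

      1≤pw : ∀ a → 1 ℕ.≤ pw a
      1≤pw a = ℕP.^-monoʳ-≤ (suc z) {0} {a} ℕ.z≤n

      pw-2 : pw 2 ≡ suc z ℕ.* suc z
      pw-2 = cong (ℕ._*_ (suc z)) (ℕP.*-identityʳ (suc z))

    P : ℕ → ℤ
    P a = + pw a

    P-+ : ∀ a b → P a * P b ≡ P (a ℕ.+ b)
    P-+ a b = trans (sym (pos-* (pw a) (pw b))) (cong +_ (sym (pw-+ a b)))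

    -- The scale is T = z⁵, so that Y = T² = w⁵ for w = z², with cutoffs d = w³ and e = 4w², 2w².
    T Y₁ Y₂ Y₄ d e₂ e₄ : ℕ
    T = pw 5
    Y₁ = T ℕ.* T
    Y₂ = Y₁ ℕ.+ Y₁
    Y₄ = (T ℕ.+ T) ℕ.* (T ℕ.+ T)
    d = pw 6
    e₂ = pw 4 ℕ.+ pw 4
    e₄ = e₂ ℕ.+ e₂

    Y₄≡ : Y₄ ≡ Y₂ ℕ.+ Y₂
    Y₄≡ = trans (ℕP.*-distribˡ-+ (T ℕ.+ T) T T) (cong₂ ℕ._+_ (ℕP.*-distribʳ-+ T T T) (ℕP.*-distribʳ-+ T T T))

    Y₁≡ : Y₁ ≡ pw 10
    Y₁≡ = sym (pw-+ 5 5)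

    double : ∀ {a b c} → c ≡ a ℕ.* b → c ℕ.+ c ≡ a ℕ.* (b ℕ.+ b)
    double {a} {b} e = trans (cong₂ ℕ._+_ e e) (sym (ℕP.*-distribˡ-+ a b b))

    Y₂≤ : Y₂ ℕ.≤ d ℕ.* e₂
    Y₂≤ = ℕP.≤-reflexive (double {d} {pw 4} (trans Y₁≡ (pw-+ 6 4)))

    Y₄≤ : Y₂ ℕ.+ Y₂ ℕ.≤ d ℕ.* e₄
    Y₄≤ = ℕP.≤-reflexive (double {d} {e₂} (double {d} {pw 4} (trans Y₁≡ (pw-+ 6 4))))

    d≤Y₁ : d ℕ.≤ Y₁
    d≤Y₁ = subst (d ℕ.≤_) (sym Y₁≡) (pw-mono (ℕP.m≤m+n 6 4))

    e≤Y₁ : pw 4 ℕ.≤ Y₁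
    e≤Y₁ = subst (pw 4 ℕ.≤_) (sym Y₁≡) (pw-mono (ℕP.m≤m+n 4 6))

    d≤Y₂ : d ℕ.≤ Y₂
    d≤Y₂ = ℕP.≤-trans d≤Y₁ (ℕP.m≤m+n Y₁ Y₁)

    1≤e₂ : 1 ℕ.≤ e₂
    1≤e₂ = ℕP.≤-trans (1≤pw 4) (ℕP.m≤m+n (pw 4) (pw 4))

    E₂ : Bounded (+ 8 * (+ N * W Y₂) - + 4 * M * cube (+ Y₂)) (K″ * (+ d * + d * + d * + Y₂ + + e₂ * + e₂ * (+ Y₂ * + Y₂)))
    E₂ = Estimate.hyperbola-asymptotic Y₂ d e₂ (1≤pw 6) 1≤e₂ Y₂≤ d≤Y₂ (ℕP.+-mono-≤ e≤Y₁ e≤Y₁)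

    E₄ : Bounded (+ 8 * (+ N * W (Y₂ ℕ.+ Y₂)) - + 4 * M * cube (+ (Y₂ ℕ.+ Y₂))) (K″ * (+ d * + d * + d * + (Y₂ ℕ.+ Y₂) + + e₄ * + e₄ * (+ (Y₂ ℕ.+ Y₂) * + (Y₂ ℕ.+ Y₂))))
    E₄ = Estimate.hyperbola-asymptotic (Y₂ ℕ.+ Y₂) d e₄ (1≤pw 6) (ℕP.≤-trans 1≤e₂ (ℕP.m≤m+n e₂ e₂)) Y₄≤ (ℕP.≤-trans d≤Y₂ (ℕP.m≤m+n Y₂ Y₂)) (ℕP.+-mono-≤ (ℕP.+-mono-≤ e≤Y₁ e≤Y₁) (ℕP.+-mono-≤ e≤Y₁ e≤Y₁))

    +Y₂ : + Y₂ ≡ + 2 * P 10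
    +Y₂ = trans (cong (λ y → + (y ℕ.+ y)) Y₁≡) (trans (pos-+ (pw 10) (pw 10)) (lem (P 10)))
      where
      lem : ∀ y → y + y ≡ + 2 * y
      lem = solve-∀

    +Y₄ : + (Y₂ ℕ.+ Y₂) ≡ + 4 * P 10
    +Y₄ = trans (pos-+ Y₂ Y₂) (trans (cong₂ _+_ +Y₂ +Y₂) (lem (P 10)))
      where
      lem : ∀ y → + 2 * y + + 2 * y ≡ + 4 * y
      lem = solve-∀

    +e₂ : + e₂ ≡ + 2 * P 4
    +e₂ = trans (pos-+ (pw 4) (pw 4)) (lem (P 4))
      where
      lem : ∀ y → y + y ≡ + 2 * y
      lem = solve-∀

    +e₄ : + e₄ ≡ + 4 * P 4
    +e₄ = trans (pos-+ e₂ e₂) (trans (cong₂ _+_ +e₂ +e₂) (lem (P 4)))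
      where
      lem : ∀ y → + 2 * y + + 2 * y ≡ + 4 * y
      lem = solve-∀

    d³Y : P 6 * P 6 * P 6 * P 10 ≡ P 28
    d³Y = trans (cong (λ x → x * P 6 * P 10) (P-+ 6 6)) (trans (cong (_* P 10) (P-+ 12 6)) (P-+ 18 10))

    e²Y² : P 4 * P 4 * (P 10 * P 10) ≡ P 28
    e²Y² = trans (cong₂ _*_ (P-+ 4 4) (P-+ 10 10)) (P-+ 8 20)

    E₂′ : Bounded (+ 8 * (+ N * W Y₂) - + 32 * M * P 30) (K″ * (+ 18 * P 28))
    E₂′ = subst₂ (λ x y → Bounded (+ 8 * (+ N * W Y₂) - x) (K″ * y)) main error E₂
      where
      main : + 4 * M * cube (+ Y₂) ≡ + 32 * M * P 30
      main = trans (cong (λ y → + 4 * M * cube y) +Y₂) (trans (lem M (P 10)) (cong (_*_ (+ 32 * M)) (trans (cong (_* P 10) (P-+ 10 10)) (P-+ 20 10))))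
        where
        lem : ∀ m y → + 4 * m * (+ 2 * y * (+ 2 * y) * (+ 2 * y)) ≡ + 32 * m * (y * y * y)
        lem = solve-∀
      error : + d * + d * + d * + Y₂ + + e₂ * + e₂ * (+ Y₂ * + Y₂) ≡ + 18 * P 28
      error = trans (cong₂ (λ e y → P 6 * P 6 * P 6 * y + e * e * (y * y)) +e₂ +Y₂) (trans (lem (P 6) (P 10) (P 4)) (trans (cong₂ (λ x y → + 2 * x + + 16 * y) d³Y e²Y²) (lem′ (P 28))))
        where
        lem : ∀ d y e → d * d * d * (+ 2 * y) + + 2 * e * (+ 2 * e) * (+ 2 * y * (+ 2 * y)) ≡ + 2 * (d * d * d * y) + + 16 * (e * e * (y * y))
        lem = solve-∀
        lem′ : ∀ x → + 2 * x + + 16 * x ≡ + 18 * x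
        lem′ = solve-∀

    E₄′ : Bounded (+ 8 * (+ N * W (Y₂ ℕ.+ Y₂)) - + 256 * M * P 30) (K″ * (+ 260 * P 28))
    E₄′ = subst₂ (λ x y → Bounded (+ 8 * (+ N * W (Y₂ ℕ.+ Y₂)) - x) (K″ * y)) main error E₄
      where
      main : + 4 * M * cube (+ (Y₂ ℕ.+ Y₂)) ≡ + 256 * M * P 30
      main = trans (cong (λ y → + 4 * M * cube y) +Y₄) (trans (lem M (P 10)) (cong (_*_ (+ 256 * M)) (trans (cong (_* P 10) (P-+ 10 10)) (P-+ 20 10))))
        where
        lem : ∀ m y → + 4 * m * (+ 4 * y * (+ 4 * y) * (+ 4 * y)) ≡ + 256 * m * (y * y * y)
        lem = solve-∀
      error : + d * + d * + d * + (Y₂ ℕ.+ Y₂) + + e₄ * + e₄ * (+ (Y₂ ℕ.+ Y₂) * + (Y₂ ℕ.+ Y₂)) ≡ + 260 * P 28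
      error = trans (cong₂ (λ e y → P 6 * P 6 * P 6 * y + e * e * (y * y)) +e₄ +Y₄) (trans (lem (P 6) (P 10) (P 4)) (trans (cong₂ (λ x y → + 4 * x + + 256 * y) d³Y e²Y²) (lem′ (P 28))))
        where
        lem : ∀ d y e → d * d * d * (+ 4 * y) + + 4 * e * (+ 4 * e) * (+ 4 * y * (+ 4 * y)) ≡ + 4 * (d * d * d * y) + + 256 * (e * e * (y * y))
        lem = solve-∀
        lem′ : ∀ x → + 4 * x + + 256 * x ≡ + 260 * x
        lem′ = solve-∀

    U-scaling : U Y₄ - + 256 * U Y₁ ≡ - (+ 192 * (+ h * P 30)) + + 2 * W (Y₂ ℕ.+ Y₂) + + 32 * W Y₂
    U-scaling = trans (cong (λ n → U n - + 256 * U Y₁) Y₄≡) (trans (cong₂ (λ x y → x - + 256 * y) big (U≡ Y₁))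
        (trans (cong₂ (λ x y → + h * x + + 2 * (W (Y₂ ℕ.+ Y₂) + + 16 * (W Y₂ + + 16 * V Y₁)) - + 256 * (+ h * y + + 2 * V Y₁)) cube-big cube-small)
          (lem (+ h) (P 30) (W (Y₂ ℕ.+ Y₂)) (W Y₂) (V Y₁))))
      where
      big : U (Y₂ ℕ.+ Y₂) ≡ + h * cube (+ (Y₂ ℕ.+ Y₂)) + + 2 * (W (Y₂ ℕ.+ Y₂) + + 16 * (W Y₂ + + 16 * V Y₁))
      big = trans (U≡ (Y₂ ℕ.+ Y₂)) (cong (λ v → + h * cube (+ (Y₂ ℕ.+ Y₂)) + + 2 * v) (trans (V-double Y₂) (cong (λ v → W (Y₂ ℕ.+ Y₂) + + 16 * v) (V-double Y₁))))
      cube-small : cube (+ Y₁) ≡ P 30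
      cube-small = trans (cong (λ y → cube (+ y)) Y₁≡) (trans (cong (_* P 10) (P-+ 10 10)) (P-+ 20 10))
      cube-big : cube (+ (Y₂ ℕ.+ Y₂)) ≡ + 64 * P 30
      cube-big = trans (cong cube +Y₄) (trans (lem₀ (P 10)) (cong (_*_ (+ 64)) (trans (cong (_* P 10) (P-+ 10 10)) (P-+ 20 10))))
        where
        lem₀ : ∀ y → + 4 * y * (+ 4 * y) * (+ 4 * y) ≡ + 64 * (y * y * y)
        lem₀ = solve-∀
      lem : ∀ h y w₄ w₂ v → h * (+ 64 * y) + + 2 * (w₄ + + 16 * (w₂ + + 16 * v)) - + 256 * (h * y + + 2 * v) ≡ - (+ 192 * (h * y)) + + 2 * w₄ + + 32 * w₂
      lem = solve-∀

    E₁ : Bounded (+ N * (+ 8 * (- (+ 192 * (+ h * P 30)) + + 2 * W (Y₂ ℕ.+ Y₂) + + 32 * W Y₂))) (+ N * (K′ * P 28))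
    E₁ = bounded-* {+ N} {+ 8 * (- (+ 192 * (+ h * P 30)) + + 2 * W (Y₂ ℕ.+ Y₂) + + 32 * W Y₂)} {+ N} {K′ * P 28} (bounded-nonneg {+ N} {+ N} 0≤ℕ ≤-refl)
      (bounded-≤ (*-monoˡ K′ 0≤K (≤-trans (≤-reflexive (trans (cong (λ x → x * P 5 * P 5 * P 5) (P-+ 5 5)) (trans (cong (λ x → x * P 5 * P 5) (P-+ 10 5)) (trans (cong (_* P 5) (P-+ 15 5)) (P-+ 20 5)))))
          (+≤+ (pw-mono (ℕP.m≤m+n 25 3)))))
        (subst (λ x → Bounded (+ 8 * x) (K′ * (P 5 * P 5 * P 5 * P 5 * P 5))) U-scaling (lattice-scaling T (1≤pw 5))))

    C : ℤ
    C = + N * K′ + + 1096 * K″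

    comparison : Bounded (+ 1536 * (M - + N * + h) * (+ suc z * + suc z)) C
    comparison = subst (λ x → Bounded (+ 1536 * (M - + N * + h) * x) C) (trans (cong +_ pw-2) (pos-* (suc z) (suc z)))
      (leading-coefficient (+ N) K′ K″ (+ h) M (P 30) (W (Y₂ ℕ.+ Y₂)) (W Y₂) (P 28) (P 2) E₁ E₄′ E₂′ (sym (P-+ 2 28)) (+<+ (1≤pw 28)))

  class-number-formula : + N * + h ≡ ∑ N (partial c)
  class-number-formula = sym (i-j≡0⇒i≡j M (+ N * + h) (*-cancelˡ-≢0 (+ 1536) {M - + N * + h} {0ℤ} (λ ()) (trans (unbounded-multiples (+ 1536 * (M - + N * + h)) (+ N * K′ + + 1096 * K″) AtScale.comparison) (sym (*-zeroʳ (+ 1536))))))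

∑-thirds : ∀ n f → ∑ (3 ℕ.* n) f ≡ ∑ n (λ k → f (3 ℕ.* k) + f (1 ℕ.+ 3 ℕ.* k) + f (2 ℕ.+ 3 ℕ.* k))
∑-thirds zero f = refl
∑-thirds (suc n) f = trans (cong (λ k → ∑ k f) (lem n)) (trans (cong (λ s → s + f (3 ℕ.* n) + f (1 ℕ.+ 3 ℕ.* n) + f (2 ℕ.+ 3 ℕ.* n)) (∑-thirds n f))
  (lem′ (∑ n (λ k → f (3 ℕ.* k) + f (1 ℕ.+ 3 ℕ.* k) + f (2 ℕ.+ 3 ℕ.* k))) (f (3 ℕ.* n)) (f (1 ℕ.+ 3 ℕ.* n)) (f (2 ℕ.+ 3 ℕ.* n))))
  where
  lem : ∀ n → 3 ℕ.* suc n ≡ suc (suc (suc (3 ℕ.* n)))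
  lem = ℕSolver.solve-∀
  lem′ : ∀ s x y z → s + x + y + z ≡ s + (x + y + z)
  lem′ = solve-∀

-- Two ways of listing 1, …, 2t as pairs {x, 2t + 1 − x}.

∑-reflect : ∀ t f → ∑ (t ℕ.+ t) (λ k → f (suc k)) ≡ ∑ t (λ k → f (suc k) + f (suc (t ℕ.+ t) ∸ suc k))
∑-reflect t f = trans (∑-split t t (λ k → f (suc k))) (trans (cong (_+_ (∑ t (λ k → f (suc k)))) (trans (∑-reverse t (λ k → f (suc (t ℕ.+ k))))
    (∑-cong t (λ k k<t → cong f (trans (sym (ℕP.+-suc t (t ∸ suc k))) (trans (cong (t ℕ.+_) (sym (ℕP.+-∸-assoc 1 k<t))) (sym (ℕP.+-∸-assoc t (ℕP.<⇒≤ k<t)))))))))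
  (sym (∑-+ t (λ k → f (suc k)) (λ k → f (suc (t ℕ.+ t) ∸ suc k)))))

∑-reflect-even : ∀ t f → ∑ (t ℕ.+ t) (λ k → f (suc k)) ≡ ∑ t (λ k → f (2 ℕ.* suc k) + f (suc (t ℕ.+ t) ∸ 2 ℕ.* suc k))
∑-reflect-even t f = trans (∑-even-odd t (λ k → f (suc k))) (trans (∑-+ t (λ k → f (suc (k ℕ.+ k))) (λ k → f (suc (suc (k ℕ.+ k)))))
  (trans (cong₂ _+_ (trans (∑-reverse t (λ k → f (suc (k ℕ.+ k)))) (∑-cong t odd)) (∑-cong′ t (λ k → cong f (lem k))))
    (trans (+-comm (∑ t (λ k → f (suc (t ℕ.+ t) ∸ 2 ℕ.* suc k))) (∑ t (λ k → f (2 ℕ.* suc k)))) (sym (∑-+ t (λ k → f (2 ℕ.* suc k)) (λ k → f (suc (t ℕ.+ t) ∸ 2 ℕ.* suc k)))))))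
  where
  lem : ∀ k → suc (suc (k ℕ.+ k)) ≡ 2 ℕ.* suc k
  lem = ℕSolver.solve-∀
  odd : ∀ k → k ℕ.< t → f (suc ((t ∸ suc k) ℕ.+ (t ∸ suc k))) ≡ f (suc (t ℕ.+ t) ∸ 2 ℕ.* suc k)
  odd k k<t = cong f (sym (trans (cong (_∸ 2 ℕ.* suc k) (trans (cong (λ x → suc (x ℕ.+ x)) (sym (ℕP.m∸n+n≡m k<t))) (lem′ (t ∸ suc k) k))) (ℕP.m+n∸n≡m (suc ((t ∸ suc k) ℕ.+ (t ∸ suc k))) (2 ℕ.* suc k))))
    where
    lem′ : ∀ j k → suc (j ℕ.+ suc k ℕ.+ (j ℕ.+ suc k)) ≡ suc (j ℕ.+ j) ℕ.+ 2 ℕ.* suc k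
    lem′ = ℕSolver.solve-∀

module HalfSum (m : ℕ) where

  open Char m
  open CharacterSum m

  F : ℕ → ℤ
  F n = ∑ n c

  t : ℕ
  t = suc (m ℕ.+ m)

  N≡ : N ≡ suc (t ℕ.+ t)
  N≡ = lem m
    where
    lem : ∀ m → suc (suc (suc (m ℕ.* 4))) ≡ suc (suc (m ℕ.+ m) ℕ.+ suc (m ℕ.+ m))
    lem = ℕSolver.solve-∀

  private
    τ ν B₁ : ℤ
    τ = + t
    ν = + N
    B₁ = ∑ t (λ k → + suc k * c k)

    ≤N : ∀ {k} → k ℕ.< t → 2 ℕ.* suc k ℕ.≤ N
    ≤N {k} k<t = subst (2 ℕ.* suc k ℕ.≤_) (sym N≡) (ℕP.≤-trans (ℕP.*-monoʳ-≤ 2 k<t) (ℕP.≤-trans (ℕP.≤-reflexive (cong (t ℕ.+_) (ℕP.+-identityʳ t))) (ℕP.n≤1+n (t ℕ.+ t))))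

    N∸ : ∀ {x} → x ℕ.≤ N → + (N ∸ x) ≡ ν - + x
    N∸ {x} x≤N = trans (sym (⊖-≥ x≤N)) (sym (m-n≡m⊖n N x))

    moment : ℕ → ℤ
    moment x = + x * χ x

    moment-reflect : ∀ {x} → x ℕ.≤ N → moment (N ∸ x) ≡ (+ x - ν) * χ x
    moment-reflect {x} x≤N = trans (cong₂ _*_ (N∸ x≤N) (χ-reflect x x≤N)) (lem ν (+ x) (χ x))
      where
      lem : ∀ n x y → (n - x) * - y ≡ (x - n) * y
      lem = solve-∀

    ∑-moment : ∑ (t ℕ.+ t) (λ k → moment (suc k)) ≡ - ∑ N (partial c)
    ∑-moment = begin
      ∑ (t ℕ.+ t) (λ k → moment (suc k)) ≡⟨ +-identityʳ (∑ (t ℕ.+ t) (λ k → moment (suc k))) ⟨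
      ∑ (t ℕ.+ t) (λ k → moment (suc k)) + 0ℤ ≡⟨ cong (_+_ (∑ (t ℕ.+ t) (λ k → moment (suc k)))) (trans (cong (λ n → + n * χ n) (sym N≡)) (trans (cong (_*_ (+ N)) χ-N) (*-zeroʳ (+ N)))) ⟨
      ∑ (suc (t ℕ.+ t)) (λ k → moment (suc k)) ≡⟨ cong (λ n → ∑ n (λ k → moment (suc k))) (sym N≡) ⟩
      ∑ N (λ k → moment (suc k)) ≡⟨ ∑-cong′ N (λ k → trans (cong (_* c k) (pos-+ 1 k)) (lem (+ k) (c k))) ⟩
      ∑ N (λ k → c k + - (c k * - + k)) ≡⟨ ∑-+ N c (λ k → - (c k * - + k)) ⟩
      F N + ∑ N (λ k → - (c k * - + k)) ≡⟨ cong₂ _+_ zero-sum (∑-neg N (λ k → c k * - + k)) ⟩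
      0ℤ + - ∑ N (λ k → c k * - + k) ≡⟨ +-identityˡ (- ∑ N (λ k → c k * - + k)) ⟩
      - ∑ N (λ k → c k * - + k) ≡⟨ cong -_ (abel N c (λ k → - + k)) ⟩
      - (F N * - + N + ∑ N (λ k → partial c k * ∇ (λ k → - + k) k)) ≡⟨ cong -_ (cong₂ _+_ (cong (_* - + N) zero-sum) (∑-cong′ N (λ k → trans (cong (λ y → partial c k * (- + k - - y)) (pos-+ 1 k)) (lem′ (partial c k) (+ k))))) ⟩
      - (0ℤ * - + N + ∑ N (partial c)) ≡⟨ cong -_ (trans (cong (_+ ∑ N (partial c)) (*-zeroˡ (- + N))) (+-identityˡ (∑ N (partial c)))) ⟩
      - ∑ N (partial c) ∎
      where
      open ≡-Reasoning
      lem : ∀ k c → (1ℤ + k) * c ≡ c + - (c * - k)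
      lem = solve-∀
      lem′ : ∀ p k → p * (- k - - (1ℤ + k)) ≡ p
      lem′ = solve-∀

    combination : ∀ α → ∑ t (λ k → (α * + suc k - ν) * c k) ≡ α * B₁ - ν * F t
    combination α = trans (∑-cong′ t (λ k → lem α (+ suc k) ν (c k))) (trans (∑-- t (λ k → α * (+ suc k * c k)) (λ k → ν * c k)) (cong₂ _-_ (∑-* t α (λ k → + suc k * c k)) (∑-* t ν c)))
      where
      lem : ∀ a x n c → (a * x - n) * c ≡ a * (x * c) - n * c
      lem = solve-∀

    fold : ∑ (t ℕ.+ t) (λ k → moment (suc k)) ≡ + 2 * B₁ - ν * F t
    fold = trans (∑-reflect t moment) (trans (∑-cong t term) (combination (+ 2)))
      where
      lem : ∀ x n c → x * c + (x - n) * c ≡ (+ 2 * x - n) * c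
      lem = solve-∀
      term : ∀ k → k ℕ.< t → moment (suc k) + moment (suc (t ℕ.+ t) ∸ suc k) ≡ (+ 2 * + suc k - ν) * c k
      term k k<t = trans (cong (_+_ (moment (suc k))) (trans (cong (λ n → moment (n ∸ suc k)) (sym N≡)) (moment-reflect (ℕP.≤-trans (ℕP.m≤n*m (suc k) 2) (≤N k<t))))) (lem (+ suc k) ν (c k))

    fold-even : ∑ (t ℕ.+ t) (λ k → moment (suc k)) ≡ χ 2 * (+ 4 * B₁ - ν * F t)
    fold-even = trans (∑-reflect-even t moment) (trans (∑-cong t term) (trans (∑-* t (χ 2) (λ k → (+ 4 * + suc k - ν) * c k)) (cong (_*_ (χ 2)) (combination (+ 4)))))
      where
      lem : ∀ x n c d → + 2 * x * (d * c) + (+ 2 * x - n) * (d * c) ≡ d * ((+ 4 * x - n) * c)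
      lem = solve-∀
      term : ∀ k → k ℕ.< t → moment (2 ℕ.* suc k) + moment (suc (t ℕ.+ t) ∸ 2 ℕ.* suc k) ≡ χ 2 * ((+ 4 * + suc k - ν) * c k)
      term k k<t = trans (cong (_+_ (moment (2 ℕ.* suc k))) (trans (cong (λ n → moment (n ∸ 2 ℕ.* suc k)) (sym N≡)) (moment-reflect (≤N k<t))))
        (trans (cong₂ (λ x y → x * y + (x - ν) * y) (pos-* 2 (suc k)) (χ-* 2 (suc k))) (lem (+ suc k) ν (c k) (χ 2)))

  module _ {h : ℕ} (formula : + N * + h ≡ ∑ N (partial c)) where

    private
      moment-identity : + N * + h ≡ ν * F t - + 2 * B₁
      moment-identity = trans (sym (neg-involutive (+ N * + h))) (trans (cong -_ (trans (cong -_ formula) (trans (sym ∑-moment) fold))) (lem (ν * F t) B₁))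
        where
        lem : ∀ x b → - (+ 2 * b - x) ≡ x - + 2 * b
        lem = solve-∀

      moment-identity-even : + N * + h ≡ χ 2 * (ν * F t - + 4 * B₁)
      moment-identity-even = trans (sym (neg-involutive (+ N * + h))) (trans (cong -_ (trans (cong -_ formula) (trans (sym ∑-moment) fold-even))) (lem (χ 2) (ν * F t) B₁))
        where
        lem : ∀ d x b → - (d * (+ 4 * b - x)) ≡ d * (x - + 4 * b)
        lem = solve-∀

    half-sum⁺ : χ 2 ≡ 1ℤ → F t ≡ + h
    half-sum⁺ e = *-cancelˡ-≢0 ν (λ ()) (trans (lem (ν * F t) B₁) (trans (cong₂ (λ x y → + 2 * x - y) (sym moment-identity) (trans (sym (*-identityˡ (ν * F t - + 4 * B₁))) (trans (cong (_* (ν * F t - + 4 * B₁)) (sym e)) (sym moment-identity-even)))) (lem′ (+ N * + h))))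
      where
      lem : ∀ x b → x ≡ + 2 * (x - + 2 * b) - (x - + 4 * b)
      lem = solve-∀
      lem′ : ∀ x → + 2 * x - x ≡ x
      lem′ = solve-∀

    half-sum⁻ : χ 2 ≡ -1ℤ → F t ≡ + 3 * + h
    half-sum⁻ e = *-cancelˡ-≢0 ν (λ ()) (trans (lem (ν * F t) B₁) (trans (cong₂ (λ x y → + 2 * x + y) (sym moment-identity) (trans (cong (_* (ν * F t - + 4 * B₁)) (sym e)) (sym moment-identity-even))) (lem′ ν (+ h))))
      where
      lem : ∀ x b → x ≡ + 2 * (x - + 2 * b) + -1ℤ * (x - + 4 * b)
      lem = solve-∀
      lem′ : ∀ n h → + 2 * (n * h) + n * h ≡ n * (+ 3 * h)
      lem′ = solve-∀

  F-interval : ∀ a w → F (a ℕ.+ w) ≡ F a + ∑ w (λ k → c (a ℕ.+ k))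
  F-interval a w = ∑-split a w c

  F-interval-reversed : ∀ a w → F (a ℕ.+ w) ≡ F a + ∑ w (λ k → χ (a ℕ.+ w ∸ k))
  F-interval-reversed a w = trans (F-interval a w) (cong (_+_ (F a)) (trans (∑-reverse w (λ k → c (a ℕ.+ k)))
    (∑-cong w (λ k k<w → cong χ (trans (sym (ℕP.+-suc a (w ∸ suc k))) (trans (cong (a ℕ.+_) (sym (ℕP.+-∸-assoc 1 k<w))) (sym (ℕP.+-∸-assoc a (ℕP.<⇒≤ k<w)))))))))

  χ-complement : ∀ x y → x ℕ.+ y ≡ N → χ x ≡ - χ y
  χ-complement x y e = χ-neg (divides 1ℤ (trans (sym (pos-+ x y)) (trans (cong +_ e) (sym (*-identityˡ (+ N))))))

  χ-shift : ∀ x y → N ℕ.+ x ≡ y → χ x ≡ χ y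
  χ-shift x y e = sym (χ-cong (divides 1ℤ (trans (cong (_- + x) (trans (cong +_ (sym e)) (pos-+ N x))) (lem (+ N) (+ x)))))
    where
    lem : ∀ n x → n + x - x ≡ 1ℤ * n
    lem = solve-∀

  -- The sixths of (0, N/2): u = ⌊N/6⌋ and u + w = ⌊N/3⌋.
  module Thirds (u w : ℕ) (t≡ : t ≡ u ℕ.+ w ℕ.+ w) where

    private
      t∸ : ∀ {a k} → k ℕ.< w → a ℕ.+ w ∸ k ℕ.+ k ≡ a ℕ.+ w
      t∸ {a} {k} k<w = ℕP.m∸n+n≡m (ℕP.≤-trans (ℕP.<⇒≤ k<w) (ℕP.m≤n+m w a))

      N≡′ : N ≡ suc (2 ℕ.* (u ℕ.+ w ℕ.+ w))
      N≡′ = trans N≡ (trans (cong (λ s → suc (s ℕ.+ s)) t≡) (lem (u ℕ.+ w ℕ.+ w)))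
        where
        lem : ∀ s → suc (s ℕ.+ s) ≡ suc (2 ℕ.* s)
        lem = ℕSolver.solve-∀

      odd-term : ∀ k → k ℕ.< w → c (k ℕ.+ k) ≡ - (χ 2 * χ (u ℕ.+ w ℕ.+ w ∸ k))
      odd-term k k<w = trans (χ-complement (suc (k ℕ.+ k)) (2 ℕ.* x) eq) (cong -_ (χ-* 2 x))
        where
        x = u ℕ.+ w ℕ.+ w ∸ k
        eq : suc (k ℕ.+ k) ℕ.+ 2 ℕ.* x ≡ N
        eq = trans (lem k x) (trans (cong (λ s → suc (2 ℕ.* s)) (t∸ {u ℕ.+ w} k<w)) (sym N≡′))
          where
          lem : ∀ k x → suc (k ℕ.+ k) ℕ.+ 2 ℕ.* x ≡ suc (2 ℕ.* (x ℕ.+ k))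
          lem = ℕSolver.solve-∀

      even-terms : ∑ u (λ k → c (suc (k ℕ.+ k))) ≡ χ 2 * F u
      even-terms = trans (∑-cong′ u (λ k → trans (cong χ (lem k)) (χ-* 2 (suc k)))) (∑-* u (χ 2) c)
        where
        lem : ∀ k → suc (suc (k ℕ.+ k)) ≡ 2 ℕ.* suc k
        lem = ℕSolver.solve-∀

      odd-terms : ∑ w (λ k → c (k ℕ.+ k)) ≡ - (χ 2 * ∑ w (λ k → χ (u ℕ.+ w ℕ.+ w ∸ k)))
      odd-terms = trans (∑-cong w odd-term) (trans (∑-neg w (λ k → χ 2 * χ (u ℕ.+ w ℕ.+ w ∸ k))) (cong -_ (∑-* w (χ 2) (λ k → χ (u ℕ.+ w ℕ.+ w ∸ k)))))

    two-relation : w ≡ u ⊎ w ≡ suc u → F (u ℕ.+ w) ≡ χ 2 * (F u - (F t - F (u ℕ.+ w)))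
    two-relation e = trans (interleave e) (trans (cong₂ _+_ even-terms odd-terms)
        (trans (lem (χ 2) (F u) (F (u ℕ.+ w)) (∑ w (λ k → χ (u ℕ.+ w ℕ.+ w ∸ k)))) (cong (λ s → χ 2 * (F u - (s - F (u ℕ.+ w)))) (trans (sym (F-interval-reversed (u ℕ.+ w) w)) (cong F (sym t≡))))))
      where
      lem : ∀ d x y z → d * x + - (d * z) ≡ d * (x - (y + z - y))
      lem = solve-∀
      interleave : w ≡ u ⊎ w ≡ suc u → F (u ℕ.+ w) ≡ ∑ u (λ k → c (suc (k ℕ.+ k))) + ∑ w (λ k → c (k ℕ.+ k))
      interleave (inj₁ refl) = trans (∑-even-odd u c) (trans (∑-+ u (λ k → c (k ℕ.+ k)) (λ k → c (suc (k ℕ.+ k)))) (+-comm (∑ u (λ k → c (k ℕ.+ k))) (∑ u (λ k → c (suc (k ℕ.+ k))))))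
      interleave (inj₂ refl) = trans (cong F (ℕP.+-suc u u)) (trans (cong (_+ c (u ℕ.+ u)) (trans (∑-even-odd u c) (∑-+ u (λ k → c (k ℕ.+ k)) (λ k → c (suc (k ℕ.+ k))))))
        (lem′ (∑ u (λ k → c (k ℕ.+ k))) (∑ u (λ k → c (suc (k ℕ.+ k)))) (c (u ℕ.+ u))))
        where
        lem′ : ∀ x y z → x + y + z ≡ y + (x + z)
        lem′ = solve-∀

    private
      minus-terms : ∀ i → N ≡ suc i ℕ.+ 3 ℕ.* (u ℕ.+ w) → ∑ w (λ k → c (i ℕ.+ 3 ℕ.* k)) ≡ - (χ 3 * (F (u ℕ.+ w) - F u))
      minus-terms i e = trans (∑-cong w term) (trans (∑-neg w (λ k → χ 3 * χ (u ℕ.+ w ∸ k))) (cong -_ (trans (∑-* w (χ 3) (λ k → χ (u ℕ.+ w ∸ k)))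
          (cong (_*_ (χ 3)) (trans (lem₁ (F u) (∑ w (λ k → χ (u ℕ.+ w ∸ k)))) (cong (_- F u) (sym (F-interval-reversed u w))))))))
        where
        lem₁ : ∀ x y → y ≡ x + y - x
        lem₁ = solve-∀
        term : ∀ k → k ℕ.< w → c (i ℕ.+ 3 ℕ.* k) ≡ - (χ 3 * χ (u ℕ.+ w ∸ k))
        term k k<w = trans (χ-complement (suc (i ℕ.+ 3 ℕ.* k)) (3 ℕ.* x) (trans (lem i k x) (trans (cong (λ s → suc i ℕ.+ 3 ℕ.* s) (t∸ {u} k<w)) (sym e)))) (cong -_ (χ-* 3 x))
          where
          x = u ℕ.+ w ∸ k
          lem : ∀ i k x → suc (i ℕ.+ 3 ℕ.* k) ℕ.+ 3 ℕ.* x ≡ suc i ℕ.+ 3 ℕ.* (x ℕ.+ k)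
          lem = ℕSolver.solve-∀

      plus-terms : ∀ i → N ℕ.+ suc i ≡ 3 ℕ.* suc (u ℕ.+ w) → ∑ w (λ k → c (i ℕ.+ 3 ℕ.* k)) ≡ χ 3 * (F t - F (u ℕ.+ w))
      plus-terms i e = trans (∑-cong′ w (λ k → trans (χ-shift (suc (i ℕ.+ 3 ℕ.* k)) (3 ℕ.* suc (u ℕ.+ w ℕ.+ k)) (trans (lem N i k) (trans (cong (ℕ._+ 3 ℕ.* k) e) (lem′ (u ℕ.+ w) k)))) (χ-* 3 (suc (u ℕ.+ w ℕ.+ k)))))
          (trans (∑-* w (χ 3) (λ k → c (u ℕ.+ w ℕ.+ k))) (cong (_*_ (χ 3)) (trans (lem₁ (F (u ℕ.+ w)) (∑ w (λ k → c (u ℕ.+ w ℕ.+ k)))) (cong (_- F (u ℕ.+ w)) (trans (sym (F-interval (u ℕ.+ w) w)) (cong F (sym t≡)))))))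
        where
        lem : ∀ n i k → n ℕ.+ suc (i ℕ.+ 3 ℕ.* k) ≡ n ℕ.+ suc i ℕ.+ 3 ℕ.* k
        lem = ℕSolver.solve-∀
        lem′ : ∀ s k → 3 ℕ.* suc s ℕ.+ 3 ℕ.* k ≡ 3 ℕ.* suc (s ℕ.+ k)
        lem′ = ℕSolver.solve-∀
        lem₁ : ∀ x y → y ≡ x + y - x
        lem₁ = solve-∀

      zero-terms : ∑ u (λ k → c (2 ℕ.+ 3 ℕ.* k)) ≡ χ 3 * F u
      zero-terms = trans (∑-cong′ u (λ k → trans (cong χ (lem k)) (χ-* 3 (suc k)))) (∑-* u (χ 3) c)
        where
        lem : ∀ k → suc (2 ℕ.+ 3 ℕ.* k) ≡ 3 ℕ.* suc k
        lem = ℕSolver.solve-∀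

      split-thirds : ∀ n → F (3 ℕ.* n) ≡ ∑ n (λ k → c (3 ℕ.* k)) + ∑ n (λ k → c (1 ℕ.+ 3 ℕ.* k)) + ∑ n (λ k → c (2 ℕ.+ 3 ℕ.* k))
      split-thirds n = trans (∑-thirds n c) (trans (∑-+ n (λ k → c (3 ℕ.* k) + c (1 ℕ.+ 3 ℕ.* k)) (λ k → c (2 ℕ.+ 3 ℕ.* k))) (cong (_+ ∑ n (λ k → c (2 ℕ.+ 3 ℕ.* k))) (∑-+ n (λ k → c (3 ℕ.* k)) (λ k → c (1 ℕ.+ 3 ℕ.* k)))))

    three-relation : w ≡ u ⊎ w ≡ suc u → F t ≡ χ 3 * (F u - (F (u ℕ.+ w) - F u) + (F t - F (u ℕ.+ w)))
    three-relation (inj₁ e@refl) = trans (cong F (trans t≡ (lem u))) (trans (split-thirds u) (trans (cong₂ _+_ (cong₂ _+_ (minus-terms 0 (trans N≡′ (lem₁ u))) (plus-terms 1 (trans (cong (ℕ._+ 2) N≡′) (lem₂ u)))) zero-terms)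
        (lem₃ (χ 3) (F u) (F (u ℕ.+ u)) (F t))))
      where
      lem : ∀ u → u ℕ.+ u ℕ.+ u ≡ 3 ℕ.* u
      lem = ℕSolver.solve-∀
      lem₁ : ∀ u → suc (2 ℕ.* (u ℕ.+ u ℕ.+ u)) ≡ 1 ℕ.+ 3 ℕ.* (u ℕ.+ u)
      lem₁ = ℕSolver.solve-∀
      lem₂ : ∀ u → suc (2 ℕ.* (u ℕ.+ u ℕ.+ u)) ℕ.+ 2 ≡ 3 ℕ.* suc (u ℕ.+ u)
      lem₂ = ℕSolver.solve-∀
      lem₃ : ∀ d x y z → - (d * (y - x)) + d * (z - y) + d * x ≡ d * (x - (y - x) + (z - y))
      lem₃ = solve-∀
    three-relation (inj₂ refl) = trans (cong F (trans t≡ (lem u))) (trans (cong (λ s → s + c (3 ℕ.* u) + c (1 ℕ.+ 3 ℕ.* u)) (split-thirds u))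
        (trans (lem₄ (∑ u (λ k → c (3 ℕ.* k))) (∑ u (λ k → c (1 ℕ.+ 3 ℕ.* k))) (∑ u (λ k → c (2 ℕ.+ 3 ℕ.* k))) (c (3 ℕ.* u)) (c (1 ℕ.+ 3 ℕ.* u)))
          (trans (cong₂ _+_ (cong₂ _+_ (plus-terms 0 (trans (cong (ℕ._+ 1) N≡′) (lem₂ u))) (minus-terms 1 (trans N≡′ (lem₁ u)))) zero-terms) (lem₃ (χ 3) (F u) (F (u ℕ.+ suc u)) (F t)))))
      where
      lem : ∀ u → u ℕ.+ suc u ℕ.+ suc u ≡ suc (suc (3 ℕ.* u))
      lem = ℕSolver.solve-∀
      lem₁ : ∀ u → suc (2 ℕ.* (u ℕ.+ suc u ℕ.+ suc u)) ≡ 2 ℕ.+ 3 ℕ.* (u ℕ.+ suc u)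
      lem₁ = ℕSolver.solve-∀
      lem₂ : ∀ u → suc (2 ℕ.* (u ℕ.+ suc u ℕ.+ suc u)) ℕ.+ 1 ≡ 3 ℕ.* suc (u ℕ.+ suc u)
      lem₂ = ℕSolver.solve-∀
      lem₃ : ∀ d x y z → d * (z - y) + - (d * (y - x)) + d * x ≡ d * (x - (y - x) + (z - y))
      lem₃ = solve-∀
      lem₄ : ∀ x y z a b → x + y + z + a + b ≡ x + a + (y + b) + z
      lem₄ = solve-∀

open import Defs using (E; IsClassNumber)

foldr-sumL : ∀ {A : Set} (f : A → ℤ) xs → foldr _+_ 0ℤ (map f xs) ≡ sumL f xs
foldr-sumL f [] = refl
foldr-sumL f (x ∷ xs) = cong (_+_ (f x)) (foldr-sumL f xs)

sumL-interval : ∀ {P : Pred ℕ _} (P? : Decidable P) (f : ℕ → ℤ) n a w → a ℕ.+ w ℕ.≤ n →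
  (∀ x → P x → a ℕ.< x × x ℕ.≤ a ℕ.+ w) → (∀ x → a ℕ.< x → x ℕ.≤ a ℕ.+ w → ¬ P x → f x ≡ 0ℤ) →
  sumL f (filter P? (map suc (upTo n))) ≡ ∑ w (λ k → f (suc (a ℕ.+ k)))
sumL-interval {P} P? f n a w le sound complete = begin
  sumL f (filter P? (map suc (upTo n))) ≡⟨ sumL-filter P? f (map suc (upTo n)) ⟩
  sumL (λ x → ⟦ P? x ⟧ * f x) (map suc (upTo n)) ≡⟨ sumL-map (λ x → ⟦ P? x ⟧ * f x) suc (upTo n) ⟩
  sumL G (upTo n) ≡⟨ sumL-upTo G n ⟩
  ∑ n G ≡⟨ ∑-extend {a ℕ.+ w} {n} le (λ k le′ → outside k (λ p → ℕP.<⇒≱ (ℕ.s≤s le′) (proj₂ (sound (suc k) p)))) ⟩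
  ∑ (a ℕ.+ w) G ≡⟨ ∑-split a w G ⟩
  ∑ a G + ∑ w (λ k → G (a ℕ.+ k)) ≡⟨ cong₂ _+_ (∑-zero a (λ k k<a → outside k (λ p → ℕP.<⇒≱ (proj₁ (sound (suc k) p)) k<a))) (∑-cong w (λ k k<w → inside k k<w (P? (suc (a ℕ.+ k))))) ⟩
  0ℤ + ∑ w (λ k → f (suc (a ℕ.+ k))) ≡⟨ +-identityˡ (∑ w (λ k → f (suc (a ℕ.+ k)))) ⟩
  ∑ w (λ k → f (suc (a ℕ.+ k))) ∎
  where
  open ≡-Reasoning
  G : ℕ → ℤ
  G k = ⟦ P? (suc k) ⟧ * f (suc k)
  outside : ∀ k → ¬ P (suc k) → G k ≡ 0ℤ
  outside k ¬p = cong (_* f (suc k)) (⟦⟧-no (P? (suc k)) ¬p)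
  inside : ∀ k → k ℕ.< w → (d : Dec (P (suc (a ℕ.+ k)))) → ⟦ d ⟧ * f (suc (a ℕ.+ k)) ≡ f (suc (a ℕ.+ k))
  inside k k<w (yes _) = *-identityˡ (f (suc (a ℕ.+ k)))
  inside k k<w (no ¬p) = sym (complete (suc (a ℕ.+ k)) (ℕ.s≤s (ℕP.m≤m+n a k)) (subst (ℕ._≤ a ℕ.+ w) (ℕP.+-suc a k) (ℕP.+-monoʳ-≤ a k<w)) ¬p)

InRange : ℤ → ℕ → ℕ → Set
InRange D j x = Coprime x ∣ D ∣ × j ℕ.* ∣ D ∣ ℕ.< 6 ℕ.* x × 6 ℕ.* x ℕ.< suc j ℕ.* ∣ D ∣

inRange? : ∀ D j → Decidable (InRange D j)
inRange? D j x = coprime? x ∣ D ∣ ×-dec (j ℕ.* ∣ D ∣ ℕP.<? 6 ℕ.* x) ×-dec (6 ℕ.* x ℕP.<? suc j ℕ.* ∣ D ∣)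

E-sumL : ∀ D j → E D 6 j ≡ sumL (Defs.χ D) (filter (inRange? D j) (map suc (upTo ∣ D ∣)))
E-sumL D j = foldr-sumL (Defs.χ D) (filter (inRange? D j) (map suc (upTo ∣ D ∣)))

≤-slack : ∀ {a b} k → b ≡ a ℕ.+ k → a ℕ.≤ b
≤-slack {a} k e = subst (a ℕ.≤_) (sym e) (ℕP.m≤m+n a k)

module Discriminant (m : ℕ) where

  open Char m
  open CharacterSum m
  open HalfSum m

  D : ℤ
  D = -[1+ suc (suc (m ℕ.* 4)) ]

  E-interval : ∀ j a w → a ℕ.+ w ℕ.≤ N → 6 ℕ.* a ℕ.≤ j ℕ.* N → j ℕ.* N ℕ.< 6 ℕ.* suc a →
    6 ℕ.* (a ℕ.+ w) ℕ.< suc j ℕ.* N → suc j ℕ.* N ℕ.≤ 6 ℕ.* suc (a ℕ.+ w) → E D 6 j ≡ ∑ w (λ k → c (a ℕ.+ k))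
  E-interval j a w le lo lo′ hi hi′ = trans (E-sumL D j) (trans (sumL-interval (inRange? D j) (Defs.χ D) N a w le
      (λ { x (_ , p , q) → ℕP.*-cancelˡ-< 6 a x (ℕP.≤-<-trans lo p) , ℕ.s≤s⁻¹ (ℕP.*-cancelˡ-< 6 x (suc (a ℕ.+ w)) (ℕP.<-≤-trans q hi′)) })
      (λ x a<x x≤ ¬p → trans (sym (χ-def x)) (χ-coprime {x} (λ co → ¬p (co , ℕP.<-≤-trans lo′ (ℕP.*-monoʳ-≤ 6 a<x) , ℕP.≤-<-trans (ℕP.*-monoʳ-≤ 6 x≤) hi)))))
    (∑-cong′ w (λ k → sym (χ-def (suc (a ℕ.+ k))))))

  module _ (u w : ℕ) (t≡ : t ≡ u ℕ.+ w ℕ.+ w) where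

    private
      N≡′ : N ≡ suc (2 ℕ.* (u ℕ.+ w ℕ.+ w))
      N≡′ = trans N≡ (trans (cong (λ s → suc (s ℕ.+ s)) t≡) (lem (u ℕ.+ w ℕ.+ w)))
        where
        lem : ∀ s → suc (s ℕ.+ s) ≡ suc (2 ℕ.* s)
        lem = ℕSolver.solve-∀

      t≤N : u ℕ.+ w ℕ.+ w ℕ.≤ N
      t≤N = subst (u ℕ.+ w ℕ.+ w ℕ.≤_) (sym N≡′) (ℕP.m≤n⇒m≤1+n (ℕP.m≤n*m (u ℕ.+ w ℕ.+ w) 2))

      u+w≤N : u ℕ.+ w ℕ.≤ N
      u+w≤N = ℕP.≤-trans (ℕP.m≤m+n (u ℕ.+ w) w) t≤N

      compare : ∀ j {a} k → (∀ n → n ≡ suc (2 ℕ.* (u ℕ.+ w ℕ.+ w)) → j ℕ.* n ≡ a ℕ.+ k) → a ℕ.≤ j ℕ.* N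
      compare j k eq = ≤-slack k (eq N N≡′)

      compare′ : ∀ j {b} k → b ≡ j ℕ.* suc (2 ℕ.* (u ℕ.+ w ℕ.+ w)) ℕ.+ k → j ℕ.* N ℕ.≤ b
      compare′ j k eq = ≤-slack k (trans eq (cong (λ n → j ℕ.* n ℕ.+ k) (sym N≡′)))

      compare″ : ∀ j {b} k → b ≡ suc (j ℕ.* suc (2 ℕ.* (u ℕ.+ w ℕ.+ w))) ℕ.+ k → j ℕ.* N ℕ.< b
      compare″ j k eq = ≤-slack k (trans eq (cong (λ n → suc (j ℕ.* n) ℕ.+ k) (sym N≡′)))

      difference : ∀ x y → y ≡ x + y - x
      difference = solve-∀

      interval : ∀ a w → ∑ w (λ k → c (a ℕ.+ k)) ≡ F (a ℕ.+ w) - F a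
      interval a w = trans (difference (F a) (∑ w (λ k → c (a ℕ.+ k)))) (cong (_- F a) (sym (F-interval a w)))

    E-sixths : w ≡ u ⊎ w ≡ suc u → E D 6 0 ≡ F u × E D 6 1 ≡ F (u ℕ.+ w) - F u × E D 6 2 ≡ F t - F (u ℕ.+ w)
    E-sixths e = E-interval 0 0 u (ℕP.≤-trans (ℕP.m≤m+n u w) u+w≤N) ℕ.z≤n (ℕ.s≤s ℕ.z≤n) (l₁ e) (l₂ e) ,
      trans (E-interval 1 u w u+w≤N (ℕP.<⇒≤ (l₁ e)) (l₃ e) (l₄ e) (l₅ e)) (interval u w) ,
      trans (E-interval 2 (u ℕ.+ w) w t≤N (ℕP.<⇒≤ (l₄ e)) (l₆ e) (l₇ e) (l₈ e)) (trans (interval (u ℕ.+ w) w) (cong (λ n → F n - F (u ℕ.+ w)) (sym t≡)))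
      where
      Third : Set
      Third = w ≡ u ⊎ w ≡ suc u
      l₁ : Third → 6 ℕ.* u ℕ.< 1 ℕ.* N
      l₁ (inj₁ refl) = compare 1 0 λ { _ refl → lem u }
        where
        lem : ∀ u → 1 ℕ.* suc (2 ℕ.* (u ℕ.+ u ℕ.+ u)) ≡ suc (6 ℕ.* u) ℕ.+ 0
        lem = ℕSolver.solve-∀
      l₁ (inj₂ refl) = compare 1 4 λ { _ refl → lem u }
        where
        lem : ∀ u → 1 ℕ.* suc (2 ℕ.* (u ℕ.+ suc u ℕ.+ suc u)) ≡ suc (6 ℕ.* u) ℕ.+ 4
        lem = ℕSolver.solve-∀
      l₃ : Third → 1 ℕ.* N ℕ.< 6 ℕ.* suc u
      l₃ (inj₁ refl) = compare″ 1 4 (lem u)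
        where
        lem : ∀ u → 6 ℕ.* suc u ≡ suc (1 ℕ.* suc (2 ℕ.* (u ℕ.+ u ℕ.+ u))) ℕ.+ 4
        lem = ℕSolver.solve-∀
      l₃ (inj₂ refl) = compare″ 1 0 (lem u)
        where
        lem : ∀ u → 6 ℕ.* suc u ≡ suc (1 ℕ.* suc (2 ℕ.* (u ℕ.+ suc u ℕ.+ suc u))) ℕ.+ 0
        lem = ℕSolver.solve-∀
      l₂ : Third → 1 ℕ.* N ℕ.≤ 6 ℕ.* suc u
      l₂ e = ℕP.<⇒≤ (l₃ e)
      l₄ : Third → 6 ℕ.* (u ℕ.+ w) ℕ.< 2 ℕ.* N
      l₄ (inj₁ refl) = compare 2 1 λ { _ refl → lem u }
        where
        lem : ∀ u → 2 ℕ.* suc (2 ℕ.* (u ℕ.+ u ℕ.+ u)) ≡ suc (6 ℕ.* (u ℕ.+ u)) ℕ.+ 1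
        lem = ℕSolver.solve-∀
      l₄ (inj₂ refl) = compare 2 3 λ { _ refl → lem u }
        where
        lem : ∀ u → 2 ℕ.* suc (2 ℕ.* (u ℕ.+ suc u ℕ.+ suc u)) ≡ suc (6 ℕ.* (u ℕ.+ suc u)) ℕ.+ 3
        lem = ℕSolver.solve-∀
      l₆ : Third → 2 ℕ.* N ℕ.< 6 ℕ.* suc (u ℕ.+ w)
      l₆ (inj₁ refl) = compare″ 2 3 (lem u)
        where
        lem : ∀ u → 6 ℕ.* suc (u ℕ.+ u) ≡ suc (2 ℕ.* suc (2 ℕ.* (u ℕ.+ u ℕ.+ u))) ℕ.+ 3
        lem = ℕSolver.solve-∀
      l₆ (inj₂ refl) = compare″ 2 1 (lem u)
        where
        lem : ∀ u → 6 ℕ.* suc (u ℕ.+ suc u) ≡ suc (2 ℕ.* suc (2 ℕ.* (u ℕ.+ suc u ℕ.+ suc u))) ℕ.+ 1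
        lem = ℕSolver.solve-∀
      l₅ : Third → 2 ℕ.* N ℕ.≤ 6 ℕ.* suc (u ℕ.+ w)
      l₅ e = ℕP.<⇒≤ (l₆ e)
      l₇ : Third → 6 ℕ.* (u ℕ.+ w ℕ.+ w) ℕ.< 3 ℕ.* N
      l₇ _ = compare 3 2 λ { _ refl → lem (u ℕ.+ w ℕ.+ w) }
        where
        lem : ∀ t → 3 ℕ.* suc (2 ℕ.* t) ≡ suc (6 ℕ.* t) ℕ.+ 2
        lem = ℕSolver.solve-∀
      l₈ : Third → 3 ℕ.* N ℕ.≤ 6 ℕ.* suc (u ℕ.+ w ℕ.+ w)
      l₈ _ = compare′ 3 3 (lem (u ℕ.+ w ℕ.+ w))
        where
        lem : ∀ t → 6 ℕ.* suc t ≡ 3 ℕ.* suc (2 ℕ.* t) ℕ.+ 3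
        lem = ℕSolver.solve-∀

-- Here A, G, H are the sums over (0, N/6), (0, N/3), (0, N/2).
module Solve (A G H : ℤ) where

  private
    difference≡ : ∀ n {x y} → + suc n * (x - y) ≡ 0ℤ → x ≡ y
    difference≡ n {x} {y} e = i-j≡0⇒i≡j x y (*-cancelˡ-≢0 (+ suc n) {x - y} {0ℤ} (λ ()) (trans e (sym (*-zeroʳ (+ suc n)))))

  three⁺ : H ≡ 1ℤ * (A - (G - A) + (H - G)) → G ≡ A
  three⁺ e = difference≡ 1 {G} {A} (trans (lem A G H) (i≡j⇒i-j≡0 e))
    where
    lem : ∀ A G H → + 2 * (G - A) ≡ H - 1ℤ * (A - (G - A) + (H - G))
    lem = solve-∀

  three⁻ : H ≡ -1ℤ * (A - (G - A) + (H - G)) → G ≡ A + H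
  three⁻ e = difference≡ 1 {G} {A + H} (trans (lem A G H) (cong -_ (i≡j⇒i-j≡0 e)))
    where
    lem : ∀ A G H → + 2 * (G - (A + H)) ≡ - (H - -1ℤ * (A - (G - A) + (H - G)))
    lem = solve-∀

  two⁺ : G ≡ 1ℤ * (A - (H - G)) → A ≡ H
  two⁺ e = difference≡ 0 {A} {H} (trans (lem A G H) (cong -_ (i≡j⇒i-j≡0 e)))
    where
    lem : ∀ A G H → + 1 * (A - H) ≡ - (G - 1ℤ * (A - (H - G)))
    lem = solve-∀

  two⁻ : G ≡ -1ℤ * (A - (H - G)) → + 2 * G ≡ H - A
  two⁻ e = trans (lem A G H) (trans (cong (_+_ (H - A)) (i≡j⇒i-j≡0 e)) (+-identityʳ (H - A)))
    where
    lem : ∀ A G H → + 2 * G ≡ H - A + (G - -1ℤ * (A - (H - G)))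
    lem = solve-∀

  module _ (h : ℤ) where

    Values : ℤ → ℤ → ℤ → Set
    Values x y z = A ≡ x × G - A ≡ y × H - G ≡ z

    case⁺⁺ : G ≡ 1ℤ * (A - (H - G)) → H ≡ 1ℤ * (A - (G - A) + (H - G)) → H ≡ h → Values h 0ℤ 0ℤ
    case⁺⁺ e₂ e₃ eₕ = A≡ , trans (cong (_- A) G≡) (+-inverseʳ A) , trans (cong₂ _-_ eₕ (trans G≡ A≡)) (+-inverseʳ h)
      where
      A≡ = trans (two⁺ e₂) eₕ
      G≡ = three⁺ e₃

    case⁻⁺ : G ≡ -1ℤ * (A - (H - G)) → H ≡ 1ℤ * (A - (G - A) + (H - G)) → H ≡ + 3 * h → Values h 0ℤ (+ 2 * h)
    case⁻⁺ e₂ e₃ eₕ = A≡ , trans (cong (_- A) G≡) (+-inverseʳ A) , trans (cong₂ _-_ eₕ (trans G≡ A≡)) (lem′ h)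
      where
      G≡ = three⁺ e₃
      lem : ∀ A H → + 3 * (A - H) ≡ + 2 * A - (+ 3 * H - A)
      lem = solve-∀
      lem′ : ∀ h → + 3 * h - h ≡ + 2 * h
      lem′ = solve-∀
      A≡ : A ≡ h
      A≡ = difference≡ 2 {A} {h} (trans (lem A h) (i≡j⇒i-j≡0 (trans (cong (_*_ (+ 2)) (sym G≡)) (trans (two⁻ e₂) (cong (_- A) eₕ)))))

    case⁺⁻ : G ≡ 1ℤ * (A - (H - G)) → H ≡ -1ℤ * (A - (G - A) + (H - G)) → H ≡ h → Values h h (- h)
    case⁺⁻ e₂ e₃ eₕ = A≡ , trans (cong (_- A) G≡) (trans (lem A H) eₕ) , trans (cong₂ _-_ eₕ (trans G≡ (cong₂ _+_ A≡ eₕ))) (lem′ h)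
      where
      A≡ = trans (two⁺ e₂) eₕ
      G≡ = three⁻ e₃
      lem : ∀ A H → A + H - A ≡ H
      lem = solve-∀
      lem′ : ∀ h → h - (h + h) ≡ - h
      lem′ = solve-∀

    case⁻⁻ : G ≡ -1ℤ * (A - (H - G)) → H ≡ -1ℤ * (A - (G - A) + (H - G)) → H ≡ + 3 * h → Values (- h) (+ 3 * h) h
    case⁻⁻ e₂ e₃ eₕ = A≡ , trans (cong (_- A) G≡) (trans (lem A H) eₕ) , trans (cong₂ _-_ eₕ (trans G≡ (cong₂ _+_ A≡ eₕ))) (lem′ h)
      where
      G≡ = three⁻ e₃
      lem : ∀ A H → A + H - A ≡ H
      lem = solve-∀
      lem′ : ∀ h → + 3 * h - (- h + + 3 * h) ≡ h
      lem′ = solve-∀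
      lem″ : ∀ A h → + 3 * (A - - h) ≡ + 2 * (A + + 3 * h) - (+ 3 * h - A)
      lem″ = solve-∀
      A≡ : A ≡ - h
      A≡ = difference≡ 2 {A} { - h} (trans (lem″ A h) (i≡j⇒i-j≡0 (trans (cong (λ k → + 2 * (A + k)) (sym eₕ)) (trans (cong (_*_ (+ 2)) (sym G≡)) (trans (two⁻ e₂) (cong (_- A) eₕ))))))

χ₈-periodic : ∀ r k → χ₈ (r ℕ.+ k ℕ.* 24) ≡ χ₈ r
χ₈-periodic r k = cong table₈ (trans (cong (λ x → (r ℕ.+ x) ℕ.% 8) (sym (ℕP.*-assoc k 3 8))) (ℕM.[m+kn]%n≡m%n r (k ℕ.* 3) 8))

module Residues (m : ℕ) (1≤m : 1 ℕ.≤ m) (square-free : SquareFree (Char.N m)) (3∤N : ¬ (3 ℕD.∣ Char.N m))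
  {h : ℕ} (class-number : IsClassNumber (Discriminant.D m) h) where

  open Char m
  open HalfSum m
  open Discriminant m

  formula : + N * + h ≡ ∑ N (partial (CharacterSum.c m))
  formula = MassFormula.class-number-formula m 1≤m
    (λ d d∣ → square-free d (subst₂ ℕD._∣_ (abs-* (+ d) (+ d)) (cong ∣_∣ (sym N-int)) (∣⇒∣ᵤ d∣)))
    (RingOfIntegers.representatives m square-free class-number)

  module _ {r v : ℕ} (N≡r : N ≡ r ℕ.+ v ℕ.* 24) where

    χ-2-value : χ 2 ≡ χ₈ r
    χ-2-value = trans χ-2 (trans (cong χ₈ N≡r) (χ₈-periodic r v))

    χ-3-candidate : ∀ {ε} → χ 3 ≡ ε → + 3 ∣ ε + + r
    χ-3-candidate {ε} e = ∣-eq (trans (cong (λ x → x - (- + N) * 1ℤ - + v * + 24) e) (trans (cong (λ n → ε - - n * 1ℤ - + v * + 24) (trans (cong +_ N≡r) (trans (pos-+ r (v ℕ.* 24)) (cong (_+_ (+ r)) (pos-* v 24))))) (lem ε (+ r) (+ v))))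
        (∣m∣n⇒∣m-n (χ-euler {3} {1} 3-prime refl 3∤N) (∣n⇒∣m*n (+ v) (divides (+ 8) refl)))
      where
      3-prime : Prime 3
      3-prime = toWitness {a? = prime? 3} _
      lem : ∀ e r v → e - - (r + v * + 24) * 1ℤ - v * + 24 ≡ e + r
      lem = solve-∀

    χ-3≡1 : ¬ (+ 3 ∣ -1ℤ + + r) → χ 3 ≡ 1ℤ
    χ-3≡1 ¬d with splitting {3} (toWitness {a? = prime? 3} _)
    ... | split e _ _ _ = e
    ... | ramified _ _ _ _ 3∣N = ⊥-elim (3∤N 3∣N)
    ... | inert e _ = ⊥-elim (¬d (χ-3-candidate e))

    χ-3≡-1 : ¬ (+ 3 ∣ 1ℤ + + r) → χ 3 ≡ -1ℤ
    χ-3≡-1 ¬d with splitting {3} (toWitness {a? = prime? 3} _)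
    ... | split e _ _ _ = ⊥-elim (¬d (χ-3-candidate e))
    ... | ramified _ _ _ _ 3∣N = ⊥-elim (3∤N 3∣N)
    ... | inert e _ = e

  module _ (u w : ℕ) (e : w ≡ u ⊎ w ≡ suc u) (t≡ : t ≡ u ℕ.+ w ℕ.+ w) where

    open Thirds u w t≡
    open Solve (F u) (F (u ℕ.+ w)) (F t)

    two : ∀ {ε} → χ 2 ≡ ε → F (u ℕ.+ w) ≡ ε * (F u - (F t - F (u ℕ.+ w)))
    two ε = trans (two-relation e) (cong (_* (F u - (F t - F (u ℕ.+ w)))) ε)

    three : ∀ {ε} → χ 3 ≡ ε → F t ≡ ε * (F u - (F (u ℕ.+ w) - F u) + (F t - F (u ℕ.+ w)))
    three ε = trans (three-relation e) (cong (_* (F u - (F (u ℕ.+ w) - F u) + (F t - F (u ℕ.+ w)))) ε)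

    transfer : ∀ {x y z} → F u ≡ x × F (u ℕ.+ w) - F u ≡ y × F t - F (u ℕ.+ w) ≡ z → E D 6 0 ≡ x × E D 6 1 ≡ y × E D 6 2 ≡ z
    transfer (p , q , r) = trans E₀ p , trans E₁ q , trans E₂ r
      where
      E₀ = proj₁ (E-sixths u w t≡ e)
      E₁ = proj₁ (proj₂ (E-sixths u w t≡ e))
      E₂ = proj₂ (proj₂ (E-sixths u w t≡ e))

    sixths⁺⁺ : χ 2 ≡ 1ℤ → χ 3 ≡ 1ℤ → E D 6 0 ≡ + h × E D 6 1 ≡ 0ℤ × E D 6 2 ≡ 0ℤ
    sixths⁺⁺ χ₂ χ₃ = transfer (case⁺⁺ (+ h) (two χ₂) (three χ₃) (half-sum⁺ {h} formula χ₂))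

    sixths⁻⁺ : χ 2 ≡ -1ℤ → χ 3 ≡ 1ℤ → E D 6 0 ≡ + h × E D 6 1 ≡ 0ℤ × E D 6 2 ≡ + 2 * + h
    sixths⁻⁺ χ₂ χ₃ = transfer (case⁻⁺ (+ h) (two χ₂) (three χ₃) (half-sum⁻ {h} formula χ₂))

    sixths⁺⁻ : χ 2 ≡ 1ℤ → χ 3 ≡ -1ℤ → E D 6 0 ≡ + h × E D 6 1 ≡ + h × E D 6 2 ≡ - (+ h)
    sixths⁺⁻ χ₂ χ₃ = transfer (case⁺⁻ (+ h) (two χ₂) (three χ₃) (half-sum⁺ {h} formula χ₂))

    sixths⁻⁻ : χ 2 ≡ -1ℤ → χ 3 ≡ -1ℤ → E D 6 0 ≡ - (+ h) × E D 6 1 ≡ + 3 * + h × E D 6 2 ≡ + h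
    sixths⁻⁻ χ₂ χ₃ = transfer (case⁻⁻ (+ h) (two χ₂) (three χ₃) (half-sum⁻ {h} formula χ₂))

  private
    half : ∀ {r s} v → N ≡ r ℕ.+ v ℕ.* 24 → r ℕ.+ v ℕ.* 24 ≡ suc (2 ℕ.* s) → t ≡ s
    half {r} {s} v e eq = ℕP.*-cancelˡ-≡ t s 2 (trans (cong (t ℕ.+_) (ℕP.+-identityʳ t)) (ℕP.suc-injective (trans (sym N≡) (trans e eq))))

  residue-23 : ∀ v → N ≡ 23 ℕ.+ v ℕ.* 24 → E D 6 0 ≡ + h × E D 6 1 ≡ 0ℤ × E D 6 2 ≡ 0ℤ
  residue-23 v e = sixths⁺⁺ u (suc u) (inj₂ refl) (half {23} {u ℕ.+ suc u ℕ.+ suc u} v e (lem v)) (χ-2-value {23} {v} e) (χ-3≡1 {23} {v} e (from-no (+ 3 ∣? -1ℤ + + 23)))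
    where
    u : ℕ
    u = 3 ℕ.+ 4 ℕ.* v
    lem : ∀ v → 23 ℕ.+ v ℕ.* 24 ≡ suc (2 ℕ.* ((3 ℕ.+ 4 ℕ.* v) ℕ.+ suc (3 ℕ.+ 4 ℕ.* v) ℕ.+ suc (3 ℕ.+ 4 ℕ.* v)))
    lem = ℕSolver.solve-∀

  residue-11 : ∀ v → N ≡ 11 ℕ.+ v ℕ.* 24 → E D 6 0 ≡ + h × E D 6 1 ≡ 0ℤ × E D 6 2 ≡ + 2 * + h
  residue-11 v e = sixths⁻⁺ u (suc u) (inj₂ refl) (half {11} {u ℕ.+ suc u ℕ.+ suc u} v e (lem v)) (χ-2-value {11} {v} e) (χ-3≡1 {11} {v} e (from-no (+ 3 ∣? -1ℤ + + 11)))
    where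
    u : ℕ
    u = 1 ℕ.+ 4 ℕ.* v
    lem : ∀ v → 11 ℕ.+ v ℕ.* 24 ≡ suc (2 ℕ.* ((1 ℕ.+ 4 ℕ.* v) ℕ.+ suc (1 ℕ.+ 4 ℕ.* v) ℕ.+ suc (1 ℕ.+ 4 ℕ.* v)))
    lem = ℕSolver.solve-∀

  residue-7 : ∀ v → N ≡ 7 ℕ.+ v ℕ.* 24 → E D 6 0 ≡ + h × E D 6 1 ≡ + h × E D 6 2 ≡ - (+ h)
  residue-7 v e = sixths⁺⁻ u u (inj₁ refl) (half {7} {u ℕ.+ u ℕ.+ u} v e (lem v)) (χ-2-value {7} {v} e) (χ-3≡-1 {7} {v} e (from-no (+ 3 ∣? 1ℤ + + 7)))
    where
    u : ℕ
    u = 1 ℕ.+ 4 ℕ.* v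
    lem : ∀ v → 7 ℕ.+ v ℕ.* 24 ≡ suc (2 ℕ.* ((1 ℕ.+ 4 ℕ.* v) ℕ.+ (1 ℕ.+ 4 ℕ.* v) ℕ.+ (1 ℕ.+ 4 ℕ.* v)))
    lem = ℕSolver.solve-∀

  residue-19 : ∀ v → N ≡ 19 ℕ.+ v ℕ.* 24 → E D 6 0 ≡ - (+ h) × E D 6 1 ≡ + 3 * + h × E D 6 2 ≡ + h
  residue-19 v e = sixths⁻⁻ u u (inj₁ refl) (half {19} {u ℕ.+ u ℕ.+ u} v e (lem v)) (χ-2-value {19} {v} e) (χ-3≡-1 {19} {v} e (from-no (+ 3 ∣? 1ℤ + + 19)))
    where
    u : ℕ
    u = 3 ℕ.+ 4 ℕ.* v
    lem : ∀ v → 19 ℕ.+ v ℕ.* 24 ≡ suc (2 ℕ.* ((3 ℕ.+ 4 ℕ.* v) ℕ.+ (3 ℕ.+ 4 ℕ.* v) ℕ.+ (3 ℕ.+ 4 ℕ.* v)))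
    lem = ℕSolver.solve-∀

  private
    quotient : ∀ n r → n ≡ N → n ℕ.% 24 ≡ r → N ≡ r ℕ.+ n ℕ./ 24 ℕ.* 24
    quotient n r n≡N e = trans (sym n≡N) (trans (ℕM.m≡m%n+[m/n]*n n 24) (cong (ℕ._+ n ℕ./ 24 ℕ.* 24) e))

  residues : ∀ n → n ≡ N →
    (n ℕ.% 24 ≡ 23 → E D 6 0 ≡ + h × E D 6 1 ≡ 0ℤ × E D 6 2 ≡ 0ℤ)
    × (n ℕ.% 24 ≡ 11 → E D 6 0 ≡ + h × E D 6 1 ≡ 0ℤ × E D 6 2 ≡ + 2 * + h)
    × (n ℕ.% 24 ≡ 7 → E D 6 0 ≡ + h × E D 6 1 ≡ + h × E D 6 2 ≡ - (+ h))
    × (n ℕ.% 24 ≡ 19 → E D 6 0 ≡ - (+ h) × E D 6 1 ≡ + 3 * + h × E D 6 2 ≡ + h)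
  residues n n≡N = (λ e → residue-23 (n ℕ./ 24) (quotient n 23 n≡N e)) , (λ e → residue-11 (n ℕ./ 24) (quotient n 11 n≡N e)) ,
    (λ e → residue-7 (n ℕ./ 24) (quotient n 7 n≡N e)) , (λ e → residue-19 (n ℕ./ 24) (quotient n 19 n≡N e))

%ℕ4≡1⇒ : ∀ n → -[1+ n ] %ℕ 4 ≡ 1 → ∃ λ m → n ≡ suc (suc (m ℕ.* 4))
%ℕ4≡1⇒ n e with suc n ℕ.% 4 in eq | suc n ℕ./ 4 | ℕM.m≡m%n+[m/n]*n (suc n) 4
... | zero | _ | _ = ⊥-elim (ℕP.0≢1+n e)
... | suc zero | _ | _ = ⊥-elim (case e)
  where
  case : 3 ≡ 1 → ⊥
  case ()
... | suc (suc zero) | _ | _ = ⊥-elim (case e)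
  where
  case : 2 ≡ 1 → ⊥
  case ()
... | suc (suc (suc zero)) | m | d = m , ℕP.suc-injective d
... | suc (suc (suc (suc r))) | _ | _ = ⊥-elim (ℕP.<⇒≱ (ℕM.m%n<n (suc n) 4) (subst (4 ℕ.≤_) (sym eq) (ℕ.s≤s (ℕ.s≤s (ℕ.s≤s (ℕ.s≤s ℕ.z≤n))))))

discriminant-form : ∀ D → D < - (+ 4) → D %ℕ 4 ≡ 1 → ∃ λ m → 1 ℕ.≤ m × D ≡ Discriminant.D m
discriminant-form -[1+ n ] D<-4 e = proj₁ normal , 1≤m (proj₁ normal) D<-4 (proj₂ normal) , cong -[1+_] (proj₂ normal)
  where
  normal = %ℕ4≡1⇒ n e
  1≤m : ∀ {n} m → -[1+ n ] < - (+ 4) → n ≡ suc (suc (m ℕ.* 4)) → 1 ℕ.≤ m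
  1≤m zero (-<- (ℕ.s≤s (ℕ.s≤s ()))) refl
  1≤m (suc m) _ _ = ℕ.s≤s ℕ.z≤n

at-discriminant : ∀ m → 1 ℕ.≤ m → ∀ D → D ≡ Discriminant.D m → SquareFree ∣ D ∣ → ¬ (3 ℕD.∣ ∣ D ∣) → ∀ h → IsClassNumber D h →
  ∀ n → n ≡ ∣ D ∣ →
  (n ℕ.% 24 ≡ 23 → E D 6 0 ≡ + h × E D 6 1 ≡ 0ℤ × E D 6 2 ≡ 0ℤ)
  × (n ℕ.% 24 ≡ 11 → E D 6 0 ≡ + h × E D 6 1 ≡ 0ℤ × E D 6 2 ≡ + 2 * + h)
  × (n ℕ.% 24 ≡ 7 → E D 6 0 ≡ + h × E D 6 1 ≡ + h × E D 6 2 ≡ - (+ h))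
  × (n ℕ.% 24 ≡ 19 → E D 6 0 ≡ - (+ h) × E D 6 1 ≡ + 3 * + h × E D 6 2 ≡ + h)
at-discriminant m 1≤m D refl square-free 3∤D h class-number = Residues.residues m 1≤m square-free 3∤D class-number

theorem4p2 : (D : ℤ) → D < - (+ 4) → D %ℕ 4 ≡ 1 → SquareFree ∣ D ∣ → 3 ∤ ∣ D ∣ →
    (h : ℕ) → IsClassNumber D h →
    let N = ∣ D ∣ in
    (N % 24 ≡ 23 → E D 6 0 ≡ + h × E D 6 1 ≡ 0ℤ × E D 6 2 ≡ 0ℤ)
    × (N % 24 ≡ 11 → E D 6 0 ≡ + h × E D 6 1 ≡ 0ℤ × E D 6 2 ≡ + 2 * + h)
    × (N % 24 ≡ 7 → E D 6 0 ≡ + h × E D 6 1 ≡ + h × E D 6 2 ≡ - (+ h))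
    × (N % 24 ≡ 19 → E D 6 0 ≡ - (+ h) × E D 6 1 ≡ + 3 * + h × E D 6 2 ≡ + h)
theorem4p2 D D<-4 D%4≡1 square-free 3∤D h class-number =
  at-discriminant (proj₁ normal) (proj₁ (proj₂ normal)) D (proj₂ (proj₂ normal)) square-free 3∤D h class-number ∣ D ∣ refl
  where
  normal = discriminant-form D D<-4 D%4≡1
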